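{- Let $n\geq 3$ and $m\geq 3$ be integers. Then $\Delta_m^{n,2}=\mathrm{VR}(\{0,1,\ldots,m\}^n;2)$ is homotopy equivalent to a wedge sum $\bigvee^{\nu_m}\mathbb{S}^3$ of $\nu_m$ copies of the $3$-sphere, where $\nu_m\geq (m-2)^3$.
   Context: $\{0,1,\ldots,m\}^n\subseteq\mathbb{Z}^n$ carries the Manhattan metric $d(x,y)=\sum_{i=1}^n |x_i-y_i|$. For a metric space $X$ and $r\geq 0$, $\mathrm{VR}(X;r)$ is the simplicial complex with vertex set $X$ whose simplices are the finite subsets of $X$ of diameter at most $r$. -}

module Defs where

open import Data.Fin.Base using (Fin; zero; suc; toℕ)
open import Data.Fin.Properties using (*↔×; toℕ-injective) renaming (_≟_ to _≟ᶠ_)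
open import Data.List.Base using (List; [_])
open import Data.List.Membership.Propositional using (_∈_)
open import Data.List.Relation.Binary.Subset.Propositional using (_⊆_)
open import Data.List.Relation.Unary.Any using (here)
open import Data.Maybe.Base using (Maybe; just; nothing)
import Data.Nat.Base as ℕ
open import Data.Nat.Base using (ℕ)
import Data.Nat.Properties as ℕ
open import Data.Product.Base using (∃-syntax; _×_; _,_; <_,_>; uncurry; proj₁; proj₂)
open import Data.Product.Function.NonDependent.Propositional using (_×-↔_)
open import Data.Rational.Base as ℚ using (ℚ; 0ℚ; 1ℚ; ½)
import Data.Rational.Properties as ℚ
open import Data.Rational.Solver using (module +-*-Solver)
open import Data.Sum.Base using (inj₁; inj₂)
import Data.Vec.Base as Vec
open import Data.Vec.Base using (Vec; []; _∷_)
open import Data.Vec.Functional using (Vector; foldr)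
open import Data.Empty using (⊥-elim)
open import Function.Base using (id; _∘_)
open import Function.Bundles using (_↔_; mk↔ₛ′; Inverse)
open import Function.Construct.Composition using (_↔-∘_)
open import Function.Construct.Identity using (↔-id)
import Function.Metric.Nat.Structures as Nat
import Function.Metric.Structures as Metric
open import Level using (0ℓ)
open import Relation.Binary.Core using (Rel)
open import Relation.Binary.PropositionalEquality.Core using (_≡_; refl; sym; trans; cong; cong₂; subst)
open import Relation.Binary.PropositionalEquality.Properties using (isEquivalence)
open import Relation.Binary.Structures using (IsPartialOrder)
open import Relation.Nullary.Decidable using (yes; no)

open +-*-Solver using (solve; _:=_; _:+_; _:*_; _:-_; :-_; con)

IsCauchy : (ℕ → ℚ) → Set
IsCauchy a = ∀ {ε} → 0ℚ ℚ.< ε →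
  ∃[ N ] (∀ {i j} → N ℕ.≤ i → N ℕ.≤ j → ℚ.∣ a i ℚ.- a j ∣ ℚ.< ε)

record ℝ : Set where
  constructor mkℝ
  field
    seq    : ℕ → ℚ
    cauchy : IsCauchy seq

open ℝ public

infix 4 _≤_ _<_ _≃_

record _≤_ (x y : ℝ) : Set where
  constructor mk≤
  field
    eventually-≤ : ∀ {ε} → 0ℚ ℚ.< ε →
                   ∃[ N ] (∀ {i} → N ℕ.≤ i → seq x i ℚ.≤ seq y i ℚ.+ ε)

open _≤_ public

record _<_ (x y : ℝ) : Set where
  constructor mk<
  field
    gap          : ℚ
    gap-positive : 0ℚ ℚ.< gap
    eventually-< : ∃[ N ] (∀ {i} → N ℕ.≤ i → seq x i ℚ.+ gap ℚ.≤ seq y i)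

open _<_ public

_≃_ : Rel ℝ 0ℓ
x ≃ y = x ≤ y × y ≤ x

private
  half-pos : ∀ {ε} → 0ℚ ℚ.< ε → 0ℚ ℚ.< ½ ℚ.* ε
  half-pos {ε} p = subst (ℚ._< ½ ℚ.* ε) (ℚ.*-zeroʳ ½) (ℚ.*-monoʳ-<-pos ½ p)

  half+half : ∀ ε → ½ ℚ.* ε ℚ.+ ½ ℚ.* ε ≡ ε
  half+half = solve 1 (λ e → con ½ :* e :+ con ½ :* e := e) refl

  eventually₂ : ∀ {P Q : ℕ → ℕ → Set} →
    ∃[ N ] (∀ {i j} → N ℕ.≤ i → N ℕ.≤ j → P i j) →
    ∃[ N ] (∀ {i j} → N ℕ.≤ i → N ℕ.≤ j → Q i j) →
    ∃[ N ] (∀ {i j} → N ℕ.≤ i → N ℕ.≤ j → P i j × Q i j)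
  eventually₂ (M , p) (N , q) = M ℕ.⊔ N , λ a b →
    p (ℕ.≤-trans (ℕ.m≤m⊔n M N) a) (ℕ.≤-trans (ℕ.m≤m⊔n M N) b) ,
    q (ℕ.≤-trans (ℕ.m≤n⊔m M N) a) (ℕ.≤-trans (ℕ.m≤n⊔m M N) b)

  bound-pos : ∀ p → 0ℚ ℚ.< ℚ.∣ p ∣ ℚ.+ 1ℚ
  bound-pos p = ℚ.+-mono-≤-< (ℚ.0≤∣p∣ p) (ℚ.positive⁻¹ 1ℚ)

  bounded : ∀ x → ∃[ B ] (0ℚ ℚ.< B ×
    ∃[ N ] (∀ {i j} → N ℕ.≤ i → N ℕ.≤ j → ℚ.∣ seq x i ∣ ℚ.≤ B))
  bounded x with cauchy x (ℚ.positive⁻¹ 1ℚ)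
  ... | N , c = B , bound-pos a , N , λ {i} N≤i _ → begin
      ℚ.∣ seq x i ∣                            ≡⟨ cong ℚ.∣_∣ (split (seq x i) a) ⟩
      ℚ.∣ a ℚ.+ (seq x i ℚ.- a) ∣              ≤⟨ ℚ.∣p+q∣≤∣p∣+∣q∣ a (seq x i ℚ.- a) ⟩
      ℚ.∣ a ∣ ℚ.+ ℚ.∣ seq x i ℚ.- a ∣          ≤⟨ ℚ.+-monoʳ-≤ ℚ.∣ a ∣ (ℚ.<⇒≤ (c N≤i ℕ.≤-refl)) ⟩
      B                                        ∎
    where
    open ℚ.≤-Reasoning
    a = seq x N
    B = ℚ.∣ a ∣ ℚ.+ 1ℚ
    split : ∀ p q → p ≡ q ℚ.+ (p ℚ.- q)
    split = solve 2 (λ p q → p := q :+ (p :- q)) refl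

  quotient : ∀ {ε B} → 0ℚ ℚ.< ε → 0ℚ ℚ.< B → ∃[ δ ] (0ℚ ℚ.< δ × B ℚ.* δ ≡ ε)
  quotient {ε} {B} ε>0 B>0 = B⁻¹ ℚ.* ε ,
    subst (ℚ._< B⁻¹ ℚ.* ε) (ℚ.*-zeroʳ B⁻¹) (ℚ.*-monoʳ-<-pos B⁻¹ ε>0) ,
    trans (sym (ℚ.*-assoc B B⁻¹ ε))
      (trans (cong (ℚ._* ε) (ℚ.*-inverseʳ B)) (ℚ.*-identityˡ ε))
    where
    instance
      B-pos : ℚ.Positive B
      B-pos = ℚ.positive B>0
      B-nonZero : ℚ.NonZero B
      B-nonZero = ℚ.pos⇒nonZero B
    B⁻¹ : ℚ
    B⁻¹ = ℚ.1/ B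
    instance
      B⁻¹-pos : ℚ.Positive B⁻¹
      B⁻¹-pos = ℚ.1/pos⇒pos B

abstract
  fromℚ-cauchy : ∀ p → IsCauchy (λ _ → p)
  fromℚ-cauchy p {ε} ε>0 = 0 , λ _ _ →
    subst (ℚ._< ε) (sym (cong ℚ.∣_∣ (ℚ.+-inverseʳ p))) ε>0

fromℚ : ℚ → ℝ
fromℚ p = mkℝ (λ _ → p) (fromℚ-cauchy p)

0ℝ 1ℝ : ℝ
0ℝ = fromℚ 0ℚ
1ℝ = fromℚ 1ℚ

infix  8 -_
infixl 7 _*_
infixl 6 _+_ _-_

abstract
  +-cauchy : ∀ x y → IsCauchy (λ i → seq x i ℚ.+ seq y i)
  +-cauchy x y {ε} ε>0 =
    let (N , c) = eventually₂ (cauchy x (half-pos ε>0)) (cauchy y (half-pos ε>0))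
    in N , λ {i} {j} a b → let (p , q) = c a b in begin-strict
      ℚ.∣ (seq x i ℚ.+ seq y i) ℚ.- (seq x j ℚ.+ seq y j) ∣
        ≡⟨ cong ℚ.∣_∣ (swap (seq x i) (seq y i) (seq x j) (seq y j)) ⟩
      ℚ.∣ (seq x i ℚ.- seq x j) ℚ.+ (seq y i ℚ.- seq y j) ∣
        ≤⟨ ℚ.∣p+q∣≤∣p∣+∣q∣ (seq x i ℚ.- seq x j) (seq y i ℚ.- seq y j) ⟩
      ℚ.∣ seq x i ℚ.- seq x j ∣ ℚ.+ ℚ.∣ seq y i ℚ.- seq y j ∣
        <⟨ ℚ.+-mono-< p q ⟩
      ½ ℚ.* ε ℚ.+ ½ ℚ.* ε
        ≡⟨ half+half ε ⟩
      ε ∎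
    where
    open ℚ.≤-Reasoning
    swap : ∀ a b c d → (a ℚ.+ b) ℚ.- (c ℚ.+ d) ≡ (a ℚ.- c) ℚ.+ (b ℚ.- d)
    swap = solve 4 (λ a b c d → (a :+ b) :- (c :+ d) := (a :- c) :+ (b :- d)) refl

_+_ : ℝ → ℝ → ℝ
x + y = mkℝ (λ i → seq x i ℚ.+ seq y i) (+-cauchy x y)

abstract
  -‿cauchy : ∀ x → IsCauchy (λ i → ℚ.- seq x i)
  -‿cauchy x {ε} ε>0 =
    let (N , c) = cauchy x ε>0
    in N , λ {i} {j} a b → subst (ℚ._< ε)
      (trans (sym (ℚ.∣-p∣≡∣p∣ (seq x i ℚ.- seq x j))) (cong ℚ.∣_∣ (swap (seq x i) (seq x j))))
      (c a b)
    where
    swap : ∀ a b → ℚ.- (a ℚ.- b) ≡ ℚ.- a ℚ.- ℚ.- b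
    swap = solve 2 (λ a b → :- (a :- b) := :- a :- :- b) refl

-_ : ℝ → ℝ
- x = mkℝ (λ i → ℚ.- seq x i) (-‿cauchy x)

_-_ : ℝ → ℝ → ℝ
x - y = x + - y

abstract
  *-cauchy : ∀ x y → IsCauchy (λ i → seq x i ℚ.* seq y i)
  *-cauchy x y = prf
    where
    open ℚ.≤-Reasoning
    split : ∀ a b c d → a ℚ.* b ℚ.- c ℚ.* d ≡ a ℚ.* (b ℚ.- d) ℚ.+ d ℚ.* (a ℚ.- c)
    split = solve 4 (λ a b c d → a :* b :- c :* d := a :* (b :- d) :+ d :* (a :- c)) refl

    mul-≤ : ∀ {p B q δ} → ℚ.∣ p ∣ ℚ.≤ B → 0ℚ ℚ.< B → ℚ.∣ q ∣ ℚ.< δ → ℚ.∣ p ℚ.* q ∣ ℚ.< B ℚ.* δ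
    mul-≤ {p} {B} {q} {δ} p≤B B>0 q<δ = begin-strict
      ℚ.∣ p ℚ.* q ∣        ≡⟨ ℚ.∣p*q∣≡∣p∣*∣q∣ p q ⟩
      ℚ.∣ p ∣ ℚ.* ℚ.∣ q ∣  ≤⟨ ℚ.*-monoʳ-≤-nonNeg ℚ.∣ q ∣ {{ℚ.∣-∣-nonNeg q}} p≤B ⟩
      B ℚ.* ℚ.∣ q ∣        <⟨ ℚ.*-monoʳ-<-pos B {{ℚ.positive B>0}} q<δ ⟩
      B ℚ.* δ              ∎

    step : ∀ {ε Bx By δx δy} → 0ℚ ℚ.< Bx → 0ℚ ℚ.< By →
           Bx ℚ.* δy ≡ ½ ℚ.* ε → By ℚ.* δx ≡ ½ ℚ.* ε → ∀ xi yi xj yj →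
           ℚ.∣ xi ∣ ℚ.≤ Bx → ℚ.∣ yj ∣ ℚ.≤ By → ℚ.∣ xi ℚ.- xj ∣ ℚ.< δx → ℚ.∣ yi ℚ.- yj ∣ ℚ.< δy →
           ℚ.∣ xi ℚ.* yi ℚ.- xj ℚ.* yj ∣ ℚ.< ε
    step {ε} {Bx} {By} {δx} {δy} Bx>0 By>0 eqy eqx xi yi xj yj xi≤ yj≤ dx dy = begin-strict
      ℚ.∣ xi ℚ.* yi ℚ.- xj ℚ.* yj ∣
        ≡⟨ cong ℚ.∣_∣ (split xi yi xj yj) ⟩
      ℚ.∣ xi ℚ.* (yi ℚ.- yj) ℚ.+ yj ℚ.* (xi ℚ.- xj) ∣
        ≤⟨ ℚ.∣p+q∣≤∣p∣+∣q∣ (xi ℚ.* (yi ℚ.- yj)) (yj ℚ.* (xi ℚ.- xj)) ⟩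
      ℚ.∣ xi ℚ.* (yi ℚ.- yj) ∣ ℚ.+ ℚ.∣ yj ℚ.* (xi ℚ.- xj) ∣
        <⟨ ℚ.+-mono-< (mul-≤ {xi} {Bx} {yi ℚ.- yj} {δy} xi≤ Bx>0 dy)
                      (mul-≤ {yj} {By} {xi ℚ.- xj} {δx} yj≤ By>0 dx) ⟩
      Bx ℚ.* δy ℚ.+ By ℚ.* δx
        ≡⟨ cong₂ ℚ._+_ eqy eqx ⟩
      ½ ℚ.* ε ℚ.+ ½ ℚ.* ε
        ≡⟨ half+half ε ⟩
      ε ∎

    prf : IsCauchy (λ i → seq x i ℚ.* seq y i)
    prf {ε} ε>0 =
      let (Bx , Bx>0 , bx) = bounded x
          (By , By>0 , by) = bounded y
          (δy , δy>0 , eqy) = quotient (half-pos ε>0) Bx>0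
          (δx , δx>0 , eqx) = quotient (half-pos ε>0) By>0
          (N , c) = eventually₂ (eventually₂ bx by) (eventually₂ (cauchy x δx>0) (cauchy y δy>0))
      in N , λ {i} {j} a b →
        step Bx>0 By>0 eqy eqx (seq x i) (seq y i) (seq x j) (seq y j)
          (proj₁ (proj₁ (c a b))) (proj₂ (proj₁ (c b a)))
          (proj₁ (proj₂ (c a b))) (proj₂ (proj₂ (c a b)))

_*_ : ℝ → ℝ → ℝ
x * y = mkℝ (λ i → seq x i ℚ.* seq y i) (*-cauchy x y)

abstract
  ∣∣-cauchy : ∀ x → IsCauchy (λ i → ℚ.∣ seq x i ∣)
  ∣∣-cauchy x ε>0 =
    let (N , c) = cauchy x ε>0
    in N , λ {i} {j} a b → ℚ.≤-<-trans (reverse (seq x i) (seq x j)) (c a b)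
    where
    open ℚ.≤-Reasoning
    one-sided : ∀ p q → ℚ.∣ p ∣ ℚ.- ℚ.∣ q ∣ ℚ.≤ ℚ.∣ p ℚ.- q ∣
    one-sided p q = begin
      ℚ.∣ p ∣ ℚ.- ℚ.∣ q ∣
        ≡⟨ cong (λ z → ℚ.∣ z ∣ ℚ.- ℚ.∣ q ∣)
             (solve 2 (λ p q → p := (p :- q) :+ q) refl p q) ⟩
      ℚ.∣ (p ℚ.- q) ℚ.+ q ∣ ℚ.- ℚ.∣ q ∣
        ≤⟨ ℚ.+-monoˡ-≤ (ℚ.- ℚ.∣ q ∣) (ℚ.∣p+q∣≤∣p∣+∣q∣ (p ℚ.- q) q) ⟩
      (ℚ.∣ p ℚ.- q ∣ ℚ.+ ℚ.∣ q ∣) ℚ.- ℚ.∣ q ∣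
        ≡⟨ solve 2 (λ a b → (a :+ b) :- b := a) refl ℚ.∣ p ℚ.- q ∣ ℚ.∣ q ∣ ⟩
      ℚ.∣ p ℚ.- q ∣ ∎

    ∣-∣-comm : ∀ p q → ℚ.∣ p ℚ.- q ∣ ≡ ℚ.∣ q ℚ.- p ∣
    ∣-∣-comm p q = trans (sym (ℚ.∣-p∣≡∣p∣ (p ℚ.- q)))
      (cong ℚ.∣_∣ (solve 2 (λ p q → :- (p :- q) := q :- p) refl p q))

    reverse : ∀ p q → ℚ.∣ ℚ.∣ p ∣ ℚ.- ℚ.∣ q ∣ ∣ ℚ.≤ ℚ.∣ p ℚ.- q ∣
    reverse p q with ℚ.∣p∣≡p∨∣p∣≡-p (ℚ.∣ p ∣ ℚ.- ℚ.∣ q ∣)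
    ... | inj₁ eq = ℚ.≤-trans (ℚ.≤-reflexive eq) (one-sided p q)
    ... | inj₂ eq = begin
      ℚ.∣ ℚ.∣ p ∣ ℚ.- ℚ.∣ q ∣ ∣  ≡⟨ eq ⟩
      ℚ.- (ℚ.∣ p ∣ ℚ.- ℚ.∣ q ∣)  ≡⟨ solve 2 (λ a b → :- (a :- b) := b :- a) refl ℚ.∣ p ∣ ℚ.∣ q ∣ ⟩
      ℚ.∣ q ∣ ℚ.- ℚ.∣ p ∣        ≤⟨ one-sided q p ⟩
      ℚ.∣ q ℚ.- p ∣              ≡⟨ ∣-∣-comm q p ⟩
      ℚ.∣ p ℚ.- q ∣              ∎

∣_∣ : ℝ → ℝ
∣ x ∣ = mkℝ (λ i → ℚ.∣ seq x i ∣) (∣∣-cauchy x)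

sum : ∀ {n} → Vector ℝ n → ℝ
sum = foldr _+_ 0ℝ

pointwise-≤ : ∀ {x y} → (∀ i → seq x i ℚ.≤ seq y i) → x ≤ y
pointwise-≤ {x} {y} p = mk≤ λ {ε} ε>0 → 0 , λ {i} _ → begin
  seq x i          ≤⟨ p i ⟩
  seq y i          ≡⟨ ℚ.+-identityʳ (seq y i) ⟨
  seq y i ℚ.+ 0ℚ   ≤⟨ ℚ.+-monoʳ-≤ (seq y i) (ℚ.<⇒≤ ε>0) ⟩
  seq y i ℚ.+ ε    ∎
  where open ℚ.≤-Reasoning

pointwise-≃ : ∀ {x y} → (∀ i → seq x i ≡ seq y i) → x ≃ y
pointwise-≃ {x} {y} p =
  pointwise-≤ {x} {y} (λ i → ℚ.≤-reflexive (p i)) ,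
  pointwise-≤ {y} {x} (λ i → ℚ.≤-reflexive (sym (p i)))

private
  combine : ∀ {P Q : ℕ → Set} → ∃[ N ] (∀ {i} → N ℕ.≤ i → P i) →
    ∃[ N ] (∀ {i} → N ℕ.≤ i → Q i) → ∃[ N ] (∀ {i} → N ℕ.≤ i → P i × Q i)
  combine (M , p) (N , q) = M ℕ.⊔ N , λ a →
    p (ℕ.≤-trans (ℕ.m≤m⊔n M N) a) , q (ℕ.≤-trans (ℕ.m≤n⊔m M N) a)

≤-refl : ∀ {x} → x ≤ x
≤-refl {x} = pointwise-≤ {x} {x} (λ _ → ℚ.≤-refl)

≤-trans : ∀ {x y z} → x ≤ y → y ≤ z → x ≤ z
≤-trans {x} {y} {z} p q = mk≤ λ {ε} ε>0 →
  let (N , c) = combine (eventually-≤ p (half-pos ε>0)) (eventually-≤ q (half-pos ε>0))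
  in N , λ {i} a → begin
    seq x i                                  ≤⟨ proj₁ (c a) ⟩
    seq y i ℚ.+ ½ ℚ.* ε                      ≤⟨ ℚ.+-monoˡ-≤ (½ ℚ.* ε) (proj₂ (c a)) ⟩
    (seq z i ℚ.+ ½ ℚ.* ε) ℚ.+ ½ ℚ.* ε        ≡⟨ ℚ.+-assoc (seq z i) (½ ℚ.* ε) (½ ℚ.* ε) ⟩
    seq z i ℚ.+ (½ ℚ.* ε ℚ.+ ½ ℚ.* ε)        ≡⟨ cong (seq z i ℚ.+_) (half+half ε) ⟩
    seq z i ℚ.+ ε                            ∎
  where open ℚ.≤-Reasoning

+-mono-≤ : ∀ {x y u v} → x ≤ y → u ≤ v → x + u ≤ y + v
+-mono-≤ {x} {y} {u} {v} p q = mk≤ λ {ε} ε>0 →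
  let (N , c) = combine (eventually-≤ p (half-pos ε>0)) (eventually-≤ q (half-pos ε>0))
  in N , λ {i} a → begin
    seq x i ℚ.+ seq u i
      ≤⟨ ℚ.+-mono-≤ (proj₁ (c a)) (proj₂ (c a)) ⟩
    (seq y i ℚ.+ ½ ℚ.* ε) ℚ.+ (seq v i ℚ.+ ½ ℚ.* ε)
      ≡⟨ rearrange (seq y i) (seq v i) ε ⟩
    (seq y i ℚ.+ seq v i) ℚ.+ ε ∎
  where
  open ℚ.≤-Reasoning
  rearrange : ∀ a b e → (a ℚ.+ ½ ℚ.* e) ℚ.+ (b ℚ.+ ½ ℚ.* e) ≡ (a ℚ.+ b) ℚ.+ e
  rearrange = solve 3 (λ a b e → (a :+ con ½ :* e) :+ (b :+ con ½ :* e) := (a :+ b) :+ e) refl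

≃-refl : ∀ {x} → x ≃ x
≃-refl {x} = ≤-refl {x} , ≤-refl {x}

≃-sym : ∀ {x y} → x ≃ y → y ≃ x
≃-sym (p , q) = q , p

≃-trans : ∀ {x y z} → x ≃ y → y ≃ z → x ≃ z
≃-trans {x} {y} {z} (p , q) (r , s) = ≤-trans {x} {y} {z} p r , ≤-trans {z} {y} {x} s q

+-cong : ∀ {x y u v} → x ≃ y → u ≃ v → x + u ≃ y + v
+-cong {x} {y} {u} {v} (p , q) (r , s) =
  +-mono-≤ {x} {y} {u} {v} p r , +-mono-≤ {y} {x} {v} {u} q s

0+0≃0 : 0ℝ + 0ℝ ≃ 0ℝ
0+0≃0 = pointwise-≃ (λ _ → refl)

+-nonNegative : ∀ {x y} → 0ℝ ≤ x → 0ℝ ≤ y → 0ℝ ≤ x + y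
+-nonNegative p q = ≤-trans (proj₂ 0+0≃0) (+-mono-≤ p q)

≤-isPartialOrder : IsPartialOrder _≃_ _≤_
≤-isPartialOrder = record
  { isPreorder = record
    { isEquivalence = record
      { refl  = λ {x} → ≃-refl {x}
      ; sym   = λ {x} {y} → ≃-sym {x} {y}
      ; trans = λ {x} {y} {z} → ≃-trans {x} {y} {z}
      }
    ; reflexive = proj₁
    ; trans     = λ {x} {y} {z} → ≤-trans {x} {y} {z}
    }
  ; antisym = _,_
  }

record MetricSpace : Set₁ where
  infix 4 _≈_
  field
    Carrier  : Set
    _≈_      : Rel Carrier 0ℓ
    d        : Carrier → Carrier → ℝ
    isMetric : Metric.IsGeneralMetric _≈_ _≃_ _≤_ 0ℝ _+_ d

-- The metric quotient of a pseudometric: points at distance 0 are identified.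
module _ {X : Set} (d : X → X → ℝ)
  (nonNegative : ∀ x y → 0ℝ ≤ d x y)
  (d-refl      : ∀ x → d x x ≃ 0ℝ)
  (d-sym       : ∀ x y → d x y ≤ d y x)
  (triangle    : ∀ x y z → d x z ≤ d x y + d y z)
  where

  private
    vanish : ∀ x y z w → d x y ≃ 0ℝ → d z w ≃ 0ℝ → d x y + d z w ≤ 0ℝ
    vanish x y z w p q = ≤-trans
      (+-mono-≤ (proj₁ p) (proj₁ q))
      (proj₁ 0+0≃0)

    swap : ∀ x y → d x y ≃ 0ℝ → d y x ≃ 0ℝ
    swap x y p =
      ≤-trans (d-sym y x) (proj₁ p) , nonNegative y x

    move : ∀ x y u v → d x y ≃ 0ℝ → d u v ≃ 0ℝ → d x u ≤ d y v
    move x y u v p q =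
      ≤-trans (triangle x y u)
      (≤-trans
        (+-mono-≤ (proj₁ p)
          (≤-trans (triangle y v u)
            (+-mono-≤ ≤-refl (proj₁ (swap u v q)))))
        (pointwise-≤ λ i → ℚ.≤-reflexive
          (trans (ℚ.+-identityˡ _) (ℚ.+-identityʳ _))))

  metricQuotient : MetricSpace
  metricQuotient = record
    { Carrier  = X
    ; _≈_      = λ x y → d x y ≃ 0ℝ
    ; d        = d
    ; isMetric = record
      { isSemiMetric = record
        { isQuasiSemiMetric = record
          { isPreMetric = record
            { isProtoMetric = record
              { isPartialOrder  = ≤-isPartialOrder
              ; ≈-isEquivalence = record
                { refl  = λ {x} → d-refl x
                ; sym   = λ {x} {y} → swap x y
                ; trans = λ {x} {y} {z} p q →
                    ≤-trans (triangle x y z) (vanish x y y z p q) ,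
                    nonNegative x z
                }
              ; cong = λ {x} {y} {u} {v} p q →
                  move x y u v p q , move y x v u (swap x y p) (swap u v q)
              ; nonNegative = λ {x} {y} → nonNegative x y
              }
            ; ≈⇒0 = id
            }
          ; 0⇒≈ = id
          }
        ; sym = λ x y → d-sym x y , d-sym y x
        }
      ; triangle = triangle
      }
    }

-- A set of vectors in ℝⁿ, with the metric ∑ᵢ |xᵢ − yᵢ|. It induces the
-- Euclidean topology.
module _ {A : Set} {n : ℕ} (coord : A → Vector ℝ n) where

  private
    dist : A → A → ℝ
    dist x y = sum (λ i → ∣ coord x i - coord y i ∣)

    sum-mono : ∀ {n} (f g : Vector ℝ n) → (∀ i k → seq (f i) k ℚ.≤ seq (g i) k) →
               ∀ k → seq (sum f) k ℚ.≤ seq (sum g) k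
    sum-mono {ℕ.zero}  f g p k = ℚ.≤-refl
    sum-mono {ℕ.suc n} f g p k =
      ℚ.+-mono-≤ (p zero k) (sum-mono (f ∘ suc) (g ∘ suc) (λ i → p (suc i)) k)

    sum-zero : ∀ n k → seq (sum {n} (λ _ → 0ℝ)) k ≡ 0ℚ
    sum-zero ℕ.zero    k = refl
    sum-zero (ℕ.suc n) k = trans (ℚ.+-identityˡ _) (sum-zero n k)

    sum-+ : ∀ {n} (f g : Vector ℝ n) k →
            seq (sum (λ i → f i + g i)) k ≡ seq (sum f) k ℚ.+ seq (sum g) k
    sum-+ {ℕ.zero}  f g k = refl
    sum-+ {ℕ.suc n} f g k = trans
      (cong (seq (f zero) k ℚ.+ seq (g zero) k ℚ.+_) (sum-+ (f ∘ suc) (g ∘ suc) k))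
      (interchange (seq (f zero) k) (seq (g zero) k) (seq (sum (f ∘ suc)) k) (seq (sum (g ∘ suc)) k))
      where
      interchange : ∀ a b c e → (a ℚ.+ b) ℚ.+ (c ℚ.+ e) ≡ (a ℚ.+ c) ℚ.+ (b ℚ.+ e)
      interchange = solve 4 (λ a b c e → (a :+ b) :+ (c :+ e) := (a :+ c) :+ (b :+ e)) refl

    comm : ∀ p q → ℚ.∣ p ℚ.- q ∣ ≡ ℚ.∣ q ℚ.- p ∣
    comm p q = trans (sym (ℚ.∣-p∣≡∣p∣ (p ℚ.- q)))
      (cong ℚ.∣_∣ (solve 2 (λ p q → :- (p :- q) := q :- p) refl p q))

    tri : ∀ p q r → ℚ.∣ p ℚ.- r ∣ ℚ.≤ ℚ.∣ p ℚ.- q ∣ ℚ.+ ℚ.∣ q ℚ.- r ∣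
    tri p q r = ℚ.≤-trans
      (ℚ.≤-reflexive (cong ℚ.∣_∣
        (solve 3 (λ p q r → p :- r := (p :- q) :+ (q :- r)) refl p q r)))
      (ℚ.∣p+q∣≤∣p∣+∣q∣ (p ℚ.- q) (q ℚ.- r))

    dist-nonNegative : ∀ x y → 0ℝ ≤ dist x y
    dist-nonNegative x y = pointwise-≤ λ k → ℚ.≤-trans
      (ℚ.≤-reflexive (sym (sum-zero n k)))
      (sum-mono (λ _ → 0ℝ) (λ i → ∣ coord x i - coord y i ∣)
        (λ i k → ℚ.0≤∣p∣ (seq (coord x i) k ℚ.- seq (coord y i) k)) k)

    dist-refl : ∀ x → dist x x ≃ 0ℝ
    dist-refl x = pointwise-≤ (λ k → ℚ.≤-trans
      (sum-mono (λ i → ∣ coord x i - coord x i ∣) (λ _ → 0ℝ)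
        (λ i k → ℚ.≤-reflexive (cong ℚ.∣_∣ (ℚ.+-inverseʳ (seq (coord x i) k)))) k)
      (ℚ.≤-reflexive (sum-zero n k))) , dist-nonNegative x x

    dist-sym : ∀ x y → dist x y ≤ dist y x
    dist-sym x y = pointwise-≤
      (sum-mono (λ i → ∣ coord x i - coord y i ∣) (λ i → ∣ coord y i - coord x i ∣)
        (λ i k → ℚ.≤-reflexive (comm (seq (coord x i) k) (seq (coord y i) k))))

    dist-triangle : ∀ x y z → dist x z ≤ dist x y + dist y z
    dist-triangle x y z = pointwise-≤ λ k → ℚ.≤-trans
      (sum-mono (λ i → ∣ coord x i - coord z i ∣)
        (λ i → ∣ coord x i - coord y i ∣ + ∣ coord y i - coord z i ∣)
        (λ i k → tri (seq (coord x i) k) (seq (coord y i) k) (seq (coord z i) k)) k)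
      (ℚ.≤-reflexive
        (sum-+ (λ i → ∣ coord x i - coord y i ∣) (λ i → ∣ coord y i - coord z i ∣) k))

  subspace : MetricSpace
  subspace = metricQuotient dist dist-nonNegative dist-refl dist-sym dist-triangle

module _ (X : MetricSpace) where
  private
    module X = MetricSpace X
    module M = Metric.IsGeneralMetric X.isMetric

  d-refl : ∀ x → X.d x x ≃ 0ℝ
  d-refl x = M.≈⇒0 M.EqC.refl

  d-nonNegative : ∀ x y → 0ℝ ≤ X.d x y
  d-nonNegative x y = M.nonNegative

  d-sym : ∀ x y → X.d x y ≤ X.d y x
  d-sym x y = proj₁ (M.sym x y)

  d-triangle : ∀ x y z → X.d x z ≤ X.d x y + X.d y z
  d-triangle = M.triangle

infixr 2 _×ₘ_

_×ₘ_ : MetricSpace → MetricSpace → MetricSpace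
X ×ₘ Y = metricQuotient dist
  (λ { (x , u) (y , v) →
    +-nonNegative (d-nonNegative X x y) (d-nonNegative Y u v) })
  (λ { (x , u) → ≃-trans (+-cong (d-refl X x) (d-refl Y u)) 0+0≃0 })
  (λ { (x , u) (y , v) →
    +-mono-≤ (d-sym X x y) (d-sym Y u v) })
  (λ { (x , u) (y , v) (z , w) →
    ≤-trans
      (+-mono-≤ (d-triangle X x y z) (d-triangle Y u v w))
      (pointwise-≤
        λ i → ℚ.≤-reflexive (interchange (seq (X.d x y) i) (seq (X.d y z) i)
                                         (seq (Y.d u v) i) (seq (Y.d v w) i))) })
  where
  module X = MetricSpace X
  module Y = MetricSpace Y

  dist : X.Carrier × Y.Carrier → X.Carrier × Y.Carrier → ℝ
  dist (x , u) (y , v) = X.d x y + Y.d u v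

  interchange : ∀ a b c e → (a ℚ.+ b) ℚ.+ (c ℚ.+ e) ≡ (a ℚ.+ c) ℚ.+ (b ℚ.+ e)
  interchange = solve 4 (λ a b c e → (a :+ b) :+ (c :+ e) := (a :+ c) :+ (b :+ e)) refl

-- The wedge sum of ν copies of X at x₀: `nothing` is the wedge point, and the
-- wedge metric identifies it with every `just (i , x₀)` and nothing else, by
-- measuring distances between different copies through x₀. For finite ν this
-- metric induces the quotient topology. With ν = 0 the wedge is a point.
⋁ : ℕ → (X : MetricSpace) → MetricSpace.Carrier X → MetricSpace
⋁ ν X x₀ = metricQuotient dist nonNeg reflex symm tri
  where
  module X = MetricSpace X

  dist : Maybe (Fin ν × X.Carrier) → Maybe (Fin ν × X.Carrier) → ℝ
  dist nothing        nothing        = 0ℝ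
  dist nothing        (just (_ , y)) = X.d x₀ y
  dist (just (_ , x)) nothing        = X.d x x₀
  dist (just (i , x)) (just (j , y)) with i ≟ᶠ j
  ... | yes _ = X.d x y
  ... | no  _ = X.d x x₀ + X.d x₀ y

  nonNeg : ∀ p q → 0ℝ ≤ dist p q
  nonNeg nothing        nothing        = ≤-refl
  nonNeg nothing        (just (_ , y)) = d-nonNegative X x₀ y
  nonNeg (just (_ , x)) nothing        = d-nonNegative X x x₀
  nonNeg (just (i , x)) (just (j , y)) with i ≟ᶠ j
  ... | yes _ = d-nonNegative X x y
  ... | no  _ = +-nonNegative (d-nonNegative X x x₀) (d-nonNegative X x₀ y)

  reflex : ∀ p → dist p p ≃ 0ℝ
  reflex nothing = ≃-refl
  reflex (just (i , x)) with i ≟ᶠ i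
  ... | yes _   = d-refl X x
  ... | no  i≢i = ⊥-elim (i≢i refl)

  +-comm-≤ : ∀ a b → a + b ≤ b + a
  +-comm-≤ a b = pointwise-≤ λ k → ℚ.≤-reflexive (ℚ.+-comm (seq a k) (seq b k))

  symm : ∀ p q → dist p q ≤ dist q p
  symm nothing        nothing        = ≤-refl
  symm nothing        (just (_ , y)) = d-sym X x₀ y
  symm (just (_ , x)) nothing        = d-sym X x x₀
  symm (just (i , x)) (just (j , y)) with i ≟ᶠ j | j ≟ᶠ i
  ... | yes _   | yes _   = d-sym X x y
  ... | yes i≡j | no  j≢i = ⊥-elim (j≢i (sym i≡j))
  ... | no  i≢j | yes j≡i = ⊥-elim (i≢j (sym j≡i))
  ... | no  _   | no  _   = ≤-trans
      (+-mono-≤ (d-sym X x x₀) (d-sym X x₀ y)) (+-comm-≤ (X.d x₀ x) (X.d y x₀))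

  via : ∀ x y → X.d x y ≤ X.d x x₀ + X.d x₀ y
  via x y = d-triangle X x x₀ y

  +-identity-≤ : ∀ a → a ≤ a + 0ℝ
  +-identity-≤ a = pointwise-≤ λ k → ℚ.≤-reflexive (sym (ℚ.+-identityʳ (seq a k)))

  identity-+-≤ : ∀ a → a ≤ 0ℝ + a
  identity-+-≤ a = pointwise-≤ λ k → ℚ.≤-reflexive (sym (ℚ.+-identityˡ (seq a k)))

  weakenʳ : ∀ a b → 0ℝ ≤ b → a ≤ a + b
  weakenʳ a b b≥0 = ≤-trans (+-identity-≤ a)
    (+-mono-≤ ≤-refl b≥0)

  weakenˡ : ∀ a b → 0ℝ ≤ a → b ≤ a + b
  weakenˡ a b a≥0 = ≤-trans (identity-+-≤ b)
    (+-mono-≤ a≥0 ≤-refl)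

  assoc-≤ : ∀ a b c → (a + b) + c ≤ a + (b + c)
  assoc-≤ a b c = pointwise-≤ λ k →
    ℚ.≤-reflexive (ℚ.+-assoc (seq a k) (seq b k) (seq c k))

  assoc-≥ : ∀ a b c → a + (b + c) ≤ (a + b) + c
  assoc-≥ a b c = pointwise-≤ λ k →
    ℚ.≤-reflexive (sym (ℚ.+-assoc (seq a k) (seq b k) (seq c k)))

  detour : ∀ a b c e → 0ℝ ≤ b → 0ℝ ≤ c → a + e ≤ (a + b) + (c + e)
  detour a b c e b≥0 c≥0 =
    +-mono-≤ (weakenʳ a b b≥0) (weakenˡ c e c≥0)

  tri : ∀ p q r → dist p r ≤ dist p q + dist q r
  tri nothing nothing nothing = proj₂ 0+0≃0
  tri nothing nothing (just (_ , z)) = identity-+-≤ (X.d x₀ z)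
  tri nothing (just (_ , y)) nothing =
    +-nonNegative (d-nonNegative X x₀ y) (d-nonNegative X y x₀)
  tri nothing (just (j , y)) (just (k , z)) with j ≟ᶠ k
  ... | yes _ = d-triangle X x₀ y z
  ... | no  _ = ≤-trans
      (weakenˡ (X.d y x₀) (X.d x₀ z) (d-nonNegative X y x₀))
      (weakenˡ (X.d x₀ y) (X.d y x₀ + X.d x₀ z) (d-nonNegative X x₀ y))
  tri (just (_ , x)) nothing nothing = +-identity-≤ (X.d x x₀)
  tri (just (i , x)) nothing (just (k , z)) with i ≟ᶠ k
  ... | yes _ = via x z
  ... | no  _ = ≤-refl
  tri (just (i , x)) (just (j , y)) nothing with i ≟ᶠ j
  ... | yes _ = d-triangle X x y x₀
  ... | no  _ = ≤-trans
      (weakenʳ (X.d x x₀) (X.d x₀ y) (d-nonNegative X x₀ y))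
      (weakenʳ (X.d x x₀ + X.d x₀ y) (X.d y x₀) (d-nonNegative X y x₀))
  tri (just (i , x)) (just (j , y)) (just (k , z)) with i ≟ᶠ k | i ≟ᶠ j | j ≟ᶠ k
  ... | yes _   | yes _   | yes _   = d-triangle X x y z
  ... | yes i≡k | yes i≡j | no  j≢k = ⊥-elim (j≢k (trans (sym i≡j) i≡k))
  ... | yes i≡k | no  i≢j | yes j≡k = ⊥-elim (i≢j (trans i≡k (sym j≡k)))
  ... | no  i≢k | yes i≡j | yes j≡k = ⊥-elim (i≢k (trans i≡j j≡k))
  ... | yes _   | no  _   | no  _   =
    ≤-trans (via x z)
      (detour (X.d x x₀) (X.d x₀ y) (X.d y x₀) (X.d x₀ z) (d-nonNegative X x₀ y) (d-nonNegative X y x₀))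
  ... | no  _   | no  _   | no  _   =
    detour (X.d x x₀) (X.d x₀ y) (X.d y x₀) (X.d x₀ z) (d-nonNegative X x₀ y) (d-nonNegative X y x₀)
  ... | no  _   | yes _   | no  _   =
    ≤-trans
      (+-mono-≤ (d-triangle X x y x₀) ≤-refl)
      (assoc-≤ (X.d x y) (X.d y x₀) (X.d x₀ z))
  ... | no  _   | no  _   | yes _   =
    ≤-trans
      (+-mono-≤ ≤-refl (d-triangle X x₀ y z))
      (assoc-≥ (X.d x x₀) (X.d x₀ y) (X.d y z))

-- Continuity at points at distance 0 forces f to respect _≈_.
Continuous : (X Y : MetricSpace) → (MetricSpace.Carrier X → MetricSpace.Carrier Y) → Set
Continuous X Y f = ∀ x {ε} → 0ℝ < ε →
  ∃[ δ ] (0ℝ < δ × (∀ x′ → X.d x x′ < δ → Y.d (f x) (f x′) < ε))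
  where
  module X = MetricSpace X
  module Y = MetricSpace Y

record UnitInterval : Set where
  constructor mkI
  field
    value : ℝ
    lower : 0ℝ ≤ value
    upper : value ≤ 1ℝ

𝕀 : MetricSpace
𝕀 = subspace {UnitInterval} {1} (λ t _ → UnitInterval.value t)

0ᴵ 1ᴵ : UnitInterval
0ᴵ = mkI 0ℝ ≤-refl (pointwise-≤ (λ _ → ℚ.<⇒≤ (ℚ.positive⁻¹ 1ℚ)))
1ᴵ = mkI 1ℝ (pointwise-≤ (λ _ → ℚ.<⇒≤ (ℚ.positive⁻¹ 1ℚ))) ≤-refl

record Homotopic (X Y : MetricSpace)
                 (f g : MetricSpace.Carrier X → MetricSpace.Carrier Y) : Set where
  private
    module X = MetricSpace X
    module Y = MetricSpace Y
  field
    H            : X.Carrier × UnitInterval → Y.Carrier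
    H-continuous : Continuous (X ×ₘ 𝕀) Y H
    H-start      : ∀ x → H (x , 0ᴵ) Y.≈ f x
    H-end        : ∀ x → H (x , 1ᴵ) Y.≈ g x

infix 4 _≃ₕ_

record _≃ₕ_ (X Y : MetricSpace) : Set where
  private
    module X = MetricSpace X
    module Y = MetricSpace Y
  field
    to              : X.Carrier → Y.Carrier
    from            : Y.Carrier → X.Carrier
    to-continuous   : Continuous X Y to
    from-continuous : Continuous Y X from
    from∘to         : Homotopic X X (from ∘ to) id
    to∘from         : Homotopic Y Y (to ∘ from) id

record SpherePoint (k : ℕ) : Set where
  field
    coord : Vector ℝ (ℕ.suc k)
    unit  : sum (λ i → coord i * coord i) ≃ 1ℝ

𝕊 : ℕ → MetricSpace
𝕊 k = subspace {SpherePoint k} SpherePoint.coord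

northPole : ∀ k → SpherePoint k
northPole k = record
  { coord = e₀
  ; unit  = pointwise-≃
              (λ j → trans (cong (1ℚ ℚ.* 1ℚ ℚ.+_) (zeros k j)) refl)
  }
  where
  e₀ : ∀ {n} → Vector ℝ (ℕ.suc n)
  e₀ zero    = 1ℝ
  e₀ (suc _) = 0ℝ

  zeros : ∀ n j → seq (sum {n} (λ _ → 0ℝ * 0ℝ)) j ≡ 0ℚ
  zeros ℕ.zero    j = refl
  zeros (ℕ.suc n) j = trans (ℚ.+-identityˡ _) (zeros n j)

-- Finite sets of vertices are lists up to mutual inclusion; ⊆-closed makes
-- IsSimplex invariant under it.
record SimplicialComplex : Set₁ where
  field
    Vertex    : Set
    IsSimplex : List Vertex → Set
    singleton : ∀ v → IsSimplex [ v ]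
    ⊆-closed  : ∀ {σ τ} → σ ⊆ τ → IsSimplex τ → IsSimplex σ

Finite : Set → Set
Finite A = ∃[ n ] (Fin n ↔ A)

module _ (K : SimplicialComplex) (finite : Finite (SimplicialComplex.Vertex K)) where
  open SimplicialComplex K

  private
    vertex : Fin (proj₁ finite) → Vertex
    vertex = Inverse.to (proj₂ finite)

  record RealizationPoint : Set where
    field
      weight      : Vertex → ℝ
      nonNegative : ∀ v → 0ℝ ≤ weight v
      total       : sum (weight ∘ vertex) ≃ 1ℝ
      -- The support is a simplex. As it need not be decidable, this is said of
      -- every finite set of vertices contained in it.
      support     : ∀ σ → (∀ {v} → v ∈ σ → 0ℝ < weight v) → IsSimplex σ

  -- As there are finitely many vertices, this metric induces the weak topology.
  realization : MetricSpace
  realization = subspace {RealizationPoint} (λ t → RealizationPoint.weight t ∘ vertex)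

VR : {X : Set} {d : X → X → ℕ} → Nat.IsMetric _≡_ d → ℕ → SimplicialComplex
VR {X} {d} isMetric r = record
  { Vertex    = X
  ; IsSimplex = λ σ → ∀ {x y} → x ∈ σ → y ∈ σ → d x y ℕ.≤ r
  ; singleton = λ { v (here refl) (here refl) → ℕ.≤-trans (ℕ.≤-reflexive (M.≈⇒0 refl)) ℕ.z≤n }
  ; ⊆-closed  = λ σ⊆τ diam x∈σ y∈σ → diam (σ⊆τ x∈σ) (σ⊆τ y∈σ)
  }
  where module M = Nat.IsMetric isMetric

Grid : ℕ → ℕ → Set
Grid m n = Vec (Fin (ℕ.suc m)) n

grid-finite : ∀ m n → Finite (Grid m n)
grid-finite m n = ℕ.suc m ℕ.^ n , enumerate n
  where
  cons : ∀ {n} → (Fin (ℕ.suc m) × Grid m n) ↔ Grid m (ℕ.suc n)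
  cons = mk↔ₛ′ (uncurry _∷_) < Vec.head , Vec.tail > (λ { (_ ∷ _) → refl }) (λ _ → refl)

  enumerate : ∀ n → Fin (ℕ.suc m ℕ.^ n) ↔ Grid m n
  enumerate ℕ.zero    = mk↔ₛ′ (λ _ → []) (λ _ → zero) (λ { [] → refl }) (λ { zero → refl ; (suc ()) })
  enumerate (ℕ.suc n) = cons ↔-∘ ((↔-id _ ×-↔ enumerate n) ↔-∘ *↔×)

manhattan : ∀ {m n} → Grid m n → Grid m n → ℕ
manhattan x y = Vec.sum (Vec.zipWith (λ a b → ℕ.∣ toℕ a - toℕ b ∣) x y)

manhattan-isMetric : ∀ m n → Nat.IsMetric _≡_ (manhattan {m} {n})
manhattan-isMetric m n = record
  { isSemiMetric = record
    { isQuasiSemiMetric = record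
      { isPreMetric = record
        { isProtoMetric = record
          { isPartialOrder  = ℕ.≤-isPartialOrder
          ; ≈-isEquivalence = isEquivalence
          ; cong            = cong₂ manhattan
          ; nonNegative     = ℕ.z≤n
          }
        ; ≈⇒0 = λ { {x} refl → reflexive x }
        }
      ; 0⇒≈ = λ {x} {y} → indiscernible x y
      }
    ; sym = symmetric
    }
  ; triangle = triangle
  }
  where
  reflexive : ∀ {n} (x : Grid m n) → manhattan x x ≡ 0
  reflexive []      = refl
  reflexive (a ∷ x) = cong₂ ℕ._+_ (ℕ.∣n-n∣≡0 (toℕ a)) (reflexive x)

  indiscernible : ∀ {n} (x y : Grid m n) → manhattan x y ≡ 0 → x ≡ y
  indiscernible []      []      _  = refl
  indiscernible (a ∷ x) (b ∷ y) eq = cong₂ _∷_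
    (toℕ-injective (ℕ.∣m-n∣≡0⇒m≡n (ℕ.m+n≡0⇒m≡0 ℕ.∣ toℕ a - toℕ b ∣ eq)))
    (indiscernible x y (ℕ.m+n≡0⇒n≡0 ℕ.∣ toℕ a - toℕ b ∣ eq))

  symmetric : ∀ {n} (x y : Grid m n) → manhattan x y ≡ manhattan y x
  symmetric []      []      = refl
  symmetric (a ∷ x) (b ∷ y) = cong₂ ℕ._+_ (ℕ.∣-∣-comm (toℕ a) (toℕ b)) (symmetric x y)

  triangle : ∀ {n} (x y z : Grid m n) → manhattan x z ℕ.≤ manhattan x y ℕ.+ manhattan y z
  triangle []      []      []      = ℕ.z≤n
  triangle (a ∷ x) (b ∷ y) (c ∷ z) = ℕ.≤-trans
    (ℕ.+-mono-≤ (ℕ.∣-∣-triangle (toℕ a) (toℕ b) (toℕ c)) (triangle x y z))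
    (ℕ.≤-reflexive (interchange ℕ.∣ toℕ a - toℕ b ∣ ℕ.∣ toℕ b - toℕ c ∣
                                (manhattan x y) (manhattan y z)))
    where
    interchange : ∀ p q r s → (p ℕ.+ q) ℕ.+ (r ℕ.+ s) ≡ (p ℕ.+ r) ℕ.+ (q ℕ.+ s)
    interchange p q r s = trans (ℕ.+-assoc p q (r ℕ.+ s))
      (trans (cong (p ℕ.+_) (trans (sym (ℕ.+-assoc q r s))
        (trans (cong (ℕ._+ s) (ℕ.+-comm q r)) (ℕ.+-assoc r q s))))
      (sym (ℕ.+-assoc p r (q ℕ.+ s))))

Δ : (m n r : ℕ) → SimplicialComplex
Δ m n r = VR (manhattan-isMetric m n) r

{-# OPTIONS --safe #-}
module Submission where

-- Call four vertices with pairwise distances at most 2 centreless if no vertex is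
-- within distance 1 of all of them. Centreless quadruples are maximal simplices
-- (unit squares and alternating corners of unit 3-cubes). A centreless quadruple is
-- critical if its points agree in an initial block of coordinates 0, …, 0, a with
-- a ≥ 1. Removing the critical facets leaves a collapsible complex L: the layer
-- {x₁ = a}, a = m, …, 1, is pushed down onto {x₁ = a − 1} by removing first its
-- triples (the cone point is the lowered median), then its pairs, then its vertices,
-- and the layer {x₁ = 0} is handled by induction on the dimension. As L is
-- contractible and the critical facets are 3-simplices, the realization of the whole
-- complex is a wedge of 3-spheres, one for each critical facet, and the unit squares
-- in the first three coordinates already give m³ of them.
--
-- Real numbers are not decidable here, so every map is either given by one formula
-- or glued from two formulas on overlapping open sets, on whose intersection they
-- agree up to distance 0; since ≤ on reals is stable under double negation,
-- inequalities and equations may be proved by case distinction.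

-- Dividing out a contractible subcomplex classically needs the homotopy extension property; here
-- both maps are explicit. Let q be four times the least corner weight of a facet and z the
-- differences of its corner weights. The stereographic coordinate z/q identifies the facet modulo
-- its boundary with the sphere, by a map `γ` defined on the whole realization. Radial expansion `e`
-- of the facets corresponds under `γ` to the dilation `E` of the sphere, and away from the
-- barycentres it ends in `L`, where the contraction applies. The composites are then not the
-- identity but `Sq ∘ e₁` and `E₁ ∘ E₁`, which are homotopic to it by construction. Only quantities
-- bounded below by a fixed rational are ever inverted, so reciprocals can be total.
--
-- On the combinatorial side medians control small cliques: the median is the only possible centre
-- of three distinct vertices at pairwise distance at most 2, and a further vertex within 2 of all
-- three but not within 1 of their median must be x ⊕ y ⊕ z in the binary code. Maximality of
-- centreless quadruples uses both facts, and the cone condition for triples uses uniqueness of the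
-- centre.

module Analysis where

  open import Defs
  open import Data.Empty using (⊥; ⊥-elim)
  open import Data.Fin.Base using (Fin; zero; suc)
  import Data.Fin.Properties as Fin
  open import Data.Integer.Base using (+_)
  open import Data.List.Base using (List; []; _∷_; [_]; _++_; filter)
  open import Data.List.Membership.Propositional using (_∈_; _∉_)
  open import Data.List.Membership.Propositional.Properties using (∈-++⁺ˡ; ∈-++⁺ʳ; ∈-++⁻; ∈-filter⁺; ∈-filter⁻)
  open import Data.List.Relation.Binary.Subset.Propositional using (_⊆_)
  open import Data.List.Relation.Unary.All as All using (All; []; _∷_)
  open import Data.List.Relation.Unary.AllPairs using ([]; _∷_)
  open import Data.List.Relation.Unary.Any using (here; there)
  open import Data.List.Relation.Unary.Unique.Propositional using (Unique)
  open import Data.Maybe.Base using (just; nothing)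
  import Data.Nat.Base as ℕ
  open import Data.Nat.Base using (ℕ)
  import Data.Nat.Properties as ℕ
  open import Data.Product.Base using (Σ; ∃-syntax; _×_; _,_; proj₁; proj₂)
  import Data.Rational.Base as ℚ
  open import Data.Rational.Base using (ℚ; 0ℚ; 1ℚ; ½)
  import Data.Rational.Properties as ℚ
  open import Data.Rational.Solver using (module +-*-Solver)
  open import Data.Sum.Base using (_⊎_; inj₁; inj₂)
  open import Data.Vec.Functional using (Vector)
  open import Function.Base using (id; _∘_)
  open import Function.Bundles using (_↔_; Inverse)
  import Function.Metric.Structures as Metric
  open import Relation.Binary.Definitions using (DecidableEquality)
  open import Relation.Binary.PropositionalEquality.Core using (_≡_; _≢_; refl; sym; trans; cong; cong₂; subst)
  open import Relation.Nullary.Decidable using (Dec; yes; no; ¬?; True; toWitness; False; toWitnessFalse)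
  open import Relation.Nullary.Negation.Core using (¬_)
  open +-*-Solver using (solve; _:=_; _:+_; _:*_; _:-_; :-_; con)

  -- Constructive order and arithmetic of the reals, with total truncated reciprocals.

  module Reals where

    -- Rational arithmetic

    ¼ ℚ2 ℚ3 ℚ4 : ℚ
    ¼  = ½ ℚ.* ½
    ℚ2 = 1ℚ ℚ.+ 1ℚ
    ℚ3 = ℚ2 ℚ.+ 1ℚ
    ℚ4 = ℚ2 ℚ.+ ℚ2

    ℚ-pos : ∀ {p} → {True (0ℚ ℚ.<? p)} → 0ℚ ℚ.< p
    ℚ-pos {_} {t} = toWitness t

    ℚ-lt : ∀ {p q} → {True (p ℚ.<? q)} → p ℚ.< q
    ℚ-lt {_} {_} {t} = toWitness t

    ℚ-le : ∀ {p q} → {True (p ℚ.≤? q)} → p ℚ.≤ q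
    ℚ-le {_} {_} {t} = toWitness t

    ≤⇒0≤ℚ : ∀ {p q} → p ℚ.≤ q → 0ℚ ℚ.≤ q ℚ.- p
    ≤⇒0≤ℚ {p} {q} p≤q = subst (ℚ._≤ q ℚ.- p) (ℚ.+-inverseʳ p) (ℚ.+-monoˡ-≤ (ℚ.- p) p≤q)

    0≤⇒≤ℚ : ∀ {p q r} → 0ℚ ℚ.≤ r → r ≡ q ℚ.- p → p ℚ.≤ q
    0≤⇒≤ℚ {p} {q} {r} 0≤r eq = begin
      p                    ≡⟨ ℚ.+-identityʳ p ⟨
      p ℚ.+ 0ℚ             ≤⟨ ℚ.+-monoʳ-≤ p 0≤r ⟩
      p ℚ.+ r              ≡⟨ cong (p ℚ.+_) eq ⟩
      p ℚ.+ (q ℚ.- p)      ≡⟨ solve 2 (λ p q → p :+ (q :- p) := q) refl p q ⟩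
      q                    ∎
      where open ℚ.≤-Reasoning

    0≤+ℚ : ∀ {p q} → 0ℚ ℚ.≤ p → 0ℚ ℚ.≤ q → 0ℚ ℚ.≤ p ℚ.+ q
    0≤+ℚ = ℚ.+-mono-≤

    0≤*ℚ : ∀ {p q} → 0ℚ ℚ.≤ p → 0ℚ ℚ.≤ q → 0ℚ ℚ.≤ p ℚ.* q
    0≤*ℚ {p} {q} p≥0 q≥0 = subst (ℚ._≤ p ℚ.* q) (ℚ.*-zeroʳ p)
      (ℚ.*-monoˡ-≤-nonNeg p {{ℚ.nonNegative p≥0}} q≥0)

    0<*ℚ : ∀ {p q} → 0ℚ ℚ.< p → 0ℚ ℚ.< q → 0ℚ ℚ.< p ℚ.* q
    0<*ℚ {p} {q} p>0 q>0 = subst (ℚ._< p ℚ.* q) (ℚ.*-zeroʳ p)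
      (ℚ.*-monoʳ-<-pos p {{ℚ.positive p>0}} q>0)

    0<+ℚ : ∀ {p q} → 0ℚ ℚ.< p → 0ℚ ℚ.< q → 0ℚ ℚ.< p ℚ.+ q
    0<+ℚ = ℚ.+-mono-<

    square≥0ℚ : ∀ p → 0ℚ ℚ.≤ p ℚ.* p
    square≥0ℚ p with ℚ.≤-total 0ℚ p
    ... | inj₁ p≥0 = 0≤*ℚ p≥0 p≥0
    ... | inj₂ p≤0 = subst (0ℚ ℚ.≤_) (solve 1 (λ p → (:- p) :* (:- p) := p :* p) refl p)
      (0≤*ℚ (ℚ.neg-antimono-≤ p≤0) (ℚ.neg-antimono-≤ p≤0))

    p≤p+ε : ∀ p {ε} → 0ℚ ℚ.< ε → p ℚ.≤ p ℚ.+ ε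
    p≤p+ε p {ε} ε>0 = 0≤⇒≤ℚ (ℚ.<⇒≤ ε>0) (solve 2 (λ b e → e := (b :+ e) :- b) refl p ε)

    half : ℚ → ℚ
    half ε = ½ ℚ.* ε

    half-pos : ∀ {ε} → 0ℚ ℚ.< ε → 0ℚ ℚ.< half ε
    half-pos = 0<*ℚ {½} ℚ-pos

    half+half : ∀ ε → half ε ℚ.+ half ε ≡ ε
    half+half = solve 1 (λ e → con ½ :* e :+ con ½ :* e := e) refl

    quotientℚ : ∀ {ε B} → 0ℚ ℚ.< ε → 0ℚ ℚ.< B → ∃[ δ ] (0ℚ ℚ.< δ × B ℚ.* δ ≡ ε)
    quotientℚ {ε} {B} ε>0 B>0 = B⁻¹ ℚ.* ε , 0<*ℚ (ℚ.positive⁻¹ B⁻¹) ε>0 ,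
      trans (sym (ℚ.*-assoc B B⁻¹ ε))
        (trans (cong (ℚ._* ε) (ℚ.*-inverseʳ B)) (ℚ.*-identityˡ ε))
      where
      instance
        _ = ℚ.positive B>0
        _ = ℚ.pos⇒nonZero B
      B⁻¹ : ℚ
      B⁻¹ = ℚ.1/ B
      instance
        _ = ℚ.1/pos⇒pos B

    <+⇒∣∣< : ∀ p q {ε} → p ℚ.< q ℚ.+ ε → q ℚ.< p ℚ.+ ε → ℚ.∣ p ℚ.- q ∣ ℚ.< ε
    <+⇒∣∣< p q {ε} a b with ℚ.∣p∣≡p∨∣p∣≡-p (p ℚ.- q)
    ... | inj₁ eq = subst (ℚ._< ε) (sym eq) (subst (p ℚ.- q ℚ.<_)
          (solve 2 (λ q e → (q :+ e) :- q := e) refl q ε) (ℚ.+-monoˡ-< (ℚ.- q) a))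
    ... | inj₂ eq = subst (ℚ._< ε) (sym (trans eq (solve 2 (λ p q → :- (p :- q) := q :- p) refl p q)))
          (subst (q ℚ.- p ℚ.<_) (solve 2 (λ p e → (p :+ e) :- p := e) refl p ε) (ℚ.+-monoˡ-< (ℚ.- p) b))

    p≤∣p∣ : ∀ p → p ℚ.≤ ℚ.∣ p ∣
    p≤∣p∣ p with ℚ.∣p∣≡p∨∣p∣≡-p p
    ... | inj₁ eq = ℚ.≤-reflexive (sym eq)
    ... | inj₂ eq = ℚ.≤-trans p≤0 (ℚ.0≤∣p∣ p)
      where
      p≤0 : p ℚ.≤ 0ℚ
      p≤0 = 0≤⇒≤ℚ (ℚ.0≤∣p∣ p) (trans eq (sym (ℚ.+-identityˡ (ℚ.- p))))

    -p≤∣p∣ : ∀ p → ℚ.- p ℚ.≤ ℚ.∣ p ∣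
    -p≤∣p∣ p = subst (ℚ.- p ℚ.≤_) (ℚ.∣-p∣≡∣p∣ p) (p≤∣p∣ (ℚ.- p))

    ∣∣<⇒<+ : ∀ p q {ε} → ℚ.∣ p ℚ.- q ∣ ℚ.< ε → p ℚ.< q ℚ.+ ε × q ℚ.< p ℚ.+ ε
    ∣∣<⇒<+ p q {ε} h =
      subst (ℚ._< q ℚ.+ ε) (solve 2 (λ p q → q :+ (p :- q) := p) refl p q)
        (ℚ.+-monoʳ-< q (ℚ.≤-<-trans (p≤∣p∣ (p ℚ.- q)) h)) ,
      subst (ℚ._< p ℚ.+ ε) (solve 2 (λ p q → p :+ :- (p :- q) := q) refl p q)
        (ℚ.+-monoʳ-< p (ℚ.≤-<-trans (-p≤∣p∣ (p ℚ.- q)) h))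

    ⊓-<+ : ∀ {p p′ q q′ ε} → p ℚ.< p′ ℚ.+ ε → q ℚ.< q′ ℚ.+ ε → p ℚ.⊓ q ℚ.< p′ ℚ.⊓ q′ ℚ.+ ε
    ⊓-<+ {p} {p′} {q} {q′} {ε} a b with ℚ.⊓-sel p′ q′
    ... | inj₁ eq = subst (λ r → p ℚ.⊓ q ℚ.< r ℚ.+ ε) (sym eq) (ℚ.≤-<-trans (ℚ.p⊓q≤p p q) a)
    ... | inj₂ eq = subst (λ r → p ℚ.⊓ q ℚ.< r ℚ.+ ε) (sym eq) (ℚ.≤-<-trans (ℚ.p⊓q≤q p q) b)

    -- Order on the reals

    Eventually : (ℕ → Set) → Set
    Eventually P = ∃[ N ] (∀ {i} → N ℕ.≤ i → P i)

    infixr 5 _&_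
    _&_ : ∀ {P Q : ℕ → Set} → Eventually P → Eventually Q → Eventually (λ i → P i × Q i)
    (M , p) & (N , q) = M ℕ.⊔ N , λ a →
      p (ℕ.≤-trans (ℕ.m≤m⊔n M N) a) , q (ℕ.≤-trans (ℕ.m≤n⊔m M N) a)

    Stable : Set → Set
    Stable A = ¬ ¬ A → A

    -- The approximation index is chosen together with a further eventual property,
    -- so that later comparisons can be made at that index.
    approx : ∀ x {ε} → 0ℚ ℚ.< ε → ∀ {P} → Eventually P →
      ∃[ N ] (P N × (∀ {i} → N ℕ.≤ i → P i × seq x i ℚ.< seq x N ℚ.+ ε × seq x N ℚ.< seq x i ℚ.+ ε))
    approx x {ε} ε>0 (M , p) =
      let (N , c) = cauchy x ε>0
          L = M ℕ.⊔ N
          N≤L = ℕ.m≤n⊔m M N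
          M≤L = ℕ.m≤m⊔n M N
      in L , p M≤L , λ {i} a →
        p (ℕ.≤-trans M≤L a) , ∣∣<⇒<+ (seq x i) (seq x L) (c (ℕ.≤-trans N≤L a) N≤L)

    -- Together with `gap⇒<` this trades a strict inequality for a non-strict one with a rational
    -- gap, so that strict inequalities can be chained and certified with the tools for `≤`.
    <⇒gap : ∀ {x y} → x < y → ∃[ q ] (0ℚ ℚ.< q × x + fromℚ q ≤ y)
    <⇒gap {x} {y} (mk< g g>0 (N , p)) = g , g>0 , mk≤ λ {ε} ε>0 → N , λ {i} a →
      ℚ.≤-trans (p a) (0≤⇒≤ℚ (ℚ.<⇒≤ ε>0)
        (solve 2 (λ y e → e := (y :+ e) :- y) refl (seq y i) ε))

    gap⇒< : ∀ {x y q} → 0ℚ ℚ.< q → x + fromℚ q ≤ y → x < y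
    gap⇒< {x} {y} {q} q>0 (mk≤ h) =
      -- Half of the gap pays for the tolerance in `≤`, which holds only up to an arbitrary ε.
      let (N , p) = h (half-pos q>0) in mk< (half q) (half-pos q>0) (N , λ {i} a →
        0≤⇒≤ℚ (≤⇒0≤ℚ (p a)) (solve 3 (λ x y q →
          (y :+ con ½ :* q) :- (x :+ q) := y :- (x :+ con ½ :* q)) refl (seq x i) (seq y i) q))

    -- Certificate form of an inequality: a visibly nonnegative z is exhibited, usually a sum of
    -- products, and the ring solver identifies it with `y - x` at every index. Most estimates below
    -- have this form.
    0≤⇒≤ : ∀ {x y z} → 0ℝ ≤ z → (∀ i → seq z i ≡ seq y i ℚ.- seq x i) → x ≤ y
    0≤⇒≤ {x} {y} {z} (mk≤ h) eq = mk≤ λ {ε} ε>0 → let (N , p) = h ε>0 in N , λ {i} a →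
      0≤⇒≤ℚ (p a) (trans (cong (ℚ._+ ε) (eq i))
        (solve 3 (λ x y e → (y :- x) :+ e := (y :+ e) :- x) refl (seq x i) (seq y i) ε))

    ≤⇒0≤ : ∀ {x y} → x ≤ y → 0ℝ ≤ y - x
    ≤⇒0≤ {x} {y} (mk≤ h) = mk≤ λ {ε} ε>0 → let (N , p) = h ε>0 in N , λ {i} a →
      0≤⇒≤ℚ (≤⇒0≤ℚ (p a)) (solve 3 (λ x y e → (y :+ e) :- x := ((y :- x) :+ e) :- con 0ℚ) refl (seq x i) (seq y i) ε)

    ≡⇒≤ : ∀ {x y} → (∀ i → seq x i ≡ seq y i) → x ≤ y
    ≡⇒≤ eq = pointwise-≤ (λ i → ℚ.≤-reflexive (eq i))

    fromℚ-mono : ∀ {p q} → p ℚ.≤ q → fromℚ p ≤ fromℚ q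
    fromℚ-mono p≤q = pointwise-≤ λ _ → p≤q

    fromℚ-mono-< : ∀ {p q} → p ℚ.< q → fromℚ p < fromℚ q
    fromℚ-mono-< {p} {q} p<q = gap⇒< {q = q ℚ.- p} d>0
      (≡⇒≤ λ _ → solve 2 (λ p q → p :+ (q :- p) := q) refl p q)
      where
      d>0 : 0ℚ ℚ.< q ℚ.- p
      d>0 = subst (ℚ._< q ℚ.- p) (ℚ.+-inverseʳ p) (ℚ.+-monoˡ-< (ℚ.- p) p<q)

    fromℚ-pos : ∀ {p} → 0ℚ ℚ.< p → 0ℝ < fromℚ p
    fromℚ-pos = fromℚ-mono-<

    +-monoʳ-≤ : ∀ x {y z} → y ≤ z → x + y ≤ x + z
    +-monoʳ-≤ x p = +-mono-≤ (≤-refl {x}) p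

    +-monoˡ-≤ : ∀ x {y z} → y ≤ z → y + x ≤ z + x
    +-monoˡ-≤ x p = +-mono-≤ p (≤-refl {x})

    <-≤-trans : ∀ {x y z} → x < y → y ≤ z → x < z
    <-≤-trans x<y y≤z = let (q , q>0 , p) = <⇒gap x<y in gap⇒< q>0 (≤-trans p y≤z)

    ≤-<-trans : ∀ {x y z} → x ≤ y → y < z → x < z
    ≤-<-trans x≤y y<z = let (q , q>0 , p) = <⇒gap y<z in gap⇒< q>0 (≤-trans (+-monoˡ-≤ (fromℚ q) x≤y) p)

    x≤x+q : ∀ x {q} → 0ℚ ℚ.≤ q → x ≤ x + fromℚ q
    x≤x+q x {q} q≥0 = pointwise-≤ λ i → 0≤⇒≤ℚ q≥0 (solve 2 (λ x q → q := (x :+ q) :- x) refl (seq x i) q)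

    <⇒≤ : ∀ {x y} → x < y → x ≤ y
    <⇒≤ {x} x<y = let (q , q>0 , p) = <⇒gap x<y in ≤-trans (x≤x+q x (ℚ.<⇒≤ q>0)) p

    <-irrefl : ∀ {x y} → x < y → y ≤ x → ⊥
    <-irrefl {x} {y} (mk< g g>0 E) (mk≤ h) =
      let (N , p) = E & h (half-pos g>0)
          (a , b) = p ℕ.≤-refl
      in ℚ.<-irrefl refl (ℚ.<-≤-trans (half-pos g>0) (0≤⇒≤ℚ (0≤+ℚ (≤⇒0≤ℚ a) (≤⇒0≤ℚ b))
           (solve 3 (λ x y g → (y :- (x :+ g)) :+ ((x :+ con ½ :* g) :- y) := con 0ℚ :- con ½ :* g) refl (seq x N) (seq y N) g)))

    <-trans : ∀ {x y z} → x < y → y < z → x < z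
    <-trans p q = <-≤-trans p (<⇒≤ q)

    -- Cotransitivity, the substitute for trichotomy. At a late index N the rational approximation
    -- of z is compared with that of x plus g/2. Each approximation moves by less than g/8 after N,
    -- so a gap of g/4 survives in either case.
    compare : ∀ {x y} → x < y → ∀ z → (x < z) ⊎ (z < y)
    compare {x} {y} (mk< g g>0 E) z =
      let e = half (half (half g))
          e>0 = half-pos (half-pos (half-pos g>0))
          (Nx , cx) = cauchy x e>0
          (Ny , cy) = cauchy y e>0
          K = Nx ℕ.⊔ Ny
          (N , (K≤N , x+g≤y) , c) = approx z e>0 ((K , λ a → a) & E)
          nearx : ∀ {i} → N ℕ.≤ i → seq x i ℚ.< seq x N ℚ.+ e
          nearx {i} a = proj₁ (∣∣<⇒<+ (seq x i) (seq x N) (cx (ℕ.≤-trans (ℕ.m≤m⊔n Nx Ny) (ℕ.≤-trans K≤N a)) (ℕ.≤-trans (ℕ.m≤m⊔n Nx Ny) K≤N)))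
          neary : ∀ {i} → N ℕ.≤ i → seq y N ℚ.< seq y i ℚ.+ e
          neary {i} a = proj₂ (∣∣<⇒<+ (seq y i) (seq y N) (cy (ℕ.≤-trans (ℕ.m≤n⊔m Nx Ny) (ℕ.≤-trans K≤N a)) (ℕ.≤-trans (ℕ.m≤n⊔m Nx Ny) K≤N)))
      in decide N x+g≤y nearx neary (λ a → proj₁ (proj₂ (c a))) (λ a → proj₂ (proj₂ (c a)))
      where
      decide : ∀ N → (let e = half (half (half g))) → seq x N ℚ.+ g ℚ.≤ seq y N →
        (∀ {i} → N ℕ.≤ i → seq x i ℚ.< seq x N ℚ.+ e) → (∀ {i} → N ℕ.≤ i → seq y N ℚ.< seq y i ℚ.+ e) →
        (∀ {i} → N ℕ.≤ i → seq z i ℚ.< seq z N ℚ.+ e) → (∀ {i} → N ℕ.≤ i → seq z N ℚ.< seq z i ℚ.+ e) →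
        (x < z) ⊎ (z < y)
      decide N x+g≤y nx ny nz nz′ with seq x N ℚ.+ half g ℚ.≤? seq z N
      ... | yes p = inj₁ (mk< (half (half g)) (half-pos (half-pos g>0)) (N , λ {i} a →
          0≤⇒≤ℚ (0≤+ℚ (0≤+ℚ (≤⇒0≤ℚ p) (≤⇒0≤ℚ (ℚ.<⇒≤ (nx a)))) (≤⇒0≤ℚ (ℚ.<⇒≤ (nz′ a))))
            (solve 5 (λ xN xi zN zi g →
               (zN :- (xN :+ con ½ :* g)) :+ ((xN :+ con ½ :* (con ½ :* (con ½ :* g))) :- xi) :+ ((zi :+ con ½ :* (con ½ :* (con ½ :* g))) :- zN)
               := zi :- (xi :+ con ½ :* (con ½ :* g))) refl (seq x N) (seq x i) (seq z N) (seq z i) g)))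
      ... | no p = inj₂ (mk< (half (half g)) (half-pos (half-pos g>0)) (N , λ {i} a →
          0≤⇒≤ℚ (0≤+ℚ (0≤+ℚ (0≤+ℚ (≤⇒0≤ℚ (ℚ.<⇒≤ (ℚ.≰⇒> p))) (≤⇒0≤ℚ x+g≤y)) (≤⇒0≤ℚ (ℚ.<⇒≤ (ny a)))) (≤⇒0≤ℚ (ℚ.<⇒≤ (nz a))))
            (solve 6 (λ xN yN yi zN zi g →
               ((xN :+ con ½ :* g) :- zN) :+ (yN :- (xN :+ g)) :+ ((yi :+ con ½ :* (con ½ :* (con ½ :* g))) :- yN)
                 :+ ((zN :+ con ½ :* (con ½ :* (con ½ :* g))) :- zi)
               := yi :- (zi :+ con ½ :* (con ½ :* g))) refl (seq x N) (seq y N) (seq y i) (seq z N) (seq z i) g)))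

    ≤-eps : ∀ {x y} → (∀ {ε} → 0ℚ ℚ.< ε → x ≤ y + fromℚ ε) → x ≤ y
    ≤-eps {x} {y} h = mk≤ λ {ε} ε>0 →
      let (N , p) = eventually-≤ (h (half-pos ε>0)) (half-pos ε>0) in N , λ {i} a →
        ℚ.≤-trans (p a) (ℚ.≤-reflexive (solve 2 (λ y e → (y :+ con ½ :* e) :+ con ½ :* e := y :+ e) refl (seq y i) ε))

    ≮⇒≥ : ∀ {x y} → ¬ (x < y) → y ≤ x
    ≮⇒≥ {x} {y} h = ≤-eps λ {ε} ε>0 → pick ε>0 (compare (gap⇒< ε>0 ≤-refl) y)
      where
      pick : ∀ {ε} → 0ℚ ℚ.< ε → (x < y) ⊎ (y < x + fromℚ ε) → y ≤ x + fromℚ ε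
      pick _ (inj₁ x<y) = ⊥-elim (h x<y)
      pick _ (inj₂ q)   = <⇒≤ q

    ≤-stable : ∀ {x y} → Stable (x ≤ y)
    ≤-stable h = ≮⇒≥ λ y<x → h (<-irrefl y<x)

    ≃-stable : ∀ {x y} → Stable (x ≃ y)
    ≃-stable h = ≤-stable (λ k → h λ p → k (proj₁ p)) , ≤-stable (λ k → h λ p → k (proj₂ p))

    ⊥-stable : Stable ⊥
    ⊥-stable h = h λ z → z

    -- Under a double negation the dichotomy is available, and a stable goal lets the negations be
    -- removed. Order, distance 0 and membership in a complex are all stable.
    by-cases : ∀ x y {A} → Stable A → (x ≤ y → A) → (y < x → A) → A
    by-cases x y st f g = st λ k → k (f (≮⇒≥ λ y<x → k (g y<x)))

    -- Arithmetic

    boundedℚ : ∀ x → ∃[ B ] (0ℚ ℚ.< B × Eventually (λ i → seq x i ℚ.≤ B × ℚ.- B ℚ.≤ seq x i))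
    boundedℚ x =
      let (N , _ , c) = approx x {1ℚ} ℚ-pos (0 , λ _ → refl {x = 0})
          a = seq x N
      in ℚ.∣ a ∣ ℚ.+ 1ℚ , ℚ.+-mono-≤-< (ℚ.0≤∣p∣ a) (ℚ-pos {1ℚ}) , N , λ {i} h →
        let (_ , p , q) = c h in
        ℚ.≤-trans (ℚ.<⇒≤ p) (ℚ.+-monoˡ-≤ 1ℚ (p≤∣p∣ a)) ,
        0≤⇒≤ℚ (0≤+ℚ (≤⇒0≤ℚ (ℚ.<⇒≤ q)) (≤⇒0≤ℚ (-p≤∣p∣ a)))
          (solve 3 (λ a b m → ((b :+ con 1ℚ) :- a) :+ (m :- (:- a)) := b :- (:- (m :+ con 1ℚ))) refl a (seq x i) ℚ.∣ a ∣)

    bounded : ∀ x → ∃[ B ] (0ℚ ℚ.< B × x ≤ fromℚ B × fromℚ (ℚ.- B) ≤ x)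
    bounded x = let (B , B>0 , N , p) = boundedℚ x in B , B>0 ,
      mk≤ (λ {ε} ε>0 → N , λ a → ℚ.≤-trans (proj₁ (p a)) (0≤⇒≤ℚ (ℚ.<⇒≤ ε>0) (solve 2 (λ b e → e := (b :+ e) :- b) refl B ε))) ,
      mk≤ (λ {ε} ε>0 → N , λ {i} a → ℚ.≤-trans (proj₂ (p a)) (0≤⇒≤ℚ (ℚ.<⇒≤ ε>0) (solve 2 (λ b e → e := (b :+ e) :- b) refl (seq x i) ε)))

    -- A nonnegative real may have negative terms in its sequence, so the factors are first raised
    -- to x + η and y + η. The product of these exceeds x y by η (x + y + η), which is at most (Bx +
    -- By + 1) δ = ε.
    0≤* : ∀ {x y} → 0ℝ ≤ x → 0ℝ ≤ y → 0ℝ ≤ x * y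
    0≤* {x} {y} (mk≤ hx) (mk≤ hy) = mk≤ λ {ε} ε>0 →
      let (Bx , Bx>0 , ex) = boundedℚ x
          (By , By>0 , ey) = boundedℚ y
          C = Bx ℚ.+ By ℚ.+ 1ℚ
          C>0 = 0<+ℚ {Bx ℚ.+ By} {1ℚ} (0<+ℚ Bx>0 By>0) ℚ-pos
          (δ , δ>0 , Cδ≡ε) = quotientℚ {ε} {C} ε>0 C>0
          η = δ ℚ.⊓ 1ℚ
          η>0 = min-pos δ>0
          (N , p) = ex & ey & hx η>0 & hy η>0
      in N , λ {i} a → let (bx , by , px , py) = p a in
        estimate (seq x i) (seq y i) η δ Bx By ε (ℚ.<⇒≤ η>0) (ℚ.p⊓q≤p δ 1ℚ) (ℚ.p⊓q≤q δ 1ℚ) Cδ≡ε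
          (proj₁ bx) (proj₁ by) px py (ℚ.<⇒≤ C>0)
      where
      min-pos : ∀ {δ} → 0ℚ ℚ.< δ → 0ℚ ℚ.< δ ℚ.⊓ 1ℚ
      min-pos {δ} δ>0 with ℚ.⊓-sel δ 1ℚ
      ... | inj₁ eq = subst (0ℚ ℚ.<_) (sym eq) δ>0
      ... | inj₂ eq = subst (0ℚ ℚ.<_) (sym eq) ℚ-pos
      estimate : ∀ x y η δ Bx By ε → 0ℚ ℚ.≤ η → η ℚ.≤ δ → η ℚ.≤ 1ℚ → (Bx ℚ.+ By ℚ.+ 1ℚ) ℚ.* δ ≡ ε →
        x ℚ.≤ Bx → y ℚ.≤ By → 0ℚ ℚ.≤ x ℚ.+ η → 0ℚ ℚ.≤ y ℚ.+ η → 0ℚ ℚ.≤ Bx ℚ.+ By ℚ.+ 1ℚ → 0ℚ ℚ.≤ x ℚ.* y ℚ.+ ε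
      estimate x y η δ Bx By ε η≥0 η≤δ η≤1 refl x≤ y≤ px py C≥0 =
        0≤⇒≤ℚ (0≤+ℚ (0≤+ℚ (0≤*ℚ px py) (0≤*ℚ η≥0 (0≤+ℚ (0≤+ℚ (≤⇒0≤ℚ x≤) (≤⇒0≤ℚ y≤)) (≤⇒0≤ℚ η≤1)))) (0≤*ℚ C≥0 (≤⇒0≤ℚ η≤δ)))
          (solve 6 (λ x y η δ Bx By → (x :+ η) :* (y :+ η) :+ η :* ((Bx :- x) :+ (By :- y) :+ (con 1ℚ :- η)) :+ (Bx :+ By :+ con 1ℚ) :* (δ :- η)
            := (x :* y :+ (Bx :+ By :+ con 1ℚ) :* δ) :- con 0ℚ) refl x y η δ Bx By)

    0≤+ : ∀ {x y} → 0ℝ ≤ x → 0ℝ ≤ y → 0ℝ ≤ x + y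
    0≤+ = +-nonNegative

    0≤square : ∀ x → 0ℝ ≤ x * x
    0≤square x = pointwise-≤ λ i → square≥0ℚ (seq x i)

    *-monoˡ-≤ : ∀ {x y z} → 0ℝ ≤ z → x ≤ y → z * x ≤ z * y
    *-monoˡ-≤ {x} {y} {z} z≥0 x≤y = 0≤⇒≤ (0≤* z≥0 (≤⇒0≤ x≤y)) λ i →
      solve 3 (λ x y z → z :* (y :- x) := z :* y :- z :* x) refl (seq x i) (seq y i) (seq z i)

    infix 4 _≐_
    _≐_ : ℝ → ℝ → Set
    x ≐ y = ∀ i → seq x i ≡ seq y i

    ≐⇒≃ : ∀ {x y} → x ≐ y → x ≃ y
    ≐⇒≃ = pointwise-≃

    neg-anti : ∀ {x y} → x ≤ y → - y ≤ - x
    neg-anti {x} {y} p = 0≤⇒≤ (≤⇒0≤ p) λ i → solve 2 (λ x y → y :- x := (:- x) :- (:- y)) refl (seq x i) (seq y i)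

    neg-cong : ∀ {x y} → x ≃ y → - x ≃ - y
    neg-cong (p , q) = neg-anti q , neg-anti p

    x-y≃0 : ∀ {x y} → x ≃ y → x - y ≃ 0ℝ
    x-y≃0 {x} {y} (p , q) =
      0≤⇒≤ (≤⇒0≤ p) (λ i → solve 2 (λ x y → y :- x := con 0ℚ :- (x :- y)) refl (seq x i) (seq y i)) , ≤⇒0≤ q

    ≃-by-0 : ∀ {x y z} → z ≃ 0ℝ → (∀ i → seq z i ≡ seq x i ℚ.- seq y i) → x ≃ y
    ≃-by-0 {x} {y} {z} (p , q) eq =
      0≤⇒≤ (≤⇒0≤ p) (λ i → trans (cong (λ r → 0ℚ ℚ.- r) (eq i)) (solve 2 (λ x y → con 0ℚ :- (x :- y) := y :- x) refl (seq x i) (seq y i))) ,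
      0≤⇒≤ q eq

    *-zero-≃ : ∀ x {y} → y ≃ 0ℝ → x * y ≃ 0ℝ
    *-zero-≃ x {y} (p , q) = ≤-eps (λ {ε} ε>0 → proj₁ (both ε>0)) , ≤-eps (λ ε>0 → proj₂ (both ε>0))
      where
      both : ∀ {ε} → 0ℚ ℚ.< ε → x * y ≤ 0ℝ + fromℚ ε × 0ℝ ≤ x * y + fromℚ ε
      both {ε} ε>0 = let (B , B>0 , x≤B , -B≤x) = bounded x in
        0≤⇒≤ (0≤+ (0≤+ (0≤* (≤⇒0≤ x≤B) q) (0≤* (fromℚ-mono (ℚ.<⇒≤ B>0)) (≤⇒0≤ p))) (fromℚ-mono (ℚ.<⇒≤ ε>0)))
          (λ i → solve 4 (λ x y b e → (b :- x) :* y :+ b :* (con 0ℚ :- y) :+ e := (con 0ℚ :+ e) :- x :* y) refl (seq x i) (seq y i) B ε) ,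
        0≤⇒≤ (0≤+ (0≤+ (0≤* (≤⇒0≤ -B≤x) q) (0≤* (fromℚ-mono (ℚ.<⇒≤ B>0)) (≤⇒0≤ p))) (fromℚ-mono (ℚ.<⇒≤ ε>0)))
          (λ i → solve 4 (λ x y b e → (x :- (:- b)) :* y :+ b :* (con 0ℚ :- y) :+ e := (x :* y :+ e) :- con 0ℚ) refl (seq x i) (seq y i) B ε)

    *-cong : ∀ {x y u v} → x ≃ y → u ≃ v → x * u ≃ y * v
    *-cong {x} {y} {u} {v} p q = ≃-by-0 {z = x * (u - v) + v * (x - y)}
      (≃-trans (+-cong (*-zero-≃ x (x-y≃0 q)) (*-zero-≃ v (x-y≃0 p))) 0+0≃0)
      (λ i → solve 4 (λ x y u v → x :* (u :- v) :+ v :* (x :- y) := x :* u :- y :* v) refl (seq x i) (seq y i) (seq u i) (seq v i))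

    -- Minimum, maximum, reciprocal

    infixr 7 _⊓_
    infixr 6 _⊔_

    abstract
      ⊓-cauchy : ∀ x y → IsCauchy (λ i → seq x i ℚ.⊓ seq y i)
      ⊓-cauchy x y ε>0 =
        let (M , c) = cauchy x ε>0
            (N , e) = cauchy y ε>0
            l = ℕ.m≤m⊔n M N
            r = ℕ.m≤n⊔m M N
        in M ℕ.⊔ N , λ {i} {j} a b →
          let (p , p′) = ∣∣<⇒<+ (seq x i) (seq x j) (c (ℕ.≤-trans l a) (ℕ.≤-trans l b))
              (q , q′) = ∣∣<⇒<+ (seq y i) (seq y j) (e (ℕ.≤-trans r a) (ℕ.≤-trans r b))
          in <+⇒∣∣< (seq x i ℚ.⊓ seq y i) (seq x j ℚ.⊓ seq y j)
               (⊓-<+ {p′ = seq x j} {q′ = seq y j} p q) (⊓-<+ {p′ = seq x i} {q′ = seq y i} p′ q′)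

    _⊓_ : ℝ → ℝ → ℝ
    x ⊓ y = mkℝ (λ i → seq x i ℚ.⊓ seq y i) (⊓-cauchy x y)

    _⊔_ : ℝ → ℝ → ℝ
    x ⊔ y = - (- x ⊓ - y)

    ⊓≤ˡ : ∀ x y → x ⊓ y ≤ x
    ⊓≤ˡ x y = pointwise-≤ λ i → ℚ.p⊓q≤p (seq x i) (seq y i)

    ⊓≤ʳ : ∀ x y → x ⊓ y ≤ y
    ⊓≤ʳ x y = pointwise-≤ λ i → ℚ.p⊓q≤q (seq x i) (seq y i)

    ⊓-glb : ∀ {x y z} → z ≤ x → z ≤ y → z ≤ x ⊓ y
    ⊓-glb {x} {y} {z} (mk≤ p) (mk≤ q) = mk≤ λ {ε} ε>0 → let (N , r) = p ε>0 & q ε>0 in N , λ {i} a →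
      sel (seq x i) (seq y i) (proj₁ (r a)) (proj₂ (r a))
      where
      sel : ∀ x y {z ε} → z ℚ.≤ x ℚ.+ ε → z ℚ.≤ y ℚ.+ ε → z ℚ.≤ x ℚ.⊓ y ℚ.+ ε
      sel x y {z} {ε} a b with ℚ.⊓-sel x y
      ... | inj₁ eq = subst (λ r → z ℚ.≤ r ℚ.+ ε) (sym eq) a
      ... | inj₂ eq = subst (λ r → z ℚ.≤ r ℚ.+ ε) (sym eq) b

    neg-neg : ∀ x → - (- x) ≃ x
    neg-neg x = ≐⇒≃ λ i → solve 1 (λ x → :- (:- x) := x) refl (seq x i)

    ≤⊔ˡ : ∀ x y → x ≤ x ⊔ y
    ≤⊔ˡ x y = ≤-trans (proj₂ (neg-neg x)) (neg-anti (⊓≤ˡ (- x) (- y)))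

    ≤⊔ʳ : ∀ x y → y ≤ x ⊔ y
    ≤⊔ʳ x y = ≤-trans (proj₂ (neg-neg y)) (neg-anti (⊓≤ʳ (- x) (- y)))

    ⊔-lub : ∀ {x y z} → x ≤ z → y ≤ z → x ⊔ y ≤ z
    ⊔-lub {z = z} p q = ≤-trans (neg-anti (⊓-glb (neg-anti p) (neg-anti q))) (proj₁ (neg-neg z))

    ⊓-glb-< : ∀ {x y z} → z < x → z < y → z < x ⊓ y
    ⊓-glb-< {x} {y} {z} z<x z<y =
      let (p , p>0 , a) = <⇒gap z<x
          (q , q>0 , b) = <⇒gap z<y
      in gap⇒< {q = p ℚ.⊓ q} (⊓ℚ-pos p>0 q>0) (⊓-glb
           (≤-trans (+-monoʳ-≤ z (fromℚ-mono (ℚ.p⊓q≤p p q))) a)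
           (≤-trans (+-monoʳ-≤ z (fromℚ-mono (ℚ.p⊓q≤q p q))) b))
      where
      ⊓ℚ-pos : ∀ {p q} → 0ℚ ℚ.< p → 0ℚ ℚ.< q → 0ℚ ℚ.< p ℚ.⊓ q
      ⊓ℚ-pos {p} {q} a b with ℚ.⊓-sel p q
      ... | inj₁ eq = subst (0ℚ ℚ.<_) (sym eq) a
      ... | inj₂ eq = subst (0ℚ ℚ.<_) (sym eq) b

    c₀ : ℚ
    c₀ = + 1 ℚ./ 100

    -- Truncating below at c₀ makes the reciprocal total and Lipschitz.
    opaque
      invℚ : ℚ → ℚ
      invℚ p = ℚ.1/_ (p ℚ.⊔ c₀) {{ℚ.pos⇒nonZero (p ℚ.⊔ c₀) {{ℚ.positive (ℚ.<-≤-trans (ℚ-pos {c₀}) (ℚ.p≤q⊔p p c₀))}}}}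

      invℚ-inverse : ∀ p → (p ℚ.⊔ c₀) ℚ.* invℚ p ≡ 1ℚ
      invℚ-inverse p = ℚ.*-inverseʳ (p ℚ.⊔ c₀) {{ℚ.pos⇒nonZero (p ℚ.⊔ c₀) {{ℚ.positive (ℚ.<-≤-trans (ℚ-pos {c₀}) (ℚ.p≤q⊔p p c₀))}}}}

      invℚ-pos : ∀ p → 0ℚ ℚ.< invℚ p
      invℚ-pos p = ℚ.positive⁻¹ _ {{ℚ.1/pos⇒pos (p ℚ.⊔ c₀) {{ℚ.positive (ℚ.<-≤-trans (ℚ-pos {c₀}) (ℚ.p≤q⊔p p c₀))}}}}

    ℚ100 ℚ10000 : ℚ
    ℚ100 = + 100 ℚ./ 1
    ℚ10000 = + 10000 ℚ./ 1

    invℚ-≤ : ∀ p → invℚ p ℚ.≤ ℚ100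
    invℚ-≤ p = 0≤⇒≤ℚ (0≤*ℚ {ℚ100} ℚ-le (0≤*ℚ (≤⇒0≤ℚ (ℚ.p≤q⊔p p c₀)) (ℚ.<⇒≤ (invℚ-pos p))))
      (trans (solve 2 (λ y i → con ℚ100 :* ((y :- con c₀) :* i) := con ℚ100 :* (y :* i) :- i) refl (p ℚ.⊔ c₀) (invℚ p))
        (cong (λ r → ℚ100 ℚ.* r ℚ.- invℚ p) (invℚ-inverse p)))

    ⊔c₀-≤ : ∀ {p q ε} → 0ℚ ℚ.≤ ε → p ℚ.≤ q ℚ.+ ε → p ℚ.⊔ c₀ ℚ.≤ q ℚ.⊔ c₀ ℚ.+ ε
    ⊔c₀-≤ {p} {q} {ε} ε≥0 h = ℚ.⊔-lub (ℚ.≤-trans h (ℚ.+-monoˡ-≤ ε (ℚ.p≤p⊔q q c₀)))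
      (ℚ.≤-trans (ℚ.p≤q⊔p q c₀) (0≤⇒≤ℚ ε≥0 (solve 2 (λ b e → e := (b :+ e) :- b) refl (q ℚ.⊔ c₀) ε)))

    -- For reciprocals i and j of y and z, i - j = i j (z - y), and both are at most 100; the
    -- constant 10000 is the square of that bound.
    invℚ-lipschitz : ∀ {p q ε} → 0ℚ ℚ.≤ ε → q ℚ.≤ p ℚ.+ ε → invℚ p ℚ.≤ invℚ q ℚ.+ ℚ10000 ℚ.* ε
    invℚ-lipschitz {p} {q} {ε} ε≥0 h = 0≤⇒≤ℚ
      (0≤+ℚ (0≤*ℚ (0≤*ℚ (ℚ.<⇒≤ (invℚ-pos p)) (ℚ.<⇒≤ (invℚ-pos q))) (≤⇒0≤ℚ (⊔c₀-≤ {q} {p} ε≥0 h)))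
            (0≤*ℚ ε≥0 (0≤+ℚ (0≤*ℚ {ℚ100} ℚ-le (≤⇒0≤ℚ (invℚ-≤ p))) (0≤*ℚ (ℚ.<⇒≤ (invℚ-pos p)) (≤⇒0≤ℚ (invℚ-≤ q))))))
      (trans (solve 5 (λ y z i j e → i :* j :* ((y :+ e) :- z) :+ e :* (con ℚ100 :* (con ℚ100 :- i) :+ i :* (con ℚ100 :- j))
                    := (j :* (y :* i) :+ con ℚ10000 :* e) :- i :* (z :* j)) refl (p ℚ.⊔ c₀) (q ℚ.⊔ c₀) (invℚ p) (invℚ q) ε)
        (cong₂ ℚ._-_ (cong (ℚ._+ ℚ10000 ℚ.* ε) (trans (cong (invℚ q ℚ.*_) (invℚ-inverse p)) (ℚ.*-identityʳ (invℚ q))))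
                     (trans (cong (invℚ p ℚ.*_) (invℚ-inverse q)) (ℚ.*-identityʳ (invℚ p)))))

    -- 10000 times `c₁` is ½: when the argument moves by `c₁` ε, the reciprocal moves by at most
    -- ε/2, strictly less than ε.
    c₁ : ℚ
    c₁ = + 1 ℚ./ 20000

    abstract
      inv-cauchy : ∀ x → IsCauchy (λ i → invℚ (seq x i))
      inv-cauchy x {ε} ε>0 =
        let δ = c₁ ℚ.* ε
            δ>0 = 0<*ℚ {c₁} ℚ-pos ε>0
            (N , c) = cauchy x δ>0
        in N , λ {i} {j} a b → let (p , q) = ∣∣<⇒<+ (seq x i) (seq x j) (c a b) in
           <+⇒∣∣< (invℚ (seq x i)) (invℚ (seq x j)) (lem δ>0 q) (lem δ>0 p)
        where
        lem : ∀ {p q} → 0ℚ ℚ.< c₁ ℚ.* ε → q ℚ.< p ℚ.+ c₁ ℚ.* ε → invℚ p ℚ.< invℚ q ℚ.+ ε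
        lem {p} {q} δ>0 h = ℚ.≤-<-trans (invℚ-lipschitz (ℚ.<⇒≤ δ>0) (ℚ.<⇒≤ h)) (ℚ.+-monoʳ-< (invℚ q)
          (subst₂< (solve 1 (λ e → con ½ :* e := con ℚ10000 :* (con c₁ :* e)) refl ε) (half+half ε)
            (subst (ℚ._< half ε ℚ.+ half ε) (ℚ.+-identityʳ (half ε)) (ℚ.+-monoʳ-< (half ε) (half-pos ε>0)))))
          where
          subst₂< : ∀ {a b c d} → a ≡ b → c ≡ d → a ℚ.< c → b ℚ.< d
          subst₂< refl refl r = r

    inv : ℝ → ℝ
    inv x = mkℝ (λ i → invℚ (seq x i)) (inv-cauchy x)

    0≤inv : ∀ x → 0ℝ ≤ inv x
    0≤inv x = pointwise-≤ λ i → ℚ.<⇒≤ (invℚ-pos (seq x i))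

    -- A value strictly between `c₀` and 1/76, the smallest lower bound established for a
    -- denominator. The margin over `c₀` absorbs the tolerance in `≤` when `*-inv` shows that the
    -- truncation is inactive.
    c₂ : ℚ
    c₂ = + 1 ℚ./ 96

    *-inv : ∀ {x} → fromℚ c₂ ≤ x → x * inv x ≃ 1ℝ
    *-inv {x} (mk≤ h) =
      let (N , p) = h {c₂ ℚ.- c₀} ℚ-pos
          eq : ∀ {i} → N ℕ.≤ i → seq x i ℚ.* invℚ (seq x i) ≡ 1ℚ
          eq {i} a = trans (cong (ℚ._* invℚ (seq x i)) (sym (ℚ.p≥q⇒p⊔q≡p {seq x i} {c₀}
            (0≤⇒≤ℚ (≤⇒0≤ℚ (p a)) (solve 1 (λ x → (x :+ (con c₂ :- con c₀)) :- con c₂ := x :- con c₀) refl (seq x i)))))) (invℚ-inverse (seq x i))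
      in mk≤ (λ {ε} ε>0 → N , λ a → ℚ.≤-trans (ℚ.≤-reflexive (eq a)) (p≤p+ε 1ℚ ε>0)) ,
         mk≤ (λ {ε} ε>0 → N , λ {i} a → ℚ.≤-trans (ℚ.≤-reflexive (sym (eq a))) (p≤p+ε (seq x i ℚ.* invℚ (seq x i)) ε>0))

  open Reals public

  -- Metric spaces up to distance 0: continuity, gluing and homotopies.

  module Continuity where

    ∣_∣ₘ : MetricSpace → Set
    ∣ X ∣ₘ = MetricSpace.Carrier X

    dist : (X : MetricSpace) → ∣ X ∣ₘ → ∣ X ∣ₘ → ℝ
    dist X = MetricSpace.d X

    infix 4 [_]_∼_
    record [_]_∼_ (X : MetricSpace) (x y : ∣ X ∣ₘ) : Set where
      constructor mk∼
      field
        dist≤0 : dist X x y ≤ 0ℝ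

    open [_]_∼_ public

    ⊓-pos : ∀ {p q} → 0ℚ ℚ.< p → 0ℚ ℚ.< q → 0ℚ ℚ.< p ℚ.⊓ q
    ⊓-pos {p} {q} a b with ℚ.⊓-sel p q
    ... | inj₁ eq = subst (0ℚ ℚ.<_) (sym eq) a
    ... | inj₂ eq = subst (0ℚ ℚ.<_) (sym eq) b

    ∼-refl : ∀ X {x} → [ X ] x ∼ x
    ∼-refl X {x} = mk∼ (proj₁ (d-refl X x))

    ∼-sym : ∀ X {x y} → [ X ] x ∼ y → [ X ] y ∼ x
    ∼-sym X {x} {y} (mk∼ p) = mk∼ (≤-trans (d-sym X y x) p)

    dist-move : ∀ X {x y z ε} → dist X x y ≤ fromℚ ε → [ X ] y ∼ z → dist X x z ≤ fromℚ ε
    dist-move X {x} {y} {z} {ε} p (mk∼ q) = ≤-trans (d-triangle X x y z) (≤-trans (+-mono-≤ p q)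
      (≡⇒≤ λ i → ℚ.+-identityʳ ε))

    ∼-trans : ∀ X {x y z} → [ X ] x ∼ y → [ X ] y ∼ z → [ X ] x ∼ z
    ∼-trans X (mk∼ p) q = mk∼ (dist-move X p q)

    ∼-stable : ∀ X {x y} → Stable ([ X ] x ∼ y)
    ∼-stable X h = mk∼ (≤-stable λ k → h λ p → k (dist≤0 p))

    -- Continuity with rational ε and δ; a record, so that f can be inferred.
    record C (X Y : MetricSpace) (f : ∣ X ∣ₘ → ∣ Y ∣ₘ) : Set where
      constructor mkC
      field
        modulus : ∀ x {ε} → 0ℚ ℚ.< ε →
          ∃[ δ ] (0ℚ ℚ.< δ × (∀ x′ → dist X x x′ ≤ fromℚ δ → dist Y (f x) (f x′) ≤ fromℚ ε))

    open C public

    C⇒Continuous : ∀ X Y {f} → C X Y f → Continuous X Y f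
    C⇒Continuous X Y {f} (mkC c) x {ε} ε>0 =
      let (g , g>0 , g≤) = <⇒gap ε>0
          (δ , δ>0 , h) = c x (half-pos g>0)
      in fromℚ δ , fromℚ-pos δ>0 , λ x′ p → ≤-<-trans (h x′ (<⇒≤ p))
           (gap⇒< (half-pos g>0) (≤-trans (≡⇒≤ λ i → trans (half+half g) (sym (ℚ.+-identityˡ g))) g≤))

    C-id : ∀ X → C X X id
    C-id X = mkC λ x {ε} ε>0 → ε , ε>0 , λ _ p → p

    C-∘ : ∀ X Y Z {f g} → C Y Z g → C X Y f → C X Z (λ x → g (f x))
    C-∘ X Y Z {f} (mkC cg) (mkC cf) = mkC λ x ε>0 →
      let (η , η>0 , h) = cg (f x) ε>0
          (δ , δ>0 , k) = cf x η>0
      in δ , δ>0 , λ x′ p → h (f x′) (k x′ p)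

    C-const : ∀ X Y y → C X Y (λ _ → y)
    C-const X Y y = mkC λ x {ε} ε>0 → 1ℚ , ℚ-pos , λ _ _ → ≤-trans (dist≤0 (∼-refl Y)) (fromℚ-mono (ℚ.<⇒≤ ε>0))

    C-resp : ∀ X Y {f} → C X Y f → ∀ {x x′} → [ X ] x ∼ x′ → [ Y ] f x ∼ f x′
    C-resp X Y (mkC c) {x} {x′} (mk∼ p) = mk∼ (≤-eps λ {ε} ε>0 → let (δ , δ>0 , h) = c x ε>0 in
      ≤-trans (h x′ (≤-trans p (fromℚ-mono (ℚ.<⇒≤ δ>0)))) (≡⇒≤ λ _ → sym (ℚ.+-identityˡ ε)))

    C-isometric : ∀ X Y {f} → (∀ x x′ → dist Y (f x) (f x′) ≤ dist X x x′) → C X Y f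
    C-isometric X Y h = mkC λ x {ε} ε>0 → ε , ε>0 , λ x′ p → ≤-trans (h x x′) p

    -- Real-valued functions

    Near : ℚ → ℝ → ℝ → Set
    Near ε x y = x ≤ y + fromℚ ε × y ≤ x + fromℚ ε

    record Cont (X : MetricSpace) (f : ∣ X ∣ₘ → ℝ) : Set where
      constructor mkCont
      field
        modulusℝ : ∀ x {ε} → 0ℚ ℚ.< ε →
          ∃[ δ ] (0ℚ ℚ.< δ × (∀ x′ → dist X x x′ ≤ fromℚ δ → Near ε (f x) (f x′)))

    open Cont public

    near⇒∣∣ : ∀ {ε x y} → Near ε x y → ∣ x - y ∣ ≤ fromℚ ε
    near⇒∣∣ {ε} {x} {y} (mk≤ p , mk≤ q) = mk≤ λ {η} η>0 → let (N , r) = p η>0 & q η>0 in N , λ {i} a →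
      abs (seq x i) (seq y i) (proj₁ (r a)) (proj₂ (r a))
      where
      abs : ∀ x y {ε η} → x ℚ.≤ (y ℚ.+ ε) ℚ.+ η → y ℚ.≤ (x ℚ.+ ε) ℚ.+ η → ℚ.∣ x ℚ.- y ∣ ℚ.≤ ε ℚ.+ η
      abs x y {ε} {η} a b with ℚ.∣p∣≡p∨∣p∣≡-p (x ℚ.- y)
      ... | inj₁ eq = 0≤⇒≤ℚ (≤⇒0≤ℚ a) (trans (solve 4 (λ x y e h → ((y :+ e) :+ h) :- x := (e :+ h) :- (x :- y)) refl x y ε η)
                        (cong (λ r → (ε ℚ.+ η) ℚ.- r) (sym eq)))
      ... | inj₂ eq = 0≤⇒≤ℚ (≤⇒0≤ℚ b) (trans (solve 4 (λ x y e h → ((x :+ e) :+ h) :- y := (e :+ h) :- (:- (x :- y))) refl x y ε η)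
                        (cong (λ r → (ε ℚ.+ η) ℚ.- r) (sym eq)))

    x≤∣x∣ : ∀ x → x ≤ ∣ x ∣
    x≤∣x∣ x = pointwise-≤ λ i → p≤∣p∣ (seq x i)

    -x≤∣x∣ : ∀ x → - x ≤ ∣ x ∣
    -x≤∣x∣ x = pointwise-≤ λ i → -p≤∣p∣ (seq x i)

    0≤∣x∣ : ∀ x → 0ℝ ≤ ∣ x ∣
    0≤∣x∣ x = pointwise-≤ λ i → ℚ.0≤∣p∣ (seq x i)

    ∣∣⇒near : ∀ {ε x y} → ∣ x - y ∣ ≤ fromℚ ε → Near ε x y
    ∣∣⇒near {ε} {x} {y} h =
      0≤⇒≤ (≤⇒0≤ (≤-trans (x≤∣x∣ (x - y)) h)) (λ i → solve 3 (λ x y e → e :- (x :- y) := (y :+ e) :- x) refl (seq x i) (seq y i) ε) ,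
      0≤⇒≤ (≤⇒0≤ (≤-trans (-x≤∣x∣ (x - y)) h)) (λ i → solve 3 (λ x y e → e :- (:- (x :- y)) := (x :+ e) :- y) refl (seq x i) (seq y i) ε)

    near-+ : ∀ {ε η x y u v} → Near ε x y → Near η u v → Near (ε ℚ.+ η) (x + u) (y + v)
    near-+ {ε} {η} {x} {y} {u} {v} (p , p′) (q , q′) =
      ≤-trans (+-mono-≤ p q) (≡⇒≤ λ i → solve 4 (λ y v e h → (y :+ e) :+ (v :+ h) := (y :+ v) :+ (e :+ h)) refl (seq y i) (seq v i) ε η) ,
      ≤-trans (+-mono-≤ p′ q′) (≡⇒≤ λ i → solve 4 (λ y v e h → (y :+ e) :+ (v :+ h) := (y :+ v) :+ (e :+ h)) refl (seq x i) (seq u i) ε η)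

    near-neg : ∀ {ε x y} → Near ε x y → Near ε (- x) (- y)
    near-neg {ε} {x} {y} (p , q) =
      0≤⇒≤ (≤⇒0≤ q) (λ i → solve 3 (λ x y e → (x :+ e) :- y := (:- y :+ e) :- (:- x)) refl (seq x i) (seq y i) ε) ,
      0≤⇒≤ (≤⇒0≤ p) (λ i → solve 3 (λ x y e → (y :+ e) :- x := (:- x :+ e) :- (:- y)) refl (seq x i) (seq y i) ε)

    near-⊓ : ∀ {ε x y u v} → Near ε x y → Near ε u v → Near ε (x ⊓ u) (y ⊓ v)
    near-⊓ {ε} {x} {y} {u} {v} (p , p′) (q , q′) = one p q , one p′ q′
      where
      back : ∀ {a b} → a ≤ b + fromℚ ε → a - fromℚ ε ≤ b
      back {a} {b} h = 0≤⇒≤ (≤⇒0≤ h) λ i → solve 3 (λ a b e → (b :+ e) :- a := b :- (a :- e)) refl (seq a i) (seq b i) ε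
      forth : ∀ {a b} → a - fromℚ ε ≤ b → a ≤ b + fromℚ ε
      forth {a} {b} h = 0≤⇒≤ (≤⇒0≤ h) λ i → solve 3 (λ a b e → b :- (a :- e) := (b :+ e) :- a) refl (seq a i) (seq b i) ε
      one : ∀ {x y u v} → x ≤ y + fromℚ ε → u ≤ v + fromℚ ε → x ⊓ u ≤ y ⊓ v + fromℚ ε
      one {x} {y} {u} {v} p q = forth (⊓-glb (back (≤-trans (⊓≤ˡ x u) p)) (back (≤-trans (⊓≤ʳ x u) q)))

    near-inv : ∀ {ε x y} → 0ℚ ℚ.≤ ε → Near ε x y → Near (ℚ10000 ℚ.* ε) (inv x) (inv y)
    near-inv {ε} {x} {y} ε≥0 (p , q) = one q , one p
      where
      one : ∀ {x y} → y ≤ x + fromℚ ε → inv x ≤ inv y + fromℚ (ℚ10000 ℚ.* ε)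
      one {x} {y} (mk≤ h) = mk≤ λ {η} η>0 →
        let (δ , δ>0 , eq) = quotientℚ {η} {ℚ10000} η>0 ℚ-pos
            (N , r) = h δ>0
        in N , λ {i} a → ℚ.≤-trans (invℚ-lipschitz {seq x i} {seq y i} {ε ℚ.+ δ} (0≤+ℚ ε≥0 (ℚ.<⇒≤ δ>0))
             (ℚ.≤-trans (r a) (ℚ.≤-reflexive (ℚ.+-assoc (seq x i) ε δ))))
             (ℚ.≤-reflexive (trans (solve 4 (λ y k e d → y :+ k :* (e :+ d) := (y :+ k :* e) :+ k :* d) refl (invℚ (seq y i)) ℚ10000 ε δ)
               (cong ((invℚ (seq y i) ℚ.+ ℚ10000 ℚ.* ε) ℚ.+_) eq)))

    -- From x u - y v = x (u - v) + v (x - y), bounds on x and v suffice. Factors of unknown sign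
    -- are avoided by weighting the two one-sided inequalities by (A - x)/2 and (A + x)/2, which are
    -- nonnegative and sum to A.
    near-* : ∀ {ε η A B x y u v} → x ≤ fromℚ A → fromℚ (ℚ.- A) ≤ x → v ≤ fromℚ B → fromℚ (ℚ.- B) ≤ v →
      Near ε x y → Near η u v → Near (A ℚ.* η ℚ.+ B ℚ.* ε) (x * u) (y * v)
    near-* {ε} {η} {A} {B} {x} {y} {u} {v} x≤A A≤x v≤B B≤v (p , p′) (q , q′) =
      0≤⇒≤ (0≤+ (0≤+ (0≤* h (0≤* a₁ d₁)) (0≤* h (0≤* a₂ d₂))) (0≤+ (0≤* h (0≤* b₁ e₁)) (0≤* h (0≤* b₂ e₂))))
        (λ i → solve 8 (λ x y u v A B e n →
          (con ½ :* ((A :- x) :* ((u :+ n) :- v)) :+ con ½ :* ((x :- (:- A)) :* ((v :+ n) :- u)))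
            :+ (con ½ :* ((B :- v) :* ((x :+ e) :- y)) :+ con ½ :* ((v :- (:- B)) :* ((y :+ e) :- x)))
          := ((y :* v :+ (A :* n :+ B :* e)) :- x :* u)) refl (seq x i) (seq y i) (seq u i) (seq v i) A B ε η) ,
      0≤⇒≤ (0≤+ (0≤+ (0≤* h (0≤* a₁ d₂)) (0≤* h (0≤* a₂ d₁))) (0≤+ (0≤* h (0≤* b₁ e₂)) (0≤* h (0≤* b₂ e₁))))
        (λ i → solve 8 (λ x y u v A B e n →
          (con ½ :* ((A :- x) :* ((v :+ n) :- u)) :+ con ½ :* ((x :- (:- A)) :* ((u :+ n) :- v)))
            :+ (con ½ :* ((B :- v) :* ((y :+ e) :- x)) :+ con ½ :* ((v :- (:- B)) :* ((x :+ e) :- y)))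
          := ((x :* u :+ (A :* n :+ B :* e)) :- y :* v)) refl (seq x i) (seq y i) (seq u i) (seq v i) A B ε η)
      where
      h : 0ℝ ≤ fromℚ ½
      h = fromℚ-mono ℚ-le
      a₁ : 0ℝ ≤ fromℚ A - x
      a₁ = ≤⇒0≤ x≤A
      a₂ : 0ℝ ≤ x - fromℚ (ℚ.- A)
      a₂ = ≤⇒0≤ A≤x
      b₁ : 0ℝ ≤ fromℚ B - v
      b₁ = ≤⇒0≤ v≤B
      b₂ : 0ℝ ≤ v - fromℚ (ℚ.- B)
      b₂ = ≤⇒0≤ B≤v
      d₁ : 0ℝ ≤ (u + fromℚ η) - v
      d₁ = ≤⇒0≤ q′
      d₂ : 0ℝ ≤ (v + fromℚ η) - u
      d₂ = ≤⇒0≤ q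
      e₁ : 0ℝ ≤ (x + fromℚ ε) - y
      e₁ = ≤⇒0≤ p′
      e₂ : 0ℝ ≤ (y + fromℚ ε) - x
      e₂ = ≤⇒0≤ p

    near-refl : ∀ {ε} → 0ℚ ℚ.≤ ε → ∀ x → Near ε x x
    near-refl e x = x≤x+q x e , x≤x+q x e

    module _ (X : MetricSpace) where

      private
        both : ∀ {x : ∣ X ∣ₘ} {P Q : ∣ X ∣ₘ → Set} →
          ∃[ δ ] (0ℚ ℚ.< δ × (∀ x′ → dist X x x′ ≤ fromℚ δ → P x′)) →
          ∃[ δ ] (0ℚ ℚ.< δ × (∀ x′ → dist X x x′ ≤ fromℚ δ → Q x′)) →
          ∃[ δ ] (0ℚ ℚ.< δ × (∀ x′ → dist X x x′ ≤ fromℚ δ → P x′ × Q x′))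
        both (δ , δ>0 , p) (η , η>0 , q) = δ ℚ.⊓ η , ⊓-pos δ>0 η>0 , λ x′ h →
          p x′ (≤-trans h (fromℚ-mono (ℚ.p⊓q≤p δ η))) , q x′ (≤-trans h (fromℚ-mono (ℚ.p⊓q≤q δ η)))

        mapδ : ∀ {x : ∣ X ∣ₘ} {P Q : ∣ X ∣ₘ → Set} → (∀ {x′} → P x′ → Q x′) →
          ∃[ δ ] (0ℚ ℚ.< δ × (∀ x′ → dist X x x′ ≤ fromℚ δ → P x′)) →
          ∃[ δ ] (0ℚ ℚ.< δ × (∀ x′ → dist X x x′ ≤ fromℚ δ → Q x′))
        mapδ f (δ , δ>0 , p) = δ , δ>0 , λ x′ h → f (p x′ h)

      near-by-both = both

      Cont-const : ∀ r → Cont X (λ _ → r)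
      Cont-const r = mkCont λ x ε>0 → 1ℚ , ℚ-pos , λ _ _ → near-refl (ℚ.<⇒≤ ε>0) r

      Cont-+ : ∀ {f g} → Cont X f → Cont X g → Cont X (λ x → f x + g x)
      Cont-+ {f} {g} (mkCont cf) (mkCont cg) = mkCont λ x {ε} ε>0 →
        mapδ (λ {x′} (p , q) → subst (λ e → Near e (f x + g x) (f x′ + g x′)) (half+half ε) (near-+ p q)) (both (cf x (half-pos ε>0)) (cg x (half-pos ε>0)))

      Cont-neg : ∀ {f} → Cont X f → Cont X (λ x → - f x)
      Cont-neg (mkCont cf) = mkCont λ x ε>0 → mapδ near-neg (cf x ε>0)

      Cont-- : ∀ {f g} → Cont X f → Cont X g → Cont X (λ x → f x - g x)
      Cont-- cf cg = Cont-+ cf (Cont-neg cg)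

      Cont-⊓ : ∀ {f g} → Cont X f → Cont X g → Cont X (λ x → f x ⊓ g x)
      Cont-⊓ (mkCont cf) (mkCont cg) = mkCont λ x ε>0 → mapδ (λ (p , q) → near-⊓ p q) (both (cf x ε>0) (cg x ε>0))

      Cont-⊔ : ∀ {f g} → Cont X f → Cont X g → Cont X (λ x → f x ⊔ g x)
      Cont-⊔ cf cg = Cont-neg (Cont-⊓ (Cont-neg cf) (Cont-neg cg))

      Cont-inv : ∀ {f} → Cont X f → Cont X (λ x → inv (f x))
      Cont-inv {f} (mkCont cf) = mkCont λ x {ε} ε>0 →
        let (δ , δ>0 , eq) = quotientℚ {ε} {ℚ10000} ε>0 ℚ-pos
        in mapδ (λ {x′} p → subst (λ e → Near e (inv (f x)) (inv (f x′))) eq (near-inv (ℚ.<⇒≤ δ>0) p)) (cf x δ>0)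

      Cont-* : ∀ {f g} → Cont X f → Cont X g → Cont X (λ x → f x * g x)
      Cont-* {f} {g} (mkCont cf) (mkCont cg) = mkCont λ x {ε} ε>0 →
        let (A , A>0 , f≤ , ≤f) = bounded (f x)
            (B , B>0 , g≤ , ≤g) = bounded (g x)
            -- The bound has to hold at the neighbouring point x′, where g may exceed its value at x
            -- by up to 1.
            B′ = B ℚ.+ 1ℚ
            (η , η>0 , eqη) = quotientℚ {half ε} {A} (half-pos ε>0) A>0
            (ζ , ζ>0 , eqζ) = quotientℚ {half ε} {B′} (half-pos ε>0) (0<+ℚ {B} {1ℚ} B>0 ℚ-pos)
        in mapδ (λ {x′} (p , q , r) → subst (λ e → Near e (f x * g x) (f x′ * g x′))
              (trans (cong₂ ℚ._+_ eqη eqζ) (half+half ε))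
              (near-* {B = B′} f≤ ≤f (≤-trans (proj₂ r) (≤-trans (+-monoˡ-≤ 1ℝ g≤) (≡⇒≤ {fromℚ B + 1ℝ} {fromℚ B′} λ _ → refl)))
                (lower x x′ (proj₁ r) ≤g)
                p q))
            (both (cf x ζ>0) (both (cg x η>0) (cg x {1ℚ} ℚ-pos)))
        where
        lower : ∀ x x′ {B} → g x ≤ g x′ + fromℚ 1ℚ → fromℚ (ℚ.- B) ≤ g x → fromℚ (ℚ.- (B ℚ.+ 1ℚ)) ≤ g x′
        lower x x′ {B} a b = 0≤⇒≤ (0≤+ (≤⇒0≤ a) (≤⇒0≤ b)) λ i →
          solve 3 (λ g h b → ((h :+ con 1ℚ) :- g) :+ (g :- (:- b)) := h :- (:- (b :+ con 1ℚ))) refl (seq (g x) i) (seq (g x′) i) B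

      Cont-≃ : ∀ {f g} → (∀ x → f x ≃ g x) → Cont X f → Cont X g
      Cont-≃ {f} {g} e (mkCont cf) = mkCont λ x {ε} ε>0 → mapδ (λ {x′} (p , q) →
        ≤-trans (proj₂ (e x)) (≤-trans p (+-monoˡ-≤ (fromℚ ε) (proj₁ (e x′)))) ,
        ≤-trans (proj₂ (e x′)) (≤-trans q (+-monoˡ-≤ (fromℚ ε) (proj₁ (e x))))) (cf x ε>0)

      sum-near : ∀ {n} {f : ∣ X ∣ₘ → Vector ℝ n} → (∀ k → Cont X (λ x → f x k)) → ∀ x {ε} → 0ℚ ℚ.< ε →
        ∃[ δ ] (0ℚ ℚ.< δ × (∀ x′ → dist X x x′ ≤ fromℚ δ → sum (λ k → ∣ f x k - f x′ k ∣) ≤ fromℚ ε))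
      sum-near {ℕ.zero}  c x ε>0 = 1ℚ , ℚ-pos , λ _ _ → fromℚ-mono (ℚ.<⇒≤ ε>0)
      sum-near {ℕ.suc n} c x {ε} ε>0 = mapδ
        (λ (p , q) → ≤-trans (+-mono-≤ (near⇒∣∣ p) q) (≡⇒≤ λ _ → half+half ε))
        (both (modulusℝ (c zero) x (half-pos ε>0)) (sum-near (λ k → c (suc k)) x (half-pos ε>0)))

      C-into : ∀ {A : Set} {n} (coord : A → Vector ℝ n) {f : ∣ X ∣ₘ → A} →
        (∀ k → Cont X (λ x → coord (f x) k)) → C X (subspace coord) f
      C-into coord c = mkC (sum-near c)

      Cont-∘ : ∀ Y {f g} → Cont Y g → C X Y f → Cont X (λ x → g (f x))
      Cont-∘ Y {f} (mkCont cg) (mkC cf) = mkCont λ x ε>0 →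
        let (η , η>0 , h) = cg (f x) ε>0
            (δ , δ>0 , k) = cf x η>0
        in δ , δ>0 , λ x′ p → h (f x′) (k x′ p)

      persist-< : ∀ {f} → Cont X f → ∀ {a} x → a < f x → ∃[ δ ] (0ℚ ℚ.< δ × (∀ x′ → dist X x x′ ≤ fromℚ δ → a < f x′))
      persist-< {f} (mkCont cf) {a} x a<fx =
        let (g , g>0 , a+g≤) = <⇒gap a<fx
        in mapδ (λ {x′} p → gap⇒< (half-pos g>0) (0≤⇒≤ (0≤+ (≤⇒0≤ a+g≤) (≤⇒0≤ (proj₁ p))) λ i →
             solve 4 (λ a f f′ g → (f :- (a :+ g)) :+ ((f′ :+ con ½ :* g) :- f) := f′ :- (a :+ con ½ :* g)) refl
               (seq a i) (seq (f x) i) (seq (f x′) i) g)) (cf x (half-pos g>0))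

    ≤sum : ∀ {n} (f : Vector ℝ n) → (∀ k → 0ℝ ≤ f k) → 0ℝ ≤ sum f × (∀ k → f k ≤ sum f)
    ≤sum {ℕ.zero}  f p = ≤-refl , λ ()
    ≤sum {ℕ.suc n} f p =
      let (q , r) = ≤sum (f ∘ suc) (p ∘ suc)
          weak : ∀ {a b} → 0ℝ ≤ b → a ≤ a + b
          weak {a} {b} h = 0≤⇒≤ h λ i → solve 2 (λ a b → b := (a :+ b) :- a) refl (seq a i) (seq b i)
          weak′ : ∀ {a b c} → 0ℝ ≤ a → c ≤ b → c ≤ a + b
          weak′ {a} {b} {c} h k = 0≤⇒≤ (0≤+ h (≤⇒0≤ k)) λ i → solve 3 (λ a b c → a :+ (b :- c) := (a :+ b) :- c) refl (seq a i) (seq b i) (seq c i)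
      in 0≤+ (p zero) q , λ { zero → weak q ; (suc k) → weak′ (p zero) (r k) }

    Cont-coord : ∀ {A : Set} {n} (coord : A → Vector ℝ n) k → Cont (subspace coord) (λ a → coord a k)
    Cont-coord coord k = mkCont λ x {ε} ε>0 → ε , ε>0 , λ x′ p → ∣∣⇒near
      (≤-trans (proj₂ (≤sum (λ k → ∣ coord x k - coord x′ k ∣) (λ k → 0≤∣x∣ (coord x k - coord x′ k))) k) p)

    ∼-coord : ∀ {A : Set} {n} (coord : A → Vector ℝ n) {x y} → [ subspace coord ] x ∼ y → ∀ k → coord x k ≃ coord y k
    ∼-coord coord {x} {y} (mk∼ p) k = eps proj₁ , eps′ proj₂
      where
      n : ∀ {ε} → 0ℚ ℚ.< ε → Near ε (coord x k) (coord y k)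
      n ε>0 = let (δ , δ>0 , h) = modulusℝ (Cont-coord coord k) x ε>0 in h y (≤-trans p (fromℚ-mono (ℚ.<⇒≤ δ>0)))
      eps : (∀ {ε} → Near ε (coord x k) (coord y k) → coord x k ≤ coord y k + fromℚ ε) → coord x k ≤ coord y k
      eps f = ≤-eps λ ε>0 → f (n ε>0)
      eps′ : (∀ {ε} → Near ε (coord x k) (coord y k) → coord y k ≤ coord x k + fromℚ ε) → coord y k ≤ coord x k
      eps′ f = ≤-eps λ ε>0 → f (n ε>0)

    coord-∼ : ∀ {A : Set} {n} (coord : A → Vector ℝ n) {x y} → (∀ k → coord x k ≃ coord y k) → [ subspace coord ] x ∼ y
    coord-∼ coord {x} {y} h = mk∼ (go (coord x) (coord y) h)
      where
      go : ∀ {n} (f g : Vector ℝ n) → (∀ k → f k ≃ g k) → sum (λ k → ∣ f k - g k ∣) ≤ 0ℝ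
      go {ℕ.zero}  f g h = ≤-refl
      go {ℕ.suc n} f g h = ≤-trans (+-mono-≤ (near⇒∣∣ {0ℚ} (z (h zero))) (go (f ∘ suc) (g ∘ suc) (h ∘ suc))) (proj₁ 0+0≃0)
        where
        z : ∀ {a b} → a ≃ b → Near 0ℚ a b
        z {a} {b} (p , q) = ≤-trans p (x≤x+q b ℚ.≤-refl) , ≤-trans q (x≤x+q a ℚ.≤-refl)

    -- Subspaces, products, gluing

    infixl 5 _↾_
    _↾_ : (X : MetricSpace) → (∣ X ∣ₘ → Set) → MetricSpace
    X ↾ A = metricQuotient {Σ ∣ X ∣ₘ A} (λ a b → dist X (proj₁ a) (proj₁ b))
      (λ a b → d-nonNegative X (proj₁ a) (proj₁ b)) (λ a → d-refl X (proj₁ a))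
      (λ a b → d-sym X (proj₁ a) (proj₁ b)) (λ a b c → d-triangle X (proj₁ a) (proj₁ b) (proj₁ c))

    C-↾ : ∀ X {A} → C (X ↾ A) X proj₁
    C-↾ X {A} = C-isometric (X ↾ A) X (λ _ _ → ≤-refl)

    C-proj₁ : ∀ X Y → C (X ×ₘ Y) X proj₁
    C-proj₁ X Y = C-isometric (X ×ₘ Y) X λ { (x , y) (x′ , y′) → 0≤⇒≤ (d-nonNegative Y y y′) λ i →
      solve 2 (λ a b → b := (a :+ b) :- a) refl (seq (dist X x x′) i) (seq (dist Y y y′) i) }

    C-proj₂ : ∀ X Y → C (X ×ₘ Y) Y proj₂
    C-proj₂ X Y = C-isometric (X ×ₘ Y) Y λ { (x , y) (x′ , y′) → 0≤⇒≤ (d-nonNegative X x x′) λ i →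
      solve 2 (λ a b → a := (a :+ b) :- b) refl (seq (dist X x x′) i) (seq (dist Y y y′) i) }

    C-pair : ∀ Z X Y {f g} → C Z X f → C Z Y g → C Z (X ×ₘ Y) (λ z → f z , g z)
    C-pair Z X Y (mkC cf) (mkC cg) = mkC λ z {ε} ε>0 →
      let (δ , δ>0 , p) = near-by-both Z (cf z (half-pos ε>0)) (cg z (half-pos ε>0))
      in δ , δ>0 , λ z′ h → let (a , b) = p z′ h in ≤-trans (+-mono-≤ a b) (≡⇒≤ λ _ → half+half ε)

    module Glue (X Y : MetricSpace) (φ : ∣ X ∣ₘ → ℝ) (φ-cont : Cont X φ) (lo hi : ℚ) (lo<hi : lo ℚ.< hi)
      (f : Σ ∣ X ∣ₘ (λ x → fromℚ lo < φ x) → ∣ Y ∣ₘ) (f-cont : C (X ↾ λ x → fromℚ lo < φ x) Y f)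
      (g : Σ ∣ X ∣ₘ (λ x → φ x < fromℚ hi) → ∣ Y ∣ₘ) (g-cont : C (X ↾ λ x → φ x < fromℚ hi) Y g)
      (agree : ∀ x p q → [ Y ] f (x , p) ∼ g (x , q)) where

      select : ∀ x → (fromℚ lo < φ x) ⊎ (φ x < fromℚ hi) → ∣ Y ∣ₘ
      select x (inj₁ p) = f (x , p)
      select x (inj₂ q) = g (x , q)

      glue : ∣ X ∣ₘ → ∣ Y ∣ₘ
      glue x = select x (compare (fromℚ-mono-< lo<hi) (φ x))

      select-f : ∀ x s p → [ Y ] f (x , p) ∼ select x s
      select-f x (inj₁ p′) p = C-resp (X ↾ λ x → fromℚ lo < φ x) Y f-cont (mk∼ (dist≤0 (∼-refl X)))
      select-f x (inj₂ q)  p = agree x p q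

      select-g : ∀ x s q → [ Y ] g (x , q) ∼ select x s
      select-g x (inj₁ p)  q = ∼-sym Y (agree x p q)
      select-g x (inj₂ q′) q = C-resp (X ↾ λ x → φ x < fromℚ hi) Y g-cont (mk∼ (dist≤0 (∼-refl X)))

      glue-f : ∀ x p → [ Y ] f (x , p) ∼ glue x
      glue-f x = select-f x (compare (fromℚ-mono-< lo<hi) (φ x))

      glue-g : ∀ x q → [ Y ] g (x , q) ∼ glue x
      glue-g x = select-g x (compare (fromℚ-mono-< lo<hi) (φ x))

      -- The open condition chosen at x persists nearby, so the formula chosen at x is still defined
      -- at x′. By `glue-f` or `glue-g` it gives the glued value there, whichever branch was
      -- selected at x′.
      glue-cont : C X Y glue
      glue-cont = mkC λ x {ε} ε>0 → by x ε>0 (compare (fromℚ-mono-< lo<hi) (φ x))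
        where
        by : ∀ x {ε} → 0ℚ ℚ.< ε → ∀ s → ∃[ δ ] (0ℚ ℚ.< δ × (∀ x′ → dist X x x′ ≤ fromℚ δ → dist Y (select x s) (glue x′) ≤ fromℚ ε))
        by x ε>0 (inj₁ p) =
          let (δ , δ>0 , h) = modulus f-cont (x , p) ε>0
              (η , η>0 , k) = persist-< X φ-cont x p
          in δ ℚ.⊓ η , ⊓-pos δ>0 η>0 , λ x′ c →
             let p′ = k x′ (≤-trans c (fromℚ-mono (ℚ.p⊓q≤q δ η)))
             in dist-move Y (h (x′ , p′) (≤-trans c (fromℚ-mono (ℚ.p⊓q≤p δ η)))) (glue-f x′ p′)
        by x ε>0 (inj₂ q) =
          let (δ , δ>0 , h) = modulus g-cont (x , q) ε>0
              (η , η>0 , k) = persist-< X (Cont-neg X φ-cont) {a = - fromℚ hi} x (neg-strict q)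
          in δ ℚ.⊓ η , ⊓-pos δ>0 η>0 , λ x′ c →
             let q′ = neg-strict⁻ (k x′ (≤-trans c (fromℚ-mono (ℚ.p⊓q≤q δ η))))
             in dist-move Y (h (x′ , q′) (≤-trans c (fromℚ-mono (ℚ.p⊓q≤p δ η)))) (glue-g x′ q′)
          where
          neg-strict : ∀ {a b} → a < b → - b < - a
          neg-strict {a} {b} h = let (r , r>0 , p) = <⇒gap h in gap⇒< r>0
            (0≤⇒≤ (≤⇒0≤ p) λ i → solve 3 (λ a b r → b :- (a :+ r) := :- a :- (:- b :+ r)) refl (seq a i) (seq b i) r)
          neg-strict⁻ : ∀ {a b} → - b < - a → a < b
          neg-strict⁻ {a} {b} h = let (r , r>0 , p) = <⇒gap h in gap⇒< r>0
            (0≤⇒≤ (≤⇒0≤ p) λ i → solve 3 (λ a b r → :- a :- (:- b :+ r) := b :- (a :+ r)) refl (seq a i) (seq b i) r)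

    -- Homotopies

    clampℝ : ℝ → ℝ
    clampℝ x = 0ℝ ⊔ (x ⊓ 1ℝ)

    0≤1 : 0ℝ ≤ 1ℝ
    0≤1 = fromℚ-mono ℚ-le

    abstract
      clampℝ≥0 : ∀ x → 0ℝ ≤ clampℝ x
      clampℝ≥0 x = ≤⊔ˡ 0ℝ (x ⊓ 1ℝ)

      clampℝ≤1 : ∀ x → clampℝ x ≤ 1ℝ
      clampℝ≤1 x = ⊔-lub 0≤1 (⊓≤ʳ x 1ℝ)

    clampℝ-0 : ∀ {x} → x ≤ 0ℝ → clampℝ x ≃ 0ℝ
    clampℝ-0 {x} p = ⊔-lub ≤-refl (≤-trans (⊓≤ˡ x 1ℝ) p) , clampℝ≥0 x

    clampℝ-1 : ∀ {x} → 1ℝ ≤ x → clampℝ x ≃ 1ℝ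
    clampℝ-1 {x} p = clampℝ≤1 x , ≤-trans (⊓-glb p ≤-refl) (≤⊔ʳ 0ℝ (x ⊓ 1ℝ))

    clamp : ℝ → UnitInterval
    clamp x = mkI (clampℝ x) (clampℝ≥0 x) (clampℝ≤1 x)

    time : UnitInterval → ℝ
    time = UnitInterval.value

    Cont-clampℝ : ∀ X {f} → Cont X f → Cont X (λ x → clampℝ (f x))
    Cont-clampℝ X c = Cont-⊔ X (Cont-const X 0ℝ) (Cont-⊓ X c (Cont-const X 1ℝ))

    C-clamp : ∀ X {f} → Cont X f → C X 𝕀 (λ x → clamp (f x))
    C-clamp X c = C-into X {UnitInterval} {1} (λ t _ → UnitInterval.value t) (λ _ → Cont-clampℝ X c)

    Cont-time : Cont 𝕀 time
    Cont-time = Cont-coord {UnitInterval} {1} (λ t _ → UnitInterval.value t) zero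

    ∼-time : ∀ {s t} → time s ≃ time t → [ 𝕀 ] s ∼ t
    ∼-time p = coord-∼ {UnitInterval} {1} (λ t _ → UnitInterval.value t) (λ _ → p)

    ∼-× : ∀ X Y {x x′ y y′} → [ X ] x ∼ x′ → [ Y ] y ∼ y′ → [ X ×ₘ Y ] (x , y) ∼ (x′ , y′)
    ∼-× X Y (mk∼ p) (mk∼ q) = mk∼ (≤-trans (+-mono-≤ p q) (proj₁ 0+0≃0))

    record HtpyOn (P Y : MetricSpace) {A : Set} (i₀ i₁ : A → ∣ P ∣ₘ) (f g : A → ∣ Y ∣ₘ) : Set where
      field
        H      : ∣ P ∣ₘ → ∣ Y ∣ₘ
        H-cont : C P Y H
        start  : ∀ x → [ Y ] H (i₀ x) ∼ f x
        end    : ∀ x → [ Y ] H (i₁ x) ∼ g x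

    open HtpyOn public

    Htpy : (X Y : MetricSpace) (f g : ∣ X ∣ₘ → ∣ Y ∣ₘ) → Set
    Htpy X Y = HtpyOn (X ×ₘ 𝕀) Y (λ x → x , 0ᴵ) (λ x → x , 1ᴵ)

    htpy-cong : ∀ X Y {f g f′ g′} → (∀ x → [ Y ] f x ∼ f′ x) → (∀ x → [ Y ] g x ∼ g′ x) → Htpy X Y f g → Htpy X Y f′ g′
    htpy-cong X Y p q h = record { H = H h ; H-cont = H-cont h
      ; start = λ x → ∼-trans Y (start h x) (p x) ; end = λ x → ∼-trans Y (end h x) (q x) }

    htpy-pre : ∀ X Y Z {f g} → Htpy Y Z f g → ∀ {k} → C X Y k → Htpy X Z (λ x → f (k x)) (λ x → g (k x))
    htpy-pre X Y Z h {k} c = record { H = λ (x , t) → H h (k x , t)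
      ; H-cont = C-∘ (X ×ₘ 𝕀) (Y ×ₘ 𝕀) Z (H-cont h) (C-pair (X ×ₘ 𝕀) Y 𝕀 (C-∘ (X ×ₘ 𝕀) X Y c (C-proj₁ X 𝕀)) (C-proj₂ X 𝕀))
      ; start = λ x → start h (k x) ; end = λ x → end h (k x) }

    htpy-post : ∀ X Y Z {f g} → Htpy X Y f g → ∀ {k} → C Y Z k → Htpy X Z (λ x → k (f x)) (λ x → k (g x))
    htpy-post X Y Z h {k} c = record { H = λ p → k (H h p) ; H-cont = C-∘ (X ×ₘ 𝕀) Y Z c (H-cont h)
      ; start = λ x → C-resp Y Z c (start h x) ; end = λ x → C-resp Y Z c (end h x) }

    Cont-time₂ : ∀ X → Cont (X ×ₘ 𝕀) (λ p → time (proj₂ p))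
    Cont-time₂ X = Cont-∘ (X ×ₘ 𝕀) 𝕀 Cont-time (C-proj₂ X 𝕀)

    reparam : ∀ X Y {f g} (h : Htpy X Y f g) {s : ∣ X ∣ₘ × UnitInterval → ℝ} → Cont (X ×ₘ 𝕀) s →
      C (X ×ₘ 𝕀) Y (λ p → H h (proj₁ p , clamp (s p)))
    reparam X Y h c = C-∘ (X ×ₘ 𝕀) (X ×ₘ 𝕀) Y (H-cont h)
      (C-pair (X ×ₘ 𝕀) X 𝕀 (C-proj₁ X 𝕀) (C-clamp (X ×ₘ 𝕀) c))

    at-time : ∀ X Y {f g} (h : Htpy X Y f g) x {s t} → time s ≃ time t → [ Y ] H h (x , s) ∼ H h (x , t)
    at-time X Y h x {s} {t} p = C-resp (X ×ₘ 𝕀) Y (H-cont h) {x , s} {x , t} (∼-× X 𝕀 {y = s} {t} (∼-refl X) (∼-time {s} {t} p))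

    htpy-sym : ∀ X Y {f g} → Htpy X Y f g → Htpy X Y g f
    htpy-sym X Y h = record
      { H = λ (x , t) → H h (x , clamp (1ℝ - time t))
      ; H-cont = reparam X Y h (Cont-- (X ×ₘ 𝕀) (Cont-const (X ×ₘ 𝕀) 1ℝ) (Cont-time₂ X))
      ; start = λ x → ∼-trans Y (at-time X Y h x {clamp (1ℝ - time 0ᴵ)} {1ᴵ} (clampℝ-1 {1ℝ - time 0ᴵ} (≡⇒≤ λ _ → refl))) (end h x)
      ; end = λ x → ∼-trans Y (at-time X Y h x {clamp (1ℝ - time 1ᴵ)} {0ᴵ} (clampℝ-0 {1ℝ - time 1ᴵ} (≡⇒≤ λ _ → refl))) (start h x) }

    ⅓ ⅔ : ℚ
    ⅓ = + 1 ℚ./ 3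
    ⅔ = + 2 ℚ./ 3

    -- The first homotopy runs during [0, 1/3] and the second during [2/3, 1]; in
    -- between both are stationary, so the choice of branch need not be decidable.
    htpy-trans : ∀ X Y {f g k} → Htpy X Y f g → Htpy X Y g k → Htpy X Y f k
    htpy-trans X Y {f} {g} {k} h₁ h₂ = record
      { H = glue
      ; H-cont = glue-cont
      ; start = λ x → ∼-trans Y (∼-sym Y (glue-g (x , 0ᴵ) (fromℚ-mono-< ℚ-lt)))
          (∼-trans Y (at-time X Y h₁ x {clamp (early 0ᴵ)} {0ᴵ} (clampℝ-0 {early 0ᴵ} (≡⇒≤ λ _ → refl))) (start h₁ x))
      ; end = λ x → ∼-trans Y (∼-sym Y (glue-f (x , 1ᴵ) (fromℚ-mono-< ℚ-lt)))
          (∼-trans Y (at-time X Y h₂ x {clamp (late 1ᴵ)} {1ᴵ} (clampℝ-1 {late 1ᴵ} (≡⇒≤ λ _ → refl))) (end h₂ x)) }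
      where
      early late : UnitInterval → ℝ
      early t = fromℚ ℚ3 * time t
      late  t = fromℚ ℚ3 * time t - fromℚ ℚ2
      XI = X ×ₘ 𝕀
      early-cont : Cont XI (λ p → early (proj₂ p))
      early-cont = Cont-* XI (Cont-const XI (fromℚ ℚ3)) (Cont-time₂ X)
      late-cont : Cont XI (λ p → late (proj₂ p))
      late-cont = Cont-- XI early-cont (Cont-const XI (fromℚ ℚ2))
      agree : ∀ (p : ∣ XI ∣ₘ) → fromℚ ⅓ < time (proj₂ p) → time (proj₂ p) < fromℚ ⅔ →
        [ Y ] H h₂ (proj₁ p , clamp (late (proj₂ p))) ∼ H h₁ (proj₁ p , clamp (early (proj₂ p)))
      agree (x , t) p q = ∼-trans Y (∼-trans Y (at-time X Y h₂ x {clamp (late t)} {0ᴵ} (clampℝ-0 {late t} late≤0)) (start h₂ x))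
        (∼-sym Y (∼-trans Y (at-time X Y h₁ x {clamp (early t)} {1ᴵ} (clampℝ-1 {early t} 1≤early)) (end h₁ x)))
        where
        late≤0 : late t ≤ 0ℝ
        late≤0 = 0≤⇒≤ (0≤* {fromℚ ℚ3} (fromℚ-mono ℚ-le) (≤⇒0≤ (<⇒≤ q)))
          λ i → solve 1 (λ t → con ℚ3 :* (con ⅔ :- t) := con 0ℚ :- (con ℚ3 :* t :- con ℚ2)) refl (seq (time t) i)
        1≤early : 1ℝ ≤ early t
        1≤early = 0≤⇒≤ (0≤* {fromℚ ℚ3} (fromℚ-mono ℚ-le) (≤⇒0≤ (<⇒≤ p)))
          λ i → solve 1 (λ t → con ℚ3 :* (t :- con ⅓) := con ℚ3 :* t :- con 1ℚ) refl (seq (time t) i)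
      open Glue XI Y (λ p → time (proj₂ p)) (Cont-time₂ X) ⅓ ⅔ ℚ-lt
        (λ (p , _) → H h₂ (proj₁ p , clamp (late (proj₂ p))))
        (C-∘ (XI ↾ _) XI Y (reparam X Y h₂ late-cont) (C-↾ XI))
        (λ (p , _) → H h₁ (proj₁ p , clamp (early (proj₂ p))))
        (C-∘ (XI ↾ _) XI Y (reparam X Y h₁ early-cont) (C-↾ XI))
        agree

    -- Homotopy equivalences

    htpy⇒Homotopic : ∀ X Y {f g} → Htpy X Y f g → Homotopic X Y f g
    htpy⇒Homotopic X Y h = record
      { H = H h ; H-continuous = C⇒Continuous (X ×ₘ 𝕀) Y (H-cont h)
      ; H-start = λ x → M.0⇒≈ (dist≤0 (start h x) , d-nonNegative Y _ _)
      ; H-end = λ x → M.0⇒≈ (dist≤0 (end h x) , d-nonNegative Y _ _) }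
      where module M = Metric.IsGeneralMetric (MetricSpace.isMetric Y)

    equivalence : ∀ X Y {f g} → C X Y f → C Y X g → Htpy X X (λ x → g (f x)) id → Htpy Y Y (λ y → f (g y)) id → X ≃ₕ Y
    equivalence X Y {f} {g} cf cg p q = record
      { to = f ; from = g ; to-continuous = C⇒Continuous X Y cf ; from-continuous = C⇒Continuous Y X cg
      ; from∘to = htpy⇒Homotopic X X p ; to∘from = htpy⇒Homotopic Y Y q }

    -- Serves to carry the equivalence, built for an auxiliary realization, over to the realization
    -- of the theorem; the two are inverse to each other up to distance 0.
    transport-equivalence : ∀ X Y Z {g g′ f h} → C X Y g → C Y X g′ → (∀ x → [ X ] g′ (g x) ∼ x) → (∀ y → [ Y ] g (g′ y) ∼ y) →
      C Y Z f → C Z Y h → Htpy Y Y (λ y → h (f y)) id → Htpy Z Z (λ z → f (h z)) id → X ≃ₕ Z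
    transport-equivalence X Y Z {g} {g′} {f} {h} cg cg′ l r cf ch p q = equivalence X Z (C-∘ X Y Z cf cg) (C-∘ Z Y X cg′ ch)
      (htpy-cong X X (λ _ → ∼-refl X) l (htpy-post X Y X (htpy-pre X Y Y p cg) cg′))
      (htpy-cong Z Z (λ z → C-resp Y Z cf (∼-sym Y (r (h z)))) (λ _ → ∼-refl Z) q)

  open Continuity public

  -- The 3-sphere in stereographic coordinates, its dilation, and maps on wedges.

  module Spheres where

    -- Equations between reals from certificates: x − y is exhibited as a
    -- combination of hypotheses l − r.

    lin₁ : ∀ {x y l r} → l ≃ r → ∀ k → (∀ i → seq k i ℚ.* (seq l i ℚ.- seq r i) ≡ seq x i ℚ.- seq y i) → x ≃ y
    lin₁ {l = l} {r} h k eq = ≃-by-0 {z = k * (l - r)} (*-zero-≃ k (x-y≃0 h)) eq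

    lin₂ : ∀ {x y l r l′ r′} → l ≃ r → l′ ≃ r′ → ∀ k k′ →
      (∀ i → seq k i ℚ.* (seq l i ℚ.- seq r i) ℚ.+ seq k′ i ℚ.* (seq l′ i ℚ.- seq r′ i) ≡ seq x i ℚ.- seq y i) → x ≃ y
    lin₂ {l = l} {r} {l′} {r′} h h′ k k′ eq = ≃-by-0 {z = k * (l - r) + k′ * (l′ - r′)}
      (≃-trans (+-cong (*-zero-≃ k (x-y≃0 h)) (*-zero-≃ k′ (x-y≃0 h′))) 0+0≃0) eq

    ⊓-case : ∀ x y {A} → Stable A → (x ⊓ y ≃ x → A) → (x ⊓ y ≃ y → A) → A
    ⊓-case x y st f g = by-cases x y st (λ p → f (⊓≤ˡ x y , ⊓-glb ≤-refl p)) (λ p → g (⊓≤ʳ x y , ⊓-glb (<⇒≤ p) ≤-refl))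

    f0 f1 f2 f3 : Fin 4
    f0 = zero
    f1 = suc zero
    f2 = suc (suc zero)
    f3 = suc (suc (suc zero))

    min₄ : (Fin 4 → ℝ) → ℝ
    min₄ a = a f0 ⊓ (a f1 ⊓ (a f2 ⊓ a f3))

    min₄≤ : ∀ a j → min₄ a ≤ a j
    min₄≤ a zero = ⊓≤ˡ (a f0) (a f1 ⊓ (a f2 ⊓ a f3))
    min₄≤ a (suc zero) = ≤-trans (⊓≤ʳ (a f0) (a f1 ⊓ (a f2 ⊓ a f3))) (⊓≤ˡ (a f1) (a f2 ⊓ a f3))
    min₄≤ a (suc (suc zero)) = ≤-trans (⊓≤ʳ (a f0) (a f1 ⊓ (a f2 ⊓ a f3))) (≤-trans (⊓≤ʳ (a f1) (a f2 ⊓ a f3)) (⊓≤ˡ (a f2) (a f3)))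
    min₄≤ a (suc (suc (suc zero))) = ≤-trans (⊓≤ʳ (a f0) (a f1 ⊓ (a f2 ⊓ a f3))) (≤-trans (⊓≤ʳ (a f1) (a f2 ⊓ a f3)) (⊓≤ʳ (a f2) (a f3)))

    min₄-glb : ∀ a {z} → (∀ j → z ≤ a j) → z ≤ min₄ a
    min₄-glb a h = ⊓-glb (h f0) (⊓-glb (h f1) (⊓-glb (h f2) (h f3)))

    min₄-glb-< : ∀ a {z} → (∀ j → z < a j) → z < min₄ a
    min₄-glb-< a h = ⊓-glb-< (h f0) (⊓-glb-< (h f1) (⊓-glb-< (h f2) (h f3)))

    min₄-case : ∀ a {A} → Stable A → (∀ j → min₄ a ≃ a j → A) → A
    min₄-case a st f = ⊓-case (a f0) (a f1 ⊓ (a f2 ⊓ a f3)) st (f f0) λ p →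
      ⊓-case (a f1) (a f2 ⊓ a f3) st (λ q → f f1 (≃-trans p q)) λ q →
      ⊓-case (a f2) (a f3) st (λ r → f f2 (≃-trans p (≃-trans q r))) (λ r → f f3 (≃-trans p (≃-trans q r)))

    -- A nonnegative factor preserves order. For the upper bound an index attaining the minimum of a
    -- is chosen, which is legitimate because `≤` is stable.
    min₄-affine : ∀ a b {k c} → 0ℝ ≤ k → (∀ j → b j ≃ k * (a j - c)) → min₄ b ≃ k * (min₄ a - c)
    min₄-affine a b {k} {c} k≥0 h =
      min₄-case a ≤-stable (λ j p → ≤-trans (min₄≤ b j) (≤-trans (proj₁ (h j))
        (proj₁ (*-cong (≃-refl {k}) (+-cong (≃-sym p) (≃-refl {x = - c})))))) ,
      min₄-glb b λ j → ≤-trans (*-monoˡ-≤ k≥0 (+-monoˡ-≤ (- c) (min₄≤ a j))) (proj₂ (h j))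

    Cont-min₄ : ∀ X {a : ∣ X ∣ₘ → Fin 4 → ℝ} → (∀ j → Cont X (λ x → a x j)) → Cont X (λ x → min₄ (a x))
    Cont-min₄ X h = Cont-⊓ X (h f0) (Cont-⊓ X (h f1) (Cont-⊓ X (h f2) (h f3)))

    -- The 3-sphere

    pt : SpherePoint 3 → Fin 4 → ℝ
    pt = SpherePoint.coord

    height : SpherePoint 3 → ℝ
    height p = pt p f0

    Cont-pt : ∀ j → Cont (𝕊 3) (λ p → pt p j)
    Cont-pt j = Cont-coord {SpherePoint 3} {4} SpherePoint.coord j

    vec₄ : ℝ → ℝ → ℝ → ℝ → Vector ℝ 4
    vec₄ a b c d zero = a
    vec₄ a b c d (suc zero) = b
    vec₄ a b c d (suc (suc zero)) = c
    vec₄ a b c d (suc (suc (suc zero))) = d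

    ∼-pt : ∀ {p p′} → [ 𝕊 3 ] p ∼ p′ → ∀ j → pt p j ≃ pt p′ j
    ∼-pt = ∼-coord {SpherePoint 3} {4} SpherePoint.coord

    pt-∼ : ∀ {p p′} → (∀ j → pt p j ≃ pt p′ j) → [ 𝕊 3 ] p ∼ p′
    pt-∼ = coord-∼ {SpherePoint 3} {4} SpherePoint.coord

    2ℝ : ℝ
    2ℝ = fromℚ ℚ2

    -- With A = q² and y = q z this is inverse stereographic projection of z / q
    -- from the north pole, in homogeneous coordinates.
    module _ (B A : ℝ) (y : Fin 3 → ℝ) where
      sphCoord : Vector ℝ 4
      sphCoord = vec₄ ((B - A) * inv (A + B)) (2ℝ * y zero * inv (A + B)) (2ℝ * y (suc zero) * inv (A + B)) (2ℝ * y (suc (suc zero)) * inv (A + B))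

      normSq : ℝ
      normSq = y zero * y zero + (y (suc zero) * y (suc zero) + y (suc (suc zero)) * y (suc (suc zero)))

      abstract
        -- Rests on (B - A)² + 4 A B = (A + B)²; the certificate combines the hypothesis on `normSq`
        -- with the defining equation of the reciprocal of A + B.
        sph-unit : fromℚ c₂ ≤ A + B → normSq ≃ A * B → sum (λ i → sphCoord i * sphCoord i) ≃ 1ℝ
        sph-unit D≥ yy = lin₂ (*-inv D≥) yy ((A + B) * inv (A + B) + 1ℝ) (fromℚ ℚ4 * (inv (A + B) * inv (A + B))) λ i →
          solve 6 (λ B A a b c I →
            ((A :+ B) :* I :+ con 1ℚ) :* ((A :+ B) :* I :- con 1ℚ) :+ (con ℚ4 :* (I :* I)) :* ((a :* a :+ (b :* b :+ c :* c)) :- A :* B)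
            := (((B :- A) :* I) :* ((B :- A) :* I) :+ ((con ℚ2 :* a :* I) :* (con ℚ2 :* a :* I) :+ ((con ℚ2 :* b :* I) :* (con ℚ2 :* b :* I) :+ ((con ℚ2 :* c :* I) :* (con ℚ2 :* c :* I) :+ con 0ℚ)))) :- con 1ℚ)
            refl (seq B i) (seq A i) (seq (y zero) i) (seq (y (suc zero)) i) (seq (y (suc (suc zero))) i) (invℚ (seq A i ℚ.+ seq B i))

      sph : fromℚ c₂ ≤ A + B → normSq ≃ A * B → SpherePoint 3
      sph D≥ yy = record { coord = sphCoord ; unit = sph-unit D≥ yy }

      abstract
        sph-eq : ∀ D≥ yy p → (B - A) ≃ (A + B) * height p → (∀ j → 2ℝ * y j ≃ (A + B) * pt p (suc j)) → [ 𝕊 3 ] sph D≥ yy ∼ p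
        sph-eq D≥ yy p h₀ h = pt-∼ {sph D≥ yy} {p} λ { zero → ratio (B - A) f0 h₀ ; (suc zero) → ratio (2ℝ * y zero) f1 (h zero)
          ; (suc (suc zero)) → ratio (2ℝ * y (suc zero)) f2 (h (suc zero)) ; (suc (suc (suc zero))) → ratio (2ℝ * y (suc (suc zero))) f3 (h (suc (suc zero))) }
          where
          ratio : ∀ n j → n ≃ (A + B) * pt p j → n * inv (A + B) ≃ pt p j
          ratio n j e = lin₂ e (*-inv D≥) (inv (A + B)) (pt p j) λ i →
            solve 4 (λ n D I x → I :* (n :- D :* x) :+ x :* (D :* I :- con 1ℚ) := n :* I :- x) refl
              (seq n i) (seq A i ℚ.+ seq B i) (invℚ (seq A i ℚ.+ seq B i)) (seq (pt p j) i)

        sph-north : ∀ D≥ yy → A ≃ 0ℝ → (∀ j → y j ≃ 0ℝ) → [ 𝕊 3 ] sph D≥ yy ∼ (northPole 3)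
        sph-north D≥ yy A≃0 y≃0 = sph-eq D≥ yy (northPole 3)
          (lin₁ A≃0 (fromℚ (ℚ.- ℚ2)) λ i → solve 2 (λ A B → con (ℚ.- ℚ2) :* (A :- con 0ℚ) := (B :- A) :- (A :+ B) :* con 1ℚ) refl (seq A i) (seq B i))
          λ j → lin₁ (y≃0 j) 2ℝ λ i → solve 3 (λ A B y → con ℚ2 :* (y :- con 0ℚ) := con ℚ2 :* y :- (A :+ B) :* con 0ℚ) refl (seq A i) (seq B i) (seq (y j) i)

    -- Homogeneous coordinates (B : A : y) matter only up to a common factor. Neither k nor k′ has
    -- to be inverted, because k′ (a + b) ≃ A′ + B′ and the reciprocal of the latter is at hand.
    sph-proportional : ∀ {B A B′ A′ : ℝ} {y y′ : Fin 3 → ℝ}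
      (D≥ : fromℚ c₂ ≤ A + B) (yy : normSq B A y ≃ A * B) (D≥′ : fromℚ c₂ ≤ A′ + B′) (yy′ : normSq B′ A′ y′ ≃ A′ * B′)
      (b a : ℝ) (v : Fin 3 → ℝ) (k k′ : ℝ) →
      B ≃ k * b → A ≃ k * a → (∀ j → y j ≃ k * v j) → B′ ≃ k′ * b → A′ ≃ k′ * a → (∀ j → y′ j ≃ k′ * v j) →
      [ 𝕊 3 ] sph B A y D≥ yy ∼ sph B′ A′ y′ D≥′ yy′
    sph-proportional {B} {A} {B′} {A′} {y} {y′} D≥ yy D≥′ yy′ b a v k k′ hB hA hy hB′ hA′ hy′ =
      sph-eq B A y D≥ yy (sph B′ A′ y′ D≥′ yy′)
        (cross (B - A) (B′ - A′) (b - a) (diff hB hA) (diff hB′ hA′))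
        λ { zero → coordinate zero ; (suc zero) → coordinate (suc zero) ; (suc (suc zero)) → coordinate (suc (suc zero)) }
      where
      D = A + B
      D′ = A′ + B′
      plus : ∀ {B A k} → B ≃ k * b → A ≃ k * a → A + B ≃ k * (a + b)
      plus {B} {A} {k} p q = ≃-trans (+-cong q p) (≐⇒≃ λ i → solve 3 (λ k a b → k :* a :+ k :* b := k :* (a :+ b)) refl (seq k i) (seq a i) (seq b i))
      diff : ∀ {B A k} → B ≃ k * b → A ≃ k * a → B - A ≃ k * (b - a)
      diff {B} {A} {k} p q = ≃-trans (+-cong p (neg-cong q)) (≐⇒≃ λ i → solve 3 (λ k a b → k :* b :- k :* a := k :* (b :- a)) refl (seq k i) (seq a i) (seq b i))
      twice : ∀ y k v → y ≃ k * v → 2ℝ * y ≃ k * (2ℝ * v)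
      twice y k v p = ≃-trans (*-cong (≃-refl {2ℝ}) p) (≐⇒≃ λ i → solve 2 (λ k v → con ℚ2 :* (k :* v) := k :* (con ℚ2 :* v)) refl (seq k i) (seq v i))
      cross : ∀ n n′ m → n ≃ k * m → n′ ≃ k′ * m → n ≃ D * (n′ * inv D′)
      cross n n′ m hn hn′ = ≃-trans hn (≃-trans (lin₁ (one′) (- (k * m)) λ i →
          solve 6 (λ k m a b k′ I → (:- (k :* m)) :* ((k′ :* (a :+ b)) :* I :- con 1ℚ) := k :* m :- (k :* (a :+ b)) :* ((k′ :* m) :* I)) refl
            (seq k i) (seq m i) (seq a i) (seq b i) (seq k′ i) (invℚ (seq A′ i ℚ.+ seq B′ i)))
        (≃-sym (*-cong (plus hB hA) (*-cong hn′ (≃-refl {inv D′})))))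
        where
        one′ : (k′ * (a + b)) * inv D′ ≃ 1ℝ
        one′ = ≃-trans (*-cong (≃-sym (plus hB′ hA′)) (≃-refl {inv D′})) (*-inv D≥′)
      coordinate : ∀ j → 2ℝ * y j ≃ D * ((2ℝ * y′ j) * inv D′)
      coordinate j = cross (2ℝ * y j) (2ℝ * y′ j) (2ℝ * v j) (twice (y j) k (v j) (hy j)) (twice (y′ j) k′ (v j) (hy′ j))

    unit₄ : ∀ p → pt p f0 * pt p f0 + (pt p f1 * pt p f1 + (pt p f2 * pt p f2 + (pt p f3 * pt p f3 + 0ℝ))) ≃ 1ℝ
    unit₄ = SpherePoint.unit

    1-height≥0 : ∀ p → 0ℝ ≤ 1ℝ - height p
    1-height≥0 p = ≤-trans (0≤* {fromℚ ½} (fromℚ-mono ℚ-le)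
        (0≤+ (0≤square (1ℝ - height p)) (0≤+ (0≤square (pt p f1)) (0≤+ (0≤square (pt p f2)) (0≤square (pt p f3))))))
      (proj₁ (lin₁ (unit₄ p) (fromℚ ½) λ i → solve 4 (λ a b c d →
        con ½ :* ((a :* a :+ (b :* b :+ (c :* c :+ (d :* d :+ con 0ℚ)))) :- con 1ℚ)
        := con ½ :* ((con 1ℚ :- a) :* (con 1ℚ :- a) :+ (b :* b :+ (c :* c :+ d :* d))) :- (con 1ℚ :- a)) refl
        (seq (pt p f0) i) (seq (pt p f1) i) (seq (pt p f2) i) (seq (pt p f3) i)))

    -- Dilation of the 3-sphere away from the south pole; at time 1 it collapses the
    -- northern hemisphere to the north pole.

    -- Cut-off in the height: 0 up to -½, and 1 from 0 on. It keeps the dilation trivial near the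
    -- south pole, where scaling A to 0 would leave all homogeneous coordinates zero.
    lam : ℝ → ℝ
    lam h = clampℝ (2ℝ * h + 1ℝ)

    lam-1 : ∀ {h} → 0ℝ ≤ h → lam h ≃ 1ℝ
    lam-1 {h} p = clampℝ-1 {2ℝ * h + 1ℝ} (0≤⇒≤ (0≤* {2ℝ} (fromℚ-mono ℚ-le) p) λ i →
      solve 1 (λ h → con ℚ2 :* h := (con ℚ2 :* h :+ con 1ℚ) :- con 1ℚ) refl (seq h i))

    lam-0 : ∀ {h} → h ≤ fromℚ (ℚ.- ½) → lam h ≃ 0ℝ
    lam-0 {h} p = clampℝ-0 {2ℝ * h + 1ℝ} (0≤⇒≤ (0≤* {2ℝ} (fromℚ-mono ℚ-le) (≤⇒0≤ p)) λ i →
      solve 1 (λ h → con ℚ2 :* (con (ℚ.- ½) :- h) := con 0ℚ :- (con ℚ2 :* h :+ con 1ℚ)) refl (seq h i))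

    mu : ℝ → ℝ → ℝ
    mu t h = 1ℝ - t * lam h

    -- A point p of height h has homogeneous coordinates (1 + h : 1 - h : p₁, p₂, p₃), since the
    -- squares of the last three add up to 1 - h². Scaling q by m multiplies A by m² and y by m, so
    -- it divides the stereographic coordinate by m; m = 0 gives the north pole.
    module Dilate (p : SpherePoint 3) (t : UnitInterval) where
      m h Bd Ad : ℝ
      m = mu (time t) (height p)
      h = height p
      Bd = 1ℝ + h
      Ad = (m * m) * (1ℝ - h)
      yd : Fin 3 → ℝ
      yd j = m * pt p (suc j)

      abstract
        -- Up to height -½ the cut-off gives m = 1 and the sum is exactly 2; above it 1 + h is
        -- already at least ½.
        D≥ : fromℚ c₂ ≤ Ad + Bd
        D≥ = by-cases h (fromℚ (ℚ.- ½)) ≤-stable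
          (λ low → ≤-trans (fromℚ-mono {c₂} {ℚ2} ℚ-le) (proj₁ (lin₂ (lam-0 {h} low) (≃-refl {0ℝ})
            (time t * (1ℝ - h) * (1ℝ + m)) 0ℝ λ i →
            solve 3 (λ t l h → t :* (con 1ℚ :- h) :* (con 1ℚ :+ (con 1ℚ :- t :* l)) :* (l :- con 0ℚ) :+ con 0ℚ :* (con 0ℚ :- con 0ℚ)
              := con ℚ2 :- (((con 1ℚ :- t :* l) :* (con 1ℚ :- t :* l)) :* (con 1ℚ :- h) :+ (con 1ℚ :+ h))) refl
              (seq (time t) i) (seq (lam h) i) (seq h i))))
          (λ high → ≤-trans (fromℚ-mono {c₂} {½} ℚ-le) (0≤⇒≤ (0≤+ (≤⇒0≤ (<⇒≤ high)) (0≤* (0≤square m) (1-height≥0 p))) λ i →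
            solve 2 (λ M h → (h :- con (ℚ.- ½)) :+ M := (M :+ (con 1ℚ :+ h)) :- con ½) refl (seq Ad i) (seq h i)))

        norm : normSq Bd Ad yd ≃ Ad * Bd
        norm = lin₁ (unit₄ p) (m * m) λ i → solve 5 (λ m a b c d →
          m :* m :* ((a :* a :+ (b :* b :+ (c :* c :+ (d :* d :+ con 0ℚ)))) :- con 1ℚ)
          := ((m :* b) :* (m :* b) :+ ((m :* c) :* (m :* c) :+ (m :* d) :* (m :* d))) :- (m :* m) :* (con 1ℚ :- a) :* (con 1ℚ :+ a)) refl
          (seq m i) (seq (pt p f0) i) (seq (pt p f1) i) (seq (pt p f2) i) (seq (pt p f3) i)

      dilate : SpherePoint 3
      dilate = sph Bd Ad yd D≥ norm

    open Dilate public using (dilate)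

    opaque
      E : SpherePoint 3 × UnitInterval → SpherePoint 3
      E (p , t) = dilate p t

    E₁ : SpherePoint 3 → SpherePoint 3
    E₁ p = E (p , 1ᴵ)

    opaque
      unfolding E

      E-proportional : ∀ {B A : ℝ} {y : Fin 3 → ℝ} (D≥ : fromℚ c₂ ≤ A + B) (yy : normSq B A y ≃ A * B) p t
        (b a : ℝ) (v : Fin 3 → ℝ) (k k′ : ℝ) → B ≃ k * b → A ≃ k * a → (∀ j → y j ≃ k * v j) →
        Dilate.Bd p t ≃ k′ * b → Dilate.Ad p t ≃ k′ * a → (∀ j → Dilate.yd p t j ≃ k′ * v j) → [ 𝕊 3 ] sph B A y D≥ yy ∼ E (p , t)
      E-proportional {B} {A} {y} D≥ yy p t = sph-proportional {B} {A} {Dilate.Bd p t} {Dilate.Ad p t} {y} {Dilate.yd p t} D≥ yy (Dilate.D≥ p t) (Dilate.norm p t)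

    Cont-sph : ∀ X {B A : ∣ X ∣ₘ → ℝ} {y : ∣ X ∣ₘ → Fin 3 → ℝ} {f : ∣ X ∣ₘ → SpherePoint 3} → (∀ x j → pt (f x) j ≡ sphCoord (B x) (A x) (y x) j) →
      Cont X B → Cont X A → (∀ j → Cont X (λ x → y x j)) → C X (𝕊 3) f
    Cont-sph X {B} {A} {y} {f} eq cB cA cy = C-into X {SpherePoint 3} {4} SpherePoint.coord λ j →
      Cont-≃ X (λ x → ≐⇒≃ λ i → cong (λ r → seq r i) (sym (eq x j))) (go j)
      where
      cI : Cont X (λ x → inv (A x + B x))
      cI = Cont-inv X (Cont-+ X cA cB)
      go : ∀ j → Cont X (λ x → sphCoord (B x) (A x) (y x) j)
      go zero = Cont-* X (Cont-- X cB cA) cI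
      go (suc zero) = Cont-* X (Cont-* X (Cont-const X 2ℝ) (cy zero)) cI
      go (suc (suc zero)) = Cont-* X (Cont-* X (Cont-const X 2ℝ) (cy (suc zero))) cI
      go (suc (suc (suc zero))) = Cont-* X (Cont-* X (Cont-const X 2ℝ) (cy (suc (suc zero)))) cI

    Cont-lam : ∀ X {f} → Cont X f → Cont X (λ x → lam (f x))
    Cont-lam X c = Cont-clampℝ X (Cont-+ X (Cont-* X (Cont-const X 2ℝ) c) (Cont-const X 1ℝ))

    opaque
      unfolding E

      C-E : C ((𝕊 3) ×ₘ 𝕀) (𝕊 3) E
      C-E = Cont-sph SI {λ pt → Dilate.Bd (proj₁ pt) (proj₂ pt)} {λ pt → Dilate.Ad (proj₁ pt) (proj₂ pt)} {λ pt → Dilate.yd (proj₁ pt) (proj₂ pt)}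
          (λ _ _ → refl) (Cont-+ SI (Cont-const SI 1ℝ) ch)
          (Cont-* SI (Cont-* SI cm cm) (Cont-- SI (Cont-const SI 1ℝ) ch)) (λ j → Cont-* SI cm (cp (suc j)))
        where
        SI : MetricSpace
        SI = (𝕊 3) ×ₘ 𝕀
        cp : ∀ j → Cont SI (λ x → pt (proj₁ x) j)
        cp j = Cont-∘ SI (𝕊 3) (Cont-pt j) (C-proj₁ (𝕊 3) 𝕀)
        ch : Cont SI (λ x → height (proj₁ x))
        ch = cp f0
        cm : Cont SI (λ x → mu (time (proj₂ x)) (height (proj₁ x)))
        cm = Cont-- SI (Cont-const SI 1ℝ) (Cont-* SI (Cont-time₂ (𝕊 3)) (Cont-lam SI ch))

    C-E₁ : C (𝕊 3) (𝕊 3) E₁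
    C-E₁ = C-∘ (𝕊 3) ((𝕊 3) ×ₘ 𝕀) (𝕊 3) C-E (C-pair (𝕊 3) (𝕊 3) 𝕀 (C-id (𝕊 3)) (C-const (𝕊 3) 𝕀 1ᴵ))

    opaque
      unfolding E

      E-north : ∀ p t → height p ≃ 1ℝ → (∀ j → pt p (suc j) ≃ 0ℝ) → [ 𝕊 3 ] E (p , t) ∼ (northPole 3)
      E-north p t h1 h0 = sph-north Bd Ad yd D≥ norm
        (lin₁ h1 (- (m * m)) λ i → solve 2 (λ m h → (:- (m :* m)) :* (h :- con 1ℚ) := (m :* m) :* (con 1ℚ :- h) :- con 0ℚ) refl (seq m i) (seq h i))
        (λ j → *-zero-≃ m (h0 j))
        where open Dilate p t

    E-fixes-north : ∀ t → [ 𝕊 3 ] E ((northPole 3) , t) ∼ (northPole 3)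
    E-fixes-north t = E-north (northPole 3) t ≃-refl λ j → ≃-refl

    E-∼north : ∀ {p} t → [ 𝕊 3 ] p ∼ (northPole 3) → [ 𝕊 3 ] E (p , t) ∼ (northPole 3)
    E-∼north {p} t e = E-north p t (∼-pt {p} {(northPole 3)} e f0) λ j → ∼-pt {p} {(northPole 3)} e (suc j)

    E₁-∼north : ∀ {p} → [ 𝕊 3 ] p ∼ (northPole 3) → [ 𝕊 3 ] E₁ p ∼ (northPole 3)
    E₁-∼north = E-∼north 1ᴵ

    opaque
      unfolding E

      E-start : ∀ p → [ 𝕊 3 ] E (p , 0ᴵ) ∼ p
      E-start p = sph-eq Bd Ad yd D≥ norm p
        (≐⇒≃ λ i → solve 2 (λ l h → (con 1ℚ :+ h) :- ((con 1ℚ :- con 0ℚ :* l) :* (con 1ℚ :- con 0ℚ :* l)) :* (con 1ℚ :- h)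
           := (((con 1ℚ :- con 0ℚ :* l) :* (con 1ℚ :- con 0ℚ :* l)) :* (con 1ℚ :- h) :+ (con 1ℚ :+ h)) :* h) refl (seq (lam h) i) (seq h i))
        λ j → ≐⇒≃ λ i → solve 3 (λ l h y → con ℚ2 :* ((con 1ℚ :- con 0ℚ :* l) :* y)
           := (((con 1ℚ :- con 0ℚ :* l) :* (con 1ℚ :- con 0ℚ :* l)) :* (con 1ℚ :- h) :+ (con 1ℚ :+ h)) :* y) refl (seq (lam h) i) (seq h i) (seq (pt p (suc j)) i)
        where open Dilate p 0ᴵ

      E₁-collapse : ∀ p → 0ℝ ≤ height p → [ 𝕊 3 ] E₁ p ∼ (northPole 3)
      E₁-collapse p h≥0 = sph-north Bd Ad yd D≥ norm
        (≃-trans (≐⇒≃ λ i → solve 2 (λ m h → (m :* m) :* (con 1ℚ :- h) := (m :* (con 1ℚ :- h)) :* m) refl (seq m i) (seq h i)) (*-zero-≃ (m * (1ℝ - h)) m≃0))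
        (λ j → ≃-trans (≐⇒≃ λ i → ℚ.*-comm (seq m i) (seq (pt p (suc j)) i)) (*-zero-≃ (pt p (suc j)) m≃0))
        where
        open Dilate p 1ᴵ
        m≃0 : m ≃ 0ℝ
        m≃0 = lin₁ (lam-1 h≥0) (fromℚ (ℚ.- 1ℚ)) λ i → solve 1 (λ l → con (ℚ.- 1ℚ) :* (l :- con 1ℚ) := (con 1ℚ :- con 1ℚ :* l) :- con 0ℚ) refl (seq (lam h) i)

    -- Maps out of and into wedges

    module WedgeMaps (ν : ℕ) (X : MetricSpace) (x₀ : ∣ X ∣ₘ) where

      inj : Fin ν → ∣ X ∣ₘ → ∣ ⋁ ν X x₀ ∣ₘ
      inj i x = just (i , x)

      dist-inj : ∀ i x x′ → dist (⋁ ν X x₀) (inj i x) (inj i x′) ≤ dist X x x′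
      dist-inj i x x′ with i Fin.≟ i
      ... | yes _ = ≤-refl
      ... | no n  = ⊥-elim (n refl)

      C-inj : ∀ i → C X (⋁ ν X x₀) (inj i)
      C-inj i = C-isometric X (⋁ ν X x₀) (dist-inj i)

      inj-base : ∀ i {x} → [ X ] x ∼ x₀ → [ ⋁ ν X x₀ ] inj i x ∼ nothing
      inj-base i (mk∼ p) = mk∼ p

      uniform : ∀ {n} {P : Fin n → ℚ → Set} → (∀ j {δ δ′} → δ′ ℚ.≤ δ → P j δ → P j δ′) →
        (∀ j → ∃[ δ ] (0ℚ ℚ.< δ × P j δ)) → ∃[ δ ] (0ℚ ℚ.< δ × (∀ j → P j δ))
      uniform {ℕ.zero}  mono h = 1ℚ , ℚ-pos , λ ()
      uniform {ℕ.suc n} mono h =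
        let (δ , δ>0 , p) = h zero
            (η , η>0 , q) = uniform (λ j → mono (suc j)) (λ j → h (suc j))
        in δ ℚ.⊓ η , ⊓-pos δ>0 η>0 , λ { zero → mono zero (ℚ.p⊓q≤p δ η) p ; (suc j) → mono (suc j) (ℚ.p⊓q≤q δ η) (q j) }

      module Out (Z Y : MetricSpace) (f : Fin ν → ∣ X ∣ₘ × ∣ Z ∣ₘ → ∣ Y ∣ₘ) (f-cont : ∀ i → C (X ×ₘ Z) Y (f i))
        (y₀ : ∣ Y ∣ₘ) (f-base : ∀ i z → [ Y ] f i (x₀ , z) ∼ y₀) where

        out : ∣ ⋁ ν X x₀ ∣ₘ × ∣ Z ∣ₘ → ∣ Y ∣ₘ
        out (nothing      , z) = y₀
        out (just (i , x) , z) = f i (x , z)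

        -- One δ has to serve all copies, because a point near the wedge point may lie in any of
        -- them; there are finitely many.
        near-base : ∀ z {ε} → 0ℚ ℚ.< ε → ∃[ δ ] (0ℚ ℚ.< δ × (∀ j x′ z′ → dist X x₀ x′ + dist Z z z′ ≤ fromℚ δ → dist Y y₀ (f j (x′ , z′)) ≤ fromℚ ε))
        near-base z {ε} ε>0 = uniform (λ j δ′≤δ h x′ z′ p → h x′ z′ (≤-trans p (fromℚ-mono δ′≤δ))) λ j →
          let (δ , δ>0 , h) = modulus (f-cont j) (x₀ , z) ε>0
          in δ , δ>0 , λ x′ z′ p → ≤-trans (d-sym Y _ _) (dist-move Y (≤-trans (d-sym Y _ _) (h (x′ , z′) p)) (f-base j z))

        drop-middle : ∀ {a b c : ℝ} → 0ℝ ≤ b → a + c ≤ (a + b) + c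
        drop-middle {a} {b} {c} b≥0 = 0≤⇒≤ b≥0 λ i → solve 3 (λ a b c → b := ((a :+ b) :+ c) :- (a :+ c)) refl (seq a i) (seq b i) (seq c i)

        drop-first : ∀ {a b c : ℝ} → 0ℝ ≤ a → b + c ≤ (a + b) + c
        drop-first {a} {b} {c} a≥0 = 0≤⇒≤ a≥0 λ i → solve 3 (λ a b c → a := ((a :+ b) :+ c) :- (b :+ c)) refl (seq a i) (seq b i) (seq c i)

        out-cont : C ((⋁ ν X x₀) ×ₘ Z) Y out
        out-cont = mkC λ { (nothing , z) ε>0 → at-base z ε>0 ; (just (i , x) , z) ε>0 → at-point i x z ε>0 }
          where
          at-base : ∀ z {ε} → 0ℚ ℚ.< ε → ∃[ δ ] (0ℚ ℚ.< δ × (∀ w → dist ((⋁ ν X x₀) ×ₘ Z) (nothing , z) w ≤ fromℚ δ → dist Y y₀ (out w) ≤ fromℚ ε))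
          at-base z {ε} ε>0 = let (δ , δ>0 , h) = near-base z ε>0 in δ , δ>0 , λ
            { (nothing , z′) p → ≤-trans (dist≤0 (∼-refl Y)) (fromℚ-mono (ℚ.<⇒≤ ε>0)) ; (just (j , x′) , z′) p → h j x′ z′ p }
          at-point : ∀ i x z {ε} → 0ℚ ℚ.< ε → ∃[ δ ] (0ℚ ℚ.< δ × (∀ w → dist ((⋁ ν X x₀) ×ₘ Z) (inj i x , z) w ≤ fromℚ δ → dist Y (f i (x , z)) (out w) ≤ fromℚ ε))
          at-point i x z {ε} ε>0 =
            let (δ , δ>0 , h) = modulus (f-cont i) (x , z) (half-pos ε>0)
                (η , η>0 , k) = near-base z (half-pos ε>0)
                ε/2≤ε : half ε ℚ.≤ ε
                ε/2≤ε = 0≤⇒≤ℚ (ℚ.<⇒≤ (half-pos ε>0)) (solve 1 (λ e → con ½ :* e := e :- con ½ :* e) refl ε)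
            in δ ℚ.⊓ η , ⊓-pos δ>0 η>0 , λ
              { (nothing , z′) p → dist-move Y (≤-trans (h (x₀ , z′) (≤-trans p (fromℚ-mono (ℚ.p⊓q≤p δ η)))) (fromℚ-mono ε/2≤ε)) (f-base i z′)
              ; (just (j , x′) , z′) p → other δ η h k ε/2≤ε j x′ z′ p }
            where
            other : ∀ δ η → (∀ xz → dist (X ×ₘ Z) (x , z) xz ≤ fromℚ δ → dist Y (f i (x , z)) (f i xz) ≤ fromℚ (half ε)) →
              (∀ j x′ z′ → dist X x₀ x′ + dist Z z z′ ≤ fromℚ η → dist Y y₀ (f j (x′ , z′)) ≤ fromℚ (half ε)) → half ε ℚ.≤ ε →
              ∀ j x′ z′ → dist ((⋁ ν X x₀) ×ₘ Z) (inj i x , z) (inj j x′ , z′) ≤ fromℚ (δ ℚ.⊓ η) → dist Y (f i (x , z)) (f j (x′ , z′)) ≤ fromℚ ε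
            other δ η h k ε/2≤ε j x′ z′ p with i Fin.≟ j
            ... | yes refl = ≤-trans (h (x′ , z′) (≤-trans p (fromℚ-mono (ℚ.p⊓q≤p δ η)))) (fromℚ-mono ε/2≤ε)
            -- Across copies the distance is that of the path through the wedge point. Each of its
            -- two legs is within its own modulus and costs ε/2.
            ... | no _ = ≤-trans (d-triangle Y _ y₀ _) (≤-trans (+-mono-≤
                  (dist-move Y (h (x₀ , z′) (≤-trans (drop-middle (d-nonNegative X x₀ x′)) (≤-trans p (fromℚ-mono (ℚ.p⊓q≤p δ η))))) (f-base i z′))
                  (k j x′ z′ (≤-trans (drop-first (d-nonNegative X x x₀)) (≤-trans p (fromℚ-mono (ℚ.p⊓q≤q δ η))))))
                (≡⇒≤ λ _ → half+half ε))

  open Spheres public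

  -- Realizations, collapses as deformations, and complexes with marked facets.

  module Realizations where

    -- Elements of V need not be vertices of the complex, since collapses also remove vertices.
    -- Stability allows a support to be identified by cases on real weights.
    record Complex (V : Set) : Set₁ where
      field
        S      : List V → Set
        closed : ∀ {σ τ} → σ ⊆ τ → S τ → S σ
        stable : ∀ {σ} → Stable (S σ)

    open Complex public

    infixl 5 _∖_
    _∖_ : ∀ {V} → Complex V → List V → Complex V
    X ∖ σ = record
      { S      = λ τ → S X τ × ¬ (σ ⊆ τ)
      ; closed = λ τ⊆ρ (s , n) → closed X τ⊆ρ s , λ σ⊆τ → n (λ x∈ → τ⊆ρ (σ⊆τ x∈))
      ; stable = λ h → stable X (λ k → h λ p → k (proj₁ p)) , λ σ⊆τ → h λ p → proj₂ p σ⊆τ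
      }

    -- A generalised elementary collapse: all simplices containing σ are removed,
    -- which is a deformation retraction when the link of σ is a cone with apex p.
    data Collapses {V : Set} : Complex V → V → Set₁ where
      done : ∀ {X v} → S X [ v ] → (∀ {τ} → S X τ → ∀ {x} → x ∈ τ → x ≡ v) → Collapses X v
      step : ∀ {X v} x σ p → Unique (x ∷ σ) → p ∉ (x ∷ σ) →
             (∀ {τ} → S X τ → (x ∷ σ) ⊆ τ → S X (p ∷ τ)) → Collapses (X ∖ (x ∷ σ)) v → Collapses X v

    -- Sums

    sumℚ : ∀ {n} → (Fin n → ℚ) → ℚ
    sumℚ {ℕ.zero}  f = 0ℚ
    sumℚ {ℕ.suc n} f = f zero ℚ.+ sumℚ (f ∘ suc)

    sumℚ-+ : ∀ {n} (f g : Fin n → ℚ) → sumℚ (λ k → f k ℚ.+ g k) ≡ sumℚ f ℚ.+ sumℚ g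
    sumℚ-+ {ℕ.zero}  f g = refl
    sumℚ-+ {ℕ.suc n} f g = trans (cong (f zero ℚ.+ g zero ℚ.+_) (sumℚ-+ (f ∘ suc) (g ∘ suc)))
      (solve 4 (λ a b c d → (a :+ b) :+ (c :+ d) := (a :+ c) :+ (b :+ d)) refl (f zero) (g zero) (sumℚ (f ∘ suc)) (sumℚ (g ∘ suc)))

    sumℚ-neg : ∀ {n} (f : Fin n → ℚ) → sumℚ (λ k → ℚ.- f k) ≡ ℚ.- sumℚ f
    sumℚ-neg {ℕ.zero}  f = refl
    sumℚ-neg {ℕ.suc n} f = trans (cong (ℚ.- f zero ℚ.+_) (sumℚ-neg (f ∘ suc)))
      (solve 2 (λ a b → :- a :+ :- b := :- (a :+ b)) refl (f zero) (sumℚ (f ∘ suc)))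

    sumℚ-0 : ∀ {n} (f : Fin n → ℚ) → (∀ k → f k ≡ 0ℚ) → sumℚ f ≡ 0ℚ
    sumℚ-0 {ℕ.zero}  f h = refl
    sumℚ-0 {ℕ.suc n} f h = trans (cong₂ ℚ._+_ (h zero) (sumℚ-0 (f ∘ suc) (h ∘ suc))) refl

    sumℚ-single : ∀ {n} (f : Fin n → ℚ) j → (∀ k → k ≢ j → f k ≡ 0ℚ) → sumℚ f ≡ f j
    sumℚ-single {ℕ.suc n} f zero    h = trans (cong (f zero ℚ.+_) (sumℚ-0 (f ∘ suc) (λ k → h (suc k) λ ()))) (ℚ.+-identityʳ (f zero))
    sumℚ-single {ℕ.suc n} f (suc j) h = trans (cong₂ ℚ._+_ (h zero λ ()) (sumℚ-single (f ∘ suc) j (λ k k≢j → h (suc k) λ { refl → k≢j refl })))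
      (ℚ.+-identityˡ (f (suc j)))

    sum-0 : ∀ {n} (f : Vector ℝ n) → (∀ k → f k ≃ 0ℝ) → sum f ≃ 0ℝ
    sum-0 {ℕ.zero}  f h = ≃-refl
    sum-0 {ℕ.suc n} f h = ≃-trans (+-cong (h zero) (sum-0 (f ∘ suc) (h ∘ suc))) 0+0≃0

    sum-single : ∀ {n} (f : Vector ℝ n) j → (∀ k → k ≢ j → f k ≃ 0ℝ) → sum f ≃ f j
    sum-single {ℕ.suc n} f zero    h = ≃-trans (+-cong (≃-refl {f zero}) (sum-0 (f ∘ suc) (λ k → h (suc k) λ ())))
      (≐⇒≃ λ i → ℚ.+-identityʳ (seq (f zero) i))
    sum-single {ℕ.suc n} f (suc j) h = ≃-trans (+-cong (h zero λ ()) (sum-single (f ∘ suc) j (λ k k≢j → h (suc k) λ { refl → k≢j refl })))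
      (≐⇒≃ λ i → ℚ.+-identityˡ (seq (f (suc j)) i))

    sum-cong : ∀ {n} (f g : Vector ℝ n) → (∀ k → f k ≃ g k) → sum f ≃ sum g
    sum-cong {ℕ.zero}  f g h = ≃-refl
    sum-cong {ℕ.suc n} f g h = +-cong (h zero) (sum-cong (f ∘ suc) (g ∘ suc) (h ∘ suc))

    sum-linear : ∀ {n} (f : Vector ℝ n) (c : Fin n → ℚ) m → sum (λ k → f k + fromℚ (c k) * m) ≐ (sum f + fromℚ (sumℚ c) * m)
    sum-linear {ℕ.zero}  f c m i = solve 1 (λ m → con 0ℚ := con 0ℚ :+ con 0ℚ :* m) refl (seq m i)
    sum-linear {ℕ.suc n} f c m i = trans (cong ((seq (f zero) i ℚ.+ c zero ℚ.* seq m i) ℚ.+_) (sum-linear (f ∘ suc) (c ∘ suc) m i))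
      (solve 5 (λ a c m s d → (a :+ c :* m) :+ (s :+ d :* m) := (a :+ s) :+ (c :+ d) :* m) refl
        (seq (f zero) i) (c zero) (seq m i) (seq (sum (f ∘ suc)) i) (sumℚ (c ∘ suc)))

    sum-fromℚ : ∀ {n} (c : Fin n → ℚ) → sum (λ k → fromℚ (c k)) ≐ fromℚ (sumℚ c)
    sum-fromℚ {ℕ.zero}  c i = refl
    sum-fromℚ {ℕ.suc n} c i = cong (c zero ℚ.+_) (sum-fromℚ (c ∘ suc) i)

    -- Linear combinations

    lincomb : ∀ {n} → ℝ → (Fin n → ℚ) → (Fin n → ℝ) → ℝ
    lincomb {ℕ.zero}  b c l = b
    lincomb {ℕ.suc n} b c l = lincomb b (c ∘ suc) (l ∘ suc) + fromℚ (c zero) * l zero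

    lincomb-0 : ∀ {n} b (c : Fin n → ℚ) (l : Fin n → ℝ) → (∀ i → l i ≃ 0ℝ) → lincomb b c l ≃ b
    lincomb-0 {ℕ.zero}  b c l h = ≃-refl
    lincomb-0 {ℕ.suc n} b c l h = ≃-trans (+-cong (lincomb-0 b (c ∘ suc) (l ∘ suc) (h ∘ suc)) (*-zero-≃ (fromℚ (c zero)) (h zero)))
      (≐⇒≃ λ i → ℚ.+-identityʳ (seq b i))

    lincomb-00 : ∀ {n} b (c : Fin n → ℚ) (l : Fin n → ℝ) → (∀ i → fromℚ (c i) * l i ≃ 0ℝ) → lincomb b c l ≃ b
    lincomb-00 {ℕ.zero}  b c l h = ≃-refl
    lincomb-00 {ℕ.suc n} b c l h = ≃-trans (+-cong (lincomb-00 b (c ∘ suc) (l ∘ suc) (h ∘ suc)) (h zero))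
      (≐⇒≃ λ i → ℚ.+-identityʳ (seq b i))

    lincomb-1 : ∀ {n} b (c : Fin n → ℚ) (l : Fin n → ℝ) i → (∀ j → j ≢ i → fromℚ (c j) * l j ≃ 0ℝ) → lincomb b c l ≃ b + fromℚ (c i) * l i
    lincomb-1 {ℕ.suc n} b c l zero    h = +-cong (lincomb-00 b (c ∘ suc) (l ∘ suc) (λ j → h (suc j) λ ())) (≃-refl {fromℚ (c zero) * l zero})
    lincomb-1 {ℕ.suc n} b c l (suc i) h = ≃-trans (+-cong (lincomb-1 b (c ∘ suc) (l ∘ suc) i (λ j n → h (suc j) λ { refl → n refl })) (h zero λ ()))
      (≐⇒≃ λ k → ℚ.+-identityʳ (seq (b + fromℚ (c (suc i)) * l (suc i)) k))

    lincomb-sum : ∀ {n m} (f : Vector ℝ m) (c : Fin m → Fin n → ℚ) (l : Fin n → ℝ) →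
      sum (λ k → lincomb (f k) (c k) l) ≐ lincomb (sum f) (λ i → sumℚ (λ k → c k i)) l
    lincomb-sum {ℕ.zero}  f c l i = refl
    lincomb-sum {ℕ.suc n} f c l i = trans (sum-linear (λ k → lincomb (f k) (c k ∘ suc) (l ∘ suc)) (λ k → c k zero) (l zero) i)
      (cong (ℚ._+ sumℚ (λ k → c k zero) ℚ.* seq (l zero) i) (lincomb-sum f (λ k → c k ∘ suc) (l ∘ suc) i))

    lincomb-≃ : ∀ {n} {b b′} (c c′ : Fin n → ℚ) (l : Fin n → ℝ) → b ≃ b′ → (∀ i → c i ≡ c′ i) → lincomb b c l ≃ lincomb b′ c′ l
    lincomb-≃ {ℕ.zero}  c c′ l h e = h
    lincomb-≃ {ℕ.suc n} c c′ l h e = +-cong (lincomb-≃ (c ∘ suc) (c′ ∘ suc) (l ∘ suc) h (e ∘ suc))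
      (≐⇒≃ λ i → cong (ℚ._* seq (l zero) i) (e zero))

    lincomb≤ : ∀ {n} b (c : Fin n → ℚ) (l : Fin n → ℝ) → (∀ i → 0ℚ ℚ.≤ ℚ.- c i) → (∀ i → 0ℝ ≤ l i) → lincomb b c l ≤ b
    lincomb≤ {ℕ.zero}  b c l p q = ≤-refl
    lincomb≤ {ℕ.suc n} b c l p q = ≤-trans (0≤⇒≤ (0≤* (fromℚ-mono (p zero)) (q zero)) λ i →
        solve 3 (λ s c l → (:- c) :* l := s :- (s :+ c :* l)) refl (seq (lincomb b (c ∘ suc) (l ∘ suc)) i) (c zero) (seq (l zero) i))
      (lincomb≤ b (c ∘ suc) (l ∘ suc) (p ∘ suc) (q ∘ suc))

    lincomb≥0 : ∀ {n} (c : Fin n → ℚ) (l : Fin n → ℝ) → (∀ i → 0ℚ ℚ.≤ c i) → (∀ i → 0ℝ ≤ l i) → 0ℝ ≤ lincomb 0ℝ c l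
    lincomb≥0 {ℕ.zero}  c l p q = ≤-refl
    lincomb≥0 {ℕ.suc n} c l p q = 0≤+ (lincomb≥0 (c ∘ suc) (l ∘ suc) (p ∘ suc) (q ∘ suc)) (0≤* (fromℚ-mono (p zero)) (q zero))

    Cont-lincomb : ∀ X {n} {b : ∣ X ∣ₘ → ℝ} (c : Fin n → ℚ) {l : ∣ X ∣ₘ → Fin n → ℝ} → Cont X b → (∀ i → Cont X (λ x → l x i)) →
      Cont X (λ x → lincomb (b x) c (l x))
    Cont-lincomb X {ℕ.zero}  c cb cl = cb
    Cont-lincomb X {ℕ.suc n} c cb cl = Cont-+ X (Cont-lincomb X (c ∘ suc) cb (cl ∘ suc)) (Cont-* X (Cont-const X _) (cl zero))

    sum-+ : ∀ {n} (f g : Vector ℝ n) → sum (λ k → f k + g k) ≐ (sum f + sum g)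
    sum-+ {ℕ.zero}  f g i = refl
    sum-+ {ℕ.suc n} f g i = trans (cong (seq (f zero) i ℚ.+ seq (g zero) i ℚ.+_) (sum-+ (f ∘ suc) (g ∘ suc) i))
      (solve 4 (λ a b c d → (a :+ b) :+ (c :+ d) := (a :+ c) :+ (b :+ d)) refl (seq (f zero) i) (seq (g zero) i) (seq (sum (f ∘ suc)) i) (seq (sum (g ∘ suc)) i))

    -- The empty minimum is 1, the greatest height on the sphere, so that a complex without marked
    -- facets counts as high everywhere.
    minF : ∀ {n} → (Fin n → ℝ) → ℝ
    minF {ℕ.zero}  f = 1ℝ
    minF {ℕ.suc n} f = f zero ⊓ minF (f ∘ suc)

    minF≤ : ∀ {n} (f : Fin n → ℝ) i → minF f ≤ f i
    minF≤ {ℕ.suc n} f zero    = ⊓≤ˡ (f zero) (minF (f ∘ suc))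
    minF≤ {ℕ.suc n} f (suc i) = ≤-trans (⊓≤ʳ (f zero) (minF (f ∘ suc))) (minF≤ (f ∘ suc) i)

    minF-glb : ∀ {n} (f : Fin n → ℝ) {z} → z ≤ 1ℝ → (∀ i → z ≤ f i) → z ≤ minF f
    minF-glb {ℕ.zero}  f p h = p
    minF-glb {ℕ.suc n} f p h = ⊓-glb (h zero) (minF-glb (f ∘ suc) p (h ∘ suc))

    minF-glb-< : ∀ {n} (f : Fin n → ℝ) {z} → z < 1ℝ → (∀ i → z < f i) → z < minF f
    minF-glb-< {ℕ.zero}  f p h = p
    minF-glb-< {ℕ.suc n} f p h = ⊓-glb-< (h zero) (minF-glb-< (f ∘ suc) p (h ∘ suc))

    Cont-minF : ∀ X {n} {f : ∣ X ∣ₘ → Fin n → ℝ} → (∀ i → Cont X (λ x → f x i)) → Cont X (λ x → minF (f x))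
    Cont-minF X {ℕ.zero}  h = Cont-const X 1ℝ
    Cont-minF X {ℕ.suc n} h = Cont-⊓ X (h zero) (Cont-minF X (h ∘ suc))

    inv≤ : ∀ x → inv x ≤ fromℚ ℚ100
    inv≤ x = pointwise-≤ λ i → invℚ-≤ (seq x i)

    scale-pos : ∀ {x} → 0ℝ < fromℚ ℚ100 * x → 0ℝ < x
    scale-pos {x} p = let (q , q>0 , h) = <⇒gap p
                          (r , r>0 , eq) = quotientℚ {q} {ℚ100} q>0 ℚ-pos
      in gap⇒< {q = r} r>0 (0≤⇒≤ (0≤* {fromℚ (+ 1 ℚ./ 100)} (fromℚ-mono ℚ-le) (≤⇒0≤ h)) λ i →
           trans (cong (λ z → (+ 1 ℚ./ 100) ℚ.* ((ℚ100 ℚ.* seq x i) ℚ.- (0ℚ ℚ.+ z))) (sym eq))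
            (solve 2 (λ x r → con (+ 1 ℚ./ 100) :* ((con ℚ100 :* x) :- (con 0ℚ :+ con ℚ100 :* r)) := x :- (con 0ℚ :+ r)) refl (seq x i) r))

    unit-product≤ : ∀ {s t x} → 0ℝ ≤ s → s ≤ 1ℝ → 0ℝ ≤ x → t ≤ x → s * t ≤ x
    unit-product≤ {s} {t} {x} s≥0 s≤1 x≥0 t≤x = 0≤⇒≤ (0≤+ (0≤* s≥0 (≤⇒0≤ t≤x)) (0≤* (≤⇒0≤ s≤1) x≥0)) λ i →
      solve 3 (λ s t x → s :* (x :- t) :+ (con 1ℚ :- s) :* x := x :- s :* t) refl (seq s i) (seq t i) (seq x i)

    search : ∀ {n} {P Q : Fin n → Set} → (∀ i → P i ⊎ Q i) → (∀ i → P i) ⊎ Σ (Fin n) Q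
    search {ℕ.zero}  d = inj₁ λ ()
    search {ℕ.suc n} d with d zero
    ... | inj₂ q = inj₂ (zero , q)
    ... | inj₁ p with search (λ i → d (suc i))
    ...   | inj₁ ps = inj₁ λ { zero → p ; (suc i) → ps i }
    ...   | inj₂ (i , q) = inj₂ (suc i , q)

    -- Realizations

    module Realization {V : Set} {N : ℕ} (enum : Fin N ↔ V) (_≟_ : DecidableEquality V) where

      vertex : Fin N → V
      vertex = Inverse.to enum

      index : V → Fin N
      index = Inverse.from enum

      vertex-index : ∀ v → vertex (index v) ≡ v
      vertex-index v = Inverse.inverseˡ enum refl

      record Pt (X : Complex V) : Set where
        constructor mkPt
        field
          weight  : V → ℝ
          nonNeg  : ∀ v → 0ℝ ≤ weight v
          total   : sum (λ k → weight (vertex k)) ≃ 1ℝ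
          support : ∀ σ → (∀ {v} → v ∈ σ → 0ℝ < weight v) → S X σ

      open Pt public

      ⟦_⟧ : Complex V → MetricSpace
      ⟦ X ⟧ = subspace {Pt X} {N} (λ t k → weight t (vertex k))

      Cont-weight : ∀ X v → Cont ⟦ X ⟧ (λ t → weight t v)
      Cont-weight X v = subst (λ u → Cont ⟦ X ⟧ (λ t → weight t u)) (vertex-index v)
        (Cont-coord {Pt X} {N} (λ t k → weight t (vertex k)) (index v))

      C-weights : ∀ Z X {f : ∣ Z ∣ₘ → Pt X} → (∀ v → Cont Z (λ z → weight (f z) v)) → C Z ⟦ X ⟧ f
      C-weights Z X h = C-into Z {Pt X} {N} (λ t k → weight t (vertex k)) (λ k → h (vertex k))

      weight-∼ : ∀ X {a b : Pt X} → (∀ v → weight a v ≃ weight b v) → [ ⟦ X ⟧ ] a ∼ b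
      weight-∼ X {a} {b} h = coord-∼ {Pt X} {N} (λ t k → weight t (vertex k)) (λ k → h (vertex k))

      incl : ∀ {X Y} → (∀ {σ} → S X σ → S Y σ) → Pt X → Pt Y
      incl h a = mkPt (weight a) (nonNeg a) (total a) (λ σ p → h (support a σ p))

      C-incl : ∀ X Y (h : ∀ {σ} → S X σ → S Y σ) → C ⟦ X ⟧ ⟦ Y ⟧ (incl {X} {Y} h)
      C-incl X Y h = C-weights ⟦ X ⟧ Y (Cont-weight X)

      abstract
        weight≤1 : ∀ {X} (a : Pt X) v → weight a v ≤ 1ℝ
        weight≤1 a v = ≤-trans (subst (λ u → weight a u ≤ sum (λ k → weight a (vertex k))) (vertex-index v)
          (proj₂ (≤sum (λ k → weight a (vertex k)) (λ k → nonNeg a (vertex k))) (index v))) (proj₁ (total a))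

      ind : V → V → ℚ
      ind x y with y ≟ x
      ... | yes _ = 1ℚ
      ... | no _  = 0ℚ

      ind-≡ : ∀ x → ind x x ≡ 1ℚ
      ind-≡ x with x ≟ x
      ... | yes _ = refl
      ... | no n  = ⊥-elim (n refl)

      ind-≢ : ∀ {x y} → y ≢ x → ind x y ≡ 0ℚ
      ind-≢ {x} {y} n with y ≟ x
      ... | yes e = ⊥-elim (n e)
      ... | no _  = refl

      ind≥0 : ∀ x y → 0ℚ ℚ.≤ ind x y
      ind≥0 x y with y ≟ x
      ... | yes _ = ℚ-le
      ... | no _  = ℚ-le

      sum-ind : ∀ x → sumℚ (λ k → ind x (vertex k)) ≡ 1ℚ
      sum-ind x = trans (sumℚ-single (λ k → ind x (vertex k)) (index x)
          (λ k k≢ → ind-≢ λ e → k≢ (trans (sym (Inverse.strictlyInverseʳ enum k)) (cong index e))))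
        (trans (cong (ind x) (vertex-index x)) (ind-≡ x))

      abstract
        vtx-support : ∀ X v → S X [ v ] → ∀ σ → (∀ {x} → x ∈ σ → 0ℝ < fromℚ (ind v x)) → S X σ
        vtx-support X v s σ h = closed X σ⊆ s
          where
          σ⊆ : σ ⊆ [ v ]
          σ⊆ {x} x∈ with x ≟ v
          ... | yes e = here e
          ... | no n  = ⊥-elim (<-irrefl (h x∈) (≡⇒≤ λ _ → ind-≢ n))

        vtx-total : ∀ v → sum (λ k → fromℚ (ind v (vertex k))) ≃ 1ℝ
        vtx-total v = ≐⇒≃ λ i → trans (sum-fromℚ (λ k → ind v (vertex k)) i) (sum-ind v)

        vtx-nonNeg : ∀ v x → 0ℝ ≤ fromℚ (ind v x)
        vtx-nonNeg v x = fromℚ-mono (ind≥0 v x)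

      vtx : ∀ X v → S X [ v ] → Pt X
      vtx X v s = mkPt (λ x → fromℚ (ind v x)) (vtx-nonNeg v) (vtx-total v) (vtx-support X v s)

      Contractible : Complex V → V → Set
      Contractible X v = Σ (S X [ v ]) λ s → Htpy ⟦ X ⟧ ⟦ X ⟧ id (λ _ → vtx X v s)

      only-vertex : ∀ X v (s : S X [ v ]) → (∀ {τ} → S X τ → ∀ {x} → x ∈ τ → x ≡ v) → ∀ a → [ ⟦ X ⟧ ] a ∼ vtx X v s
      only-vertex X v s h a = weight-∼ X eq
        where
        zero-off : ∀ x → x ≢ v → weight a x ≃ 0ℝ
        zero-off x n = ≮⇒≥ (λ p → n (h (support a [ x ] λ { (here refl) → p }) (here refl))) , nonNeg a x
        one-at : weight a v ≃ 1ℝ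
        one-at = ≃-trans (≃-sym (subst (λ u → sum (λ k → weight a (vertex k)) ≃ weight a u) (vertex-index v)
            (sum-single (λ k → weight a (vertex k)) (index v) λ k n → zero-off (vertex k)
              λ e → n (trans (sym (Inverse.strictlyInverseʳ enum k)) (cong index e))))) (total a)
        eq : ∀ x → weight a x ≃ fromℚ (ind v x)
        eq x with x ≟ v
        ... | yes refl = one-at
        ... | no n     = zero-off x n

      low : ℝ → (V → ℝ) → List V → ℝ
      low t w []      = t
      low t w (x ∷ σ) = w x ⊓ low t w σ

      low≤t : ∀ t w σ → low t w σ ≤ t
      low≤t t w []      = ≤-refl
      low≤t t w (x ∷ σ) = ≤-trans (⊓≤ʳ (w x) (low t w σ)) (low≤t t w σ)

      low≤ : ∀ t w {σ x} → x ∈ σ → low t w σ ≤ w x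
      low≤ t w {y ∷ σ} (here refl) = ⊓≤ˡ (w y) (low t w σ)
      low≤ t w {y ∷ σ} (there x∈)  = ≤-trans (⊓≤ʳ (w y) (low t w σ)) (low≤ t w x∈)

      low≥0 : ∀ t w σ → 0ℝ ≤ t → (∀ x → 0ℝ ≤ w x) → 0ℝ ≤ low t w σ
      low≥0 t w []      p q = p
      low≥0 t w (x ∷ σ) p q = ⊓-glb (q x) (low≥0 t w σ p q)

      low-> : ∀ t w σ {z} → z < t → (∀ {x} → x ∈ σ → z < w x) → z < low t w σ
      low-> t w []      p q = p
      low-> t w (x ∷ σ) p q = ⊓-glb-< (q (here refl)) (low-> t w σ p (λ x∈ → q (there x∈)))

      Cont-low : ∀ Z {t : ∣ Z ∣ₘ → ℝ} {w : ∣ Z ∣ₘ → V → ℝ} → Cont Z t → (∀ v → Cont Z (λ z → w z v)) →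
        ∀ σ → Cont Z (λ z → low (t z) (w z) σ)
      Cont-low Z ct cw []      = ct
      Cont-low Z ct cw (x ∷ σ) = Cont-⊓ Z (cw x) (Cont-low Z ct cw σ)

      -- For σ without repetitions and p outside it: the length of σ at p, -1 on σ, 0 elsewhere.
      -- This is the direction, of total 0, that moves weight equally from the vertices of σ to p.
      coef : V → List V → V → ℚ
      coef p []      y = 0ℚ
      coef p (x ∷ σ) y = (ind p y ℚ.- ind x y) ℚ.+ coef p σ y

      sum-coef : ∀ p σ → sumℚ (λ k → coef p σ (vertex k)) ≡ 0ℚ
      sum-coef p []      = sumℚ-0 {N} (λ _ → 0ℚ) (λ _ → refl)
      sum-coef p (x ∷ σ) = trans (sumℚ-+ (λ k → ind p (vertex k) ℚ.- ind x (vertex k)) (λ k → coef p σ (vertex k)))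
        (trans (cong₂ ℚ._+_ (trans (sumℚ-+ (λ k → ind p (vertex k)) (λ k → ℚ.- ind x (vertex k)))
          (cong₂ ℚ._+_ (sum-ind p) (trans (sumℚ-neg (λ k → ind x (vertex k))) (cong ℚ.-_ (sum-ind x))))) (sum-coef p σ)) refl)

      coef-off : ∀ p σ {y} → y ≢ p → y ∉ σ → coef p σ y ≡ 0ℚ
      coef-off p []      n m = refl
      coef-off p (x ∷ σ) n m = trans (cong₂ ℚ._+_ (cong₂ ℚ._-_ (ind-≢ n) (ind-≢ λ { refl → m (here refl) })) (coef-off p σ n (λ z → m (there z)))) refl

      coef-apex : ∀ p σ → p ∉ σ → 0ℚ ℚ.≤ coef p σ p
      coef-apex p []      m = ℚ-le
      coef-apex p (x ∷ σ) m = 0≤+ℚ (subst (0ℚ ℚ.≤_) (sym (cong₂ ℚ._-_ (ind-≡ p) (ind-≢ {x} {p} λ { refl → m (here refl) }))) ℚ-le)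
        (coef-apex p σ (λ z → m (there z)))

      coef-in : ∀ p σ {y} → Unique σ → p ∉ σ → y ∈ σ → coef p σ y ≡ ℚ.- 1ℚ
      coef-in p (x ∷ σ) {y} (u ∷ us) m (here refl) = trans (cong₂ ℚ._+_ (cong₂ ℚ._-_ (ind-≢ {p} {y} λ { refl → m (here refl) }) (ind-≡ y))
        (coef-off p σ (λ { refl → m (here refl) }) (λ y∈ → All.lookup u y∈ refl))) refl
      coef-in p (x ∷ σ) {y} (u ∷ us) m (there y∈) = trans (cong₂ ℚ._+_ (cong₂ ℚ._-_ (ind-≢ {p} {y} λ { refl → m (there y∈) })
        (ind-≢ {x} {y} λ { refl → All.lookup u y∈ refl })) (coef-in p σ us (λ z → m (there z)) y∈)) refl

      -- All vertices of σ give weight to the apex p at the same rate until one of them is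
      -- exhausted. The amount given, the minimum of the time and the weights on σ, is a continuous
      -- formula, and it is 0 on points already in the smaller complex.
      module Step (X : Complex V) (x₀ : V) (σ₀ : List V) (p : V) (uniq : Unique (x₀ ∷ σ₀)) (p∉ : p ∉ (x₀ ∷ σ₀))
        (cone : ∀ {τ} → S X τ → (x₀ ∷ σ₀) ⊆ τ → S X (p ∷ τ)) where

        open import Data.List.Membership.DecPropositional _≟_ using (_∈?_)

        σ : List V
        σ = x₀ ∷ σ₀

        moved : Pt X → UnitInterval → ℝ
        moved a t = low (time t) (weight a) σ

        shift : Pt X → UnitInterval → V → ℝ
        shift a t y = weight a y + fromℚ (coef p σ y) * moved a t

        abstract
          moved≥0 : ∀ a t → 0ℝ ≤ moved a t
          moved≥0 a t = low≥0 (time t) (weight a) σ (UnitInterval.lower t) (nonNeg a)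

          shift-in : ∀ a t {y} → y ∈ σ → shift a t y ≐ (weight a y - moved a t)
          shift-in a t {y} y∈ i = trans (cong (λ c → seq (weight a y) i ℚ.+ c ℚ.* seq (moved a t) i) (coef-in p σ uniq p∉ y∈))
            (solve 2 (λ a m → a :+ con (ℚ.- 1ℚ) :* m := a :- m) refl (seq (weight a y) i) (seq (moved a t) i))

          shift≤ : ∀ a t {y} → y ≢ p → shift a t y ≤ weight a y
          shift≤ a t {y} y≢p with y ∈? σ
          ... | yes y∈ = ≤-trans {y = weight a y - moved a t} (≡⇒≤ (shift-in a t y∈)) (0≤⇒≤ (moved≥0 a t)
            λ i → solve 2 (λ a m → m := a :- (a :- m)) refl (seq (weight a y) i) (seq (moved a t) i))
          ... | no y∉ = ≡⇒≤ λ i → trans (cong (λ c → seq (weight a y) i ℚ.+ c ℚ.* seq (moved a t) i) (coef-off p σ y≢p y∉))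
            (solve 2 (λ a m → a :+ con 0ℚ :* m := a) refl (seq (weight a y) i) (seq (moved a t) i))

          shift-nonNeg : ∀ a t y → 0ℝ ≤ shift a t y
          shift-nonNeg a t y = go (y ∈? σ) (y ≟ p)
            where
            go : Dec (y ∈ σ) → Dec (y ≡ p) → 0ℝ ≤ shift a t y
            go (yes y∈) _ = ≤-trans (≤⇒0≤ (low≤ (time t) (weight a) y∈)) (≡⇒≤ λ i → sym (shift-in a t y∈ i))
            go (no y∉) (yes refl) = 0≤+ (nonNeg a y) (0≤* (fromℚ-mono (coef-apex p σ p∉)) (moved≥0 a t))
            go (no y∉) (no n) = 0≤+ (nonNeg a y) (0≤* (fromℚ-mono (ℚ.≤-reflexive (sym (coef-off p σ n y∉)))) (moved≥0 a t))

          shift-total : ∀ a t → sum (λ k → shift a t (vertex k)) ≃ 1ℝ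
          shift-total a t = ≃-trans (≐⇒≃ λ i → trans (sum-linear (λ k → weight a (vertex k)) (λ k → coef p σ (vertex k)) (moved a t) i)
            (trans (cong (λ c → seq (sum (λ k → weight a (vertex k))) i ℚ.+ c ℚ.* seq (moved a t) i) (sum-coef p σ))
              (solve 2 (λ a m → a :+ con 0ℚ :* m := a) refl (seq (sum (λ k → weight a (vertex k))) i) (seq (moved a t) i)))) (total a)

          -- If nothing moves, the support is unchanged. If something moves, all of σ has positive
          -- weight, so the old support together with σ is a simplex, and the cone condition allows
          -- p to be joined to it.
          shift-support : ∀ a t τ → (∀ {v} → v ∈ τ → 0ℝ < shift a t v) → S X τ
          shift-support a t τ h = by-cases (moved a t) 0ℝ (stable X)
            (λ m≤0 → support a τ λ {v} v∈ → <-≤-trans (h v∈) (proj₁ (≃-trans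
              (+-cong (≃-refl {weight a v}) (*-zero-≃ (fromℚ (coef p σ v)) (m≤0 , moved≥0 a t)))
              (≐⇒≃ λ i → ℚ.+-identityʳ (seq (weight a v) i)))))
            (λ 0<m → closed X τ⊆ (cone (support a ρ (pos 0<m)) ∈-++⁺ˡ))
            where
            ρ : List V
            ρ = σ ++ filter (λ v → ¬? (v ≟ p)) τ
            pos : 0ℝ < moved a t → ∀ {v} → v ∈ ρ → 0ℝ < weight a v
            pos 0<m v∈ with ∈-++⁻ σ v∈
            ... | inj₁ v∈σ = <-≤-trans 0<m (low≤ (time t) (weight a) v∈σ)
            ... | inj₂ v∈τ = let (v∈ , v≢p) = ∈-filter⁻ (λ v → ¬? (v ≟ p)) v∈τ in <-≤-trans (h v∈) (shift≤ a t v≢p)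
            τ⊆ : τ ⊆ (p ∷ ρ)
            τ⊆ {v} v∈ with v ≟ p
            ... | yes e = here e
            ... | no n  = there (∈-++⁺ʳ σ (∈-filter⁺ (λ v → ¬? (v ≟ p)) v∈ n))

          -- If all of σ kept positive weight at time 1, the amount moved would be strictly below
          -- every entry of the minimum that defines it. For the entry 1 this uses the vertex x₀,
          -- whose weight is at most 1.
          shift-avoids : ∀ a τ → (∀ {v} → v ∈ τ → 0ℝ < shift a 1ᴵ v) → ¬ (σ ⊆ τ)
          shift-avoids a τ h σ⊆ = <-irrefl (low-> (time 1ᴵ) (weight a) σ
              (<-≤-trans (m< (here refl)) (weight≤1 a x₀)) m<) ≤-refl
            where
            m< : ∀ {v} → v ∈ σ → moved a 1ᴵ < weight a v
            m< {v} v∈ = let (q , q>0 , r) = <⇒gap (h (σ⊆ v∈)) in gap⇒< q>0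
              (0≤⇒≤ (≤⇒0≤ (≤-trans {z = weight a v - moved a 1ᴵ} r (≡⇒≤ (shift-in a 1ᴵ v∈)))) λ i →
                solve 3 (λ q a m → (a :- m) :- (con 0ℚ :+ q) := a :- (m :+ q)) refl q (seq (weight a v) i) (seq (moved a 1ᴵ) i))

        push : Pt X × UnitInterval → Pt X
        push (a , t) = mkPt (shift a t) (shift-nonNeg a t) (shift-total a t) (shift-support a t)

        retract : Pt X → Pt (X ∖ σ)
        retract a = mkPt (shift a 1ᴵ) (shift-nonNeg a 1ᴵ) (shift-total a 1ᴵ) (λ τ h → shift-support a 1ᴵ τ h , shift-avoids a τ h)

        Cont-shift : ∀ v → Cont (⟦ X ⟧ ×ₘ 𝕀) (λ at → shift (proj₁ at) (proj₂ at) v)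
        Cont-shift v = Cont-+ XI (w v) (Cont-* XI (Cont-const XI _) (Cont-low XI (Cont-time₂ ⟦ X ⟧) w σ))
          where
          XI = ⟦ X ⟧ ×ₘ 𝕀
          w : ∀ v → Cont XI (λ at → weight (proj₁ at) v)
          w v = Cont-∘ XI ⟦ X ⟧ (Cont-weight X v) (C-proj₁ ⟦ X ⟧ 𝕀)

        C-push : C (⟦ X ⟧ ×ₘ 𝕀) ⟦ X ⟧ push
        C-push = C-weights (⟦ X ⟧ ×ₘ 𝕀) X Cont-shift

        C-retract : C ⟦ X ⟧ ⟦ X ∖ σ ⟧ retract
        C-retract = C-weights ⟦ X ⟧ (X ∖ σ) λ v → Cont-+ ⟦ X ⟧ (Cont-weight X v)
          (Cont-* ⟦ X ⟧ (Cont-const ⟦ X ⟧ _) (Cont-low ⟦ X ⟧ (Cont-const ⟦ X ⟧ (time 1ᴵ)) (Cont-weight X) σ))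

        deformation : Htpy ⟦ X ⟧ ⟦ X ⟧ id (λ a → incl {X ∖ σ} {X} proj₁ (retract a))
        deformation = record
          { H = push ; H-cont = C-push
          ; start = λ a → weight-∼ X λ v → ≃-trans
              (+-cong (≃-refl {weight a v}) (*-zero-≃ (fromℚ (coef p σ v)) (low≤t (time 0ᴵ) (weight a) σ , moved≥0 a 0ᴵ)))
              (≐⇒≃ λ i → ℚ.+-identityʳ (seq (weight a v) i))
          ; end = λ a → weight-∼ X λ v → ≃-refl }

      collapses⇒contractible : ∀ {X v} → Collapses X v → Contractible X v
      collapses⇒contractible {X} {v} (done s h) = s , record
        { H = proj₁ ; H-cont = C-proj₁ ⟦ X ⟧ 𝕀 ; start = λ a → ∼-refl ⟦ X ⟧ ; end = only-vertex X v s h }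
      collapses⇒contractible {X} {v} (step x σ p u p∉ cone c) =
        let (s , h) = collapses⇒contractible c in proj₁ s ,
          htpy-cong ⟦ X ⟧ ⟦ X ⟧ (λ _ → ∼-refl ⟦ X ⟧) (λ _ → weight-∼ X λ _ → ≃-refl)
            (htpy-trans ⟦ X ⟧ ⟦ X ⟧ deformation
              (htpy-post ⟦ X ⟧ ⟦ X ∖ (x ∷ σ) ⟧ ⟦ X ⟧ (htpy-pre ⟦ X ⟧ ⟦ X ∖ (x ∷ σ) ⟧ ⟦ X ∖ (x ∷ σ) ⟧ h C-retract)
                (C-incl (X ∖ (x ∷ σ)) X proj₁)))
        where open Step X x σ p u p∉ cone using (deformation; C-retract)

      -- Marked tetrahedra and the subcomplex avoiding them.

      module Facets (K : Complex V) (ν : ℕ) (F : Fin ν → Fin 4 → V)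
        (F-inj : ∀ i {j k} → F i j ≡ F i k → j ≡ k) where

        facet : Fin ν → List V
        facet i = F i f0 ∷ F i f1 ∷ F i f2 ∷ F i f3 ∷ []

        L : Complex V
        L = record
          { S = λ σ → S K σ × (∀ i → ¬ (facet i ⊆ σ))
          ; closed = λ σ⊆τ (s , n) → closed K σ⊆τ s , λ i f⊆ → n i (λ x → σ⊆τ (f⊆ x))
          ; stable = λ h → stable K (λ k → h λ p → k (proj₁ p)) , λ i f⊆ → h λ p → proj₂ p i f⊆ }

        facet-unique : ∀ i → Unique (facet i)
        facet-unique i = ((λ e → case (F-inj i e)) ∷ (λ e → case (F-inj i e)) ∷ (λ e → case (F-inj i e)) ∷ []) ∷
          ((λ e → case (F-inj i e)) ∷ (λ e → case (F-inj i e)) ∷ []) ∷ ((λ e → case (F-inj i e)) ∷ []) ∷ [] ∷ []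
          where
          case : ∀ {j k : Fin 4} → j ≡ k → {n : False (j Fin.≟ k)} → ⊥
          case {j} {k} e {n} = toWitnessFalse n e

        F∈ : ∀ i j → F i j ∈ facet i
        F∈ i zero = here refl
        F∈ i (suc zero) = there (here refl)
        F∈ i (suc (suc zero)) = there (there (here refl))
        F∈ i (suc (suc (suc zero))) = there (there (there (here refl)))

        ∈F : ∀ i {y} → y ∈ facet i → ∃[ j ] (y ≡ F i j)
        ∈F i (here e) = f0 , e
        ∈F i (there (here e)) = f1 , e
        ∈F i (there (there (here e))) = f2 , e
        ∈F i (there (there (there (here e)))) = f3 , e

        lsum : (V → ℝ) → List V → ℝ
        lsum w []      = 0ℝ
        lsum w (x ∷ σ) = w x + lsum w σ

        drop : V → (V → ℝ) → V → ℝ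
        drop x w y = fromℚ (1ℚ ℚ.- ind x y) * w y

        drop-≢ : ∀ x w {y} → y ≢ x → drop x w y ≐ w y
        drop-≢ x w {y} n i = trans (cong (λ c → (1ℚ ℚ.- c) ℚ.* seq (w y) i) (ind-≢ n)) (ℚ.*-identityˡ (seq (w y) i))

        drop-≡ : ∀ x w → drop x w x ≐ 0ℝ
        drop-≡ x w i = trans (cong (λ c → (1ℚ ℚ.- c) ℚ.* seq (w x) i) (ind-≡ x)) (ℚ.*-zeroˡ (seq (w x) i))

        sumV : (V → ℝ) → ℝ
        sumV w = sum (λ k → w (vertex k))

        -- Splits off one vertex. By recursion on a duplicate-free list this compares the sum over
        -- the enumeration of all vertices with the sum over that list.
        sum-split : ∀ x w → sumV w ≃ w x + sumV (drop x w)
        sum-split x w = ≃-trans (sum-cong (λ k → w (vertex k)) (λ k → fromℚ (ind x (vertex k)) * w (vertex k) + drop x w (vertex k))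
            (λ k → ≐⇒≃ λ i → solve 2 (λ c w → w := c :* w :+ (con 1ℚ :- c) :* w) refl (ind x (vertex k)) (seq (w (vertex k)) i)))
          (≃-trans (≐⇒≃ (sum-+ (λ k → fromℚ (ind x (vertex k)) * w (vertex k)) (λ k → drop x w (vertex k))))
            (+-cong (≃-trans (sum-single (λ k → fromℚ (ind x (vertex k)) * w (vertex k)) (index x)
                (λ k k≢ → ≐⇒≃ λ i → trans (cong (ℚ._* seq (w (vertex k)) i) (ind-≢ {x} {vertex k}
                  λ e → k≢ (trans (sym (Inverse.strictlyInverseʳ enum k)) (cong index e)))) (ℚ.*-zeroˡ (seq (w (vertex k)) i))))
                (≐⇒≃ λ i → trans (cong₂ (λ y z → y ℚ.* seq (w z) i) (trans (cong (ind x) (vertex-index x)) (ind-≡ x)) (vertex-index x)) (ℚ.*-identityˡ (seq (w x) i))))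
              (≃-refl {sumV (drop x w)})))

        lsum-drop : ∀ x w σ → x ∉ σ → lsum (drop x w) σ ≃ lsum w σ
        lsum-drop x w []      n = ≃-refl
        lsum-drop x w (y ∷ σ) n = +-cong (≐⇒≃ (drop-≢ x w λ { refl → n (here refl) })) (lsum-drop x w σ (λ z → n (there z)))

        lsum≤sum : ∀ σ w → Unique σ → (∀ y → 0ℝ ≤ w y) → lsum w σ ≤ sumV w
        lsum≤sum []      w u h = proj₁ (≤sum (λ k → w (vertex k)) (λ k → h (vertex k)))
        lsum≤sum (x ∷ σ) w (x∉ ∷ u) h = ≤-trans (+-monoʳ-≤ (w x) (≤-trans (proj₂ (lsum-drop x w σ (λ x∈ → All.lookup x∉ x∈ refl)))
            (lsum≤sum σ (drop x w) u drop≥0))) (proj₂ (sum-split x w))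
          where
          drop≥0 : ∀ y → 0ℝ ≤ drop x w y
          drop≥0 y = go (y ≟ x)
            where
            go : Dec (y ≡ x) → 0ℝ ≤ drop x w y
            go (yes refl) = ≡⇒≤ λ i → sym (drop-≡ x w i)
            go (no n)     = ≤-trans (h y) (≡⇒≤ λ i → sym (drop-≢ x w n i))

        sum≃lsum : ∀ σ w → Unique σ → (∀ y → y ∉ σ → w y ≃ 0ℝ) → sumV w ≃ lsum w σ
        sum≃lsum []      w u h = sum-0 (λ k → w (vertex k)) (λ k → h (vertex k) λ ())
        sum≃lsum (x ∷ σ) w (x∉ ∷ u) h = ≃-trans (sum-split x w) (+-cong (≃-refl {w x})
            (≃-trans (sum≃lsum σ (drop x w) u off) (lsum-drop x w σ (λ x∈ → All.lookup x∉ x∈ refl))))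
          where
          off : ∀ y → y ∉ σ → drop x w y ≃ 0ℝ
          off y n = go (y ≟ x)
            where
            go : Dec (y ≡ x) → drop x w y ≃ 0ℝ
            go (yes refl) = ≐⇒≃ (drop-≡ x w)
            go (no y≢x)   = ≃-trans (≐⇒≃ (drop-≢ x w y≢x)) (h y λ { (here e) → y≢x e ; (there z) → n z })

        cnt : List V → V → ℚ
        cnt []      y = 0ℚ
        cnt (x ∷ σ) y = ind x y ℚ.+ cnt σ y

        cnt-off : ∀ σ {y} → y ∉ σ → cnt σ y ≡ 0ℚ
        cnt-off []      n = refl
        cnt-off (x ∷ σ) n = trans (cong₂ ℚ._+_ (ind-≢ {x} λ { refl → n (here refl) }) (cnt-off σ (λ z → n (there z)))) refl

        cnt-in : ∀ σ {y} → Unique σ → y ∈ σ → cnt σ y ≡ 1ℚ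
        cnt-in (x ∷ σ) {y} (x∉ ∷ u) (here refl) = trans (cong₂ ℚ._+_ (ind-≡ y) (cnt-off σ (λ y∈ → All.lookup x∉ y∈ refl))) refl
        cnt-in (x ∷ σ) {y} (x∉ ∷ u) (there y∈)  = trans (cong₂ ℚ._+_ (ind-≢ {x} {y} λ { refl → All.lookup x∉ y∈ refl }) (cnt-in σ u y∈)) refl

        cnt≥0 : ∀ σ y → 0ℚ ℚ.≤ cnt σ y
        cnt≥0 []      y = ℚ-le
        cnt≥0 (x ∷ σ) y = 0≤+ℚ (ind≥0 x y) (cnt≥0 σ y)

        sum-cnt : ∀ i → sumℚ (λ k → cnt (facet i) (vertex k)) ≡ ℚ4
        sum-cnt i = go₄
          where
          one : ∀ x σ {c} → sumℚ (λ k → cnt σ (vertex k)) ≡ c → sumℚ (λ k → cnt (x ∷ σ) (vertex k)) ≡ 1ℚ ℚ.+ c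
          one x σ e = trans (sumℚ-+ (λ k → ind x (vertex k)) (λ k → cnt σ (vertex k))) (cong₂ ℚ._+_ (sum-ind x) e)
          go₄ : sumℚ (λ k → cnt (facet i) (vertex k)) ≡ ℚ4
          go₄ = one (F i f0) (F i f1 ∷ F i f2 ∷ F i f3 ∷ []) (one (F i f1) (F i f2 ∷ F i f3 ∷ [])
            (one (F i f2) (F i f3 ∷ []) (one (F i f3) [] (sumℚ-0 {N} (λ _ → 0ℚ) (λ _ → refl)))))

        -- Facets modulo boundary as spheres, and the radial expansion.

        module Geometry (F-in : ∀ i → S K (facet i)) (F-max : ∀ i {τ} → S K τ → facet i ⊆ τ → τ ⊆ facet i)
          (F-dist : ∀ i j → facet i ⊆ facet j → i ≡ j) where

          𝕂 : MetricSpace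
          𝕂 = ⟦ K ⟧

          module _ (i : Fin ν) where
            corner : Pt K → Fin 4 → ℝ
            corner a j = weight a (F i j)

            -- The least corner weight u is positive exactly in the open facet; q is scaled to be 1
            -- at the barycentre; r is the weight outside the facet.
            u q r : Pt K → ℝ
            u a = min₄ (corner a)
            q a = fromℚ ℚ4 * u a
            r a = 1ℝ - lsum (weight a) (facet i)

            z : Pt K → Fin 3 → ℝ
            z a j = corner a (suc j) - corner a f0

            -- On the open facet r vanishes and B is the squared length of z. Off the facet q and z
            -- may vanish together, and the summand r then keeps A + B positive.
            zz B A : Pt K → ℝ
            zz a = z a zero * z a zero + (z a (suc zero) * z a (suc zero) + z a (suc (suc zero)) * z a (suc (suc zero)))
            B a = zz a + r a
            A a = q a * q a

          qz : ∀ i → Pt K → Fin 3 → ℝ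
          qz i a j = q i a * z i a j

          abstract
            u≥0 : ∀ i a → 0ℝ ≤ u i a
            u≥0 i a = min₄-glb (corner i a) λ j → nonNeg a (F i j)

            u-off : ∀ {X} → (h : ∀ {σ} → S X σ → S K σ) → (∀ i {σ} → S X σ → ¬ (facet i ⊆ σ)) → ∀ (a : Pt X) i → u i (incl {X} {K} h a) ≃ 0ℝ
            u-off {X} h n a i = ≮⇒≥ (λ 0<u → n i (support a (facet i) (λ y∈ → let (j , e) = ∈F i y∈ in
              subst (λ y → 0ℝ < weight a y) (sym e) (<-≤-trans 0<u (min₄≤ (corner i (incl {X} {K} h a)) j)))) id) , u≥0 i (incl {X} {K} h a)

            u>0⇒ : ∀ i a → 0ℝ < u i a → ∀ {y} → y ∈ facet i → 0ℝ < weight a y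
            u>0⇒ i a 0<u y∈ = let (j , e) = ∈F i y∈ in subst (λ y → 0ℝ < weight a y) (sym e) (<-≤-trans 0<u (min₄≤ (corner i a) j))

            -- The support contains both facets, so their union is a simplex, and maximality of
            -- facet j places facet i inside it.
            exclusive : ∀ i j a → 0ℝ < u i a → 0ℝ < u j a → i ≡ j
            exclusive i j a p p′ = F-dist i j (λ y∈ → F-max j (support a (facet i ++ facet j) pos) (∈-++⁺ʳ (facet i)) (∈-++⁺ˡ y∈))
              where
              pos : ∀ {y} → y ∈ facet i ++ facet j → 0ℝ < weight a y
              pos y∈ with ∈-++⁻ (facet i) y∈
              ... | inj₁ y∈i = u>0⇒ i a p y∈i
              ... | inj₂ y∈j = u>0⇒ j a p′ y∈j

            others : ∀ i j a → 0ℝ < u i a → j ≢ i → u j a ≃ 0ℝ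
            others i j a p n = ≮⇒≥ (λ p′ → n (exclusive j i a p′ p)) , u≥0 j a

            -- Which facet, if any, contains a in its interior is undecidable, but a stable goal may
            -- be proved as if it were known.
            by-one : ∀ a {G} → Stable G → ((∀ i → u i a ≃ 0ℝ) → G) → (∀ i → 0ℝ < u i a → G) → G
            by-one a st f g = st λ k → k (f λ i → ≮⇒≥ (λ 0<u → k (g i 0<u)) , u≥0 i a)

            weight-off : ∀ i a → 0ℝ < u i a → ∀ y → y ∉ facet i → weight a y ≃ 0ℝ
            weight-off i a 0<u y n = ≮⇒≥ (λ 0<w → n (F-max i (support a (y ∷ facet i) λ { (here refl) → 0<w ; (there z) → u>0⇒ i a 0<u z }) there (here refl))) , nonNeg a y

            r≥0 : ∀ i a → 0ℝ ≤ r i a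
            r≥0 i a = ≤⇒0≤ (≤-trans (lsum≤sum (facet i) (weight a) (facet-unique i) (nonNeg a)) (proj₁ (total a)))

            r≃0 : ∀ i a → 0ℝ < u i a → r i a ≃ 0ℝ
            r≃0 i a 0<u = x-y≃0 (≃-trans (≃-sym (total a)) (sum≃lsum (facet i) (weight a) (facet-unique i) (weight-off i a 0<u)))

            q≃0 : ∀ i a → u i a ≃ 0ℝ → q i a ≃ 0ℝ
            q≃0 i a h = *-zero-≃ (fromℚ ℚ4) h

            -- Where q is positive the support contains the facet; by maximality it lies within it,
            -- leaving no weight outside.
            qr≃0 : ∀ i a → q i a * r i a ≃ 0ℝ
            qr≃0 i a = by-cases (u i a) 0ℝ ≃-stable
              (λ p → ≃-trans (≐⇒≃ λ k → ℚ.*-comm (seq (q i a) k) (seq (r i a) k)) (*-zero-≃ (r i a) (q≃0 i a (p , u≥0 i a))))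
              (λ p → *-zero-≃ (q i a) (r≃0 i a p))

            norm : ∀ i a → normSq (B i a) (A i a) (qz i a) ≃ A i a * B i a
            norm i a = lin₁ (qr≃0 i a) (- q i a) λ k → solve 5 (λ q r x y w →
              (:- q) :* (q :* r :- con 0ℚ) := ((q :* x) :* (q :* x) :+ ((q :* y) :* (q :* y) :+ (q :* w) :* (q :* w))) :- (q :* q) :* ((x :* x :+ (y :* y :+ w :* w)) :+ r)) refl
              (seq (q i a) k) (seq (r i a) k) (seq (z i a zero) k) (seq (z i a (suc zero)) k) (seq (z i a (suc (suc zero))) k)

            -- The total weight 1 is at most r + q + Ψ with Ψ dominating 5 Σ |zⱼ|; each of
            -- q and 5 |zⱼ| is bounded by 38 times its square plus a constant.
            D≥ : ∀ i a → fromℚ c₂ ≤ A i a + B i a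
            D≥ i a = ≤-trans (fromℚ-mono {c₂} {+ 1 ℚ./ 76} ℚ-le)
                (0≤⇒≤ (0≤* {fromℚ (+ 1 ℚ./ 38)} (fromℚ-mono ℚ-le) (0≤+ (0≤+ (0≤* {fromℚ ℚ4} (fromℚ-mono ℚ-le) (≤⇒0≤ W0≤)) (0≤+ (0≤+ (step₁ zero) (step₁ (suc zero))) (step₁ (suc (suc zero)))))
                    (0≤+ (0≤* {fromℚ k37} (fromℚ-mono ℚ-le) (r≥0 i a)) (0≤* {fromℚ k38} (fromℚ-mono ℚ-le) (0≤square (q i a - fromℚ (+ 1 ℚ./ 76)))))))
                  λ k → solve 5 (λ u a b c d →
                    con (+ 1 ℚ./ 38) :* (con ℚ4 :* ((u :+ con ⅕ :* ψ′ (b :- a) (c :- a) (d :- a)) :- a)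
                       :+ ((con ⅕ :* (ψ₁ (b :- a) :- con k5 :* (b :- a)) :+ con ⅕ :* (ψ₁ (c :- a) :- con k5 :* (c :- a))) :+ con ⅕ :* (ψ₁ (d :- a) :- con k5 :* (d :- a)))
                       :+ (con k37 :* (con 1ℚ :- (a :+ (b :+ (c :+ (d :+ con 0ℚ))))) :+ con k38 :* ((con ℚ4 :* u :- con (+ 1 ℚ./ 76)) :* (con ℚ4 :* u :- con (+ 1 ℚ./ 76)))))
                    := ((con ℚ4 :* u) :* (con ℚ4 :* u) :+ (((b :- a) :* (b :- a) :+ ((c :- a) :* (c :- a) :+ (d :- a) :* (d :- a))) :+ (con 1ℚ :- (a :+ (b :+ (c :+ (d :+ con 0ℚ))))))) :- con (+ 1 ℚ./ 76))
                    refl (seq (u i a) k) (seq (corner i a f0) k) (seq (corner i a f1) k) (seq (corner i a f2) k) (seq (corner i a f3) k))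
              where
              -- Completed squares: 38 (x - 5/76)² = 38 x² - 5 x + 25/152 and 38 (q - 1/76)² = 38 q²
              -- - q + 1/152. The constants add up to 3 · 25/152 + 1/152 = ½, and 37 r raises r to
              -- 38 r. Hence 38 (A + B) ≥ ½, which gives 1/76.
              k5 k37 k38 k25 ⅕ : ℚ
              k5 = + 5 ℚ./ 1
              k37 = + 37 ℚ./ 1
              k38 = + 38 ℚ./ 1
              k25 = + 25 ℚ./ 152
              ⅕ = + 1 ℚ./ 5
              ψ₁ : ∀ {n} → +-*-Solver.Polynomial n → +-*-Solver.Polynomial n
              ψ₁ x = con k38 :* (x :* x) :+ con k25
              ψ′ : ∀ {n} → (x y w : +-*-Solver.Polynomial n) → +-*-Solver.Polynomial n
              ψ′ x y w = ψ₁ x :+ (ψ₁ y :+ ψ₁ w)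
              ψ : ℝ → ℝ
              ψ x = fromℚ k38 * (x * x) + fromℚ k25
              Ψ : ℝ
              Ψ = ψ (z i a zero) + (ψ (z i a (suc zero)) + ψ (z i a (suc (suc zero))))
              ψ≥ : ∀ x → 0ℝ ≤ ψ x - fromℚ k5 * x
              ψ≥ x = ≤-trans (0≤* {fromℚ k38} (fromℚ-mono ℚ-le) (0≤square (x - fromℚ (+ 5 ℚ./ 76)))) (≡⇒≤ λ k →
                solve 1 (λ x → con k38 :* ((x :- con (+ 5 ℚ./ 76)) :* (x :- con (+ 5 ℚ./ 76))) := (con k38 :* (x :* x) :+ con k25) :- con k5 :* x) refl (seq x k))
              ψ≥′ : ∀ x → 0ℝ ≤ ψ x + fromℚ k5 * x
              ψ≥′ x = ≤-trans (0≤* {fromℚ k38} (fromℚ-mono ℚ-le) (0≤square (x + fromℚ (+ 5 ℚ./ 76)))) (≡⇒≤ λ k →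
                solve 1 (λ x → con k38 :* ((x :+ con (+ 5 ℚ./ 76)) :* (x :+ con (+ 5 ℚ./ 76))) := (con k38 :* (x :* x) :+ con k25) :+ con k5 :* x) refl (seq x k))
              ψ≥0 : ∀ x → 0ℝ ≤ ψ x
              ψ≥0 x = 0≤+ (0≤* {fromℚ k38} (fromℚ-mono ℚ-le) (0≤square x)) (fromℚ-mono ℚ-le)
              step₁ : ∀ j → 0ℝ ≤ fromℚ ⅕ * (ψ (z i a j) - fromℚ k5 * z i a j)
              step₁ j = 0≤* {fromℚ ⅕} (fromℚ-mono ℚ-le) (ψ≥ (z i a j))
              ⅕≥0 : 0ℝ ≤ fromℚ ⅕
              ⅕≥0 = fromℚ-mono ℚ-le
              below : ∀ j → corner i a f0 - fromℚ ⅕ * Ψ ≤ corner i a j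
              below zero = 0≤⇒≤ (0≤* ⅕≥0 (0≤+ (ψ≥0 (z i a zero)) (0≤+ (ψ≥0 (z i a (suc zero))) (ψ≥0 (z i a (suc (suc zero)))))))
                λ k → solve 2 (λ w p → con ⅕ :* p := w :- (w :- con ⅕ :* p)) refl (seq (corner i a f0) k) (seq Ψ k)
              below (suc zero) = 0≤⇒≤ (0≤* ⅕≥0 (0≤+ (ψ≥′ (z i a zero)) (0≤+ (ψ≥0 (z i a (suc zero))) (ψ≥0 (z i a (suc (suc zero)))))))
                λ k → solve 5 (λ v w p₁ p₂ p₃ → con ⅕ :* ((p₁ :+ con k5 :* (v :- w)) :+ (p₂ :+ p₃)) := v :- (w :- con ⅕ :* (p₁ :+ (p₂ :+ p₃)))) refl
                  (seq (corner i a f1) k) (seq (corner i a f0) k) (seq (ψ (z i a zero)) k) (seq (ψ (z i a (suc zero))) k) (seq (ψ (z i a (suc (suc zero)))) k)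
              below (suc (suc zero)) = 0≤⇒≤ (0≤* ⅕≥0 (0≤+ (ψ≥0 (z i a zero)) (0≤+ (ψ≥′ (z i a (suc zero))) (ψ≥0 (z i a (suc (suc zero)))))))
                λ k → solve 5 (λ v w p₁ p₂ p₃ → con ⅕ :* (p₁ :+ ((p₂ :+ con k5 :* (v :- w)) :+ p₃)) := v :- (w :- con ⅕ :* (p₁ :+ (p₂ :+ p₃)))) refl
                  (seq (corner i a f2) k) (seq (corner i a f0) k) (seq (ψ (z i a zero)) k) (seq (ψ (z i a (suc zero))) k) (seq (ψ (z i a (suc (suc zero)))) k)
              below (suc (suc (suc zero))) = 0≤⇒≤ (0≤* ⅕≥0 (0≤+ (ψ≥0 (z i a zero)) (0≤+ (ψ≥0 (z i a (suc zero))) (ψ≥′ (z i a (suc (suc zero)))))))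
                λ k → solve 5 (λ v w p₁ p₂ p₃ → con ⅕ :* (p₁ :+ (p₂ :+ (p₃ :+ con k5 :* (v :- w)))) := v :- (w :- con ⅕ :* (p₁ :+ (p₂ :+ p₃)))) refl
                  (seq (corner i a f3) k) (seq (corner i a f0) k) (seq (ψ (z i a zero)) k) (seq (ψ (z i a (suc zero))) k) (seq (ψ (z i a (suc (suc zero)))) k)
              W0≤ : corner i a f0 ≤ u i a + fromℚ ⅕ * Ψ
              W0≤ = 0≤⇒≤ (≤⇒0≤ (min₄-glb (corner i a) below)) λ k → solve 3 (λ u w p → u :- (w :- p) := (u :+ p) :- w) refl
                (seq (u i a) k) (seq (corner i a f0) k) (⅕ ℚ.* seq Ψ k)

          opaque
            -- The quotient map onto facet i modulo its boundary: everything outside the open facet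
            -- goes to the north pole, the barycentre to the south pole.
            γ : Fin ν → Pt K → SpherePoint 3
            γ i a = sph (B i a) (A i a) (qz i a) (D≥ i a) (norm i a)

            γ-height : ∀ i a → height (γ i a) ≃ (B i a - A i a) * inv (A i a + B i a)
            γ-height i a = ≃-refl

            γ-pt : ∀ i a j → pt (γ i a) (suc j) ≃ (2ℝ * qz i a j) * inv (A i a + B i a)
            γ-pt i a zero = ≃-refl
            γ-pt i a (suc zero) = ≃-refl
            γ-pt i a (suc (suc zero)) = ≃-refl

          Cont-u : ∀ i → Cont 𝕂 (u i)
          Cont-u i = Cont-min₄ 𝕂 (λ j → Cont-weight K (F i j))

          Cont-lsum : ∀ σ → Cont 𝕂 (λ a → lsum (weight a) σ)
          Cont-lsum []      = Cont-const 𝕂 0ℝ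
          Cont-lsum (x ∷ σ) = Cont-+ 𝕂 (Cont-weight K x) (Cont-lsum σ)

          opaque
            unfolding γ

            C-γ : ∀ i → C 𝕂 (𝕊 3) (γ i)
            C-γ i = Cont-sph 𝕂 {B i} {A i} {qz i} (λ _ _ → refl)
                (Cont-+ 𝕂 (Cont-+ 𝕂 (sq zero) (Cont-+ 𝕂 (sq (suc zero)) (sq (suc (suc zero))))) (Cont-- 𝕂 (Cont-const 𝕂 1ℝ) (Cont-lsum (facet i))))
                (Cont-* 𝕂 cq cq) (λ j → Cont-* 𝕂 cq (cz j))
              where
              cq : Cont 𝕂 (q i)
              cq = Cont-* 𝕂 (Cont-const 𝕂 (fromℚ ℚ4)) (Cont-u i)
              cz : ∀ j → Cont 𝕂 (λ a → z i a j)
              cz j = Cont-- 𝕂 (Cont-weight K (F i (suc j))) (Cont-weight K (F i f0))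
              sq : ∀ j → Cont 𝕂 (λ a → z i a j * z i a j)
              sq j = Cont-* 𝕂 (cz j) (cz j)

            γ-north : ∀ i a → u i a ≃ 0ℝ → [ 𝕊 3 ] γ i a ∼ (northPole 3)
            γ-north i a h = sph-north (B i a) (A i a) (qz i a) (D≥ i a) (norm i a) (*-zero-≃ (q i a) (q≃0 i a h))
              λ j → ≃-trans (≐⇒≃ λ k → ℚ.*-comm (seq (q i a) k) (seq (z i a j) k)) (*-zero-≃ (z i a j) (q≃0 i a h))

          ht : Fin ν → Pt K → ℝ
          ht i a = height (γ i a)

          Cont-ht : ∀ i → Cont 𝕂 (ht i)
          Cont-ht i = Cont-∘ 𝕂 (𝕊 3) (Cont-pt f0) (C-γ i)

          ht-north : ∀ i a → u i a ≃ 0ℝ → ht i a ≃ 1ℝ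
          ht-north i a h = ∼-pt (γ-north i a h) f0

          lowest : Pt K → ℝ
          lowest a = minF (λ i → ht i a)

          Cont-lowest : Cont 𝕂 lowest
          Cont-lowest = Cont-minF 𝕂 Cont-ht

          -- Radial expansion of the facets onto their boundaries

          -- The weight taken from each corner. The cut-off is evaluated at the height of `γ`, so
          -- that, before normalization, q is scaled by the same factor `mu` as in the dilation of
          -- the sphere.
          loss : Fin ν → Pt K → UnitInterval → ℝ
          loss i a t = time t * (lam (ht i a) * u i a)

          -- The sum runs over all facets although at most one loss is non-zero; this gives one
          -- continuous formula with no choice of facet.
          raw : Pt K → UnitInterval → V → ℝ
          raw a t y = lincomb (weight a y) (λ i → ℚ.- cnt (facet i) y) (λ i → loss i a t)

          T : Pt K → UnitInterval → ℝ
          T a t = lincomb 1ℝ (λ _ → ℚ.- ℚ4) (λ i → loss i a t)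

          opaque
            expand : Pt K → UnitInterval → V → ℝ
            expand a t y = raw a t y * inv (T a t)

            expand-def : ∀ a t y → expand a t y ≃ raw a t y * inv (T a t)
            expand-def a t y = ≃-refl

          ¾ -¾ : ℚ
          ¾ = + 3 ℚ./ 4
          -¾ = ℚ.- ¾

          abstract
            loss≥0 : ∀ i a t → 0ℝ ≤ loss i a t
            loss≥0 i a t = 0≤* (UnitInterval.lower t) (0≤* (clampℝ≥0 (2ℝ * ht i a + 1ℝ)) (u≥0 i a))

            loss≤u : ∀ i a t → loss i a t ≤ u i a
            loss≤u i a t = unit-product≤ (UnitInterval.lower t) (UnitInterval.upper t) (u≥0 i a)
              (unit-product≤ (clampℝ≥0 (2ℝ * ht i a + 1ℝ)) (clampℝ≤1 (2ℝ * ht i a + 1ℝ)) (u≥0 i a) ≤-refl)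

            loss-0 : ∀ i a t → u i a ≃ 0ℝ → loss i a t ≃ 0ℝ
            loss-0 i a t h = *-zero-≃ (time t) (*-zero-≃ (lam (ht i a)) h)

            T-one : ∀ i a t → 0ℝ < u i a → T a t ≃ 1ℝ + fromℚ (ℚ.- ℚ4) * loss i a t
            T-one i a t p = lincomb-1 1ℝ (λ _ → ℚ.- ℚ4) (λ j → loss j a t) i λ j n → *-zero-≃ (fromℚ (ℚ.- ℚ4)) (loss-0 j a t (others i j a p n))

            raw-one : ∀ i a t y → 0ℝ < u i a → raw a t y ≃ weight a y + fromℚ (ℚ.- cnt (facet i) y) * loss i a t
            raw-one i a t y p = lincomb-1 (weight a y) (λ j → ℚ.- cnt (facet j) y) (λ j → loss j a t) i
              λ j n → *-zero-≃ (fromℚ (ℚ.- cnt (facet j) y)) (loss-0 j a t (others i j a p n))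

            corner-raw : ∀ i a t j → 0ℝ < u i a → raw a t (F i j) ≃ corner i a j - loss i a t
            corner-raw i a t j p = ≃-trans (raw-one i a t (F i j) p) (≐⇒≃ λ k →
              trans (cong (λ c → seq (corner i a j) k ℚ.+ (ℚ.- c) ℚ.* seq (loss i a t) k) (cnt-in (facet i) (facet-unique i) (F∈ i j)))
                (solve 2 (λ w l → w :+ con (ℚ.- 1ℚ) :* l := w :- l) refl (seq (corner i a j) k) (seq (loss i a t) k)))

            -- Height at most -½ means A ≥ 3 B. Every corner weight lies between u and 1 - 3 u, so
            -- each z has absolute value at most 1 - q ≤ ¼, and 3 B ≤ 9/16 ≤ q².
            near-centre : ∀ i a → 0ℝ < u i a → fromℚ ¾ ≤ q i a → ht i a ≤ fromℚ (ℚ.- ½)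
            near-centre i a 0<u q≥ = 0≤⇒≤ {z = fromℚ (ℚ.- ½) - ht i a}
                (≤-trans (0≤* {fromℚ ½} (fromℚ-mono ℚ-le) (0≤* (0≤inv (A i a + B i a)) A-3B≥0)) (proj₁ half-gap)) λ k → refl
              where
              half-gap : fromℚ ½ * (inv (A i a + B i a) * (A i a - fromℚ ℚ3 * B i a)) ≃ fromℚ (ℚ.- ½) - ht i a
              half-gap = ≃-trans (lin₁ {y = fromℚ (ℚ.- ½) - (B i a - A i a) * inv (A i a + B i a)} (*-inv (D≥ i a)) (fromℚ (ℚ.- ½)) λ k → solve 3 (λ A B I →
                con (ℚ.- ½) :* ((A :+ B) :* I :- con 1ℚ) := con ½ :* (I :* (A :- con ℚ3 :* B)) :- (con (ℚ.- ½) :- (B :- A) :* I)) refl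
                  (seq (A i a) k) (seq (B i a) k) (invℚ (seq (A i a) k ℚ.+ seq (B i a) k)))
                (+-cong (≃-refl {fromℚ (ℚ.- ½)}) (neg-cong (≃-sym (γ-height i a))))
              above : ∀ j → 0ℝ ≤ corner i a j - u i a
              above j = ≤⇒0≤ (min₄≤ (corner i a) j)
              w : Fin 4 → ℕ → ℚ
              w j k = seq (corner i a j) k
              cap : ∀ j → 0ℝ ≤ (1ℝ - fromℚ ℚ3 * u i a) - corner i a j
              cap zero = ≤-trans (0≤+ (r≥0 i a) (0≤+ (above f1) (0≤+ (above f2) (above f3)))) (≡⇒≤ λ k → solve 5 (λ u a b c d →
                (con 1ℚ :- (a :+ (b :+ (c :+ (d :+ con 0ℚ))))) :+ ((b :- u) :+ ((c :- u) :+ (d :- u))) := (con 1ℚ :- con ℚ3 :* u) :- a) refl (seq (u i a) k) (w f0 k) (w f1 k) (w f2 k) (w f3 k))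
              cap (suc zero) = ≤-trans (0≤+ (r≥0 i a) (0≤+ (above f0) (0≤+ (above f2) (above f3)))) (≡⇒≤ λ k → solve 5 (λ u a b c d →
                (con 1ℚ :- (a :+ (b :+ (c :+ (d :+ con 0ℚ))))) :+ ((a :- u) :+ ((c :- u) :+ (d :- u))) := (con 1ℚ :- con ℚ3 :* u) :- b) refl (seq (u i a) k) (w f0 k) (w f1 k) (w f2 k) (w f3 k))
              cap (suc (suc zero)) = ≤-trans (0≤+ (r≥0 i a) (0≤+ (above f0) (0≤+ (above f1) (above f3)))) (≡⇒≤ λ k → solve 5 (λ u a b c d →
                (con 1ℚ :- (a :+ (b :+ (c :+ (d :+ con 0ℚ))))) :+ ((a :- u) :+ ((b :- u) :+ (d :- u))) := (con 1ℚ :- con ℚ3 :* u) :- c) refl (seq (u i a) k) (w f0 k) (w f1 k) (w f2 k) (w f3 k))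
              cap (suc (suc (suc zero))) = ≤-trans (0≤+ (r≥0 i a) (0≤+ (above f0) (0≤+ (above f1) (above f2)))) (≡⇒≤ λ k → solve 5 (λ u a b c d →
                (con 1ℚ :- (a :+ (b :+ (c :+ (d :+ con 0ℚ))))) :+ ((a :- u) :+ ((b :- u) :+ (c :- u))) := (con 1ℚ :- con ℚ3 :* u) :- d) refl (seq (u i a) k) (w f0 k) (w f1 k) (w f2 k) (w f3 k))
              ¼-z : ∀ j → 0ℝ ≤ fromℚ ¼ - z i a j
              ¼-z j = ≤-trans (0≤+ (≤⇒0≤ q≥) (0≤+ (cap (suc j)) (above f0))) (≡⇒≤ λ k → solve 3 (λ u a b →
                (con ℚ4 :* u :- con ¾) :+ (((con 1ℚ :- con ℚ3 :* u) :- b) :+ (a :- u)) := con ¼ :- (b :- a)) refl (seq (u i a) k) (w f0 k) (w (suc j) k))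
              ¼+z : ∀ j → 0ℝ ≤ fromℚ ¼ + z i a j
              ¼+z j = ≤-trans (0≤+ (≤⇒0≤ q≥) (0≤+ (cap f0) (above (suc j)))) (≡⇒≤ λ k → solve 3 (λ u a b →
                (con ℚ4 :* u :- con ¾) :+ (((con 1ℚ :- con ℚ3 :* u) :- a) :+ (b :- u)) := con ¼ :+ (b :- a)) refl (seq (u i a) k) (w f0 k) (w (suc j) k))
              sq : ∀ j → 0ℝ ≤ (fromℚ ¼ - z i a j) * (fromℚ ¼ + z i a j)
              sq j = 0≤* (¼-z j) (¼+z j)
              q+¾ : 0ℝ ≤ q i a + fromℚ ¾
              q+¾ = 0≤+ (0≤* {fromℚ ℚ4} (fromℚ-mono ℚ-le) (u≥0 i a)) (fromℚ-mono ℚ-le)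
              A-3B≥0 : 0ℝ ≤ A i a - fromℚ ℚ3 * B i a
              A-3B≥0 = ≤-trans (0≤+ (0≤* (≤⇒0≤ q≥) q+¾) (0≤+ (0≤* {fromℚ ℚ3} (fromℚ-mono ℚ-le) (0≤+ (sq zero) (0≤+ (sq (suc zero)) (sq (suc (suc zero))))))
                  (0≤* {fromℚ ℚ3} (fromℚ-mono ℚ-le) (≤⇒0≤ (proj₁ (r≃0 i a 0<u))))))
                (≡⇒≤ λ k → solve 5 (λ q r x y v → (q :- con ¾) :* (q :+ con ¾) :+ (con ℚ3 :* ((con ¼ :- x) :* (con ¼ :+ x) :+ ((con ¼ :- y) :* (con ¼ :+ y) :+ (con ¼ :- v) :* (con ¼ :+ v)))
                    :+ con ℚ3 :* (con 0ℚ :- r)) := q :* q :- con ℚ3 :* ((x :* x :+ (y :* y :+ v :* v)) :+ r)) refl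
                  (seq (q i a) k) (seq (r i a) k) (seq (z i a zero) k) (seq (z i a (suc zero)) k) (seq (z i a (suc (suc zero))) k))

            -- If q ≥ ¾ the cut-off vanishes by `near-centre` and nothing is lost; otherwise the
            -- total loss is at most q < ¾, leaving at least ¼.
            T≥ : ∀ a t → fromℚ c₂ ≤ T a t
            T≥ a t = by-one a ≤-stable
                (λ h → ≤-trans (fromℚ-mono {c₂} {1ℚ} ℚ-le) (proj₂ (lincomb-0 1ℝ (λ _ → ℚ.- ℚ4) (λ i → loss i a t) λ i → loss-0 i a t (h i))))
                λ i p → ≤-trans (by-cases (fromℚ ¾) (q i a) ≤-stable (λ q≥ → far i p q≥) (λ q< → near i q<)) (proj₂ (T-one i a t p))
              where
              far : ∀ i → 0ℝ < u i a → fromℚ ¾ ≤ q i a → fromℚ c₂ ≤ 1ℝ + fromℚ (ℚ.- ℚ4) * loss i a t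
              far i p q≥ = ≤-trans (fromℚ-mono {c₂} {1ℚ} ℚ-le) (proj₂ (lin₁ (lam-0 (near-centre i a p q≥)) (fromℚ (ℚ.- ℚ4) * (time t * u i a)) λ k →
                solve 3 (λ t l u → con (ℚ.- ℚ4) :* (t :* u) :* (l :- con 0ℚ) := (con 1ℚ :+ con (ℚ.- ℚ4) :* (t :* (l :* u))) :- con 1ℚ) refl
                  (seq (time t) k) (seq (lam (ht i a)) k) (seq (u i a) k)))
              near : ∀ i → q i a < fromℚ ¾ → fromℚ c₂ ≤ 1ℝ + fromℚ (ℚ.- ℚ4) * loss i a t
              near i q< = ≤-trans (fromℚ-mono {c₂} {¼} ℚ-le) (0≤⇒≤ (0≤+ (≤⇒0≤ (<⇒≤ q<)) (0≤* {fromℚ ℚ4} (fromℚ-mono ℚ-le) (≤⇒0≤ (loss≤u i a t)))) λ k →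
                solve 2 (λ l u → (con ¾ :- con ℚ4 :* u) :+ con ℚ4 :* (u :- l) := (con 1ℚ :+ con (ℚ.- ℚ4) :* l) :- con ¼) refl (seq (loss i a t) k) (seq (u i a) k))

            raw≥0 : ∀ a t y → 0ℝ ≤ raw a t y
            raw≥0 a t y = by-one a ≤-stable
                (λ h → ≤-trans (nonNeg a y) (proj₂ (lincomb-0 (weight a y) (λ i → ℚ.- cnt (facet i) y) (λ i → loss i a t) λ i → loss-0 i a t (h i))))
                λ i p → go i p (y ∈? facet i)
              where
              open import Data.List.Membership.DecPropositional _≟_ using (_∈?_)
              go : ∀ i → 0ℝ < u i a → Dec (y ∈ facet i) → 0ℝ ≤ raw a t y
              go i p (yes y∈) = let (j , e) = ∈F i y∈ in subst (λ y → 0ℝ ≤ raw a t y) (sym e)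
                (≤-trans (≤⇒0≤ (≤-trans (loss≤u i a t) (min₄≤ (corner i a) j))) (proj₂ (corner-raw i a t j p)))
              go i p (no y∉) = ≤-trans (nonNeg a y) (≤-trans (≡⇒≤ λ k →
                sym (trans (cong (λ c → seq (weight a y) k ℚ.+ (ℚ.- c) ℚ.* seq (loss i a t) k) (cnt-off (facet i) y∉))
                  (solve 2 (λ w l → w :+ con (ℚ.- 0ℚ) :* l := w) refl (seq (weight a y) k) (seq (loss i a t) k))))
                (proj₂ (raw-one i a t y p)))

          opaque
            unfolding expand

            expand≥0 : ∀ a t y → 0ℝ ≤ expand a t y
            expand≥0 a t y = 0≤* (raw≥0 a t y) (0≤inv (T a t))

            -- Losses cannot raise a weight, and the reciprocal of T is at most 100. Hence the
            -- expansion never enlarges a support.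
            expand≤ : ∀ a t y → expand a t y ≤ fromℚ ℚ100 * weight a y
            expand≤ a t y = 0≤⇒≤ (0≤+ (0≤* (raw≥0 a t y) (≤⇒0≤ (inv≤ (T a t)))) (0≤* {fromℚ ℚ100} (fromℚ-mono ℚ-le)
                (≤⇒0≤ (lincomb≤ (weight a y) (λ i → ℚ.- cnt (facet i) y) (λ i → loss i a t)
                  (λ i → subst (0ℚ ℚ.≤_) (solve 1 (λ c → c := :- (:- c)) refl (cnt (facet i) y)) (cnt≥0 (facet i) y)) λ i → loss≥0 i a t))))
              λ k → solve 3 (λ x I w → x :* (con ℚ100 :- I) :+ con ℚ100 :* (w :- x) := con ℚ100 :* w :- x :* I) refl
                (seq (raw a t y) k) (invℚ (seq (T a t) k)) (seq (weight a y) k)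

            expand>0⇒ : ∀ a t y → 0ℝ < expand a t y → 0ℝ < weight a y
            expand>0⇒ a t y p = scale-pos (<-≤-trans p (expand≤ a t y))

            sum-* : ∀ {n} (f : Vector ℝ n) c → sum (λ k → f k * c) ≐ (sum f * c)
            sum-* {ℕ.zero}  f c i = sym (ℚ.*-zeroˡ (seq c i))
            sum-* {ℕ.suc n} f c i = trans (cong (seq (f zero) i ℚ.* seq c i ℚ.+_) (sum-* (f ∘ suc) c i))
              (sym (ℚ.*-distribʳ-+ (seq c i) (seq (f zero) i) (seq (sum (f ∘ suc)) i)))

            expand-total : ∀ a t → sum (λ k → expand a t (vertex k)) ≃ 1ℝ
            expand-total a t = ≃-trans {y = sum (λ k → raw a t (vertex k)) * inv (T a t)} (≐⇒≃ (sum-* (λ k → raw a t (vertex k)) (inv (T a t))))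
              (≃-trans (*-cong (≃-trans {y = lincomb (sum (λ k → weight a (vertex k))) (λ i → sumℚ (λ k → ℚ.- cnt (facet i) (vertex k))) (λ i → loss i a t)} (≐⇒≃ (lincomb-sum (λ k → weight a (vertex k)) (λ k i → ℚ.- cnt (facet i) (vertex k)) (λ i → loss i a t)))
                  (lincomb-≃ (λ i → sumℚ (λ k → ℚ.- cnt (facet i) (vertex k))) (λ _ → ℚ.- ℚ4) (λ i → loss i a t) (total a)
                    λ i → trans (sumℚ-neg (λ k → cnt (facet i) (vertex k))) (cong ℚ.-_ (sum-cnt i))))
                (≃-refl {inv (T a t)})) (*-inv (T≥ a t)))

            expand-support : ∀ a t σ → (∀ {y} → y ∈ σ → 0ℝ < expand a t y) → S K σ
            expand-support a t σ h = support a σ λ {y} y∈ → expand>0⇒ a t y (h y∈)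

            -- Nonnegative heights put the cut-off at 1, so at time 1 each corner of the facet loses
            -- exactly u. If all stayed positive, the minimum u would be smaller than itself.
            expand-avoids : ∀ a → (∀ i → 0ℝ ≤ ht i a) → ∀ σ → (∀ {y} → y ∈ σ → 0ℝ < expand a 1ᴵ y) → ∀ i → ¬ (facet i ⊆ σ)
            expand-avoids a h≥0 σ pos i f⊆ = <-irrefl (min₄-glb-< (corner i a) u<) ≤-refl
              where
              0<u : 0ℝ < u i a
              0<u = min₄-glb-< (corner i a) λ j → expand>0⇒ a 1ᴵ (F i j) (pos (f⊆ (F∈ i j)))
              loss≃u : loss i a 1ᴵ ≃ u i a
              loss≃u = lin₁ (lam-1 (h≥0 i)) (u i a) λ k → solve 2 (λ l u → u :* (l :- con 1ℚ) := con 1ℚ :* (l :* u) :- u) refl (seq (lam (ht i a)) k) (seq (u i a) k)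
              u< : ∀ j → u i a < corner i a j
              u< j = diff>0 (scale-pos (<-≤-trans (pos (f⊆ (F∈ i j))) (≤-trans (0≤⇒≤ (0≤* (raw≥0 a 1ᴵ (F i j)) (≤⇒0≤ (inv≤ (T a 1ᴵ)))) (λ k →
                  solve 2 (λ x I → x :* (con ℚ100 :- I) := con ℚ100 :* x :- x :* I) refl (seq (raw a 1ᴵ (F i j)) k) (invℚ (seq (T a 1ᴵ) k))))
                (*-monoˡ-≤ {z = fromℚ ℚ100} (fromℚ-mono ℚ-le) (proj₁ (≃-trans (corner-raw i a 1ᴵ j 0<u) (+-cong (≃-refl {corner i a j}) (neg-cong loss≃u))))))))
                where
                diff>0 : ∀ {x y} → 0ℝ < y - x → x < y
                diff>0 {x} {y} p = let (g , g>0 , h) = <⇒gap p in gap⇒< g>0 (0≤⇒≤ (≤⇒0≤ h) λ k →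
                  solve 3 (λ x y g → (y :- x) :- (con 0ℚ :+ g) := y :- (x :+ g)) refl (seq x k) (seq y k) g)

          e : Pt K × UnitInterval → Pt K
          e (a , t) = mkPt (expand a t) (expand≥0 a t) (expand-total a t) (expand-support a t)

          e₁ : Pt K → Pt K
          e₁ a = e (a , 1ᴵ)

          eL : (a : Pt K) → (∀ i → 0ℝ ≤ ht i a) → Pt L
          eL a h = mkPt (expand a 1ᴵ) (expand≥0 a 1ᴵ) (expand-total a 1ᴵ) (λ σ p → expand-support a 1ᴵ σ p , expand-avoids a h σ p)

          opaque
            unfolding expand

            Cont-expand : ∀ Z {f : ∣ Z ∣ₘ → Pt K} {t : ∣ Z ∣ₘ → UnitInterval} → C Z 𝕂 f → Cont Z (λ x → time (t x)) → ∀ y → Cont Z (λ x → expand (f x) (t x) y)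
            Cont-expand Z {f} {t} cf ct y = Cont-* Z {λ x → raw (f x) (t x) y} {λ x → inv (T (f x) (t x))} craw (Cont-inv Z {λ x → T (f x) (t x)} cT)
              where
              closs : ∀ i → Cont Z (λ x → loss i (f x) (t x))
              closs i = Cont-* Z {λ x → time (t x)} {λ x → lam (ht i (f x)) * u i (f x)} ct
                (Cont-* Z {λ x → lam (ht i (f x))} {λ x → u i (f x)} (Cont-lam Z (Cont-∘ Z 𝕂 (Cont-ht i) cf)) (Cont-∘ Z 𝕂 (Cont-u i) cf))
              craw : Cont Z (λ x → raw (f x) (t x) y)
              craw = Cont-lincomb Z {b = λ x → weight (f x) y} (λ i → ℚ.- cnt (facet i) y) {λ x i → loss i (f x) (t x)} (Cont-∘ Z 𝕂 (Cont-weight K y) cf) closs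
              cT : Cont Z (λ x → T (f x) (t x))
              cT = Cont-lincomb Z {b = λ x → 1ℝ} (λ _ → ℚ.- ℚ4) {λ x i → loss i (f x) (t x)} (Cont-const Z 1ℝ) closs

          C-e : C (𝕂 ×ₘ 𝕀) 𝕂 e
          C-e = C-weights (𝕂 ×ₘ 𝕀) K {e} (Cont-expand (𝕂 ×ₘ 𝕀) {proj₁} {proj₂} (C-proj₁ 𝕂 𝕀) (Cont-time₂ 𝕂))

          C-e₁ : C 𝕂 𝕂 e₁
          C-e₁ = C-weights 𝕂 K {e₁} (Cont-expand 𝕂 {id} {λ _ → 1ᴵ} (C-id 𝕂) (Cont-const 𝕂 (time 1ᴵ)))

          abstract
            inv-one : ∀ {x} → x ≃ 1ℝ → inv x ≃ 1ℝ
            inv-one {x} h = lin₂ h (*-inv (≤-trans (fromℚ-mono {c₂} {1ℚ} ℚ-le) (proj₂ h))) (- inv x) 1ℝ λ k →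
              solve 2 (λ x I → (:- I) :* (x :- con 1ℚ) :+ con 1ℚ :* (x :* I :- con 1ℚ) := I :- con 1ℚ) refl (seq x k) (invℚ (seq x k))

            e-start : ∀ a → [ 𝕂 ] e (a , 0ᴵ) ∼ a
            e-start a = weight-∼ K λ y → ≃-trans (expand-def a 0ᴵ y) (≃-trans (*-cong
                (lincomb-0 (weight a y) (λ i → ℚ.- cnt (facet i) y) (λ i → loss i a 0ᴵ) l≃0)
                (inv-one (lincomb-0 1ℝ (λ _ → ℚ.- ℚ4) (λ i → loss i a 0ᴵ) l≃0)))
              (≐⇒≃ λ k → ℚ.*-identityʳ (seq (weight a y) k)))
              where
              l≃0 : ∀ i → loss i a 0ᴵ ≃ 0ℝ
              l≃0 i = ≐⇒≃ λ k → ℚ.*-zeroˡ (seq (lam (ht i a) * u i a) k)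

          id~e₁ : Htpy 𝕂 𝕂 id e₁
          id~e₁ = record { H = e ; H-cont = C-e ; start = e-start ; end = λ _ → ∼-refl 𝕂 }

          abstract
            γ-e-off : ∀ i a t → u i a ≃ 0ℝ → u i (e (a , t)) ≃ 0ℝ
            γ-e-off i a t h = min₄-case (corner i a) ≤-stable (λ j p → ≤-trans (min₄≤ (corner i (e (a , t))) j) (≤-trans (expand≤ a t (F i j))
                (proj₁ (*-zero-≃ (fromℚ ℚ100) (≃-trans (≃-sym p) h))))) , u≥0 i (e (a , t))

          -- The corner weights become J (w - l), so z is scaled by J and q by J m. The homogeneous
          -- coordinates of the image are J² times (zz : m² A : m q z), and those of the dilated
          -- sphere point are 2 I times the same triple.
          module OnFacet (i : Fin ν) (a : Pt K) (t : UnitInterval) (0<u : 0ℝ < u i a) where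
            a′ : Pt K
            a′ = e (a , t)
            J I m l : ℝ
            J = inv (T a t)
            I = inv (A i a + B i a)
            m = mu (time t) (ht i a)
            l = loss i a t

            c : ∀ j → corner i a′ j ≃ J * (corner i a j - l)
            c j = ≃-trans (expand-def a t (F i j)) (≃-trans (*-cong (corner-raw i a t j 0<u) (≃-refl {J})) (≐⇒≃ λ k → ℚ.*-comm (seq (corner i a j - l) k) (seq J k)))
            u′ : u i a′ ≃ J * (u i a - l)
            u′ = min₄-affine (corner i a) (corner i a′) (0≤inv (T a t)) c
            q′ : q i a′ ≃ J * (m * q i a)
            q′ = ≃-trans (*-cong (≃-refl {fromℚ ℚ4}) u′) (≐⇒≃ λ k → solve 4 (λ J u t l → con ℚ4 :* (J :* (u :- t :* (l :* u))) := J :* ((con 1ℚ :- t :* l) :* (con ℚ4 :* u))) refl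
              (seq J k) (seq (u i a) k) (seq (time t) k) (seq (lam (ht i a)) k))
            z′ : ∀ j → z i a′ j ≃ J * z i a j
            z′ j = ≃-trans (+-cong (c (suc j)) (neg-cong (c f0))) (≐⇒≃ λ k → solve 4 (λ J w v l → J :* (w :- l) :- J :* (v :- l) := J :* (w :- v)) refl
              (seq J k) (seq (corner i a (suc j)) k) (seq (corner i a f0) k) (seq l k))
            z²′ : ∀ j → z i a′ j * z i a′ j ≃ (J * J) * (z i a j * z i a j)
            z²′ j = ≃-trans (*-cong (z′ j) (z′ j)) (≐⇒≃ λ k → solve 2 (λ J x → (J :* x) :* (J :* x) := (J :* J) :* (x :* x)) refl (seq J k) (seq (z i a j) k))
            r′ : r i a′ ≃ 0ℝ
            r′ = ≃-trans (+-cong (≃-refl {1ℝ}) (neg-cong (≃-trans (+-cong (c f0) (+-cong (c f1) (+-cong (c f2) (+-cong (c f3) (≃-refl {0ℝ})))))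
                  (≃-trans (≐⇒≃ λ k → solve 6 (λ J l a b c d → J :* (a :- l) :+ (J :* (b :- l) :+ (J :* (c :- l) :+ (J :* (d :- l) :+ con 0ℚ))) := J :* ((a :+ (b :+ (c :+ (d :+ con 0ℚ)))) :+ con (ℚ.- ℚ4) :* l)) refl
                      (seq J k) (seq l k) (seq (corner i a f0) k) (seq (corner i a f1) k) (seq (corner i a f2) k) (seq (corner i a f3) k))
                    (≃-trans (*-cong (≃-refl {J}) (≃-trans (+-cong sum≃1 (≃-refl {fromℚ (ℚ.- ℚ4) * l})) (≃-sym (T-one i a t 0<u))))
                      (≃-trans (≐⇒≃ λ k → ℚ.*-comm (seq J k) (seq (T a t) k)) (*-inv (T≥ a t)))))))) (≐⇒≃ λ k → refl)
              where
              sum≃1 : lsum (weight a) (facet i) ≃ 1ℝ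
              sum≃1 = lin₁ (r≃0 i a 0<u) (fromℚ (ℚ.- 1ℚ)) λ k → solve 1 (λ s → con (ℚ.- 1ℚ) :* ((con 1ℚ :- s) :- con 0ℚ) := s :- con 1ℚ) refl (seq (lsum (weight a) (facet i)) k)
            hB : B i a′ ≃ (J * J) * zz i a
            hB = ≃-trans (+-cong (+-cong (z²′ zero) (+-cong (z²′ (suc zero)) (z²′ (suc (suc zero))))) r′)
              (≐⇒≃ λ k → solve 4 (λ J x y v → (J :* x :+ (J :* y :+ J :* v)) :+ con 0ℚ := J :* (x :+ (y :+ v))) refl
                (seq (J * J) k) (seq (z i a zero * z i a zero) k) (seq (z i a (suc zero) * z i a (suc zero)) k) (seq (z i a (suc (suc zero)) * z i a (suc (suc zero))) k))
            hA : A i a′ ≃ (J * J) * ((m * m) * A i a)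
            hA = ≃-trans (*-cong q′ q′) (≐⇒≃ λ k → solve 3 (λ J m q → (J :* (m :* q)) :* (J :* (m :* q)) := (J :* J) :* ((m :* m) :* (q :* q))) refl (seq J k) (seq m k) (seq (q i a) k))
            hy : ∀ j → qz i a′ j ≃ (J * J) * (m * qz i a j)
            hy j = ≃-trans (*-cong q′ (z′ j)) (≐⇒≃ λ k → solve 4 (λ J m q x → (J :* (m :* q)) :* (J :* x) := (J :* J) :* (m :* (q :* x))) refl (seq J k) (seq m k) (seq (q i a) k) (seq (z i a j) k))
            h′ : ℝ
            h′ = (B i a - A i a) * I
            hB′ : Dilate.Bd (γ i a) t ≃ (2ℝ * I) * zz i a
            hB′ = ≃-trans (+-cong (≃-refl {1ℝ}) (γ-height i a)) (lin₂ {x = 1ℝ + h′} (*-inv (D≥ i a)) (r≃0 i a 0<u) (fromℚ (ℚ.- 1ℚ)) (2ℝ * I) λ k → solve 4 (λ A x r I →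
              con (ℚ.- 1ℚ) :* ((A :+ (x :+ r)) :* I :- con 1ℚ) :+ (con ℚ2 :* I) :* (r :- con 0ℚ) := (con 1ℚ :+ ((x :+ r) :- A) :* I) :- (con ℚ2 :* I) :* x) refl
              (seq (A i a) k) (seq (zz i a) k) (seq (r i a) k) (seq I k))
            hA′ : Dilate.Ad (γ i a) t ≃ (2ℝ * I) * ((m * m) * A i a)
            hA′ = ≃-trans (*-cong (≃-refl {m * m}) (+-cong (≃-refl {1ℝ}) (neg-cong (γ-height i a)))) (lin₁ {x = (m * m) * (1ℝ - h′)} (*-inv (D≥ i a)) (- (m * m)) λ k → solve 4 (λ m A B I →
              (:- (m :* m)) :* ((A :+ B) :* I :- con 1ℚ) := (m :* m) :* (con 1ℚ :- (B :- A) :* I) :- (con ℚ2 :* I) :* ((m :* m) :* A)) refl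
              (seq m k) (seq (A i a) k) (seq (B i a) k) (seq I k))
            hy′ : ∀ j → Dilate.yd (γ i a) t j ≃ (2ℝ * I) * (m * qz i a j)
            hy′ j = ≃-trans (*-cong (≃-refl {m}) (γ-pt i a j)) (≐⇒≃ λ k → solve 3 (λ m y I → m :* (con ℚ2 :* y :* I) := (con ℚ2 :* I) :* (m :* y)) refl (seq m k) (seq (qz i a j) k) (seq I k))

            opaque
              unfolding γ

              agree : [ 𝕊 3 ] γ i a′ ∼ E (γ i a , t)
              agree = E-proportional {B i a′} {A i a′} {qz i a′} (D≥ i a′) (norm i a′) (γ i a) t
                (zz i a) ((m * m) * A i a) (λ j → m * qz i a j) (J * J) (2ℝ * I) hB hA hy hB′ hA′ hy′

          abstract
            γ-e : ∀ i a t → [ 𝕊 3 ] γ i (e (a , t)) ∼ E (γ i a , t)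
            γ-e i a t = by-cases (u i a) 0ℝ (∼-stable (𝕊 3))
              (λ p → ∼-trans (𝕊 3) (γ-north i (e (a , t)) (γ-e-off i a t (p , u≥0 i a)))
                (∼-sym (𝕊 3) (E-∼north t (γ-north i a (p , u≥0 i a)))))
              (λ p → OnFacet.agree i a t p)

          -- The inverse of γ i away from the north pole

          Below : SpherePoint 3 → Set
          Below p = height p < fromℚ ¾

          hat : SpherePoint 3 → Fin 4 → ℝ
          hat p zero    = 0ℝ
          hat p (suc j) = pt p (suc j)

          slack : SpherePoint 3 → Fin 4 → ℝ
          slack p j = hat p j - min₄ (hat p)

          -- Stereographic projection gives q : z = (1 - h) : (p₁, p₂, p₃). Up to a common factor
          -- the least corner weight is therefore (1 - h)/4, and the excess of each corner over it
          -- is its slack. The sum of the four numerators is `denom`, at least ¼ below height ¾.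
          numer : SpherePoint 3 → Fin 4 → ℝ
          numer p j = fromℚ ¼ * (1ℝ - height p) + slack p j

          denom : SpherePoint 3 → ℝ
          denom p = (1ℝ - height p) + (slack p f0 + (slack p f1 + (slack p f2 + slack p f3)))

          dw : SpherePoint 3 → Fin 4 → ℝ
          dw p j = numer p j * inv (denom p)

          opaque
            δw : Fin ν → SpherePoint 3 → V → ℝ
            δw i p y = lincomb 0ℝ (λ j → ind (F i j) y) (dw p)

            slack≥0 : ∀ p j → 0ℝ ≤ slack p j
            slack≥0 p j = ≤⇒0≤ (min₄≤ (hat p) j)

            denom≥ : ∀ p → Below p → fromℚ c₂ ≤ denom p
            denom≥ p h = ≤-trans (fromℚ-mono {c₂} {¼} ℚ-le) (0≤⇒≤ (0≤+ (≤⇒0≤ (<⇒≤ h)) (0≤+ (slack≥0 p f0) (0≤+ (slack≥0 p f1) (0≤+ (slack≥0 p f2) (slack≥0 p f3)))))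
              λ k → solve 2 (λ h s → (con ¾ :- h) :+ s := ((con 1ℚ :- h) :+ s) :- con ¼) refl (seq (height p) k) (seq (slack p f0 + (slack p f1 + (slack p f2 + slack p f3))) k))

            dw≥0 : ∀ p j → 0ℝ ≤ dw p j
            dw≥0 p j = 0≤* (0≤+ (0≤* {fromℚ ¼} (fromℚ-mono ℚ-le) (1-height≥0 p)) (slack≥0 p j)) (0≤inv (denom p))

            δw≥0 : ∀ i p y → 0ℝ ≤ δw i p y
            δw≥0 i p y = lincomb≥0 (λ j → ind (F i j) y) (dw p) (λ j → ind≥0 (F i j) y) (dw≥0 p)

            δw-off : ∀ i p y → y ∉ facet i → δw i p y ≃ 0ℝ
            δw-off i p y n = lincomb-00 0ℝ (λ j → ind (F i j) y) (dw p) λ j → ≐⇒≃ λ k →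
              trans (cong (ℚ._* seq (dw p j) k) (ind-≢ {F i j} {y} λ { refl → n (F∈ i j) })) (ℚ.*-zeroˡ (seq (dw p j) k))

            δw-corner : ∀ i p j → δw i p (F i j) ≃ dw p j
            δw-corner i p j = ≃-trans (lincomb-1 0ℝ (λ k → ind (F i k) (F i j)) (dw p) j λ k n → ≐⇒≃ λ l →
                trans (cong (ℚ._* seq (dw p k) l) (ind-≢ {F i k} {F i j} λ e → n (sym (F-inj i e)))) (ℚ.*-zeroˡ (seq (dw p k) l)))
              (≐⇒≃ λ l → trans (cong (λ c → 0ℚ ℚ.+ c ℚ.* seq (dw p j) l) (ind-≡ (F i j))) (solve 1 (λ x → con 0ℚ :+ con 1ℚ :* x := x) refl (seq (dw p j) l)))

            sum-dw : ∀ p → Below p → dw p f0 + (dw p f1 + (dw p f2 + (dw p f3 + 0ℝ))) ≃ 1ℝ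
            sum-dw p h = ≃-trans {y = denom p * inv (denom p)} (≐⇒≃ λ k → solve 6 (λ h a b c d I →
                (con ¼ :* (con 1ℚ :- h) :+ a) :* I :+ ((con ¼ :* (con 1ℚ :- h) :+ b) :* I :+ ((con ¼ :* (con 1ℚ :- h) :+ c) :* I :+ ((con ¼ :* (con 1ℚ :- h) :+ d) :* I :+ con 0ℚ)))
                := ((con 1ℚ :- h) :+ (a :+ (b :+ (c :+ d)))) :* I) refl
                (seq (height p) k) (seq (slack p f0) k) (seq (slack p f1) k) (seq (slack p f2) k) (seq (slack p f3) k) (invℚ (seq (denom p) k)))
              (*-inv (denom≥ p h))

            δw-total : ∀ i p → Below p → sum (λ k → δw i p (vertex k)) ≃ 1ℝ
            δw-total i p h = ≃-trans (sum≃lsum (facet i) (δw i p) (facet-unique i) (δw-off i p))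
              (≃-trans (+-cong (δw-corner i p f0) (+-cong (δw-corner i p f1) (+-cong (δw-corner i p f2) (+-cong (δw-corner i p f3) (≃-refl {0ℝ}))))) (sum-dw p h))

            δw-facet : ∀ i p σ → (∀ {y} → y ∈ σ → 0ℝ < δw i p y) → σ ⊆ facet i
            δw-facet i p σ h {y} y∈ = go (y ∈? facet i)
              where
              open import Data.List.Membership.DecPropositional _≟_ using (_∈?_)
              go : Dec (y ∈ facet i) → y ∈ facet i
              go (yes y∈f) = y∈f
              go (no y∉f)  = ⊥-elim (<-irrefl (h y∈) (proj₁ (δw-off i p y y∉f)))

            δw-support : ∀ i p σ → (∀ {y} → y ∈ σ → 0ℝ < δw i p y) → S K σ
            δw-support i p σ h = closed K (δw-facet i p σ h) (F-in i)

            Cont-δw : ∀ i y → Cont (𝕊 3) (λ p → δw i p y)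
            Cont-δw i y = Cont-lincomb (𝕊 3) (λ j → ind (F i j) y) {dw} (Cont-const (𝕊 3) 0ℝ) λ j → Cont-* (𝕊 3) {λ p → numer p j} {λ p → inv (denom p)}
                (Cont-+ (𝕊 3) (Cont-* (𝕊 3) (Cont-const (𝕊 3) (fromℚ ¼)) c1-h) (cs j))
                (Cont-inv (𝕊 3) (Cont-+ (𝕊 3) c1-h (Cont-+ (𝕊 3) (cs f0) (Cont-+ (𝕊 3) (cs f1) (Cont-+ (𝕊 3) (cs f2) (cs f3))))))
              where
              chat : ∀ j → Cont (𝕊 3) (λ p → hat p j)
              chat zero    = Cont-const (𝕊 3) 0ℝ
              chat (suc j) = Cont-pt (suc j)
              cs : ∀ j → Cont (𝕊 3) (λ p → slack p j)
              cs j = Cont-- (𝕊 3) (chat j) (Cont-min₄ (𝕊 3) {hat} chat)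
              c1-h : Cont (𝕊 3) (λ p → 1ℝ - height p)
              c1-h = Cont-- (𝕊 3) (Cont-const (𝕊 3) 1ℝ) (Cont-pt f0)

          δ : Fin ν → Σ (SpherePoint 3) Below → Pt K
          δ i (p , h) = mkPt (δw i p) (δw≥0 i p) (δw-total i p h) (δw-support i p)

          C-δ : ∀ i → C ((𝕊 3) ↾ Below) 𝕂 (δ i)
          C-δ i = C-weights ((𝕊 3) ↾ Below) K {δ i} λ v → Cont-∘ ((𝕊 3) ↾ Below) (𝕊 3) {proj₁} (Cont-δw i v) (C-↾ (𝕊 3))

          abstract
            u-δ : ∀ i k ph → k ≢ i → u k (δ i ph) ≃ 0ℝ
            u-δ i k (p , h) n = ≮⇒≥ (λ 0<u → n (F-dist k i (δw-facet i p (facet k) (u>0⇒ k (δ i (p , h)) 0<u)))) , u≥0 k (δ i (p , h))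

          -- The constructed point has q ≃ J (1 - h) and z ≃ J (p₁, p₂, p₃); the equation of the
          -- unit sphere turns these proportions back into the coordinates of p.
          module Inverse₁ (i : Fin ν) (p : SpherePoint 3) (b : Below p) where
            a : Pt K
            a = δ i (p , b)
            J h : ℝ
            J = inv (denom p)
            h = height p

            c : ∀ j → corner i a j ≃ J * (hat p j - (min₄ (hat p) - fromℚ ¼ * (1ℝ - h)))
            c j = ≃-trans (δw-corner i p j) (≐⇒≃ λ k → solve 4 (λ J x m g → (g :+ (x :- m)) :* J := J :* (x :- (m :- g))) refl
              (seq J k) (seq (hat p j) k) (seq (min₄ (hat p)) k) (seq (fromℚ ¼ * (1ℝ - h)) k))

            qa : q i a ≃ J * (1ℝ - h)
            qa = ≃-trans (*-cong (≃-refl {fromℚ ℚ4}) (min₄-affine (hat p) (corner i a) (0≤inv (denom p)) c)) (≐⇒≃ λ k →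
              solve 3 (λ J m h → con ℚ4 :* (J :* (m :- (m :- con ¼ :* (con 1ℚ :- h)))) := J :* (con 1ℚ :- h)) refl (seq J k) (seq (min₄ (hat p)) k) (seq h k))

            za : ∀ j → z i a j ≃ J * pt p (suc j)
            za j = ≃-trans (+-cong (c (suc j)) (neg-cong (c f0))) (≐⇒≃ λ k → solve 3 (λ J x m → J :* (x :- m) :- J :* (con 0ℚ :- m) := J :* x) refl
              (seq J k) (seq (pt p (suc j)) k) (seq (min₄ (hat p) - fromℚ ¼ * (1ℝ - h)) k))

            ra : r i a ≃ 0ℝ
            ra = x-y≃0 (≃-sym (≃-trans (+-cong (δw-corner i p f0) (+-cong (δw-corner i p f1) (+-cong (δw-corner i p f2) (+-cong (δw-corner i p f3) (≃-refl {0ℝ}))))) (sum-dw p b)))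

            A₀ B₀ : ℝ
            A₀ = (J * (1ℝ - h)) * (J * (1ℝ - h))
            B₀ = (J * pt p f1) * (J * pt p f1) + ((J * pt p f2) * (J * pt p f2) + (J * pt p f3) * (J * pt p f3))

            Aa : A i a ≃ A₀
            Aa = *-cong qa qa

            Ba : B i a ≃ B₀
            Ba = ≃-trans (+-cong (+-cong (*-cong (za zero) (za zero)) (+-cong (*-cong (za (suc zero)) (za (suc zero))) (*-cong (za (suc (suc zero))) (za (suc (suc zero)))))) ra)
              (≐⇒≃ λ k → ℚ.+-identityʳ (seq B₀ k))

            h₀ : B i a - A i a ≃ (A i a + B i a) * h
            h₀ = ≃-trans (+-cong Ba (neg-cong Aa)) (≃-trans (lin₁ {x = B₀ - A₀} {y = (A₀ + B₀) * h} (unit₄ p) ((J * J) * (1ℝ - h)) λ k → solve 5 (λ J h x y v →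
                (J :* J) :* (con 1ℚ :- h) :* ((h :* h :+ (x :* x :+ (y :* y :+ (v :* v :+ con 0ℚ)))) :- con 1ℚ)
                := (((J :* x) :* (J :* x) :+ ((J :* y) :* (J :* y) :+ (J :* v) :* (J :* v))) :- (J :* (con 1ℚ :- h)) :* (J :* (con 1ℚ :- h)))
                   :- ((J :* (con 1ℚ :- h)) :* (J :* (con 1ℚ :- h)) :+ ((J :* x) :* (J :* x) :+ ((J :* y) :* (J :* y) :+ (J :* v) :* (J :* v)))) :* h) refl
                (seq J k) (seq h k) (seq (pt p f1) k) (seq (pt p f2) k) (seq (pt p f3) k))
              (≃-sym (*-cong (+-cong Aa Ba) (≃-refl {h}))))

            hⱼ : ∀ j → 2ℝ * qz i a j ≃ (A i a + B i a) * pt p (suc j)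
            hⱼ j = ≃-trans (*-cong (≃-refl {2ℝ}) (*-cong qa (za j))) (≃-trans (lin₁ {x = 2ℝ * ((J * (1ℝ - h)) * (J * pt p (suc j)))} {y = (A₀ + B₀) * pt p (suc j)} (unit₄ p) (- ((J * J) * pt p (suc j))) λ k → solve 6 (λ J h x y v w →
                (:- ((J :* J) :* w)) :* ((h :* h :+ (x :* x :+ (y :* y :+ (v :* v :+ con 0ℚ)))) :- con 1ℚ)
                := con ℚ2 :* ((J :* (con 1ℚ :- h)) :* (J :* w))
                   :- ((J :* (con 1ℚ :- h)) :* (J :* (con 1ℚ :- h)) :+ ((J :* x) :* (J :* x) :+ ((J :* y) :* (J :* y) :+ (J :* v) :* (J :* v)))) :* w) refl
                (seq J k) (seq h k) (seq (pt p f1) k) (seq (pt p f2) k) (seq (pt p f3) k) (seq (pt p (suc j)) k))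
              (≃-sym (*-cong (+-cong Aa Ba) (≃-refl {pt p (suc j)}))))

            opaque
              unfolding γ

              γδ : [ 𝕊 3 ] γ i a ∼ p
              γδ = sph-eq (B i a) (A i a) (qz i a) (D≥ i a) (norm i a) p h₀ hⱼ

          module Inverse₂ (i : Fin ν) (a : Pt K) (b : Below (γ i a)) (0<u : 0ℝ < u i a) where
            p : SpherePoint 3
            p = γ i a
            I J k : ℝ
            I = inv (A i a + B i a)
            J = inv (denom p)
            -- The common ratio of sphere data to facet data: 1 - h ≃ k q and the other coordinates
            -- are k z. It also equals `denom p`, because the corner weights add up to 1.
            k = 2ℝ * (q i a * I)

            k≥0 : 0ℝ ≤ k
            k≥0 = 0≤* {2ℝ} (fromℚ-mono ℚ-le) (0≤* (0≤* {fromℚ ℚ4} (fromℚ-mono ℚ-le) (u≥0 i a)) (0≤inv (A i a + B i a)))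

            hats : ∀ j → hat p j ≃ k * (corner i a j - corner i a f0)
            hats zero = ≐⇒≃ λ n → solve 2 (λ k w → con 0ℚ := k :* (w :- w)) refl (seq k n) (seq (corner i a f0) n)
            hats (suc j) = ≃-trans (γ-pt i a j) (≐⇒≃ λ n → solve 3 (λ q z I → (con ℚ2 :* (q :* z)) :* I := (con ℚ2 :* (q :* I)) :* z) refl
              (seq (q i a) n) (seq (z i a j) n) (seq I n))

            slacks : ∀ j → slack p j ≃ k * (corner i a j - u i a)
            slacks j = ≃-trans (+-cong (hats j) (neg-cong (min₄-affine (corner i a) (hat p) k≥0 hats))) (≐⇒≃ λ n →
              solve 4 (λ k w v u → k :* (w :- v) :- k :* (u :- v) := k :* (w :- u)) refl (seq k n) (seq (corner i a j) n) (seq (corner i a f0) n) (seq (u i a) n))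

            1-h : 1ℝ - height p ≃ k * q i a
            1-h = ≃-trans (+-cong (≃-refl {1ℝ}) (neg-cong (γ-height i a))) (lin₁ {x = 1ℝ - (B i a - A i a) * I} (*-inv (D≥ i a)) (fromℚ (ℚ.- 1ℚ)) λ n → solve 3 (λ q B I →
              con (ℚ.- 1ℚ) :* (((q :* q) :+ B) :* I :- con 1ℚ) := (con 1ℚ :- (B :- q :* q) :* I) :- (con ℚ2 :* (q :* I)) :* q) refl (seq (q i a) n) (seq (B i a) n) (seq I n))

            numers : ∀ j → numer p j ≃ k * corner i a j
            numers j = ≃-trans (+-cong (*-cong (≃-refl {fromℚ ¼}) 1-h) (slacks j)) (≐⇒≃ λ n → solve 3 (λ k u w →
              con ¼ :* (k :* (con ℚ4 :* u)) :+ k :* (w :- u) := k :* w) refl (seq k n) (seq (u i a) n) (seq (corner i a j) n))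

            denom≃k : denom p ≃ k
            denom≃k = ≃-trans (+-cong 1-h (+-cong (slacks f0) (+-cong (slacks f1) (+-cong (slacks f2) (slacks f3)))))
              (lin₁ {x = k * q i a + (k * (corner i a f0 - u i a) + (k * (corner i a f1 - u i a) + (k * (corner i a f2 - u i a) + k * (corner i a f3 - u i a))))} (r≃0 i a 0<u) (- k) λ n → solve 6 (λ k u a b c d →
                (:- k) :* ((con 1ℚ :- (a :+ (b :+ (c :+ (d :+ con 0ℚ))))) :- con 0ℚ) := (k :* (con ℚ4 :* u) :+ (k :* (a :- u) :+ (k :* (b :- u) :+ (k :* (c :- u) :+ k :* (d :- u))))) :- k) refl
                (seq k n) (seq (u i a) n) (seq (corner i a f0) n) (seq (corner i a f1) n) (seq (corner i a f2) n) (seq (corner i a f3) n))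

            dws : ∀ j → dw p j ≃ corner i a j
            dws j = ≃-trans (*-cong (numers j) (≃-refl {J})) (lin₁ {x = (k * corner i a j) * J} kJ (corner i a j) λ n → solve 3 (λ k w J → w :* (k :* J :- con 1ℚ) := (k :* w) :* J :- w) refl
                (seq k n) (seq (corner i a j) n) (seq J n))
              where
              kJ : k * J ≃ 1ℝ
              kJ = ≃-trans (*-cong (≃-sym denom≃k) (≃-refl {J})) (*-inv (denom≥ p b))

            weights : ∀ y → δw i p y ≃ weight a y
            weights y = go (y ∈? facet i)
              where
              open import Data.List.Membership.DecPropositional _≟_ using (_∈?_)
              go : Dec (y ∈ facet i) → δw i p y ≃ weight a y
              go (yes y∈) = let (j , e) = ∈F i y∈ in subst (λ y → δw i p y ≃ weight a y) (sym e) (≃-trans (δw-corner i p j) (dws j))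
              go (no y∉)  = ≃-trans (δw-off i p y y∉) (≃-sym (weight-off i a 0<u y y∉))

          abstract
            γδ : ∀ i p h → [ 𝕊 3 ] γ i (δ i (p , h)) ∼ p
            γδ i p h = Inverse₁.γδ i p h

            u>0-if-low : ∀ i a → ht i a < 1ℝ → ¬ (u i a ≤ 0ℝ)
            u>0-if-low i a h u≤0 = <-irrefl h (proj₂ (ht-north i a (u≤0 , u≥0 i a)))

            δγ : ∀ i a h → [ 𝕂 ] δ i (γ i a , h) ∼ a
            δγ i a h = by-cases (u i a) 0ℝ (∼-stable 𝕂) (λ u≤0 → ⊥-elim (u>0-if-low i a (<-trans h (fromℚ-mono-< ℚ-lt)) u≤0))
              (λ 0<u → weight-∼ K (Inverse₂.weights i a h 0<u))

          -- The equivalence with the wedge, given a contraction of `L`.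

          module Contracted (v₀ : V) (s₀ : S L [ v₀ ]) (c : Htpy ⟦ L ⟧ ⟦ L ⟧ id (λ _ → vtx L v₀ s₀)) where

            ι : Pt L → Pt K
            ι = incl {L} {K} proj₁

            C-ι : C ⟦ L ⟧ 𝕂 ι
            C-ι = C-incl L K proj₁

            base : Pt K
            base = ι (vtx L v₀ s₀)

            abstract
              γ-ι : ∀ i b → [ 𝕊 3 ] γ i (ι b) ∼ (northPole 3)
              γ-ι i b = γ-north i (ι b) (u-off {L} proj₁ (λ i s → proj₂ s i) b i)

            -- Vanishes up to ¼ and equals 1 from ½ on: the contraction stands still where it is
            -- glued to `e₁`, and is completed where all heights are at least ½.
            speed : Pt K → ℝ
            speed a = clampℝ (fromℚ ℚ4 * lowest a - 1ℝ)

            Cont-speed : Cont 𝕂 speed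
            Cont-speed = Cont-clampℝ 𝕂 (Cont-- 𝕂 (Cont-* 𝕂 (Cont-const 𝕂 (fromℚ ℚ4)) Cont-lowest) (Cont-const 𝕂 1ℝ))

            High : Pt K × UnitInterval → Set
            High at = fromℚ 0ℚ < lowest (proj₁ at)

            heights≥0 : ∀ a → fromℚ 0ℚ < lowest a → ∀ i → 0ℝ ≤ ht i a
            heights≥0 a h i = ≤-trans (<⇒≤ h) (minF≤ (λ i → ht i a) i)

            lift : (x : Σ (Pt K × UnitInterval) High) → Pt L
            lift x = eL (proj₁ (proj₁ x)) (heights≥0 (proj₁ (proj₁ x)) (proj₂ x))

            C-lift : C ((𝕂 ×ₘ 𝕀) ↾ High) ⟦ L ⟧ lift
            C-lift = C-weights ((𝕂 ×ₘ 𝕀) ↾ High) L {lift} (Cont-expand ((𝕂 ×ₘ 𝕀) ↾ High) {λ x → proj₁ (proj₁ x)} {λ _ → 1ᴵ}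
              (C-∘ ((𝕂 ×ₘ 𝕀) ↾ High) (𝕂 ×ₘ 𝕀) 𝕂 (C-proj₁ 𝕂 𝕀) (C-↾ (𝕂 ×ₘ 𝕀))) (Cont-const ((𝕂 ×ₘ 𝕀) ↾ High) (time 1ᴵ)))

            rate : Pt K × UnitInterval → ℝ
            rate at = time (proj₂ at) * speed (proj₁ at)

            Cont-rate : Cont (𝕂 ×ₘ 𝕀) rate
            Cont-rate = Cont-* (𝕂 ×ₘ 𝕀) (Cont-time₂ 𝕂) (Cont-∘ (𝕂 ×ₘ 𝕀) 𝕂 Cont-speed (C-proj₁ 𝕂 𝕀))

            tempo : Σ (Pt K × UnitInterval) High → UnitInterval
            tempo x = clamp (rate (proj₁ x))

            contracting : Σ (Pt K × UnitInterval) High → Pt K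
            contracting x = ι (H c (lift x , tempo x))

            Cont-rate′ : Cont ((𝕂 ×ₘ 𝕀) ↾ High) (λ x → rate (proj₁ x))
            Cont-rate′ = Cont-∘ ((𝕂 ×ₘ 𝕀) ↾ High) (𝕂 ×ₘ 𝕀) {proj₁} {rate} Cont-rate (C-↾ (𝕂 ×ₘ 𝕀) {High})

            C-tempo : C ((𝕂 ×ₘ 𝕀) ↾ High) 𝕀 tempo
            C-tempo = C-clamp ((𝕂 ×ₘ 𝕀) ↾ High) {λ x → rate (proj₁ x)} Cont-rate′

            C-stage : C ((𝕂 ×ₘ 𝕀) ↾ High) (⟦ L ⟧ ×ₘ 𝕀) (λ x → lift x , tempo x)
            C-stage = C-pair ((𝕂 ×ₘ 𝕀) ↾ High) ⟦ L ⟧ 𝕀 {lift} {tempo} C-lift C-tempo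

            C-contracting : C ((𝕂 ×ₘ 𝕀) ↾ High) 𝕂 contracting
            C-contracting = C-∘ ((𝕂 ×ₘ 𝕀) ↾ High) ⟦ L ⟧ 𝕂 {λ x → H c (lift x , tempo x)} {ι} C-ι
              (C-∘ ((𝕂 ×ₘ 𝕀) ↾ High) (⟦ L ⟧ ×ₘ 𝕀) ⟦ L ⟧ {λ x → lift x , tempo x} {H c} (H-cont c) C-stage)

            abstract
              contracting-0 : ∀ a t h → rate (a , t) ≤ 0ℝ → [ 𝕂 ] contracting ((a , t) , h) ∼ e₁ a
              contracting-0 a t h r≤0 = ∼-trans 𝕂 (C-resp ⟦ L ⟧ 𝕂 C-ι (∼-trans ⟦ L ⟧
                  (at-time ⟦ L ⟧ ⟦ L ⟧ c (eL a (heights≥0 a h)) {clamp (rate (a , t))} {0ᴵ} (clampℝ-0 {rate (a , t)} r≤0))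
                  (start c (eL a (heights≥0 a h)))))
                (weight-∼ K λ v → ≃-refl)

              contracting-1 : ∀ a t h → 1ℝ ≤ rate (a , t) → [ 𝕂 ] contracting ((a , t) , h) ∼ base
              contracting-1 a t h r≥1 = C-resp ⟦ L ⟧ 𝕂 C-ι (∼-trans ⟦ L ⟧
                  (at-time ⟦ L ⟧ ⟦ L ⟧ c (eL a (heights≥0 a h)) {clamp (rate (a , t))} {1ᴵ} (clampℝ-1 {rate (a , t)} r≥1))
                  (end c (eL a (heights≥0 a h))))

              slow : ∀ a t → lowest a < fromℚ ¼ → rate (a , t) ≤ 0ℝ
              slow a t l = proj₁ (*-zero-≃ (time t) (clampℝ-0 {fromℚ ℚ4 * lowest a - 1ℝ} (0≤⇒≤ (0≤* {fromℚ ℚ4} (fromℚ-mono ℚ-le) (≤⇒0≤ (<⇒≤ l)))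
                λ k → solve 1 (λ l → con ℚ4 :* (con ¼ :- l) := con 0ℚ :- (con ℚ4 :* l :- con 1ℚ)) refl (seq (lowest a) k))))

              fast : ∀ a → fromℚ ½ ≤ lowest a → 1ℝ ≤ rate (a , 1ᴵ)
              fast a l = ≤-trans (proj₂ (clampℝ-1 {fromℚ ℚ4 * lowest a - 1ℝ} (0≤⇒≤ (0≤* {fromℚ ℚ4} (fromℚ-mono ℚ-le) (≤⇒0≤ l))
                λ k → solve 1 (λ l → con ℚ4 :* (l :- con ½) := (con ℚ4 :* l :- con 1ℚ) :- con 1ℚ) refl (seq (lowest a) k))))
                (≡⇒≤ λ k → sym (ℚ.*-identityˡ (seq (speed a) k)))

            module GlueK = Glue (𝕂 ×ₘ 𝕀) 𝕂 (λ at → lowest (proj₁ at)) (Cont-∘ (𝕂 ×ₘ 𝕀) 𝕂 Cont-lowest (C-proj₁ 𝕂 𝕀)) 0ℚ ¼ ℚ-lt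
              contracting C-contracting
              (λ x → e₁ (proj₁ (proj₁ x))) (C-∘ ((𝕂 ×ₘ 𝕀) ↾ λ at → lowest (proj₁ at) < fromℚ ¼) (𝕂 ×ₘ 𝕀) 𝕂 (C-∘ (𝕂 ×ₘ 𝕀) 𝕂 𝕂 C-e₁ (C-proj₁ 𝕂 𝕀)) (C-↾ (𝕂 ×ₘ 𝕀)))
              (λ (a , t) h l → contracting-0 a t h (slow a t l))

            opaque
              -- Takes the place of the homotopy extension property: the contraction of `L`,
              -- preceded by the expansion, is extended to all of the realization by slowing it down
              -- towards the barycentres.
              squeeze : Pt K × UnitInterval → Pt K
              squeeze = GlueK.glue

              C-squeeze : C (𝕂 ×ₘ 𝕀) 𝕂 squeeze
              C-squeeze = GlueK.glue-cont

              squeeze-high : ∀ a t h → [ 𝕂 ] contracting ((a , t) , h) ∼ squeeze (a , t)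
              squeeze-high a t h = GlueK.glue-f (a , t) h

              squeeze-low : ∀ a t → lowest a < fromℚ ¼ → [ 𝕂 ] e₁ a ∼ squeeze (a , t)
              squeeze-low a t l = GlueK.glue-g (a , t) l

            Sq : Pt K → Pt K
            Sq a = squeeze (a , 1ᴵ)

            C-Sq : C 𝕂 𝕂 Sq
            C-Sq = C-∘ 𝕂 (𝕂 ×ₘ 𝕀) 𝕂 C-squeeze (C-pair 𝕂 𝕂 𝕀 (C-id 𝕂) (C-const 𝕂 𝕀 1ᴵ))

            0<¼ : fromℚ 0ℚ < fromℚ ¼
            0<¼ = fromℚ-mono-< ℚ-lt

            squeeze-start : ∀ a → [ 𝕂 ] squeeze (a , 0ᴵ) ∼ e₁ a
            squeeze-start a = go (compare 0<¼ (lowest a))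
              where
              go : (fromℚ 0ℚ < lowest a) ⊎ (lowest a < fromℚ ¼) → [ 𝕂 ] squeeze (a , 0ᴵ) ∼ e₁ a
              go (inj₁ h) = ∼-trans 𝕂 (∼-sym 𝕂 (squeeze-high a 0ᴵ h)) (contracting-0 a 0ᴵ h (≡⇒≤ λ k → ℚ.*-zeroˡ (seq (speed a) k)))
              go (inj₂ l) = ∼-sym 𝕂 (squeeze-low a 0ᴵ l)

            e₁~Sq : Htpy 𝕂 𝕂 e₁ Sq
            e₁~Sq = record { H = squeeze ; H-cont = C-squeeze ; start = squeeze-start ; end = λ _ → ∼-refl 𝕂 }

            abstract
              Sq-base : ∀ a → fromℚ ½ ≤ lowest a → [ 𝕂 ] Sq a ∼ base
              Sq-base a l = ∼-trans 𝕂 (∼-sym 𝕂 (squeeze-high a 1ᴵ h)) (contracting-1 a 1ᴵ h (fast a l))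
                where
                h : fromℚ 0ℚ < lowest a
                h = <-≤-trans (fromℚ-mono-< {0ℚ} {½} ℚ-lt) l

              -- Where the contraction acts, the image stays in `L`, which `γ` sends to the north
              -- pole; there all heights are nonnegative and `E₁` gives the north pole too.
              -- Elsewhere `Sq` is `e₁` and `γ-e` applies.
              γ-Sq : ∀ i a → [ 𝕊 3 ] γ i (Sq a) ∼ E₁ (γ i a)
              γ-Sq i a = go (compare 0<¼ (lowest a))
                where
                go : (fromℚ 0ℚ < lowest a) ⊎ (lowest a < fromℚ ¼) → [ 𝕊 3 ] γ i (Sq a) ∼ E₁ (γ i a)
                go (inj₁ h) = ∼-trans (𝕊 3) (∼-trans (𝕊 3) (C-resp 𝕂 (𝕊 3) (C-γ i) (∼-sym 𝕂 (squeeze-high a 1ᴵ h))) (γ-ι i (H c (eL a (heights≥0 a h) , clamp (rate (a , 1ᴵ))))))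
                  (∼-sym (𝕊 3) (E₁-collapse (γ i a) (heights≥0 a h i)))
                go (inj₂ l) = ∼-trans (𝕊 3) (C-resp 𝕂 (𝕊 3) (C-γ i) (∼-sym 𝕂 (squeeze-low a 1ᴵ l))) (γ-e i a 1ᴵ)

              lowest≥½ : ∀ a → (∀ i → fromℚ ½ ≤ ht i a) → fromℚ ½ ≤ lowest a
              lowest≥½ a h = minF-glb (λ i → ht i a) (fromℚ-mono {½} {1ℚ} ℚ-le) h

              ½≤north : ∀ {p} → [ 𝕊 3 ] p ∼ (northPole 3) → fromℚ ½ ≤ height p
              ½≤north {p} e = ≤-trans (fromℚ-mono {½} {1ℚ} ℚ-le) (proj₂ (∼-pt {p} {(northPole 3)} e f0))

              0<north : ∀ {p} → [ 𝕊 3 ] p ∼ (northPole 3) → 0ℝ < height p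
              0<north {p} e = <-≤-trans (fromℚ-mono-< {0ℚ} {½} ℚ-lt) (½≤north e)

            open WedgeMaps ν (𝕊 3) (northPole 3)

            -- The map to the wedge

            located : ∀ a → (∀ i → 0ℝ < ht i a) ⊎ Σ (Fin ν) (λ i → ht i a < fromℚ ½)
            located a = search (λ i → compare (fromℚ-mono-< {0ℚ} {½} ℚ-lt) (ht i a))

            -- Both answers may be correct for the same point. The choice is immaterial, since `E₁`
            -- sends all points of nonnegative height to the north pole, the wedge point.
            place : ∀ a → (∀ i → 0ℝ < ht i a) ⊎ Σ (Fin ν) (λ i → ht i a < fromℚ ½) → ∣ ⋁ ν (𝕊 3) (northPole 3) ∣ₘ
            place a (inj₁ _)       = nothing
            place a (inj₂ (i , _)) = inj i (E₁ (γ i a))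

            opaque
              to : Pt K → ∣ ⋁ ν (𝕊 3) (northPole 3) ∣ₘ
              to a = place a (located a)

            abstract
              same-facet : ∀ i j a → ht i a < fromℚ ½ → ht j a < fromℚ ½ → ¬ (i ≢ j)
              same-facet i j a p q n = by-cases (u i a) 0ℝ ⊥-stable (u>0-if-low i a (<-trans p ½<1)) λ 0<ui →
                by-cases (u j a) 0ℝ ⊥-stable (u>0-if-low j a (<-trans q ½<1)) λ 0<uj → n (exclusive i j a 0<ui 0<uj)
                where
                ½<1 : fromℚ ½ < 1ℝ
                ½<1 = fromℚ-mono-< ℚ-lt

              place-hit : ∀ i a → ht i a < fromℚ ½ → ∀ s → [ ⋁ ν (𝕊 3) (northPole 3) ] inj i (E₁ (γ i a)) ∼ place a s
              place-hit i a p (inj₁ h) = inj-base i (E₁-collapse (γ i a) (<⇒≤ (h i)))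
              place-hit i a p (inj₂ (j , q)) = go (i Fin.≟ j)
                where
                go : Dec (i ≡ j) → [ ⋁ ν (𝕊 3) (northPole 3) ] inj i (E₁ (γ i a)) ∼ inj j (E₁ (γ j a))
                go (yes refl) = ∼-refl (⋁ ν (𝕊 3) (northPole 3))
                go (no n)     = ⊥-elim (same-facet i j a p q n)

              place-miss : ∀ a → (∀ i → 0ℝ < ht i a) → ∀ s → [ ⋁ ν (𝕊 3) (northPole 3) ] nothing ∼ place a s
              place-miss a h (inj₁ _)       = ∼-refl (⋁ ν (𝕊 3) (northPole 3))
              place-miss a h (inj₂ (j , _)) = ∼-sym (⋁ ν (𝕊 3) (northPole 3)) {inj j (E₁ (γ j a))} {nothing} (inj-base j (E₁-collapse (γ j a) (<⇒≤ (h j))))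

            opaque
              unfolding to

              to-hit : ∀ i a → ht i a < fromℚ ½ → [ ⋁ ν (𝕊 3) (northPole 3) ] inj i (E₁ (γ i a)) ∼ to a
              to-hit i a p = place-hit i a p (located a)

              to-miss : ∀ a → (∀ i → 0ℝ < ht i a) → [ ⋁ ν (𝕊 3) (northPole 3) ] nothing ∼ to a
              to-miss a h = place-miss a h (located a)

              C-to : C 𝕂 (⋁ ν (𝕊 3) (northPole 3)) to
              C-to = mkC λ a ε>0 → at a ε>0 (located a)
                where
                at : ∀ a {ε} → 0ℚ ℚ.< ε → ∀ s → ∃[ η ] (0ℚ ℚ.< η × (∀ a′ → dist 𝕂 a a′ ≤ fromℚ η → dist (⋁ ν (𝕊 3) (northPole 3)) (place a s) (to a′) ≤ fromℚ ε))
                at a {ε} ε>0 (inj₁ h) =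
                  let (η , η>0 , k) = persist-< 𝕂 Cont-lowest {0ℝ} a (minF-glb-< (λ i → ht i a) (fromℚ-mono-< ℚ-lt) h)
                  in η , η>0 , λ a′ p → dist-move (⋁ ν (𝕊 3) (northPole 3)) {nothing} {nothing} {to a′} (fromℚ-mono (ℚ.<⇒≤ ε>0))
                       (to-miss a′ λ i → <-≤-trans (k a′ p) (minF≤ (λ i → ht i a′) i))
                at a {ε} ε>0 (inj₂ (i , h)) =
                  let (η , η>0 , k) = modulus (C-∘ 𝕂 (𝕊 3) (⋁ ν (𝕊 3) (northPole 3)) (C-inj i) (C-∘ 𝕂 (𝕊 3) (𝕊 3) C-E₁ (C-γ i))) a ε>0
                      (ζ , ζ>0 , l) = persist-< 𝕂 (Cont-- 𝕂 (Cont-const 𝕂 (fromℚ ½)) (Cont-ht i)) {0ℝ} a (gap-pos h)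
                  in η ℚ.⊓ ζ , ⊓-pos η>0 ζ>0 , λ a′ p → dist-move (⋁ ν (𝕊 3) (northPole 3)) {inj i (E₁ (γ i a))} {inj i (E₁ (γ i a′))} {to a′}
                       (k a′ (≤-trans p (fromℚ-mono (ℚ.p⊓q≤p η ζ))))
                       (to-hit i a′ (gap-pos⁻ (l a′ (≤-trans p (fromℚ-mono (ℚ.p⊓q≤q η ζ))))))
                  where
                  gap-pos : ∀ {x y} → x < y → 0ℝ < y - x
                  gap-pos {x} {y} h = let (g , g>0 , r) = <⇒gap h in gap⇒< g>0 (0≤⇒≤ (≤⇒0≤ r) λ k →
                    solve 3 (λ x y g → y :- (x :+ g) := (y :- x) :- (con 0ℚ :+ g)) refl (seq x k) (seq y k) g)
                  gap-pos⁻ : ∀ {x y} → 0ℝ < y - x → x < y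
                  gap-pos⁻ {x} {y} h = let (g , g>0 , r) = <⇒gap h in gap⇒< g>0 (0≤⇒≤ (≤⇒0≤ r) λ k →
                    solve 3 (λ x y g → (y :- x) :- (con 0ℚ :+ g) := y :- (x :+ g)) refl (seq x k) (seq y k) g)

            -- The map from the wedge

            abstract
              ht-δ : ∀ i k p b → fromℚ ½ ≤ height p → fromℚ ½ ≤ ht k (δ i (p , b))
              ht-δ i k p b h = go (k Fin.≟ i)
                where
                go : Dec (k ≡ i) → fromℚ ½ ≤ ht k (δ i (p , b))
                go (yes refl) = ≤-trans h (proj₂ (∼-pt {γ i (δ i (p , b))} {p} (γδ i p b) f0))
                go (no n)     = ½≤north {γ k (δ i (p , b))} (γ-north k (δ i (p , b)) (u-δ i k (p , b) n))

              Sq-δ : ∀ i p (h : fromℚ ½ < height p) b → [ 𝕂 ] base ∼ Sq (δ i (p , b))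
              Sq-δ i p h b = ∼-sym 𝕂 (Sq-base (δ i (p , b)) (lowest≥½ (δ i (p , b)) λ k → ht-δ i k p b (<⇒≤ h)))

            module GlueS (i : Fin ν) = Glue (𝕊 3) 𝕂 height (Cont-pt f0) ½ ¾ ℚ-lt (λ _ → base) (C-const ((𝕊 3) ↾ λ p → fromℚ ½ < height p) 𝕂 base)
              (λ x → Sq (δ i x)) (C-∘ ((𝕊 3) ↾ Below) 𝕂 𝕂 C-Sq (C-δ i)) (Sq-δ i)

            opaque
              from₁ : Fin ν → SpherePoint 3 → Pt K
              from₁ i = GlueS.glue i

              C-from₁ : ∀ i → C (𝕊 3) 𝕂 (from₁ i)
              C-from₁ i = GlueS.glue-cont i

              from₁-high : ∀ i p → fromℚ ½ < height p → [ 𝕂 ] base ∼ from₁ i p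
              from₁-high i p h = GlueS.glue-f i p h

              from₁-low : ∀ i p b → [ 𝕂 ] Sq (δ i (p , b)) ∼ from₁ i p
              from₁-low i p b = GlueS.glue-g i p b

            ½<¾ : fromℚ ½ < fromℚ ¾
            ½<¾ = fromℚ-mono-< ℚ-lt

            module OutK = Out 𝕀 𝕂 (λ i x → from₁ i (proj₁ x)) (λ i → C-∘ ((𝕊 3) ×ₘ 𝕀) (𝕊 3) 𝕂 (C-from₁ i) (C-proj₁ (𝕊 3) 𝕀)) base
              (λ i t → ∼-sym 𝕂 (from₁-high i (northPole 3) (fromℚ-mono-< ℚ-lt)))

            from : ∣ ⋁ ν (𝕊 3) (northPole 3) ∣ₘ → Pt K
            from w = OutK.out (w , 0ᴵ)

            C-from : C (⋁ ν (𝕊 3) (northPole 3)) 𝕂 from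
            C-from = C-∘ (⋁ ν (𝕊 3) (northPole 3)) ((⋁ ν (𝕊 3) (northPole 3)) ×ₘ 𝕀) 𝕂 OutK.out-cont (C-pair (⋁ ν (𝕊 3) (northPole 3)) (⋁ ν (𝕊 3) (northPole 3)) 𝕀 (C-id (⋁ ν (𝕊 3) (northPole 3))) (C-const (⋁ ν (𝕊 3) (northPole 3)) 𝕀 0ᴵ))

            -- Homotopies

            abstract
              high⇒base : ∀ a → (∀ i → fromℚ ½ ≤ height (E₁ (γ i a))) → [ 𝕂 ] Sq (e₁ a) ∼ base
              high⇒base a h = Sq-base (e₁ a) (lowest≥½ (e₁ a) λ i → ≤-trans (h i) (proj₂ (∼-pt {γ i (e₁ a)} {E₁ (γ i a)} (γ-e i a 1ᴵ) f0)))

              others-north : ∀ i k a → ht i a < fromℚ ½ → k ≢ i → [ 𝕊 3 ] E₁ (γ k a) ∼ (northPole 3)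
              others-north i k a h n = by-cases (u k a) 0ℝ (∼-stable (𝕊 3)) (λ u≤0 → E₁-∼north (γ-north k a (u≤0 , u≥0 k a)))
                λ 0<uk → by-cases (u i a) 0ℝ (∼-stable (𝕊 3)) (λ u≤0 → ⊥-elim (u>0-if-low i a (<-trans h (fromℚ-mono-< ℚ-lt)) u≤0))
                  λ 0<ui → ⊥-elim (n (exclusive k i a 0<uk 0<ui))

              -- Since `E₁ (γ i a)` is `γ i (e₁ a)` up to distance 0, `δ` recovers `e₁ a` from it,
              -- and `Sq` remains. Near the north pole both sides are `base`.
              from-hit : ∀ i a → ht i a < fromℚ ½ → [ 𝕂 ] from₁ i (E₁ (γ i a)) ∼ Sq (e₁ a)
              from-hit i a h = go (compare ½<¾ (height (E₁ (γ i a))))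
                where
                all : fromℚ ½ < height (E₁ (γ i a)) → ∀ k → Dec (k ≡ i) → fromℚ ½ ≤ height (E₁ (γ k a))
                all p k (yes refl) = <⇒≤ p
                all p k (no n)     = ½≤north {E₁ (γ k a)} (others-north i k a h n)
                go : (fromℚ ½ < height (E₁ (γ i a))) ⊎ (height (E₁ (γ i a)) < fromℚ ¾) → [ 𝕂 ] from₁ i (E₁ (γ i a)) ∼ Sq (e₁ a)
                go (inj₁ p) = ∼-trans 𝕂 (∼-sym 𝕂 (from₁-high i (E₁ (γ i a)) p)) (∼-sym 𝕂 (high⇒base a λ k → all p k (k Fin.≟ i)))
                go (inj₂ b) = ∼-trans 𝕂 (C-resp (𝕊 3) 𝕂 (C-from₁ i) (∼-sym (𝕊 3) (γ-e i a 1ᴵ)))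
                    (∼-trans 𝕂 (∼-sym 𝕂 (from₁-low i (γ i (e₁ a)) b′)) (C-resp 𝕂 𝕂 C-Sq (δγ i (e₁ a) b′)))
                  where
                  b′ : Below (γ i (e₁ a))
                  b′ = ≤-<-trans (proj₁ (∼-pt {γ i (e₁ a)} {E₁ (γ i a)} (γ-e i a 1ᴵ) f0)) b

              from∘to≈ : ∀ a → [ 𝕂 ] from (to a) ∼ Sq (e₁ a)
              from∘to≈ a = go (located a)
                where
                go : (∀ i → 0ℝ < ht i a) ⊎ Σ (Fin ν) (λ i → ht i a < fromℚ ½) → [ 𝕂 ] from (to a) ∼ Sq (e₁ a)
                go (inj₁ h) = ∼-trans 𝕂 (C-resp (⋁ ν (𝕊 3) (northPole 3)) 𝕂 C-from (∼-sym (⋁ ν (𝕊 3) (northPole 3)) {nothing} {to a} (to-miss a h)))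
                    (∼-sym 𝕂 (high⇒base a λ i → ½≤north {E₁ (γ i a)} (E₁-collapse (γ i a) (<⇒≤ (h i)))))
                go (inj₂ (i , h)) = ∼-trans 𝕂 (C-resp (⋁ ν (𝕊 3) (northPole 3)) 𝕂 C-from (∼-sym (⋁ ν (𝕊 3) (northPole 3)) {inj i (E₁ (γ i a))} {to a} (to-hit i a h))) (from-hit i a h)

              to-base : [ ⋁ ν (𝕊 3) (northPole 3) ] nothing ∼ to base
              to-base = to-miss base λ i → 0<north {γ i base} (γ-ι i (vtx L v₀ s₀))

              -- One `E₁` arises because `γ` turns `Sq` after `δ` into `E₁`, the other from the
              -- definition of `to`.
              to-from₁ : ∀ i p → [ ⋁ ν (𝕊 3) (northPole 3) ] to (from₁ i p) ∼ inj i (E₁ (E₁ p))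
              to-from₁ i p = branch (compare ½<¾ (height p))
                where
                a : Below p → Pt K
                a b = Sq (δ i (p , b))
                γa : ∀ b → [ 𝕊 3 ] γ i (a b) ∼ E₁ p
                γa b = ∼-trans (𝕊 3) (γ-Sq i (δ i (p , b))) (C-resp (𝕊 3) (𝕊 3) C-E₁ (γδ i p b))
                all : ∀ b → 0ℝ < ht i (a b) → ∀ k → Dec (k ≡ i) → 0ℝ < ht k (a b)
                all b h k (yes refl) = h
                all b h k (no n)     = 0<north {γ k (a b)} (∼-trans (𝕊 3) (γ-Sq k (δ i (p , b))) (E₁-∼north (γ-north k (δ i (p , b)) (u-δ i k (p , b) n))))
                decide : ∀ b → (0ℝ < ht i (a b)) ⊎ (ht i (a b) < fromℚ ½) → [ ⋁ ν (𝕊 3) (northPole 3) ] to (a b) ∼ inj i (E₁ (E₁ p))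
                decide b (inj₁ h) = ∼-trans (⋁ ν (𝕊 3) (northPole 3)) {to (a b)} {nothing} (∼-sym (⋁ ν (𝕊 3) (northPole 3)) {nothing} {to (a b)} (to-miss (a b) λ k → all b h k (k Fin.≟ i)))
                  (∼-sym (⋁ ν (𝕊 3) (northPole 3)) {inj i (E₁ (E₁ p))} {nothing} (inj-base i (E₁-collapse (E₁ p) (≤-trans (<⇒≤ h) (proj₁ (∼-pt {γ i (a b)} {E₁ p} (γa b) f0))))))
                decide b (inj₂ h) = ∼-trans (⋁ ν (𝕊 3) (northPole 3)) {to (a b)} {inj i (E₁ (γ i (a b)))} (∼-sym (⋁ ν (𝕊 3) (northPole 3)) {inj i (E₁ (γ i (a b)))} {to (a b)} (to-hit i (a b) h))
                  (C-resp (𝕊 3) (⋁ ν (𝕊 3) (northPole 3)) (C-inj i) (C-resp (𝕊 3) (𝕊 3) C-E₁ (γa b)))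
                branch : (fromℚ ½ < height p) ⊎ Below p → [ ⋁ ν (𝕊 3) (northPole 3) ] to (from₁ i p) ∼ inj i (E₁ (E₁ p))
                branch (inj₁ h) = ∼-trans (⋁ ν (𝕊 3) (northPole 3)) {to (from₁ i p)} {nothing} (∼-trans (⋁ ν (𝕊 3) (northPole 3)) {to (from₁ i p)} {to base} (C-resp 𝕂 (⋁ ν (𝕊 3) (northPole 3)) C-to (∼-sym 𝕂 (from₁-high i p h))) (∼-sym (⋁ ν (𝕊 3) (northPole 3)) {nothing} {to base} to-base))
                  (∼-sym (⋁ ν (𝕊 3) (northPole 3)) {inj i (E₁ (E₁ p))} {nothing} (inj-base i (E₁-∼north (E₁-collapse p (≤-trans (fromℚ-mono {0ℚ} {½} ℚ-le) (<⇒≤ h))))))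
                branch (inj₂ b) = ∼-trans (⋁ ν (𝕊 3) (northPole 3)) {to (from₁ i p)} {to (a b)} (C-resp 𝕂 (⋁ ν (𝕊 3) (northPole 3)) C-to (∼-sym 𝕂 (from₁-low i p b))) (decide b (compare (fromℚ-mono-< {0ℚ} {½} ℚ-lt) (ht i (a b))))

            module OutW = Out 𝕀 (⋁ ν (𝕊 3) (northPole 3)) (λ i x → inj i (E x)) (λ i → C-∘ ((𝕊 3) ×ₘ 𝕀) (𝕊 3) (⋁ ν (𝕊 3) (northPole 3)) (C-inj i) C-E) nothing
              (λ i t → inj-base i (E-fixes-north t))

            E̅ : ∣ ⋁ ν (𝕊 3) (northPole 3) ∣ₘ → ∣ ⋁ ν (𝕊 3) (northPole 3) ∣ₘ
            E̅ w = OutW.out (w , 1ᴵ)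

            C-E̅ : C (⋁ ν (𝕊 3) (northPole 3)) (⋁ ν (𝕊 3) (northPole 3)) E̅
            C-E̅ = C-∘ (⋁ ν (𝕊 3) (northPole 3)) ((⋁ ν (𝕊 3) (northPole 3)) ×ₘ 𝕀) (⋁ ν (𝕊 3) (northPole 3)) OutW.out-cont (C-pair (⋁ ν (𝕊 3) (northPole 3)) (⋁ ν (𝕊 3) (northPole 3)) 𝕀 (C-id (⋁ ν (𝕊 3) (northPole 3))) (C-const (⋁ ν (𝕊 3) (northPole 3)) 𝕀 1ᴵ))

            id~E̅ : Htpy (⋁ ν (𝕊 3) (northPole 3)) (⋁ ν (𝕊 3) (northPole 3)) id E̅
            id~E̅ = record { H = OutW.out ; H-cont = OutW.out-cont
              ; start = λ { nothing → ∼-refl (⋁ ν (𝕊 3) (northPole 3)) ; (just (i , p)) → C-resp (𝕊 3) (⋁ ν (𝕊 3) (northPole 3)) (C-inj i) (E-start p) } ; end = λ _ → ∼-refl (⋁ ν (𝕊 3) (northPole 3)) }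

            abstract
              to∘from≈ : ∀ w → [ ⋁ ν (𝕊 3) (northPole 3) ] to (from w) ∼ E̅ (E̅ w)
              to∘from≈ nothing        = ∼-sym (⋁ ν (𝕊 3) (northPole 3)) {nothing} {to base} to-base
              to∘from≈ (just (i , p)) = to-from₁ i p

            from∘to~id : Htpy 𝕂 𝕂 (λ a → from (to a)) id
            from∘to~id = htpy-cong 𝕂 𝕂 (λ a → ∼-sym 𝕂 (from∘to≈ a)) (λ _ → ∼-refl 𝕂)
              -- The chain is id, `e₁`, `e₁ ∘ e₁`, `Sq ∘ e₁`; the last map is `from ∘ to` up to
              -- distance 0.
              (htpy-sym 𝕂 𝕂 (htpy-trans 𝕂 𝕂 (htpy-trans 𝕂 𝕂 id~e₁ (htpy-pre 𝕂 𝕂 𝕂 id~e₁ C-e₁)) (htpy-pre 𝕂 𝕂 𝕂 e₁~Sq C-e₁)))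

            to∘from~id : Htpy (⋁ ν (𝕊 3) (northPole 3)) (⋁ ν (𝕊 3) (northPole 3)) (λ w → to (from w)) id
            to∘from~id = htpy-cong (⋁ ν (𝕊 3) (northPole 3)) (⋁ ν (𝕊 3) (northPole 3)) (λ w → ∼-sym (⋁ ν (𝕊 3) (northPole 3)) (to∘from≈ w)) (λ _ → ∼-refl (⋁ ν (𝕊 3) (northPole 3)))
              (htpy-sym (⋁ ν (𝕊 3) (northPole 3)) (⋁ ν (𝕊 3) (northPole 3)) (htpy-trans (⋁ ν (𝕊 3) (northPole 3)) (⋁ ν (𝕊 3) (northPole 3)) id~E̅
                (htpy-pre (⋁ ν (𝕊 3) (northPole 3)) (⋁ ν (𝕊 3) (northPole 3)) (⋁ ν (𝕊 3) (northPole 3)) id~E̅ C-E̅)))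

          wedge-theorem : ∀ {v₀} → Collapses L v₀ → ∀ X (g : ∣ X ∣ₘ → Pt K) (g′ : Pt K → ∣ X ∣ₘ) →
            (∀ x x′ → dist 𝕂 (g x) (g x′) ≤ dist X x x′) → (∀ a a′ → dist X (g′ a) (g′ a′) ≤ dist 𝕂 a a′) →
            (∀ x → dist X (g′ (g x)) x ≤ 0ℝ) → (∀ a → dist 𝕂 (g (g′ a)) a ≤ 0ℝ) → X ≃ₕ ⋁ ν (𝕊 3) (northPole 3)
          wedge-theorem {v₀} col X g g′ i i′ l r = transport-equivalence X 𝕂 (⋁ ν (𝕊 3) (northPole 3)) (C-isometric X 𝕂 i) (C-isometric 𝕂 X i′)
              (λ x → mk∼ (l x)) (λ a → mk∼ (r a)) C-to C-from from∘to~id to∘from~id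
            where open Contracted v₀ (proj₁ (collapses⇒contractible col)) (proj₂ (collapses⇒contractible col))

  open Realizations public

module Combinatorics where

  open import Defs using (Grid; manhattan; manhattan-isMetric; grid-finite; Δ; realization; RealizationPoint; MetricSpace; _≃ₕ_; ⋁; 𝕊; northPole)
  import Defs as ℝ
  open import Data.Bool.Base using (Bool; true; false; _xor_)
  open import Data.Empty using (⊥; ⊥-elim)
  open import Data.Fin.Base as Fin using (Fin; zero; suc; toℕ)
  import Data.Fin.Properties as Fin
  open import Data.List.Base as List using (List; []; _∷_; length)
  open import Data.List.Membership.Propositional using (_∈_)
  open import Data.List.Membership.Propositional.Properties using (∈-map⁺; ∈-map⁻; ∈-cartesianProduct⁺; ∈-cartesianProductWith⁺; ∈-allFin; ∈-lookup)
  open import Data.List.Relation.Binary.Subset.Propositional using (_⊆_)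
  open import Data.List.Relation.Unary.All as All using (All; []; _∷_)
  open import Data.List.Relation.Unary.All.Properties using (¬Any⇒All¬)
  open import Data.List.Relation.Unary.AllPairs using (AllPairs; []; _∷_)
  open import Data.List.Relation.Unary.Any as Any using (Any; here; there; any?)
  open import Data.List.Relation.Unary.Any.Properties using (lookup-index)
  open import Data.List.Relation.Unary.Unique.Propositional using (Unique)
  import Data.List.Relation.Unary.Unique.Propositional.Properties as Unique
  open import Data.Nat.Base
  open import Data.Nat.Properties
  open import Data.Product.Base using (Σ; ∃-syntax; _×_; _,_; proj₁; proj₂)
  open import Data.Sum.Base using (_⊎_; inj₁; inj₂)
  open import Data.Unit.Base using (⊤; tt)
  open import Data.Vec.Base as Vec using (Vec; []; _∷_)
  open import Data.Vec.Properties using (lookup∘tabulate) renaming (≡-dec to Vec-≡-dec)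
  open import Function.Bundles using (Inverse)
  import Function.Metric.Nat.Structures as Nat
  open import Relation.Binary.PropositionalEquality
  open import Relation.Nullary.Decidable using (Dec; yes; no; _×-dec_; _⊎-dec_; _→-dec_; ¬?; map′; decidable-stable)
  open import Relation.Nullary.Negation.Core using (¬_; contradiction)
  open Analysis using (dist; Complex; S; closed; stable; _∖_; Collapses; done; step; module Realization)

  -- Median geometry of the grid and the layerwise collapse.

  module Grids where

    -- The Hamming metric on bit vectors

    bit : Bool → Bool → ℕ
    bit true  false = 1
    bit false true  = 1
    bit true  true  = 0
    bit false false = 0

    ham : ∀ {N} → Vec Bool N → Vec Bool N → ℕ
    ham []      []      = 0
    ham (x ∷ u) (y ∷ v) = bit x y + ham u v

    maj : Bool → Bool → Bool → Bool
    maj true  true  _     = true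
    maj true  false z     = z
    maj false true  z     = z
    maj false false _     = false

    majs : ∀ {N} → Vec Bool N → Vec Bool N → Vec Bool N → Vec Bool N
    majs []      []      []      = []
    majs (x ∷ u) (y ∷ v) (z ∷ w) = maj x y z ∷ majs u v w

    xors : ∀ {N} → Vec Bool N → Vec Bool N → Vec Bool N → Vec Bool N
    xors []      []      []      = []
    xors (x ∷ u) (y ∷ v) (z ∷ w) = (x xor (y xor z)) ∷ xors u v w

    private
      swap : ∀ a b c d → (a + b) + (c + d) ≡ (a + c) + (b + d)
      swap a b c d = trans (+-assoc a b (c + d)) (trans (cong (a +_) (trans (sym (+-assoc b c d))
        (trans (cong (_+ d) (+-comm b c)) (+-assoc c b d)))) (sym (+-assoc a c (b + d))))

    bit-sym : ∀ x y → bit x y ≡ bit y x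
    bit-sym true  true  = refl
    bit-sym true  false = refl
    bit-sym false true  = refl
    bit-sym false false = refl

    bit-triangle : ∀ x y z → bit x z ≤ bit x y + bit y z
    bit-triangle false false false = z≤n
    bit-triangle false false true = s≤s z≤n
    bit-triangle false true false = z≤n
    bit-triangle false true true = s≤s z≤n
    bit-triangle true false false = s≤s z≤n
    bit-triangle true false true = z≤n
    bit-triangle true true false = s≤s z≤n
    bit-triangle true true true = z≤n

    ham-sym : ∀ {N} (u v : Vec Bool N) → ham u v ≡ ham v u
    ham-sym []      []      = refl
    ham-sym (x ∷ u) (y ∷ v) = cong₂ _+_ (bit-sym x y) (ham-sym u v)

    ham-triangle : ∀ {N} (u v w : Vec Bool N) → ham u w ≤ ham u v + ham v w
    ham-triangle []      []      []      = z≤n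
    ham-triangle (x ∷ u) (y ∷ v) (z ∷ w) = ≤-trans (+-mono-≤ (bit-triangle x y z) (ham-triangle u v w))
      (≤-reflexive (swap (bit x y) (bit y z) (ham u v) (ham v w)))

    maj-between : ∀ x y z → bit x (maj x y z) + bit (maj x y z) y ≡ bit x y
    maj-between false false false = refl
    maj-between false false true = refl
    maj-between false true false = refl
    maj-between false true true = refl
    maj-between true false false = refl
    maj-between true false true = refl
    maj-between true true false = refl
    maj-between true true true = refl

    maj-rotate : ∀ x y z → maj x y z ≡ maj y z x
    maj-rotate false false false = refl
    maj-rotate false false true = refl
    maj-rotate false true false = refl
    maj-rotate false true true = refl
    maj-rotate true false false = refl
    maj-rotate true false true = refl
    maj-rotate true true false = refl
    maj-rotate true true true = refl

    majs-between : ∀ {N} (u v w : Vec Bool N) → ham u (majs u v w) + ham (majs u v w) v ≡ ham u v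
    majs-between []      []      []      = refl
    majs-between (x ∷ u) (y ∷ v) (z ∷ w) = trans (swap (bit x (maj x y z)) (ham u (majs u v w)) (bit (maj x y z) y) (ham (majs u v w) v))
      (cong₂ _+_ (maj-between x y z) (majs-between u v w))

    majs-rotate : ∀ {N} (u v w : Vec Bool N) → majs u v w ≡ majs v w u
    majs-rotate []      []      []      = refl
    majs-rotate (x ∷ u) (y ∷ v) (z ∷ w) = cong₂ _∷_ (maj-rotate x y z) (majs-rotate u v w)

    sum₃-bit : Bool → Bool → Bool → Bool → ℕ
    sum₃-bit c x y z = bit c x + (bit c y + bit c z)

    sum₃ : ∀ {N} → Vec Bool N → Vec Bool N → Vec Bool N → Vec Bool N → ℕ
    sum₃ c u v w = ham c u + (ham c v + ham c w)

    private
      swap₃ : ∀ a b c a′ b′ c′ → (a + a′) + ((b + b′) + (c + c′)) ≡ (a + (b + c)) + (a′ + (b′ + c′))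
      swap₃ a b c a′ b′ c′ = trans (cong ((a + a′) +_) (swap b b′ c c′)) (swap a a′ (b + c) (b′ + c′))

    maj-minimal : ∀ c x y z → bit c (maj x y z) + sum₃-bit (maj x y z) x y z ≤ sum₃-bit c x y z
    maj-minimal false false false false = z≤n
    maj-minimal false false false true = s≤s z≤n
    maj-minimal false false true false = s≤s z≤n
    maj-minimal false false true true = s≤s (s≤s z≤n)
    maj-minimal false true false false = s≤s z≤n
    maj-minimal false true false true = s≤s (s≤s z≤n)
    maj-minimal false true true false = s≤s (s≤s z≤n)
    maj-minimal false true true true = s≤s z≤n
    maj-minimal true false false false = s≤s z≤n
    maj-minimal true false false true = s≤s (s≤s z≤n)
    maj-minimal true false true false = s≤s (s≤s z≤n)
    maj-minimal true false true true = s≤s z≤n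
    maj-minimal true true false false = s≤s (s≤s z≤n)
    maj-minimal true true false true = s≤s z≤n
    maj-minimal true true true false = s≤s z≤n
    maj-minimal true true true true = z≤n

    -- In each bit the majority value minimises the sum of the three distances, and deviating from
    -- it costs at least 1.
    majs-minimal : ∀ {N} (c u v w : Vec Bool N) → ham c (majs u v w) + sum₃ (majs u v w) u v w ≤ sum₃ c u v w
    majs-minimal []      []      []      []      = z≤n
    majs-minimal (b ∷ c) (x ∷ u) (y ∷ v) (z ∷ w) = begin
      (bit b p + ham c q) + sum₃ (p ∷ q) (x ∷ u) (y ∷ v) (z ∷ w)
        ≡⟨ cong ((bit b p + ham c q) +_) (swap₃ (bit p x) (bit p y) (bit p z) (ham q u) (ham q v) (ham q w)) ⟩
      (bit b p + ham c q) + (sum₃-bit p x y z + sum₃ q u v w)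
        ≡⟨ swap (bit b p) (ham c q) (sum₃-bit p x y z) (sum₃ q u v w) ⟩
      (bit b p + sum₃-bit p x y z) + (ham c q + sum₃ q u v w)
        ≤⟨ +-mono-≤ (maj-minimal b x y z) (majs-minimal c u v w) ⟩
      sum₃-bit b x y z + sum₃ c u v w
        ≡⟨ swap₃ (bit b x) (bit b y) (bit b z) (ham c u) (ham c v) (ham c w) ⟨
      sum₃ (b ∷ c) (x ∷ u) (y ∷ v) (z ∷ w) ∎
      where
      open ≤-Reasoning
      p = maj x y z
      q = majs u v w

    -- If x, y and z lie on geodesics from their median p to t, then so does x ⊕ y ⊕ z,
    -- the point reached from p by making all three moves.
    maj-reach : ∀ x y z t → bit (maj x y z) x + bit x t ≤ bit (maj x y z) t → bit (maj x y z) y + bit y t ≤ bit (maj x y z) t →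
      bit (maj x y z) z + bit z t ≤ bit (maj x y z) t → bit t (x xor (y xor z)) + sum₃-bit (maj x y z) x y z ≤ bit (maj x y z) t
    maj-reach false false false false _ _ _ = z≤n
    maj-reach false false false true _ _ _ = s≤s z≤n
    maj-reach false false true false _ _ ()
    maj-reach false false true true _ _ _ = s≤s z≤n
    maj-reach false true false false _ () _
    maj-reach false true false true _ _ _ = s≤s z≤n
    maj-reach false true true false _ _ _ = s≤s z≤n
    maj-reach false true true true () _ _
    maj-reach true false false false () _ _
    maj-reach true false false true _ _ _ = s≤s z≤n
    maj-reach true false true false _ _ _ = s≤s z≤n
    maj-reach true false true true _ () _
    maj-reach true true false false _ _ _ = s≤s z≤n
    maj-reach true true false true _ _ ()
    maj-reach true true true false _ _ _ = s≤s z≤n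
    maj-reach true true true true _ _ _ = z≤n

    private
      -- Two triangle inequalities whose sum is an equality are equalities themselves. This passes
      -- from a vector lying on a geodesic to each of its bits.
      split : ∀ a b c {A B C} → c ≤ a + b → C ≤ A + B → (a + A) + (b + B) ≤ c + C → a + b ≤ c × A + B ≤ C
      split a b c {A} {B} {C} p q h =
        +-cancelʳ-≤ (A + B) (a + b) c (≤-trans h′ (+-monoʳ-≤ c q)) , +-cancelˡ-≤ (a + b) (A + B) C (≤-trans h′ (+-monoˡ-≤ C p))
        where
        h′ : (a + b) + (A + B) ≤ c + C
        h′ = ≤-trans (≤-reflexive (sym (swap a A b B))) h

    majs-reach : ∀ {N} (u v w t : Vec Bool N) → ham (majs u v w) u + ham u t ≤ ham (majs u v w) t → ham (majs u v w) v + ham v t ≤ ham (majs u v w) t →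
      ham (majs u v w) w + ham w t ≤ ham (majs u v w) t → ham t (xors u v w) + sum₃ (majs u v w) u v w ≤ ham (majs u v w) t
    majs-reach []      []      []      []      _ _ _ = z≤n
    majs-reach (x ∷ u) (y ∷ v) (z ∷ w) (s ∷ t) h₁ h₂ h₃ = begin
      (bit s (x xor (y xor z)) + ham t (xors u v w)) + sum₃ (p ∷ q) (x ∷ u) (y ∷ v) (z ∷ w)
        ≡⟨ cong ((bit s (x xor (y xor z)) + ham t (xors u v w)) +_) (swap₃ (bit p x) (bit p y) (bit p z) (ham q u) (ham q v) (ham q w)) ⟩
      (bit s (x xor (y xor z)) + ham t (xors u v w)) + (sum₃-bit p x y z + sum₃ q u v w)
        ≡⟨ swap (bit s (x xor (y xor z))) (ham t (xors u v w)) (sum₃-bit p x y z) (sum₃ q u v w) ⟩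
      (bit s (x xor (y xor z)) + sum₃-bit p x y z) + (ham t (xors u v w) + sum₃ q u v w)
        ≤⟨ +-mono-≤ (maj-reach x y z s (proj₁ s₁) (proj₁ s₂) (proj₁ s₃)) (majs-reach u v w t (proj₂ s₁) (proj₂ s₂) (proj₂ s₃)) ⟩
      bit p s + ham q t ∎
      where
      open ≤-Reasoning
      p = maj x y z
      q = majs u v w
      s₁ = split (bit p x) (bit x s) (bit p s) (bit-triangle p x s) (ham-triangle q u t) h₁
      s₂ = split (bit p y) (bit y s) (bit p s) (bit-triangle p y s) (ham-triangle q v t) h₂
      s₃ = split (bit p z) (bit z s) (bit p s) (bit-triangle p z s) (ham-triangle q w t) h₃

    -- The unary code, an isometric embedding of the grid into bit vectors

    code : ∀ {m} → Fin (suc m) → Vec Bool m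
    code {zero}  zero    = []
    code {suc m} zero    = false ∷ code {m} zero
    code {suc m} (suc a) = true ∷ code a

    ham-code : ∀ {m} (a b : Fin (suc m)) → ham (code a) (code b) ≡ ∣ toℕ a - toℕ b ∣
    ham-code {zero}  zero    zero    = refl
    ham-code {suc m} zero    zero    = ham-code {m} zero zero
    ham-code {suc m} zero    (suc b) = cong suc (ham-code zero b)
    ham-code {suc m} (suc a) zero    = cong suc (trans (ham-code a zero) (∣-∣-identityʳ (toℕ a)))
    ham-code {suc m} (suc a) (suc b) = ham-code a b

    med₁ : ∀ {m} → Fin (suc m) → Fin (suc m) → Fin (suc m) → Fin (suc m)
    med₁         zero    zero    _       = zero
    med₁         zero    (suc b) zero    = zero
    med₁         (suc a) zero    zero    = zero
    med₁ {suc m} zero    (suc b) (suc c) = suc (med₁ zero b c)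
    med₁ {suc m} (suc a) zero    (suc c) = suc (med₁ a zero c)
    med₁ {suc m} (suc a) (suc b) zero    = suc (med₁ a b zero)
    med₁ {suc m} (suc a) (suc b) (suc c) = suc (med₁ a b c)

    private
      med₁-0 : ∀ {m} (b : Fin (suc m)) → med₁ zero b zero ≡ zero
      med₁-0 zero    = refl
      med₁-0 (suc b) = refl

      med₁-00 : ∀ {m} (a : Fin (suc m)) → med₁ a zero zero ≡ zero
      med₁-00 zero    = refl
      med₁-00 (suc b) = refl

    code-med₁ : ∀ {m} (a b c : Fin (suc m)) → code (med₁ a b c) ≡ majs (code a) (code b) (code c)
    code-med₁ {zero}  zero    zero    zero    = refl
    code-med₁ {suc m} zero    zero    zero    = cong (false ∷_) (code-med₁ {m} zero zero zero)
    code-med₁ {suc m} zero    zero    (suc c) = cong (false ∷_) (code-med₁ zero zero c)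
    code-med₁ {suc m} zero    (suc b) zero    = cong (false ∷_) (trans (cong code (sym (med₁-0 b))) (code-med₁ zero b zero))
    code-med₁ {suc m} (suc a) zero    zero    = cong (false ∷_) (trans (cong code (sym (med₁-00 a))) (code-med₁ a zero zero))
    code-med₁ {suc m} zero    (suc b) (suc c) = cong (true ∷_) (code-med₁ zero b c)
    code-med₁ {suc m} (suc a) zero    (suc c) = cong (true ∷_) (code-med₁ a zero c)
    code-med₁ {suc m} (suc a) (suc b) zero    = cong (true ∷_) (code-med₁ a b zero)
    code-med₁ {suc m} (suc a) (suc b) (suc c) = cong (true ∷_) (code-med₁ a b c)

    ham-++ : ∀ {M N} (u v : Vec Bool M) (w t : Vec Bool N) → ham (u Vec.++ w) (v Vec.++ t) ≡ ham u v + ham w t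
    ham-++ []      []      w t = refl
    ham-++ (x ∷ u) (y ∷ v) w t = trans (cong (bit x y +_) (ham-++ u v w t)) (sym (+-assoc (bit x y) (ham u v) (ham w t)))

    majs-++ : ∀ {M N} (u v w : Vec Bool M) (u′ v′ w′ : Vec Bool N) → majs (u Vec.++ u′) (v Vec.++ v′) (w Vec.++ w′) ≡ majs u v w Vec.++ majs u′ v′ w′
    majs-++ []      []      []      u′ v′ w′ = refl
    majs-++ (x ∷ u) (y ∷ v) (z ∷ w) u′ v′ w′ = cong (maj x y z ∷_) (majs-++ u v w u′ v′ w′)

    module _ {m : ℕ} where

      encode : ∀ {n} → Grid m n → Vec Bool (n * m)
      encode []      = []
      encode (a ∷ x) = code a Vec.++ encode x

      med : ∀ {n} → Grid m n → Grid m n → Grid m n → Grid m n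
      med []      []      []      = []
      med (a ∷ x) (b ∷ y) (c ∷ z) = med₁ a b c ∷ med x y z

      opaque
        d : ∀ {n} → Grid m n → Grid m n → ℕ
        d = manhattan

        d≡manhattan : ∀ {n} (x y : Grid m n) → d x y ≡ manhattan x y
        d≡manhattan x y = refl

        d-∷ : ∀ {n} a b (x y : Grid m n) → d (a ∷ x) (b ∷ y) ≡ ∣ toℕ a - toℕ b ∣ + d x y
        d-∷ a b x y = refl

        d≡ham : ∀ {n} (x y : Grid m n) → d x y ≡ ham (encode x) (encode y)
        d≡ham []      []      = refl
        d≡ham (a ∷ x) (b ∷ y) = trans (cong₂ _+_ (sym (ham-code a b)) (d≡ham x y)) (sym (ham-++ (code a) (code b) (encode x) (encode y)))

      encode-med : ∀ {n} (x y z : Grid m n) → encode (med x y z) ≡ majs (encode x) (encode y) (encode z)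
      encode-med []      []      []      = refl
      encode-med (a ∷ x) (b ∷ y) (c ∷ z) = trans (cong₂ Vec._++_ (code-med₁ a b c) (encode-med x y z))
        (sym (majs-++ (code a) (code b) (code c) (encode x) (encode y) (encode z)))

      module _ {n : ℕ} where
        private
          module M = Nat.IsMetric (manhattan-isMetric m n)

        opaque
          unfolding d

          d-refl : ∀ (x : Grid m n) → d x x ≡ 0
          d-refl x = M.≈⇒0 {x} refl

          d-sym : ∀ (x y : Grid m n) → d x y ≡ d y x
          d-sym = M.sym

          d-triangle : ∀ (x y z : Grid m n) → d x z ≤ d x y + d y z
          d-triangle = M.triangle

          d≡0 : ∀ {x y : Grid m n} → d x y ≡ 0 → x ≡ y
          d≡0 {x} {y} = M.0⇒≈ {x} {y}

        d>0 : ∀ {x y : Grid m n} → x ≢ y → 1 ≤ d x y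
        d>0 n = n≢0⇒n>0 λ e → n (d≡0 e)

        infix 4 _≟ᵍ_
        _≟ᵍ_ : (x y : Grid m n) → Dec (x ≡ y)
        _≟ᵍ_ = Vec-≡-dec Fin._≟_

        module Median (x y z : Grid m n) where
          p : Grid m n
          p = med x y z

          between : ∀ (u v w : Grid m n) → encode p ≡ majs (encode u) (encode v) (encode w) → d p u + d p v ≡ d u v
          between u v w e = trans (cong₂ _+_ (trans (d-sym p u) (trans (d≡ham u p) (cong (ham (encode u)) e))) (trans (d≡ham p v) (cong (λ c → ham c (encode v)) e)))
            (trans (majs-between (encode u) (encode v) (encode w)) (sym (d≡ham u v)))

          xy : d p x + d p y ≡ d x y
          xy = between x y z (encode-med x y z)

          yz : d p y + d p z ≡ d y z
          yz = between y z x (trans (encode-med x y z) (majs-rotate (encode x) (encode y) (encode z)))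

          zx : d p z + d p x ≡ d z x
          zx = between z x y (trans (encode-med x y z) (trans (majs-rotate (encode x) (encode y) (encode z)) (majs-rotate (encode y) (encode z) (encode x))))

          minimal : ∀ c → d c p + (d p x + (d p y + d p z)) ≤ d c x + (d c y + d c z)
          minimal c = subst₂ _≤_
            (sym (cong₂ _+_ (trans (d≡ham c p) (cong (ham (encode c)) e)) (cong₂ _+_ (to x) (cong₂ _+_ (to y) (to z)))))
            (sym (cong₂ _+_ (d≡ham c x) (cong₂ _+_ (d≡ham c y) (d≡ham c z))))
            (majs-minimal (encode c) (encode x) (encode y) (encode z))
            where
            e : encode p ≡ majs (encode x) (encode y) (encode z)
            e = encode-med x y z
            to : ∀ u → d p u ≡ ham (majs (encode x) (encode y) (encode z)) (encode u)
            to u = trans (d≡ham p u) (cong (λ c → ham c (encode u)) e)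

          -- Stated with `ham` because x ⊕ y ⊕ z need not be the code of a grid point.
          reach : ∀ w → d p x + d x w ≤ d p w → d p y + d y w ≤ d p w → d p z + d z w ≤ d p w →
            ham (encode w) (xors (encode x) (encode y) (encode z)) + (d p x + (d p y + d p z)) ≤ d p w
          reach w h₁ h₂ h₃ = subst₂ _≤_
            (cong (ham (encode w) (xors (encode x) (encode y) (encode z)) +_) (sym (cong₂ _+_ (to x) (cong₂ _+_ (to y) (to z)))))
            (sym (to w))
            (majs-reach (encode x) (encode y) (encode z) (encode w) (lift x h₁) (lift y h₂) (lift z h₃))
            where
            to : ∀ u → d p u ≡ ham (majs (encode x) (encode y) (encode z)) (encode u)
            to u = trans (d≡ham p u) (cong (λ c → ham c (encode u)) (encode-med x y z))
            lift : ∀ u → d p u + d u w ≤ d p w → ham (majs (encode x) (encode y) (encode z)) (encode u) + ham (encode u) (encode w) ≤ ham (majs (encode x) (encode y) (encode z)) (encode w)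
            lift u = subst₂ _≤_ (cong₂ _+_ (to u) (d≡ham u w)) (to w)

        -- Vertices at pairwise distance at most 2: centres, fourth vertices, maximality.

        private
          -- If a were 2 or more, the two upper bounds would force b = c = 0.
          small : ∀ a b c → a + b ≤ 2 → c + a ≤ 2 → 1 ≤ b + c → a ≤ 1
          small zero          b       c       _ _ _ = z≤n
          small (suc zero)    b       c       _ _ _ = s≤s z≤n
          small (suc (suc a)) zero    zero    _ _ ()
          small (suc (suc a)) (suc b) c       (s≤s (s≤s h)) _ _ = contradiction (≤-trans (≤-reflexive (sym (+-suc a b))) h) λ ()
          small (suc (suc a)) zero    (suc c) _ (s≤s h) _ = contradiction (≤-trans (≤-reflexive (sym (trans (+-suc c (suc a)) (cong suc (+-suc c a))))) h) λ { (s≤s ()) }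

          -- Adding the three equations gives 2 (a + b + c) = 3. This parity obstruction is what
          -- makes the grid graph free of triangles.
          odd : ∀ a b c → a + b ≡ 1 → b + c ≡ 1 → c + a ≡ 1 → ⊥
          odd zero    (suc zero)    zero    _ _ ()
          odd zero    (suc zero)    (suc c) _ () _
          odd (suc zero) zero       zero    _ () _
          odd (suc zero) zero       (suc zero) _ _ ()
          odd (suc zero) zero       (suc (suc c)) _ () _
          odd (suc zero) (suc b)    c       () _ _
          odd (suc (suc a)) b       c       () _ _
          odd zero    (suc (suc b)) c       () _ _

          all-one : ∀ {X Y Z} → X ≤ 1 → Y ≤ 1 → Z ≤ 1 → 3 ≤ X + (Y + Z) → Y ≡ 1 × Z ≡ 1
          all-one z≤n       z≤n       z≤n       ()
          all-one z≤n       z≤n       (s≤s z≤n) (s≤s ())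
          all-one z≤n       (s≤s z≤n) z≤n       (s≤s ())
          all-one z≤n       (s≤s z≤n) (s≤s z≤n) (s≤s (s≤s ()))
          all-one (s≤s z≤n) z≤n       z≤n       (s≤s ())
          all-one (s≤s z≤n) z≤n       (s≤s z≤n) (s≤s (s≤s ()))
          all-one (s≤s z≤n) (s≤s z≤n) z≤n       (s≤s (s≤s ()))
          all-one (s≤s z≤n) (s≤s z≤n) (s≤s z≤n) _ = refl , refl

          at-most-3 : ∀ {X Y Z} → X ≤ 1 → Y ≤ 1 → Z ≤ 1 → X + (Y + Z) ≤ 3
          at-most-3 p q r = +-mono-≤ p (+-mono-≤ q r)

          -- At most one of a, b, e vanishes, so their sum is at least 2, while X + Y + Z is at most
          -- 3; thus D ≤ 1. If D = 1, all of X, Y, Z are 1 and b or e is 1, which exhibits a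
          -- triangle.
          centre-cases : ∀ D {a b e X Y Z} → a ≤ 1 → b ≤ 1 → e ≤ 1 → 1 ≤ a + b → 1 ≤ b + e → 1 ≤ e + a → X ≤ 1 → Y ≤ 1 → Z ≤ 1 →
            D + (a + (b + e)) ≤ X + (Y + Z) → D ≡ 0 ⊎ D ≡ 1 × ((b ≡ 1 × Y ≡ 1) ⊎ (e ≡ 1 × Z ≡ 1))
          centre-cases zero _ _ _ _ _ _ _ _ _ _ = inj₁ refl
          centre-cases (suc D) (s≤s z≤n) (s≤s z≤n) (s≤s z≤n) _ _ _ p q r h =
            contradiction (≤-trans (s≤s (m≤n+m 3 D)) (≤-trans h (at-most-3 p q r))) λ { (s≤s (s≤s (s≤s ()))) }
          centre-cases (suc (suc D)) (s≤s z≤n) (s≤s z≤n) z≤n _ _ _ p q r h =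
            contradiction (≤-trans (s≤s (s≤s (m≤n+m 2 D))) (≤-trans h (at-most-3 p q r))) λ { (s≤s (s≤s (s≤s ()))) }
          centre-cases (suc (suc D)) (s≤s z≤n) z≤n (s≤s z≤n) _ _ _ p q r h =
            contradiction (≤-trans (s≤s (s≤s (m≤n+m 2 D))) (≤-trans h (at-most-3 p q r))) λ { (s≤s (s≤s (s≤s ()))) }
          centre-cases (suc (suc D)) z≤n (s≤s z≤n) (s≤s z≤n) _ _ _ p q r h =
            contradiction (≤-trans (s≤s (s≤s (m≤n+m 2 D))) (≤-trans h (at-most-3 p q r))) λ { (s≤s (s≤s (s≤s ()))) }
          centre-cases (suc zero) (s≤s z≤n) (s≤s z≤n) z≤n _ _ _ p q r h = inj₂ (refl , inj₁ (refl , proj₁ (all-one p q r h)))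
          centre-cases (suc zero) (s≤s z≤n) z≤n (s≤s z≤n) _ _ _ p q r h = inj₂ (refl , inj₂ (refl , proj₂ (all-one p q r h)))
          centre-cases (suc zero) z≤n (s≤s z≤n) (s≤s z≤n) _ _ _ p q r h = inj₂ (refl , inj₁ (refl , proj₁ (all-one p q r h)))
          centre-cases (suc D) z≤n z≤n _ () _ _ _ _ _ _
          centre-cases (suc D) _ z≤n z≤n _ () _ _ _ _ _
          centre-cases (suc D) z≤n (s≤s z≤n) z≤n _ _ () _ _ _ _

          -- If a, b, e are all 1, any of the hypotheses gives D ≤ 3; if one of them is 0, its own
          -- hypothesis gives D ≤ 2. At most one can be 0.
          reach-bound : ∀ D {a b e} → a ≤ 1 → b ≤ 1 → e ≤ 1 → 1 ≤ a + b → 1 ≤ b + e → 1 ≤ e + a → D ≤ a + 2 → D ≤ b + 2 → D ≤ e + 2 → D ≤ a + (b + e)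
          reach-bound D (s≤s z≤n) (s≤s z≤n) (s≤s z≤n) _ _ _ p q r = p
          reach-bound D z≤n (s≤s z≤n) (s≤s z≤n) _ _ _ p q r = p
          reach-bound D (s≤s z≤n) z≤n (s≤s z≤n) _ _ _ p q r = q
          reach-bound D (s≤s z≤n) (s≤s z≤n) z≤n _ _ _ p q r = r
          reach-bound D z≤n z≤n _ () _ _ _ _ _
          reach-bound D _ z≤n z≤n _ () _ _ _ _
          reach-bound D z≤n (s≤s z≤n) z≤n _ _ () _ _ _

          toward-cases : ∀ α {β γ} → β + γ ≡ 1 → γ + α ≤ 2 → 2 ≤ α + β → (β + γ) + (γ + α) ≤ α + β
          toward-cases α {zero}     {suc zero} _ (s≤s h) k = contradiction (≤-trans k (≤-trans (≤-reflexive (+-identityʳ α)) h)) λ { (s≤s ()) }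
          toward-cases α {suc zero} {zero}     _ _ _ = ≤-reflexive (+-comm 1 α)
          toward-cases α {suc zero} {suc _} () _ _
          toward-cases α {suc (suc _)} {_} () _ _

        no-triangle : ∀ {x y z : Grid m n} → d x y ≡ 1 → d y z ≡ 1 → d z x ≡ 1 → ⊥
        no-triangle {x} {y} {z} e f g = odd (d p x) (d p y) (d p z) (trans xy e) (trans yz f) (trans zx g)
          where open Median x y z

        module Triple {x y z : Grid m n} (x≢y : x ≢ y) (y≢z : y ≢ z) (z≢x : z ≢ x) (dxy : d x y ≤ 2) (dyz : d y z ≤ 2) (dzx : d z x ≤ 2) where
          open Median x y z public

          px≤1 : d p x ≤ 1
          px≤1 = small (d p x) (d p y) (d p z) (subst (_≤ 2) (sym xy) dxy) (subst (_≤ 2) (sym zx) dzx) (subst (1 ≤_) (sym yz) (d>0 y≢z))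

          py≤1 : d p y ≤ 1
          py≤1 = small (d p y) (d p z) (d p x) (subst (_≤ 2) (sym yz) dyz) (subst (_≤ 2) (sym xy) dxy) (subst (1 ≤_) (sym zx) (d>0 z≢x))

          pz≤1 : d p z ≤ 1
          pz≤1 = small (d p z) (d p x) (d p y) (subst (_≤ 2) (sym zx) dzx) (subst (_≤ 2) (sym yz) dyz) (subst (1 ≤_) (sym xy) (d>0 x≢y))

          private
            pairs : 1 ≤ d p x + d p y × 1 ≤ d p y + d p z × 1 ≤ d p z + d p x
            pairs = subst (1 ≤_) (sym xy) (d>0 x≢y) , subst (1 ≤_) (sym yz) (d>0 y≢z) , subst (1 ≤_) (sym zx) (d>0 z≢x)

          -- Minimality of the median leaves only c = p, or c adjacent to p with a common neighbour
          -- among y and z, a triangle.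
          centre≡p : ∀ c → d c x ≤ 1 → d c y ≤ 1 → d c z ≤ 1 → c ≡ p
          centre≡p c cx cy cz with centre-cases (d c p) px≤1 py≤1 pz≤1 (proj₁ pairs) (proj₁ (proj₂ pairs)) (proj₂ (proj₂ pairs)) cx cy cz (minimal c)
          ... | inj₁ e = d≡0 e
          ... | inj₂ (e , inj₁ (b , Y)) = ⊥-elim (no-triangle {c} {p} {y} e b (trans (d-sym y c) Y))
          ... | inj₂ (e , inj₂ (b , Z)) = ⊥-elim (no-triangle {c} {p} {z} e b (trans (d-sym z c) Z))

          -- Places u on a geodesic from p to w. For u adjacent to p, the distances of u and p to w
          -- differ by exactly 1; as the first is at most 2 and the second at least 2, the first is
          -- the smaller.
          toward : ∀ u w → d p u ≤ 1 → d u w ≤ 2 → 2 ≤ d p w → d p u + d u w ≤ d p w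
          toward u w h duw dpw with d p u in e
          ... | zero = ≤-trans (d-triangle u p w) (≤-reflexive (cong (_+ d p w) (trans (d-sym u p) e)))
          ... | suc zero = begin
              1 + d u w                                  ≡⟨ cong₂ _+_ (sym pu) (sym Q.zx) ⟩
              (d Q.p p + d Q.p u) + (d Q.p u + d Q.p w)  ≤⟨ toward-cases (d Q.p w) pu (subst (_≤ 2) (sym Q.zx) duw) (subst (2 ≤_) (trans (d-sym p w) (sym Q.xy)) dpw) ⟩
              d Q.p w + d Q.p p                          ≡⟨ Q.xy ⟩
              d w p                                      ≡⟨ d-sym w p ⟩
              d p w                                      ∎
            where
            open ≤-Reasoning
            module Q = Median w p u
            pu : d Q.p p + d Q.p u ≡ 1
            pu = trans Q.yz e
          toward u w (s≤s ()) duw dpw | suc (suc _)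

          private
            -- By `toward` all of x, y, z lie on geodesics from the median to w. Then `reach` bounds
            -- the distance from p to w below by the sum of the three steps plus the distance from w
            -- to x ⊕ y ⊕ z, and `reach-bound` bounds it above by the sum of the steps.
            fourth : ∀ w → d x w ≤ 2 → d y w ≤ 2 → d z w ≤ 2 → 2 ≤ d p w → ham (encode w) (xors (encode x) (encode y) (encode z)) ≡ 0
            fourth w xw yw zw pw = n≤0⇒n≡0 (+-cancelʳ-≤ (d p x + (d p y + d p z)) _ 0 (≤-trans
              (reach w (toward x w px≤1 xw pw) (toward y w py≤1 yw pw) (toward z w pz≤1 zw pw))
              (reach-bound (d p w) px≤1 py≤1 pz≤1 (proj₁ pairs) (proj₁ (proj₂ pairs)) (proj₂ (proj₂ pairs)) (via x xw) (via y yw) (via z zw))))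
              where
              via : ∀ u → d u w ≤ 2 → d p w ≤ d p u + 2
              via u h = ≤-trans (d-triangle p u w) (+-monoʳ-≤ (d p u) h)

          fourth-unique : ∀ w w′ → d x w ≤ 2 → d y w ≤ 2 → d z w ≤ 2 → 2 ≤ d p w → d x w′ ≤ 2 → d y w′ ≤ 2 → d z w′ ≤ 2 → 2 ≤ d p w′ → w ≡ w′
          fourth-unique w w′ a b c e a′ b′ c′ e′ = d≡0 (n≤0⇒n≡0 (≤-trans (≤-reflexive (d≡ham w w′)) (≤-trans (ham-triangle (encode w) t (encode w′))
              (≤-reflexive (cong₂ _+_ (fourth w a b c e) (trans (ham-sym t (encode w′)) (fourth w′ a′ b′ c′ e′)))))))
            where t = xors (encode x) (encode y) (encode z)

        centres-agree : ∀ {x y z c c′ : Grid m n} → x ≢ y → y ≢ z → z ≢ x → d c x ≤ 1 → d c y ≤ 1 → d c z ≤ 1 → d c′ x ≤ 1 → d c′ y ≤ 1 → d c′ z ≤ 1 → c ≡ c′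
        centres-agree {x} {y} {z} {c} {c′} p q r a b e a′ b′ e′ = trans (centre≡p c a b e) (sym (centre≡p c′ a′ b′ e′))
          where
          two : ∀ {u v} → d c u ≤ 1 → d c v ≤ 1 → d u v ≤ 2
          two {u} {v} h k = ≤-trans (d-triangle u c v) (+-mono-≤ (subst (_≤ 1) (d-sym c u) h) k)
          open Triple p q r (two a b) (two b e) (two e a)

        Centreless : (Fin 4 → Grid m n) → Set
        Centreless f = ∀ c → ¬ (∀ j → d c (f j) ≤ 1)

        private
          f0 f1 f2 f3 : Fin 4
          f0 = zero
          f1 = suc zero
          f2 = suc (suc zero)
          f3 = suc (suc (suc zero))

          four : {P : Fin 4 → Set} → P f0 → P f1 → P f2 → P f3 → ∀ j → P j
          four a b c e zero = a
          four a b c e (suc zero) = b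
          four a b c e (suc (suc zero)) = c
          four a b c e (suc (suc (suc zero))) = e

        -- Centrelessness puts `f f0` far from the median of `f1`, `f2`, `f3`; a further vertex q
        -- also far from it would equal `f f0`, so q is near. If q were near the median of `f1`,
        -- `f2`, `f0` as well, both medians would be centres of the first two corners and q, hence
        -- equal and near `f f0`. So q is far from the second median, and uniqueness gives q =
        -- `f f3`.
        maximal : ∀ (f : Fin 4 → Grid m n) → (∀ {j k} → f j ≡ f k → j ≡ k) → (∀ j k → d (f j) (f k) ≤ 2) → Centreless f →
          ∀ q → (∀ j → d q (f j) ≤ 2) → (∀ j → q ≢ f j) → ⊥
        maximal f inj cl cen q dq q≢ = q≢ f3 (sym (T′.fourth-unique (f f3) q (cl f1 f3) (cl f2 f3) (cl f0 f3) z-far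
            (dq′ f1) (dq′ f2) (dq′ f0) q-far))
          where
          ne : ∀ {j k} → j ≢ k → f j ≢ f k
          ne n e = n (inj e)
          dq′ : ∀ j → d (f j) q ≤ 2
          dq′ j = subst (_≤ 2) (d-sym q (f j)) (dq j)
          module T = Triple {f f1} {f f2} {f f3} (ne λ ()) (ne λ ()) (ne λ ()) (cl f1 f2) (cl f2 f3) (cl f3 f1)
          module T′ = Triple {f f1} {f f2} {f f0} (ne λ ()) (ne λ ()) (ne λ ()) (cl f1 f2) (cl f2 f0) (cl f0 f1)
          w-far : 2 ≤ d T.p (f f0)
          w-far = ≰⇒> λ h → cen T.p (four h T.px≤1 T.py≤1 T.pz≤1)
          z-far : 2 ≤ d T′.p (f f3)
          z-far = ≰⇒> λ h → cen T′.p (four T′.pz≤1 T′.px≤1 T′.py≤1 h)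
          q-near : d T.p q ≤ 1
          q-near = ≮⇒≥ λ h → q≢ f0 (sym (T.fourth-unique (f f0) q (cl f1 f0) (cl f2 f0) (cl f3 f0) w-far (dq′ f1) (dq′ f2) (dq′ f3) h))
          q-far : 2 ≤ d T′.p q
          q-far = ≰⇒> λ h → <⇒≱ w-far (subst (λ c → d c (f f0) ≤ 1)
            (centres-agree {f f1} {f f2} {q} (ne λ ()) (λ e → q≢ f2 (sym e)) (q≢ f1) T′.px≤1 T′.py≤1 h T.px≤1 T.py≤1 q-near) T′.pz≤1)

    -- Collapsing

    Collapses-resp : ∀ {V} {X Y : Complex V} {v} → (∀ {τ} → S X τ → S Y τ) → (∀ {τ} → S Y τ → S X τ) → Collapses X v → Collapses Y v
    Collapses-resp f g (done s h) = done (f s) (λ s → h (g s))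
    Collapses-resp {X = X} {Y} f g (step x σ p u n cone c) = step x σ p u n (λ s sub → f (cone (g s) sub))
      (Collapses-resp {X = X ∖ (x ∷ σ)} {Y = Y ∖ (x ∷ σ)} (λ (s , n) → f s , n) (λ (s , n) → g s , n) c)

    module _ {V V′ : Set} (ι : V → V′) (ι-inj : ∀ {x y} → ι x ≡ ι y → x ≡ y) where

      private
        pull : ∀ {x ρ} → ι x ∈ List.map ι ρ → x ∈ ρ
        pull h = let (y , y∈ , e) = ∈-map⁻ ι h in subst (_∈ _) (sym (ι-inj e)) y∈

        push : ∀ {σ ρ} → σ ⊆ ρ → List.map ι σ ⊆ List.map ι ρ
        push s h = let (y , y∈ , e) = ∈-map⁻ ι h in subst (_∈ _) (sym e) (∈-map⁺ ι (s y∈))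

      Collapses-map : ∀ {X : Complex V} {Y : Complex V′} {v} → (∀ {τ} → S Y τ → ∃[ ρ ] τ ≡ List.map ι ρ) →
        (∀ {ρ} → S Y (List.map ι ρ) → S X ρ) → (∀ {ρ} → S X ρ → S Y (List.map ι ρ)) → Collapses X v → Collapses Y (ι v)
      Collapses-map {X} {Y} {v} im f g (done s h) = done (g s) only
        where
        only : ∀ {τ} → S Y τ → ∀ {x} → x ∈ τ → x ≡ ι v
        only s′ x∈ with im s′
        ... | ρ , refl = let (y , y∈ , e) = ∈-map⁻ ι x∈ in trans e (cong ι (h (f s′) y∈))
      Collapses-map {X} {Y} im f g (step x σ p u n cone c) = step (ι x) (List.map ι σ) (ι p) (Unique.map⁺ ι-inj u) (λ h → n (pull {ρ = x ∷ σ} h)) cone′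
        (Collapses-map {X ∖ (x ∷ σ)} {Y ∖ (ι x ∷ List.map ι σ)} (λ s → im (proj₁ s)) (λ {ρ} (s , k) → f s , λ sub → k (push {x ∷ σ} {ρ} sub)) (λ {ρ} (s , k) → g s , λ sub → k (λ y∈ → pull {ρ = ρ} (sub (∈-map⁺ ι y∈)))) c)
        where
        cone′ : ∀ {τ} → S Y τ → (ι x ∷ List.map ι σ) ⊆ τ → S Y (ι p ∷ τ)
        cone′ s sub with im s
        ... | ρ , refl = g {p ∷ ρ} (cone (f s) (λ y∈ → pull (sub (∈-map⁺ ι y∈))))

    -- Many collapses at once: the apexes lie outside Q and the removed simplices
    -- inside, so that no step affects the cone condition of another.
    module Batch {V T : Set} (Q : V → Set) (G : T → Set) (G? : ∀ t → Dec (G t)) (hd : T → V) (tl : T → List V) (apex : T → V)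
      (uniq : ∀ t → G t → Unique (hd t ∷ tl t)) (inQ : ∀ t → G t → ∀ {y} → y ∈ hd t ∷ tl t → Q y) (apex∉Q : ∀ t → ¬ Q (apex t)) where

      remove : Complex V → List T → Complex V
      remove X ts = record
        { S      = λ τ → S X τ × (∀ {t} → t ∈ ts → G t → ¬ ((hd t ∷ tl t) ⊆ τ))
        ; closed = λ σ⊆τ (s , n) → closed X σ⊆τ s , λ t∈ g h → n t∈ g (λ y∈ → σ⊆τ (h y∈))
        ; stable = λ h → stable X (λ k → h λ p → k (proj₁ p)) , λ t∈ g s → h λ p → proj₂ p t∈ g s }

      Cone : Complex V → Set
      Cone X = ∀ t → G t → ∀ {τ} → S X τ → (hd t ∷ tl t) ⊆ τ → S X (apex t ∷ τ)

      private
        avoid : ∀ {t t′ τ} → G t′ → (hd t′ ∷ tl t′) ⊆ (apex t ∷ τ) → (hd t′ ∷ tl t′) ⊆ τ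
        avoid {t} {t′} g h y∈ with h y∈
        ... | here refl = contradiction (inQ t′ g y∈) (apex∉Q t)
        ... | there z   = z

      batch : ∀ ts {X v} → Cone X → Collapses (remove X ts) v → Collapses X v
      batch []       cone c = Collapses-resp proj₁ (λ s → s , λ ()) c
      batch (t ∷ ts) {X} cone c with G? t
      ... | yes g = step (hd t) (tl t) (apex t) (uniq t g) (λ h → apex∉Q t (inQ t g h)) (cone t g)
            (batch ts {X ∖ (hd t ∷ tl t)} (λ t′ g′ {τ} (s , n) sub → cone t′ g′ s sub , λ h → n (avoid {t′} {t} {τ} g h))
              (Collapses-resp (λ (s , n) → (s , n (here refl) g) , λ t∈ → n (there t∈))
                (λ ((s , n) , ns) → s , λ { (here refl) _ → n ; (there t∈) → ns t∈ }) c))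
      ... | no ¬g = batch ts cone (Collapses-resp (λ (s , n) → s , λ t∈ → n (there t∈))
            (λ (s , n) → s , λ { (here refl) g → contradiction g ¬g ; (there t∈) → n t∈ }) c)

    -- The critical facets

    module _ {m : ℕ} where

      -- The recursion on coordinates matches the induction on dimension: a common first coordinate
      -- 0 leaves the condition to the tails.
      Flat : ∀ {n} → (Fin 4 → Grid m n) → Set
      Flat {zero}  f = ⊥
      Flat {suc n} f = (∀ j → Vec.head (f j) ≡ Vec.head (f zero)) × (Vec.head (f zero) ≢ zero ⊎ Flat (λ j → Vec.tail (f j)))

      record Critical {n} (f : Fin 4 → Grid m n) : Set where
        constructor mkCritical
        field
          injective  : ∀ j k → f j ≡ f k → j ≡ k
          clique     : ∀ j k → d (f j) (f k) ≤ 2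
          centreless : Centreless f
          flat       : Flat f

      open Critical public

      Clique : ∀ {n} → List (Grid m n) → Set
      Clique τ = ∀ {x y} → x ∈ τ → y ∈ τ → d x y ≤ 2

      𝒦 : ∀ n → Complex (Grid m n)
      𝒦 n = record
        { S      = Clique
        ; closed = λ σ⊆τ c x∈ y∈ → c (σ⊆τ x∈) (σ⊆τ y∈)
        ; stable = λ h {x} {y} x∈ y∈ → decidable-stable (d x y ≤? 2) λ k → h λ c → k (c x∈ y∈) }

      ℒ : ∀ n → Complex (Grid m n)
      ℒ n = record
        { S      = λ τ → Clique τ × (∀ f → Critical f → ¬ (∀ j → f j ∈ τ))
        ; closed = λ σ⊆τ (c , n) → (λ x∈ y∈ → c (σ⊆τ x∈) (σ⊆τ y∈)) , λ f cr h → n f cr (λ j → σ⊆τ (h j))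
        ; stable = λ h → stable (𝒦 n) (λ k → h λ p → k (proj₁ p)) , λ f cr k → h λ p → proj₂ p f cr k }

      private
        step₁ : ∀ {k} (a b : Fin (suc k)) → a ≢ b → Σ (Fin (suc k)) λ c → (∣ toℕ a - toℕ c ∣ ≡ 1 × suc ∣ toℕ c - toℕ b ∣ ≡ ∣ toℕ a - toℕ b ∣)
        step₁ zero zero n = contradiction refl n
        step₁ {suc k} zero (suc b) n = suc zero , refl , refl
        step₁ {suc k} (suc a) zero n = Fin.inject₁ a , trans (cong (λ i → ∣ suc (toℕ a) - i ∣) (Fin.toℕ-inject₁ a)) (trans (∣-∣-comm (suc (toℕ a)) (toℕ a)) (∣n-1+n∣≡1 (toℕ a))) ,
          cong suc (trans (∣-∣-identityʳ (toℕ (Fin.inject₁ a))) (Fin.toℕ-inject₁ a))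
          where
          ∣n-1+n∣≡1 : ∀ n → ∣ n - suc n ∣ ≡ 1
          ∣n-1+n∣≡1 zero    = refl
          ∣n-1+n∣≡1 (suc n) = ∣n-1+n∣≡1 n
        step₁ {suc k} (suc a) (suc b) n = let (c , p , q) = step₁ a b (λ e → n (cong suc e)) in suc c , p , q

        stepᵍ : ∀ {n} (x y : Grid m n) → x ≢ y → ∃[ q ] (d x q ≡ 1 × suc (d q y) ≡ d x y)
        stepᵍ []      []      n = contradiction refl n
        stepᵍ (a ∷ x) (b ∷ y) n with a Fin.≟ b
        ... | yes refl = let (q , e , e′) = stepᵍ x y (λ h → n (cong (a ∷_) h)) in a ∷ q ,
              trans (d-∷ a a x q) (trans (cong (_+ d x q) (∣n-n∣≡0 (toℕ a))) e) ,
              trans (cong suc (trans (d-∷ a a q y) (cong (_+ d q y) (∣n-n∣≡0 (toℕ a))))) (trans e′ (sym (trans (d-∷ a a x y) (cong (_+ d x y) (∣n-n∣≡0 (toℕ a))))))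
        ... | no a≢b = let (c , e , e′) = step₁ a b a≢b in c ∷ x ,
              trans (d-∷ a c x x) (cong₂ _+_ e (d-refl x)) ,
              trans (cong suc (d-∷ c b x y)) (trans (cong (_+ d x y) e′) (sym (d-∷ a b x y)))

      -- The distance bound is a hypothesis on the property of the point and not on the point, so
      -- that `mid` is total.
      midpoint : ∀ {n} (x y : Grid m n) → ∃[ q ] (d x y ≤ 2 → d q x ≤ 1 × d q y ≤ 1)
      midpoint x y with x ≟ᵍ y
      ... | yes refl = x , λ _ → ≤-trans (≤-reflexive (d-refl x)) z≤n , ≤-trans (≤-reflexive (d-refl x)) z≤n
      ... | no n = let (q , e , e′) = stepᵍ x y n in q , λ h → ≤-reflexive (trans (d-sym q x) e) , s≤s⁻¹ (subst (_≤ 2) (sym e′) h)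

      allGrid : ∀ n → List (Grid m n)
      allGrid n = List.map (Inverse.to (proj₂ (grid-finite m n))) (List.allFin (proj₁ (grid-finite m n)))

      ∈-allGrid : ∀ {n} (x : Grid m n) → x ∈ allGrid n
      ∈-allGrid {n} x = subst (_∈ allGrid n) (Inverse.strictlyInverseˡ (proj₂ (grid-finite m n)) x) (∈-map⁺ _ (∈-allFin (Inverse.from (proj₂ (grid-finite m n)) x)))

      module _ {n : ℕ} where

        Upto : ℕ → Complex (Grid m (suc n))
        Upto k = record
          { S      = λ τ → S (ℒ (suc n)) τ × (∀ {w} → w ∈ τ → toℕ (Vec.head w) ≤ k)
          ; closed = λ σ⊆τ (s , h) → closed (ℒ (suc n)) σ⊆τ s , λ w∈ → h (σ⊆τ w∈)
          ; stable = λ h → stable (ℒ (suc n)) (λ k → h λ p → k (proj₁ p)) , λ {w} w∈ → decidable-stable (toℕ (Vec.head w) ≤? k) λ j → h λ p → j (proj₂ p w∈) }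

        module Layer (h : Fin m) where

          k : ℕ
          k = toℕ h

          X : Complex (Grid m (suc n))
          X = Upto (suc k)

          lift low : Grid m n → Grid m (suc n)
          lift x = suc h ∷ x
          low  x = Fin.inject₁ h ∷ x

          Top : Grid m (suc n) → Set
          Top w = Vec.head w ≡ suc h

          low-not-top : ∀ x → ¬ Top (low x)
          low-not-top x e = 1+n≢n (sym (trans (sym (Fin.toℕ-inject₁ h)) (cong toℕ e)))

          d-lift : ∀ x y → d (lift x) (lift y) ≡ d x y
          d-lift x y = trans (d-∷ (suc h) (suc h) x y) (cong (_+ d x y) (∣n-n∣≡0 k))

          d-low : ∀ x y → d (low x) (low y) ≡ d x y
          d-low x y = trans (d-∷ _ _ x y) (cong (_+ d x y) (∣n-n∣≡0 (toℕ (Fin.inject₁ h))))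

          private
            gap : ∀ {g k} → g ≤ k → ∣ suc k - g ∣ ≡ suc ∣ k - g ∣
            gap {zero}  {k} _ = cong suc (sym (∣-∣-identityʳ k))
            gap {suc g} {suc k} (s≤s p) = gap p

          d-drop : ∀ x w → toℕ (Vec.head w) ≤ k → d (lift x) w ≡ suc (d (low x) w)
          d-drop x (g ∷ w) p = trans (d-∷ (suc h) g x w) (trans (cong (_+ d x w) (gap p)) (cong suc (sym (trans (d-∷ (Fin.inject₁ h) g x w)
            (cong (λ i → ∣ i - toℕ g ∣ + d x w) (Fin.toℕ-inject₁ h))))))

          low≤k : ∀ x → toℕ (Vec.head (low x)) ≤ k
          low≤k x = ≤-reflexive (Fin.toℕ-inject₁ h)

          d-lift-low : ∀ x y → d (lift x) (low y) ≡ suc (d x y)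
          d-lift-low x y = trans (d-drop x (low y) (low≤k y)) (cong suc (d-low x y))

          classify : ∀ w → toℕ (Vec.head w) ≤ suc k → (∃[ x ] w ≡ lift x) ⊎ toℕ (Vec.head w) ≤ k
          classify (g ∷ x) p with toℕ g ≤? k
          ... | yes q = inj₂ q
          ... | no q  = inj₁ (x , cong (_∷ x) (Fin.toℕ-injective (≤-antisym p (≰⇒> q))))

          below : ∀ {τ x w} → Clique τ → lift x ∈ τ → w ∈ τ → toℕ (Vec.head w) ≤ k → d (low x) w ≤ 1
          below {τ} {x} {w} c x∈ w∈ p = s≤s⁻¹ (subst (_≤ 2) (d-drop x w p) (c x∈ w∈))

          extend : ∀ {τ a} → S X τ → toℕ (Vec.head a) ≤ suc k → (∀ {w} → w ∈ τ → d a w ≤ 2) → (∀ f → Critical f → ¬ (∀ j → f j ∈ a ∷ τ)) → S X (a ∷ τ)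
          extend {τ} {a} ((c , _) , top) ha ad nc = (c′ , nc) , top′
            where
            c′ : Clique (a ∷ τ)
            c′ (here refl) (here refl) = ≤-trans (≤-reflexive (d-refl a)) z≤n
            c′ (here refl) (there y∈)  = ad y∈
            c′ {x} (there x∈) (here refl) = subst (_≤ 2) (d-sym a x) (ad x∈)
            c′ (there x∈) (there y∈)   = c x∈ y∈
            top′ : ∀ {w} → w ∈ a ∷ τ → toℕ (Vec.head w) ≤ suc k
            top′ (here refl) = ha
            top′ (there w∈)  = top w∈

          low≤sk : ∀ x → toℕ (Vec.head (low x)) ≤ suc k
          low≤sk x = m≤n⇒m≤1+n (low≤k x)

          lift-injective : ∀ {x y} → lift x ≡ lift y → x ≡ y
          lift-injective refl = refl

          low-injective : ∀ {x y} → low x ≡ low y → x ≡ y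
          low-injective refl = refl

          lift-≢ : ∀ {x y} → x ≢ y → lift x ≢ lift y
          lift-≢ n e = n (lift-injective e)

          top₁ : ∀ {x v} → v ∈ lift x ∷ [] → Top v
          top₁ (here refl) = refl

          top₂ : ∀ {x y v} → v ∈ lift x ∷ lift y ∷ [] → Top v
          top₂ (here refl) = refl
          top₂ (there p)   = top₁ p

          top₃ : ∀ {x y z v} → v ∈ lift x ∷ lift y ∷ lift z ∷ [] → Top v
          top₃ (here refl) = refl
          top₃ (there p)   = top₂ p

          -- Triples of the top layer, with the lowered median as apex

          Triple₃ : Set
          Triple₃ = Grid m n × Grid m n × Grid m n

          Distinct : Triple₃ → Set
          Distinct (x , y , z) = x ≢ y × y ≢ z × z ≢ x

          module B₃ = Batch {T = Triple₃} Top Distinct (λ (x , y , z) → ¬? (x ≟ᵍ y) ×-dec (¬? (y ≟ᵍ z) ×-dec ¬? (z ≟ᵍ x)))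
            (λ (x , y , z) → lift x) (λ (x , y , z) → lift y ∷ lift z ∷ []) (λ (x , y , z) → low (med x y z))
            (λ (x , y , z) (p , q , r) → (lift-≢ p ∷ lift-≢ (λ e → r (sym e)) ∷ []) ∷ (lift-≢ q ∷ []) ∷ [] ∷ [])
            (λ _ _ → top₃)
            (λ (x , y , z) → low-not-top (med x y z))

          -- A top vertex of the simplex not within 1 of the median p would form a critical
          -- quadruple with x, y, z. A lower vertex is a centre of the lowered triple, hence the
          -- lowered median itself. So the apex is within 2 of the simplex, and no critical
          -- quadruple arises, because `lift p` would be its centre.
          cone₃ : B₃.Cone X
          cone₃ (x , y , z) (x≢y , y≢z , z≢x) {τ} s@((c , nc) , top) sub =
              extend s (low≤sk p) (λ w∈ → apart (side w∈)) (λ f cr f∈ → centreless cr (lift p) λ j → near (f∈ j))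
            where
            x∈ = sub (here refl)
            y∈ = sub (there (here refl))
            z∈ = sub (there (there (here refl)))
            flatten : ∀ {u v} → lift u ∈ τ → lift v ∈ τ → d u v ≤ 2
            flatten {u} {v} u∈ v∈ = subst (_≤ 2) (d-lift u v) (c u∈ v∈)
            open Triple x≢y y≢z z≢x (flatten x∈ y∈) (flatten y∈ z∈) (flatten z∈ x∈)
            critical : ∀ w → lift w ∈ τ → ¬ (d p w ≤ 1) → Critical (λ j → lift (Vec.lookup (w ∷ x ∷ y ∷ z ∷ []) j))
            critical w w∈ far = mkCritical inj cl cen ((λ _ → refl) , inj₁ λ ())
              where
              q : Fin 4 → Grid m n
              q = Vec.lookup (w ∷ x ∷ y ∷ z ∷ [])
              w≢ : ∀ u → d p u ≤ 1 → w ≢ u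
              w≢ u h refl = far h
              inj : ∀ j l → lift (q j) ≡ lift (q l) → j ≡ l
              inj j l e = go j l (lift-injective e)
                where
                go : ∀ j l → q j ≡ q l → j ≡ l
                go zero zero _ = refl
                go zero (suc zero) e = contradiction e (w≢ x px≤1)
                go zero (suc (suc zero)) e = contradiction e (w≢ y py≤1)
                go zero (suc (suc (suc zero))) e = contradiction e (w≢ z pz≤1)
                go (suc zero) zero e = contradiction (sym e) (w≢ x px≤1)
                go (suc zero) (suc zero) _ = refl
                go (suc zero) (suc (suc zero)) e = contradiction e x≢y
                go (suc zero) (suc (suc (suc zero))) e = contradiction (sym e) z≢x
                go (suc (suc zero)) zero e = contradiction (sym e) (w≢ y py≤1)
                go (suc (suc zero)) (suc zero) e = contradiction (sym e) x≢y
                go (suc (suc zero)) (suc (suc zero)) _ = refl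
                go (suc (suc zero)) (suc (suc (suc zero))) e = contradiction e y≢z
                go (suc (suc (suc zero))) zero e = contradiction (sym e) (w≢ z pz≤1)
                go (suc (suc (suc zero))) (suc zero) e = contradiction e z≢x
                go (suc (suc (suc zero))) (suc (suc zero)) e = contradiction (sym e) y≢z
                go (suc (suc (suc zero))) (suc (suc (suc zero))) _ = refl
              cl : ∀ j l → d (lift (q j)) (lift (q l)) ≤ 2
              cl j l = c (mem j) (mem l)
                where
                mem : ∀ j → lift (q j) ∈ τ
                mem zero = w∈
                mem (suc zero) = x∈
                mem (suc (suc zero)) = y∈
                mem (suc (suc (suc zero))) = z∈
              cen : Centreless (λ j → lift (q j))
              cen (g ∷ e) near₄ = far (subst (λ e → d e w ≤ 1) (centre≡p e (tails (suc zero)) (tails (suc (suc zero))) (tails (suc (suc (suc zero))))) (tails zero))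
                where
                tails : ∀ j → d e (q j) ≤ 1
                tails j = ≤-trans (m≤n+m (d e (q j)) ∣ toℕ g - suc k ∣) (subst (_≤ 1) (d-∷ g (suc h) e (q j)) (near₄ j))
            side : ∀ {w} → w ∈ τ → (∃[ u ] (w ≡ lift u × d p u ≤ 1)) ⊎ w ≡ low p
            side {w} w∈ with classify w (top w∈)
            ... | inj₁ (u , refl) = inj₁ (u , refl , decidable-stable (d p u ≤? 1) λ far → nc _ (critical u w∈ far) mem)
              where
              mem : ∀ j → lift (Vec.lookup (u ∷ x ∷ y ∷ z ∷ []) j) ∈ τ
              mem zero = w∈
              mem (suc zero) = x∈
              mem (suc (suc zero)) = y∈
              mem (suc (suc (suc zero))) = z∈
            ... | inj₂ h≤k = inj₂ (centres-agree {x = low x} {low y} {low z} (λ e → x≢y (low-injective e)) (λ e → y≢z (low-injective e)) (λ e → z≢x (low-injective e))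
                (up x∈) (up y∈) (up z∈) (down x px≤1) (down y py≤1) (down z pz≤1))
              where
              up : ∀ {u} → lift u ∈ τ → d w (low u) ≤ 1
              up {u} u∈ = subst (_≤ 1) (d-sym (low u) w) (below c u∈ w∈ h≤k)
              down : ∀ u → d p u ≤ 1 → d (low p) (low u) ≤ 1
              down u = subst (_≤ 1) (sym (d-low p u))
            apart : ∀ {w} → (∃[ u ] (w ≡ lift u × d p u ≤ 1)) ⊎ w ≡ low p → d (low p) w ≤ 2
            apart (inj₁ (u , refl , q)) = subst (_≤ 2) (sym (trans (d-sym (low p) (lift u)) (trans (d-lift-low u p) (cong suc (d-sym u p))))) (s≤s q)
            apart (inj₂ refl) = ≤-trans (≤-reflexive (d-refl (low p))) z≤n
            near : ∀ {w} → w ∈ low p ∷ τ → d (lift p) w ≤ 1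
            near (here refl) = ≤-reflexive (trans (d-lift-low p p) (cong suc (d-refl p)))
            near (there w∈) with side w∈
            ... | inj₁ (u , refl , q) = subst (_≤ 1) (sym (d-lift p u)) q
            ... | inj₂ refl = ≤-reflexive (trans (d-lift-low p p) (cong suc (d-refl p)))

          triples : List Triple₃
          triples = List.cartesianProduct (allGrid n) (List.cartesianProduct (allGrid n) (allGrid n))

          X₁ : Complex (Grid m (suc n))
          X₁ = B₃.remove X triples

          no-triple : ∀ {τ} → S X₁ τ → ∀ {x y z} → x ≢ y → y ≢ z → z ≢ x → lift x ∈ τ → lift y ∈ τ → lift z ∈ τ → ⊥
          no-triple (_ , n) {x} {y} {z} p q r x∈ y∈ z∈ = n (∈-cartesianProduct⁺ (∈-allGrid x) (∈-cartesianProduct⁺ (∈-allGrid y) (∈-allGrid z))) (p , q , r)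
            λ { (here refl) → x∈ ; (there (here refl)) → y∈ ; (there (there (here refl))) → z∈ }

          -- Pairs of the top layer, with a lowered midpoint as apex

          mid : Grid m n → Grid m n → Grid m n
          mid x y = proj₁ (midpoint x y)

          module B₂ = Batch {T = Grid m n × Grid m n} Top (λ (x , y) → x ≢ y) (λ (x , y) → ¬? (x ≟ᵍ y))
            (λ (x , y) → lift x) (λ (x , y) → lift y ∷ []) (λ (x , y) → low (mid x y))
            (λ (x , y) p → (lift-≢ p ∷ []) ∷ [] ∷ [])
            (λ _ _ → top₂)
            (λ (x , y) → low-not-top (mid x y))

          keep-top : ∀ {a τ} {f : Fin 4 → Grid m (suc n)} → ¬ Top a → (∀ j → Top (f j)) → (∀ (j : Fin 4) → f j ∈ a ∷ τ) → ∀ j → f j ∈ τ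
          keep-top ¬t t h j with h j
          ... | here e  = contradiction (subst Top e (t j)) ¬t
          ... | there z = z

          -- With the triples gone, x and y are the only top vertices, and all others are within 1
          -- of `low x`. A critical quadruple that uses the apex has a common first coordinate below
          -- the top, so `low x` would be its centre.
          cone₂ : B₂.Cone X₁
          cone₂ (x , y) x≢y {τ} s@(s₀@((c , nc) , top) , n) sub =
              extend s₀ (low≤sk q) (λ w∈ → apart (side w∈)) no-critical ,
              λ t∈ g h → n t∈ g (λ {v} v∈ → strip (top₃ v∈) (h v∈))
            where
            x∈ = sub (here refl)
            y∈ = sub (there (here refl))
            q : Grid m _
            q = mid x y
            qs : d q x ≤ 1 × d q y ≤ 1
            qs = proj₂ (midpoint x y) (subst (_≤ 2) (d-lift x y) (c x∈ y∈))
            strip : ∀ {v} → Top v → v ∈ low q ∷ τ → v ∈ τ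
            strip t (here refl) = contradiction t (low-not-top q)
            strip t (there z)   = z
            side : ∀ {w} → w ∈ τ → (w ≡ lift x ⊎ w ≡ lift y) ⊎ toℕ (Vec.head w) ≤ k × d (low x) w ≤ 1
            side {w} w∈ with classify w (top w∈)
            ... | inj₂ h≤k = inj₂ (h≤k , below c x∈ w∈ h≤k)
            ... | inj₁ (u , refl) with u ≟ᵍ x | u ≟ᵍ y
            ...   | yes refl | _        = inj₁ (inj₁ refl)
            ...   | no _     | yes refl = inj₁ (inj₂ refl)
            ...   | no u≢x   | no u≢y   = ⊥-elim (no-triple s x≢y (λ e → u≢y (sym e)) u≢x x∈ y∈ w∈)
            apart : ∀ {w} → (w ≡ lift x ⊎ w ≡ lift y) ⊎ toℕ (Vec.head w) ≤ k × d (low x) w ≤ 1 → d (low q) w ≤ 2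
            apart (inj₁ (inj₁ refl)) = subst (_≤ 2) (sym (trans (d-sym (low q) (lift x)) (trans (d-lift-low x q) (cong suc (d-sym x q))))) (s≤s (proj₁ qs))
            apart (inj₁ (inj₂ refl)) = subst (_≤ 2) (sym (trans (d-sym (low q) (lift y)) (trans (d-lift-low y q) (cong suc (d-sym y q))))) (s≤s (proj₂ qs))
            apart {w} (inj₂ (_ , h)) = ≤-trans (d-triangle (low q) (low x) w) (+-mono-≤ (subst (_≤ 1) (sym (d-low q x)) (proj₁ qs)) h)
            no-critical : ∀ f → Critical f → ¬ (∀ j → f j ∈ low q ∷ τ)
            no-critical f cr f∈ with Vec.head (f zero) Fin.≟ suc h
            ... | yes t = nc f cr (keep-top {f = f} (low-not-top q) (λ j → trans (proj₁ (flat cr) j) t) f∈)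
            ... | no ¬t = centreless cr (low x) λ j → near (λ t → ¬t (trans (sym (proj₁ (flat cr) j)) t)) (f∈ j)
              where
              near : ∀ {w} → ¬ Top w → w ∈ low q ∷ τ → d (low x) w ≤ 1
              near ¬t (here refl) = subst (_≤ 1) (sym (trans (d-low x q) (d-sym x q))) (proj₁ qs)
              near ¬t (there w∈) with side w∈
              ... | inj₁ (inj₁ refl) = contradiction refl ¬t
              ... | inj₁ (inj₂ refl) = contradiction refl ¬t
              ... | inj₂ (_ , p)     = p

          X₂ : Complex (Grid m (suc n))
          X₂ = B₂.remove X₁ (List.cartesianProduct (allGrid n) (allGrid n))

          no-pair : ∀ {τ} → S X₂ τ → ∀ {x y} → x ≢ y → lift x ∈ τ → lift y ∈ τ → ⊥
          no-pair (_ , n) {x} {y} p x∈ y∈ = n (∈-cartesianProduct⁺ (∈-allGrid x) (∈-allGrid y)) p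
            λ { (here refl) → x∈ ; (there (here refl)) → y∈ }

          -- Vertices of the top layer

          module B₁ = Batch {T = Grid m n} Top (λ _ → ⊤) (λ _ → yes tt) lift (λ _ → []) low (λ _ _ → [] ∷ []) (λ _ _ → top₁) low-not-top

          -- Now `lift x` is the only top vertex, so everything is within 1 of `low x`. This vertex
          -- can be added, and it would be a centre of any new critical quadruple.
          cone₁ : B₁.Cone X₂
          cone₁ x _ {τ} s@((s₀@((c , nc) , top) , n₃) , n₂) sub =
              (extend s₀ (low≤sk x) (λ w∈ → ≤-trans (near w∈) (s≤s z≤n)) (λ f cr f∈ → centreless cr (low x) λ j → near′ (f∈ j)) ,
               λ t∈ g h → n₃ t∈ g (λ {v} v∈ → strip (top₃ v∈) (h v∈))) ,
              λ t∈ g h → n₂ t∈ g (λ {v} v∈ → strip (top₂ v∈) (h v∈))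
            where
            x∈ = sub (here refl)
            strip : ∀ {v} → Top v → v ∈ low x ∷ τ → v ∈ τ
            strip t (here refl) = contradiction t (low-not-top x)
            strip t (there z)   = z
            near : ∀ {w} → w ∈ τ → d (low x) w ≤ 1
            near {w} w∈ with classify w (top w∈)
            ... | inj₂ h≤k = below c x∈ w∈ h≤k
            ... | inj₁ (u , refl) with u ≟ᵍ x
            ...   | yes refl = ≤-reflexive (trans (d-sym (low x) (lift x)) (trans (d-lift-low x x) (cong suc (d-refl x))))
            ...   | no u≢x   = ⊥-elim (no-pair s u≢x w∈ x∈)
            near′ : ∀ {w} → w ∈ low x ∷ τ → d (low x) w ≤ 1
            near′ (here refl) = ≤-trans (≤-reflexive (d-refl (low x))) z≤n
            near′ (there w∈)  = near w∈

          layer : ∀ {v} → Collapses (Upto k) v → Collapses (Upto (suc k)) v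
          layer col = B₃.batch triples cone₃ (B₂.batch (List.cartesianProduct (allGrid n) (allGrid n)) cone₂
              (B₁.batch (allGrid n) cone₁ (Collapses-resp down up col)))
            where
            no-top : ∀ {τ} → S (Upto k) τ → ∀ {w} → w ∈ τ → ¬ Top w
            no-top (_ , b) {w} w∈ t = <⇒≱ (≤-reflexive (sym (cong toℕ t))) (b w∈)
            down : ∀ {τ} → S (Upto k) τ → S (B₁.remove X₂ (allGrid n)) τ
            down s@(s₀ , b) = (((s₀ , λ w∈ → m≤n⇒m≤1+n (b w∈)) , λ _ _ h → no-top s (h (here refl)) refl) , λ _ _ h → no-top s (h (here refl)) refl) , λ _ _ h → no-top s (h (here refl)) refl
            up : ∀ {τ} → S (B₁.remove X₂ (allGrid n)) τ → S (Upto k) τ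
            up {τ} ((((s₀ , b) , _) , _) , n) = s₀ , bound
              where
              bound : ∀ {w} → w ∈ τ → toℕ (Vec.head w) ≤ k
              bound {w} w∈ with classify w (b w∈)
              ... | inj₂ p = p
              ... | inj₁ (u , refl) = ⊥-elim (n (∈-allGrid u) tt λ { (here refl) → w∈ })

        layers : ∀ {v} j → j ≤ m → Collapses (Upto 0) v → Collapses (Upto j) v
        layers zero    _ c = c
        layers (suc j) p c = subst (λ i → Collapses (Upto (suc i)) _) (Fin.toℕ-fromℕ< p)
          (Layer.layer (Fin.fromℕ< p) (subst (λ i → Collapses (Upto i) _) (sym (Fin.toℕ-fromℕ< p)) (layers j (<⇒≤ p) c)))

        -- Prefixing 0 is an isometry onto the bottom layer and matches critical quadruples in both
        -- directions, since flatness of a quadruple with first coordinate 0 is flatness of its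
        -- tails.
        bottom : ∀ {v} → Collapses (ℒ n) v → Collapses (Upto 0) (zero ∷ v)
        bottom = Collapses-map (zero ∷_) (λ { refl → refl }) image restrict include
          where
          0-d : ∀ (x y : Grid m n) → d (zero ∷ x) (zero ∷ y) ≡ d x y
          0-d x y = d-∷ zero zero x y
          head≡0 : ∀ (w : Grid m (suc n)) → toℕ (Vec.head w) ≤ 0 → w ≡ zero ∷ Vec.tail w
          head≡0 (zero ∷ w) _ = refl
          unmap : ∀ (τ : List (Grid m (suc n))) → (∀ {w} → w ∈ τ → toℕ (Vec.head w) ≤ 0) → τ ≡ List.map (zero ∷_) (List.map Vec.tail τ)
          unmap []      h = refl
          unmap (w ∷ τ) h = cong₂ _∷_ (head≡0 w (h (here refl))) (unmap τ (λ w∈ → h (there w∈)))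
          image : ∀ {τ} → S (Upto 0) τ → ∃[ ρ ] τ ≡ List.map (zero ∷_) ρ
          image {τ} (_ , h) = List.map Vec.tail τ , unmap τ h
          restrict : ∀ {ρ} → S (Upto 0) (List.map (zero ∷_) ρ) → S (ℒ n) ρ
          restrict {ρ} ((c , nc) , _) = (λ {x} {y} x∈ y∈ → subst (_≤ 2) (0-d x y) (c (∈-map⁺ _ x∈) (∈-map⁺ _ y∈))) ,
            λ f cr f∈ → nc (λ j → zero ∷ f j) (raise f cr) (λ j → ∈-map⁺ _ (f∈ j))
            where
            raise : ∀ f → Critical f → Critical (λ j → zero ∷ f j)
            raise f cr = mkCritical (λ { j l e → injective cr j l (cong Vec.tail e) }) (λ j l → subst (_≤ 2) (sym (0-d (f j) (f l))) (clique cr j l))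
              -- Forgetting the first coordinate does not increase distances, so a centre outside
              -- the layer would project to one inside.
              (λ { (g ∷ e) h → centreless cr e λ j → ≤-trans (m≤n+m (d e (f j)) ∣ toℕ g - 0 ∣) (subst (_≤ 1) (d-∷ g zero e (f j)) (h j)) })
              ((λ _ → refl) , inj₂ (flat cr))
          include : ∀ {ρ} → S (ℒ n) ρ → S (Upto 0) (List.map (zero ∷_) ρ)
          include {ρ} (c , nc) = ((λ x∈ y∈ → cl x∈ y∈) , no-critical) , λ w∈ → let (_ , _ , e) = ∈-map⁻ _ w∈ in ≤-reflexive (cong (λ w → toℕ (Vec.head w)) e)
            where
            cl : Clique (List.map (zero ∷_) ρ)
            cl x∈ y∈ with ∈-map⁻ _ x∈ | ∈-map⁻ _ y∈
            ... | x , x∈ρ , refl | y , y∈ρ , refl = subst (_≤ 2) (sym (0-d x y)) (c x∈ρ y∈ρ)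
            no-critical : ∀ f → Critical f → ¬ (∀ j → f j ∈ List.map (zero ∷_) ρ)
            no-critical f cr f∈ = nc (λ j → Vec.tail (f j)) lower mem
              where
              shape : ∀ j → f j ≡ zero ∷ Vec.tail (f j)
              shape j with f j | ∈-map⁻ _ (f∈ j)
              ... | _ | _ , _ , refl = refl
              mem : ∀ j → Vec.tail (f j) ∈ ρ
              mem j with f j | ∈-map⁻ _ (f∈ j)
              ... | _ | x , x∈ , refl = x∈
              lower : Critical (λ j → Vec.tail (f j))
              lower = mkCritical (λ j l e → injective cr j l (trans (shape j) (trans (cong (zero ∷_) e) (sym (shape l)))))
                (λ j l → subst (_≤ 2) (trans (cong₂ d (shape j) (shape l)) (0-d _ _)) (clique cr j l))
                (λ e h → centreless cr (zero ∷ e) λ j → subst (_≤ 1) (sym (trans (cong (d (zero ∷ e)) (shape j)) (0-d _ _))) (h j))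
                (flat′ (proj₂ (flat cr)))
                where
                flat′ : Vec.head (f zero) ≢ zero ⊎ Flat (λ j → Vec.tail (f j)) → Flat (λ j → Vec.tail (f j))
                flat′ (inj₁ n) = contradiction (cong Vec.head (shape zero)) n
                flat′ (inj₂ fl) = fl

      origin : ∀ n → Grid m n
      origin zero    = []
      origin (suc n) = zero ∷ origin n

      ℒ-collapses : ∀ n → Collapses (ℒ n) (origin n)
      ℒ-collapses zero = done ((λ { (here refl) (here refl) → ≤-trans (≤-reflexive (d-refl [])) z≤n }) , λ f cr _ → flat cr) λ { _ {[]} _ → refl }
      ℒ-collapses (suc n) = Collapses-resp proj₁ (λ s → s , λ {w} _ → Fin.toℕ≤pred[n] (Vec.head w)) (layers m ≤-refl (bottom (ℒ-collapses n)))

  open Grids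

  -- Critical cells up to reordering, their number, and the grid theorem.

  module Cells where

    module _ {A : Set} {P : A → Set} (P? : ∀ a → Dec (P a)) {R : A → A → Set} (R? : ∀ a b → Dec (R a b)) (R-refl : ∀ {a} → R a a) where

      -- Greedy choice: an element is kept exactly when it is related to none of those kept from the
      -- rest of the list. Here it selects one ordering of each critical facet.
      representatives : ∀ as → Σ (List A) λ fs → All P fs × AllPairs (λ a b → ¬ R a b) fs × (∀ {a} → a ∈ as → P a → Any (R a) fs)
      representatives [] = [] , [] , [] , λ ()
      representatives (a ∷ as) with representatives as | P? a
      ... | fs , ps , rs , c | no ¬p = fs , ps , rs , λ { (here refl) p → contradiction p ¬p ; (there a∈) → c a∈ }
      ... | fs , ps , rs , c | yes p with any? (R? a) fs
      ...   | yes r = fs , ps , rs , λ { (here refl) _ → r ; (there a∈) → c a∈ }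
      ...   | no ¬r = a ∷ fs , p ∷ ps , ¬Any⇒All¬ fs ¬r ∷ rs , λ { (here refl) _ → here R-refl ; (there a∈) p → there (c a∈ p) }

    AllPairs-lookup : ∀ {A : Set} {R : A → A → Set} → (∀ {a b} → R a b → R b a) → ∀ {xs} → AllPairs R xs → ∀ i j → i ≢ j → R (List.lookup xs i) (List.lookup xs j)
    AllPairs-lookup s (r ∷ rs) zero    zero    n = contradiction refl n
    AllPairs-lookup s (r ∷ rs) zero    (suc j) n = All.lookup r (∈-lookup j)
    AllPairs-lookup s (r ∷ rs) (suc i) zero    n = s (All.lookup r (∈-lookup i))
    AllPairs-lookup s (r ∷ rs) (suc i) (suc j) n = AllPairs-lookup s rs i j (λ e → n (cong suc e))

    module _ {m n : ℕ} where

      infix 4 _⊑_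
      _⊑_ : (f g : Fin 4 → Grid m n) → Set
      f ⊑ g = ∀ j → ∃[ k ] f j ≡ g k

      _⊑?_ : ∀ f g → Dec (f ⊑ g)
      f ⊑? g = Fin.all? λ j → Fin.any? λ k → f j ≟ᵍ g k

      -- Symmetrised so that pairwise unrelatedness does not depend on the order of the list; on
      -- critical quadruples it amounts to having the same points.
      Overlap : (f g : Fin 4 → Grid m n) → Set
      Overlap f g = f ⊑ g ⊎ g ⊑ f

      flat? : ∀ {n} (f : Fin 4 → Grid m n) → Dec (Flat f)
      flat? {zero}  f = no λ ()
      flat? {suc n} f = Fin.all? (λ j → Vec.head (f j) Fin.≟ Vec.head (f zero)) ×-dec (¬? (Vec.head (f zero) Fin.≟ zero) ⊎-dec flat? (λ j → Vec.tail (f j)))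

      centreless? : (f : Fin 4 → Grid m n) → Dec (Centreless f)
      centreless? f = map′ (λ h c k → h (Inverse.from (proj₂ (grid-finite m n)) c) λ j → subst (λ c → d c (f j) ≤ 1) (sym (Inverse.strictlyInverseˡ (proj₂ (grid-finite m n)) c)) (k j))
        (λ h i k → h (Inverse.to (proj₂ (grid-finite m n)) i) k)
        (Fin.all? λ i → ¬? (Fin.all? λ j → d (Inverse.to (proj₂ (grid-finite m n)) i) (f j) ≤? 1))

      critical? : (f : Fin 4 → Grid m n) → Dec (Critical f)
      critical? f = map′ (λ (a , b , c , e) → mkCritical a b c e) (λ c → injective c , clique c , centreless c , flat c)
        (Fin.all? (λ j → Fin.all? λ k → (f j ≟ᵍ f k) →-dec (j Fin.≟ k)) ×-dec (Fin.all? (λ j → Fin.all? λ k → d (f j) (f k) ≤? 2) ×-dec (centreless? f ×-dec flat? f)))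

      Flat-cong : ∀ {n} {f g : Fin 4 → Grid m n} → (∀ j → f j ≡ g j) → Flat f → Flat g
      Flat-cong {suc n} e (a , b) = (λ j → trans (cong Vec.head (sym (e j))) (trans (a j) (cong Vec.head (e zero)))) , go b
        where
        go : _ → _
        go (inj₁ h) = inj₁ λ z → h (trans (cong Vec.head (e zero)) z)
        go (inj₂ h) = inj₂ (Flat-cong (λ j → cong Vec.tail (e j)) h)

      Critical-cong : {f g : Fin 4 → Grid m n} → (∀ j → f j ≡ g j) → Critical f → Critical g
      Critical-cong e c = mkCritical (λ j k h → injective c j k (trans (e j) (trans h (sym (e k))))) (λ j k → subst (_≤ 2) (cong₂ d (e j) (e k)) (clique c j k))
        (λ x h → centreless c x λ j → subst (λ y → d x y ≤ 1) (sym (e j)) (h j)) (Flat-cong e (flat c))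

      critical-maximal : {f : Fin 4 → Grid m n} → Critical f → ∀ q → (∀ j → d q (f j) ≤ 2) → ∃[ j ] q ≡ f j
      critical-maximal {f} c q h = decidable-stable (Fin.any? λ j → q ≟ᵍ f j) λ k →
        maximal f (λ {j} {l} → injective c j l) (clique c) (centreless c) q h (λ j e → k (j , e))

      -- Each point of g is within 2 of all points of f, as these occur in g; maximality of f then
      -- puts it among them.
      ⊑-sym : {f g : Fin 4 → Grid m n} → Critical f → Critical g → f ⊑ g → g ⊑ f
      ⊑-sym {f} {g} cf cg s k = critical-maximal cf (g k) λ j → let (l , e) = s j in subst (λ y → d (g k) y ≤ 2) (sym e) (clique cg k l)

      overlap⇒⊑ : {f g : Fin 4 → Grid m n} → Critical f → Critical g → Overlap f g → f ⊑ g
      overlap⇒⊑ cf cg (inj₁ s) = s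
      overlap⇒⊑ cf cg (inj₂ s) = ⊑-sym cg cf s

      quadruples : List (Vec (Grid m n) 4)
      quadruples = all 4
        where
        all : ∀ k → List (Vec (Grid m n) k)
        all zero    = [] ∷ []
        all (suc k) = List.cartesianProductWith _∷_ (allGrid n) (all k)

      ∈-quadruples : ∀ v → v ∈ quadruples
      ∈-quadruples (a ∷ b ∷ c ∷ e ∷ []) = ∈-cartesianProductWith⁺ _∷_ (∈-allGrid a) (∈-cartesianProductWith⁺ _∷_ (∈-allGrid b)
        (∈-cartesianProductWith⁺ _∷_ (∈-allGrid c) (∈-cartesianProductWith⁺ _∷_ (∈-allGrid e) (here refl))))

      abstract
        chosen : Σ (List (Vec (Grid m n) 4)) λ fs → All (λ v → Critical (Vec.lookup v)) fs ×
          AllPairs (λ v w → ¬ Overlap (Vec.lookup v) (Vec.lookup w)) fs ×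
          (∀ {v} → v ∈ quadruples → Critical (Vec.lookup v) → Any (λ w → Overlap (Vec.lookup v) (Vec.lookup w)) fs)
        chosen = representatives (λ v → critical? (Vec.lookup v)) (λ v w → (Vec.lookup v ⊑? Vec.lookup w) ⊎-dec (Vec.lookup w ⊑? Vec.lookup v))
          (inj₁ λ j → j , refl) quadruples

      cells : List (Vec (Grid m n) 4)
      cells = proj₁ chosen

      ν : ℕ
      ν = length cells

      F : Fin ν → Fin 4 → Grid m n
      F i = Vec.lookup (List.lookup cells i)

      F-critical : ∀ i → Critical (F i)
      F-critical i = All.lookup (proj₁ (proj₂ chosen)) (∈-lookup i)

      F-distinct : ∀ i j → F i ⊑ F j → i ≡ j
      F-distinct i j s = decidable-stable (i Fin.≟ j) λ n →
        AllPairs-lookup (λ h → λ { (inj₁ s) → h (inj₂ s) ; (inj₂ s) → h (inj₁ s) }) (proj₁ (proj₂ (proj₂ chosen))) i j n (inj₁ s)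

      F-complete : ∀ {f} → Critical f → ∃[ i ] f ⊑ F i
      F-complete {f} c = Any.index found , λ j → let (k , e) = s j in k , trans (sym (lookup∘tabulate f j)) e
        where
        c′ : Critical (Vec.lookup (Vec.tabulate f))
        c′ = Critical-cong (λ j → sym (lookup∘tabulate f j)) c
        found : Any (λ w → Overlap (Vec.lookup (Vec.tabulate f)) (Vec.lookup w)) cells
        found = proj₂ (proj₂ (proj₂ chosen)) (∈-quadruples (Vec.tabulate f)) c′
        s : Vec.lookup (Vec.tabulate f) ⊑ F (Any.index found)
        s = overlap⇒⊑ c′ (F-critical (Any.index found)) (lookup-index found)

      F-inj : ∀ i {j k} → F i j ≡ F i k → j ≡ k
      F-inj i {j} {k} = injective (F-critical i) j k

      open Realization.Facets (proj₂ (grid-finite m n)) _≟ᵍ_ (𝒦 n) ν F F-inj using (facet; F∈; ∈F; L)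

      ⊆⇒⊑ : ∀ i {τ} → facet i ⊆ τ → ∀ j → F i j ∈ τ
      ⊆⇒⊑ i s j = s (F∈ i j)

      F-in : ∀ i → S (𝒦 n) (facet i)
      F-in i x∈ y∈ = let (j , e) = ∈F i x∈ ; (k , e′) = ∈F i y∈ in subst (_≤ 2) (sym (cong₂ d e e′)) (clique (F-critical i) j k)

      F-max : ∀ i {τ} → S (𝒦 n) τ → facet i ⊆ τ → τ ⊆ facet i
      F-max i c s {y} y∈ = let (j , e) = critical-maximal (F-critical i) y (λ j → c y∈ (⊆⇒⊑ i s j)) in subst (_∈ facet i) (sym e) (F∈ i j)

      F-dist : ∀ i j → facet i ⊆ facet j → i ≡ j
      F-dist i j s = F-distinct i j (λ k → ∈F j (⊆⇒⊑ i s k))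

      -- `ℒ` forbids every ordering of every critical quadruple and `L` only the chosen ones; both
      -- have the same simplices, because each quadruple has the points of a chosen one.
      L-collapses : Collapses L (origin n)
      L-collapses = Collapses-resp
        (λ (c , nc) → (λ {x} {y} → c {x} {y}) , λ i s → nc (F i) (F-critical i) (⊆⇒⊑ i s))
        (λ (c , nc) → (λ {x} {y} → c {x} {y}) , λ f cr f∈ → let (i , s) = F-complete cr in nc i λ y∈ →
          let (k , e) = ∈F i y∈ ; (j , e′) = ⊑-sym cr (F-critical i) s k in subst (_∈ _) (sym (trans e e′)) (f∈ j))
        (ℒ-collapses n)

    -- Unit squares

    module _ {m n : ℕ} where

      side : Fin m → Bool → Fin (suc m)
      side b false = Fin.inject₁ b
      side b true  = suc b

      bits : Fin 4 → Bool × Bool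
      bits zero                   = false , false
      bits (suc zero)             = false , true
      bits (suc (suc zero))       = true , false
      bits (suc (suc (suc zero))) = true , true

      private
        fins : Bool × Bool → Fin 4
        fins (false , false) = zero
        fins (false , true)  = suc zero
        fins (true  , false) = suc (suc zero)
        fins (true  , true)  = suc (suc (suc zero))

        fins-bits : ∀ j → fins (bits j) ≡ j
        fins-bits zero                   = refl
        fins-bits (suc zero)             = refl
        fins-bits (suc (suc zero))       = refl
        fins-bits (suc (suc (suc zero))) = refl

        bits-fins : ∀ s → bits (fins s) ≡ s
        bits-fins (false , false) = refl
        bits-fins (false , true)  = refl
        bits-fins (true  , false) = refl
        bits-fins (true  , true)  = refl

        side-inj : ∀ b {s t} → side b s ≡ side b t → s ≡ t
        side-inj b {false} {false} _ = refl
        side-inj b {true}  {true}  _ = refl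
        side-inj b {false} {true}  e = contradiction (trans (sym (Fin.toℕ-inject₁ b)) (cong toℕ e)) (λ h → 1+n≢n (sym h))
        side-inj b {true}  {false} e = contradiction (trans (cong toℕ e) (Fin.toℕ-inject₁ b)) 1+n≢n

        ∣n-1+n∣≤1 : ∀ n → ∣ n - suc n ∣ ≤ 1
        ∣n-1+n∣≤1 zero    = s≤s z≤n
        ∣n-1+n∣≤1 (suc n) = ∣n-1+n∣≤1 n

        side-near : ∀ b s t → ∣ toℕ (side b s) - toℕ (side b t) ∣ ≤ 1
        side-near b false false = ≤-trans (≤-reflexive (∣n-n∣≡0 (toℕ (Fin.inject₁ b)))) z≤n
        side-near b true  true  = ≤-trans (≤-reflexive (∣n-n∣≡0 (toℕ b))) z≤n
        side-near b false true  = subst (λ i → ∣ i - suc (toℕ b) ∣ ≤ 1) (sym (Fin.toℕ-inject₁ b)) (∣n-1+n∣≤1 (toℕ b))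
        side-near b true  false = ≤-trans (≤-reflexive (∣-∣-comm (suc (toℕ b)) (toℕ (Fin.inject₁ b)))) (side-near b false true)

        side-apart : ∀ b (e : ℕ) → 1 ≤ ∣ e - toℕ (side b false) ∣ + ∣ e - toℕ (side b true) ∣
        side-apart b e = ≤-trans (apart (toℕ (side b false)) (toℕ (side b true)) λ h → contradiction (trans (sym (Fin.toℕ-inject₁ b)) h) (λ h → 1+n≢n (sym h)))
          (≤-trans (∣-∣-triangle (toℕ (side b false)) e (toℕ (side b true))) (≤-reflexive (cong (_+ ∣ e - suc (toℕ b) ∣) (∣-∣-comm (toℕ (side b false)) e))))
          where
          apart : ∀ i j → i ≢ j → 1 ≤ ∣ i - j ∣
          apart i j n = n≢0⇒n>0 λ h → n (∣m-n∣≡0⇒m≡n h)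

      -- A unit square in the second and third directions. The first coordinate is a + 1 and hence
      -- non-zero, which makes the square flat.
      square : Fin m → Fin m → Fin m → Fin 4 → Grid m (3 + n)
      square a b c j = suc a ∷ side b (proj₁ (bits j)) ∷ side c (proj₂ (bits j)) ∷ origin n

      private
        d-square : ∀ g e f (r : Grid m n) a b c j → d (g ∷ e ∷ f ∷ r) (square a b c j) ≡
          ∣ toℕ g - suc (toℕ a) ∣ + (∣ toℕ e - toℕ (side b (proj₁ (bits j))) ∣ + (∣ toℕ f - toℕ (side c (proj₂ (bits j))) ∣ + d r (origin n)))
        d-square g e f r a b c j = trans (d-∷ g (suc a) _ _) (cong (∣ toℕ g - suc (toℕ a) ∣ +_)
          (trans (d-∷ e (side b (proj₁ (bits j))) _ _) (cong (∣ toℕ e - toℕ (side b (proj₁ (bits j))) ∣ +_) (d-∷ f (side c (proj₂ (bits j))) r (origin n)))))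

        -- One of A, A′ and one of C, C′ is positive, so the corner where these two meet is at
        -- distance at least 2.
        clash : ∀ {A A′ C C′} → A + C ≤ 1 → A′ + C′ ≤ 1 → A + C′ ≤ 1 → A′ + C ≤ 1 → 1 ≤ A + A′ → 1 ≤ C + C′ → ⊥
        clash {zero}        {zero}  _ _ _ _ () _
        clash {suc zero} {C = zero} {zero} _ _ _ _ _ ()
        clash {suc A} {C = suc C} h _ _ _ _ _ = contradiction h (λ { (s≤s h) → contradiction (≤-trans (≤-reflexive (sym (+-suc A C))) h) λ () })
        clash {suc A} {C = zero} {suc C′} _ _ h _ _ _ = contradiction h (λ { (s≤s h) → contradiction (≤-trans (≤-reflexive (sym (+-suc A C′))) h) λ () })
        clash {suc (suc A)} {C = zero} {zero} _ _ _ _ _ ()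
        clash {zero} {suc A′} {suc C} _ _ _ h _ _ = contradiction h (λ { (s≤s h) → contradiction (≤-trans (≤-reflexive (sym (+-suc A′ C))) h) λ () })
        clash {zero} {suc A′} {zero} {suc C′} _ h _ _ _ _ = contradiction h (λ { (s≤s h) → contradiction (≤-trans (≤-reflexive (sym (+-suc A′ C′))) h) λ () })
        clash {zero} {suc A′} {zero} {zero} _ _ _ _ _ ()

      square-critical : ∀ a b c → Critical (square a b c)
      square-critical a b c = mkCritical inj cl cen ((λ _ → refl) , inj₁ λ ())
        where
        inj : ∀ j k → square a b c j ≡ square a b c k → j ≡ k
        inj j k e = trans (sym (fins-bits j)) (trans (cong fins (cong₂ _,_ (side-inj b (cong (λ x → Vec.head (Vec.tail x)) e))
          (side-inj c (cong (λ x → Vec.head (Vec.tail (Vec.tail x))) e)))) (fins-bits k))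
        cl : ∀ j k → d (square a b c j) (square a b c k) ≤ 2
        cl j k = ≤-trans (≤-reflexive (d-square (suc a) _ _ (origin n) a b c k)) (≤-trans
          (+-mono-≤ (≤-reflexive (∣n-n∣≡0 (toℕ a))) (+-mono-≤ (side-near b (proj₁ (bits j)) (proj₁ (bits k))) (+-mono-≤ (side-near c (proj₂ (bits j)) (proj₂ (bits k))) (≤-reflexive (d-refl (origin n)))))) ≤-refl′)
          where
          ≤-refl′ : 2 ≤ 2
          ≤-refl′ = s≤s (s≤s z≤n)
        cen : Centreless (square a b c)
        cen (g ∷ e ∷ f ∷ r) h = clash {gapᵉ false} {gapᵉ true} {gapᶠ false} {gapᶠ true} (near (false , false)) (near (true , true)) (near (false , true)) (near (true , false)) (side-apart b (toℕ e)) (side-apart c (toℕ f))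
          where
          gapᵉ gapᶠ : Bool → ℕ
          gapᵉ s = ∣ toℕ e - toℕ (side b s) ∣
          gapᶠ s = ∣ toℕ f - toℕ (side c s) ∣
          near : ∀ s → ∣ toℕ e - toℕ (side b (proj₁ s)) ∣ + ∣ toℕ f - toℕ (side c (proj₂ s)) ∣ ≤ 1
          near s = ≤-trans (≤-trans (+-monoʳ-≤ ∣ toℕ e - toℕ (side b (proj₁ s)) ∣ (m≤m+n ∣ toℕ f - toℕ (side c (proj₂ s)) ∣ (d r (origin n)))) (m≤n+m _ ∣ toℕ g - suc (toℕ a) ∣))
            (subst (_≤ 1) (trans (d-square g e f r a b c (fins s)) (cong (λ s → ∣ toℕ g - suc (toℕ a) ∣ + (∣ toℕ e - toℕ (side b (proj₁ s)) ∣ + (∣ toℕ f - toℕ (side c (proj₂ s)) ∣ + d r (origin n)))) (bits-fins s))) (h (fins s)))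

      private
        -- Two unit edges whose lower ends each lie on the other edge coincide: otherwise b = b′ + 1
        -- and b′ = b + 1.
        side-match : ∀ b b′ {s t} → side b false ≡ side b′ s → side b′ false ≡ side b t → b ≡ b′
        side-match b b′ {false} e _ = Fin.inject₁-injective e
        side-match b b′ {true} {false} e e′ = Fin.inject₁-injective (sym e′)
        side-match b b′ {true} {true} e e′ = contradiction (trans (sym (Fin.toℕ-inject₁ b)) (trans (cong toℕ e)
          (cong suc (trans (sym (Fin.toℕ-inject₁ b′)) (cong toℕ e′))))) λ h → <⇒≢ (m≤n⇒m≤1+n (n<1+n (toℕ b))) h

      square-⊑ : ∀ {a b c a′ b′ c′} → square a b c ⊑ square a′ b′ c′ → square a′ b′ c′ ⊑ square a b c → a ≡ a′ × b ≡ b′ × c ≡ c′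
      square-⊑ {a} {b} {c} {a′} {b′} {c′} s t =
        let (j , e) = s zero ; (k , e′) = t zero in
        Fin.suc-injective (cong Vec.head e) ,
        side-match b b′ {proj₁ (bits j)} {proj₁ (bits k)} (cong (λ x → Vec.head (Vec.tail x)) e) (cong (λ x → Vec.head (Vec.tail x)) e′) ,
        side-match c c′ {proj₂ (bits j)} {proj₂ (bits k)} (cong (λ x → Vec.head (Vec.tail (Vec.tail x))) e) (cong (λ x → Vec.head (Vec.tail (Vec.tail x))) e′)

      -- Squares assigned to the same cell consist of the same four points, and by `square-⊑` mutual
      -- inclusion determines all three parameters; thus the assignment is injective.
      many-cells : m * (m * m) ≤ ν {m} {3 + n}
      many-cells = Fin.injective⇒≤ {f = cell} cell-injective
        where
        coords : Fin (m * (m * m)) → Fin m × Fin m × Fin m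
        coords i = proj₁ (Fin.remQuot {m} (m * m) i) , Fin.remQuot {m} m (proj₂ (Fin.remQuot {m} (m * m) i))
        coords-injective : ∀ {i j} → coords i ≡ coords j → i ≡ j
        coords-injective {i} {j} e = trans (sym (Fin.combine-remQuot {m} (m * m) i)) (trans (cong₂ Fin.combine (cong proj₁ e)
          (trans (sym (Fin.combine-remQuot {m} m _)) (trans (cong (λ p → Fin.combine (proj₁ (proj₂ p)) (proj₂ (proj₂ p))) e) (Fin.combine-remQuot {m} m _))))
          (Fin.combine-remQuot {m} (m * m) j))
        sq : Fin (m * (m * m)) → Fin 4 → Grid m (3 + n)
        sq i = square (proj₁ (coords i)) (proj₁ (proj₂ (coords i))) (proj₂ (proj₂ (coords i)))
        critical : ∀ i → Critical (sq i)
        critical i = square-critical (proj₁ (coords i)) (proj₁ (proj₂ (coords i))) (proj₂ (proj₂ (coords i)))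
        cell : Fin (m * (m * m)) → Fin (ν {m} {3 + n})
        cell i = proj₁ (F-complete (critical i))
        within : ∀ i j → cell i ≡ cell j → sq i ⊑ sq j
        within i j e k = let (l , h) = proj₂ (F-complete (critical i)) k
                             (p , h′) = ⊑-sym (critical j) (F-critical (cell i)) (subst (λ x → sq j ⊑ F x) (sym e) (proj₂ (F-complete (critical j)))) l
                         in p , trans h h′
        cell-injective : ∀ {i j} → cell i ≡ cell j → i ≡ j
        cell-injective {i} {j} e = let (p , q , r) = square-⊑ (within i j e) (within j i (sym e)) in coords-injective (cong₂ _,_ p (cong₂ _,_ q r))

    module _ (m n : ℕ) where

      open Realization (proj₂ (grid-finite m n)) (_≟ᵍ_ {m} {n}) using (Pt; mkPt; weight; nonNeg; total; support)

      toPt : RealizationPoint (Δ m n 2) (grid-finite m n) → Pt (𝒦 n)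
      toPt a = mkPt (RealizationPoint.weight a) (RealizationPoint.nonNegative a) (RealizationPoint.total a)
        λ σ h {x} {y} x∈ y∈ → subst (_≤ 2) (sym (d≡manhattan x y)) (RealizationPoint.support a σ h x∈ y∈)

      fromPt : Pt (𝒦 n) → RealizationPoint (Δ m n 2) (grid-finite m n)
      fromPt a = record { weight = weight a ; nonNegative = nonNeg a ; total = total a
        ; support = λ σ h {x} {y} x∈ y∈ → subst (_≤ 2) (d≡manhattan x y) (support a σ h x∈ y∈) }

      private
        𝕂 : MetricSpace
        𝕂 = Realization.Facets.Geometry.𝕂 (proj₂ (grid-finite m n)) (_≟ᵍ_ {m} {n}) (𝒦 {m} n) (ν {m} {n}) (F {m} {n}) (F-inj {m} {n}) (F-in {m} {n}) (F-max {m} {n}) (F-dist {m} {n})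

        toPt-isometric : ∀ x x′ → dist 𝕂 (toPt x) (toPt x′) ℝ.≤ dist (realization (Δ m n 2) (grid-finite m n)) x x′
        toPt-isometric x x′ = ℝ.≤-refl

        fromPt-isometric : ∀ a a′ → dist (realization (Δ m n 2) (grid-finite m n)) (fromPt a) (fromPt a′) ℝ.≤ dist 𝕂 a a′
        fromPt-isometric a a′ = ℝ.≤-refl

        fromPt∘toPt : ∀ x → dist (realization (Δ m n 2) (grid-finite m n)) (fromPt (toPt x)) x ℝ.≤ ℝ.0ℝ
        fromPt∘toPt x = proj₁ (ℝ.d-refl (realization (Δ m n 2) (grid-finite m n)) x)

        toPt∘fromPt : ∀ a → dist 𝕂 (toPt (fromPt a)) a ℝ.≤ ℝ.0ℝ
        toPt∘fromPt a = proj₁ (ℝ.d-refl 𝕂 a)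

      grid-wedge : realization (Δ m n 2) (grid-finite m n) ≃ₕ ⋁ (ν {m} {n}) (𝕊 3) (northPole 3)
      grid-wedge = Realization.Facets.Geometry.wedge-theorem (proj₂ (grid-finite m n)) (_≟ᵍ_ {m} {n}) (𝒦 {m} n) (ν {m} {n}) (F {m} {n}) (F-inj {m} {n})
        (F-in {m} {n}) (F-max {m} {n}) (F-dist {m} {n}) {origin {m} n} (L-collapses {m} {n})
        (realization (Δ m n 2) (grid-finite m n)) toPt fromPt toPt-isometric fromPt-isometric fromPt∘toPt toPt∘fromPt

  open Cells public

open import Data.Nat.Base using (ℕ; suc; _≤_; z≤n; s≤s; _*_; _∸_; _^_)
open import Data.Nat.Properties using (≤-trans; ≤-reflexive; ^-monoˡ-≤; m∸n≤m; *-identityʳ)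
open import Data.Product.Base using (∃-syntax; _×_; _,_)
open import Defs using (Δ; grid-finite; realization; _≃ₕ_; ⋁; 𝕊; northPole)
open import Relation.Binary.PropositionalEquality.Core using (cong)
open Combinatorics using (ν; many-cells; grid-wedge)

theorem4p13 : (n m : ℕ) → 3 ≤ n → 3 ≤ m →
    ∃[ ν ] ((m ∸ 2) ^ 3 ≤ ν × realization (Δ m n 2) (grid-finite m n) ≃ₕ ⋁ ν (𝕊 3) (northPole 3))
theorem4p13 (suc (suc (suc n))) m (s≤s (s≤s (s≤s z≤n))) _ = ν {m} {suc (suc (suc n))} ,
  -- The cube of m unfolds to `m * (m * (m * 1))`, hence the cancellation of the final factor before
  -- the square count applies.
  ≤-trans (^-monoˡ-≤ 3 (m∸n≤m m 2)) (≤-trans (≤-reflexive (cong (λ k → m * (m * k)) (*-identityʳ m))) (many-cells {m} {n})) ,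
  grid-wedge m (suc (suc (suc n)))
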